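{- Let $F(z)\in\mathbb{Z}[[z]]$ be the power series with $F(0)=1$ satisfying $F(z)=(1+z+z^2)F(z^4)-z^4F(z^{16})$. Then the functions $F(z)$, $F(z^4)$, $F'(z)$, and $F'(z^4)$ are algebraically independent over $\mathbb{C}(z)$.
   Context: The functional equation $F(z)=(1+z+z^2)F(z^4)-z^4F(z^{16})$ together with $F(0)=1$ determines the power series $F(z)=1+z+z^2+z^5+z^6+z^8+z^9+z^{10}+\cdots$ uniquely; it converges in the open unit disc. -}

module Defs where

open import Level using (Level; _⊔_)
open import Data.Nat using (ℕ; zero; suc; _∸_; _≡ᵇ_; _%_; _/_; NonZero)
open import Data.Integer using (ℤ; +_; -[1+_])
import Data.Integer.Properties as ℤP
open import Data.Bool using (if_then_else_)
open import Data.Product using (Σ; _×_)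
open import Relation.Nullary using (¬_)
open import Relation.Binary.PropositionalEquality using (_≡_)
open import Algebra.Bundles using (CommutativeRing)

module PowerSeries {c ℓ : Level} (R : CommutativeRing c ℓ) where
  open CommutativeRing R

  Series : Set c
  Series = ℕ → Carrier

  _≋_ : Series → Series → Set ℓ
  f ≋ g = ∀ n → f n ≈ g n

  Σ< : ℕ → (ℕ → Carrier) → Carrier
  Σ< zero    a = 0#
  Σ< (suc n) a = Σ< n a + a n

  natR : ℕ → Carrier
  natR zero    = 0#
  natR (suc n) = 1# + natR n

  intR : ℤ → Carrier
  intR (+ n)      = natR n
  intR -[1+ n ]   = - natR (suc n)

  zpow : ℕ → Series
  zpow k n = if n ≡ᵇ k then 1# else 0#

  _⊕_ : Series → Series → Series
  (f ⊕ g) n = f n + g n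

  _⊖_ : Series → Series → Series
  (f ⊖ g) n = f n - g n

  _⊙_ : Series → Series → Series
  (f ⊙ g) n = Σ< (suc n) (λ i → f i * g (n ∸ i))

  _⊙^_ : Series → ℕ → Series
  f ⊙^ zero  = zpow 0
  f ⊙^ suc m = f ⊙ (f ⊙^ m)

  dilate : (k : ℕ) .{{_ : NonZero k}} → Series → Series
  dilate k f n = if (n % k) ≡ᵇ 0 then f (n / k) else 0#

  deriv : Series → Series
  deriv f n = natR (suc n) * f (suc n)

  -- A polynomial in R[z][X₁,X₂,X₃,X₄], given by its coefficients
  -- c e₀ e₁ e₂ e₃ e₄ of z^e₀ X₁^e₁ X₂^e₂ X₃^e₃ X₄^e₄, all exponents ≤ d.
  record Poly5 : Set c where
    field
      deg   : ℕ
      coeff : ℕ → ℕ → ℕ → ℕ → ℕ → Carrier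

  eval5 : Poly5 → Series → Series → Series → Series → Series
  eval5 P f₁ f₂ f₃ f₄ n =
    Σ< (suc d) λ e₀ → Σ< (suc d) λ e₁ → Σ< (suc d) λ e₂ → Σ< (suc d) λ e₃ → Σ< (suc d) λ e₄ →
      coeff e₀ e₁ e₂ e₃ e₄ *
        ((zpow e₀ ⊙ ((f₁ ⊙^ e₁) ⊙ ((f₂ ⊙^ e₂) ⊙ ((f₃ ⊙^ e₃) ⊙ (f₄ ⊙^ e₄))))) n)
    where
    open Poly5 P renaming (deg to d)

  -- the coefficient c e₀ … e₄ vanishes (only exponents ≤ deg are coefficients)
  open import Data.Nat using (_≤_)
  IsZeroPoly5 : Poly5 → Set ℓ
  IsZeroPoly5 P = ∀ e₀ e₁ e₂ e₃ e₄ → e₀ ≤ deg → e₁ ≤ deg → e₂ ≤ deg → e₃ ≤ deg → e₄ ≤ deg →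
                  coeff e₀ e₁ e₂ e₃ e₄ ≈ 0#
    where open Poly5 P

  -- f₁,…,f₄ ∈ R[[z]] are algebraically independent over R(z):
  -- every polynomial over R[z] (equivalently, after clearing denominators,
  -- over R(z)) that annihilates them is the zero polynomial.
  AlgIndep4 : Series → Series → Series → Series → Set (c ⊔ ℓ)
  AlgIndep4 f₁ f₂ f₃ f₄ = ∀ (P : Poly5) → eval5 P f₁ f₂ f₃ f₄ ≋ (λ _ → 0#) → IsZeroPoly5 P

record IsChar0Field {c ℓ : Level} (K : CommutativeRing c ℓ) : Set (c ⊔ ℓ) where
  open CommutativeRing K
  open PowerSeries K using (natR)
  field
    1≉0     : ¬ (1# ≈ 0#)
    inverse : ∀ x → ¬ (x ≈ 0#) → Σ Carrier λ y → x * y ≈ 1#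
    char0   : ∀ n → natR n ≈ 0# → n ≡ 0

ℤring : CommutativeRing _ _
ℤring = ℤP.+-*-commutativeRing

module ℤSeries = PowerSeries ℤring

IsF : (ℕ → ℤ) → Set
IsF F = F 0 ≡ + 1 ×
        (F ≋ ((((zpow 0 ⊕ zpow 1) ⊕ zpow 2) ⊙ dilate 4 F) ⊖ (zpow 4 ⊙ dilate 16 F)))
  where open ℤSeries

{-# OPTIONS --safe #-}
module Submission where

-- Put x = F, y = z F(z⁴), x′ = 4 δx, y′ = 4 δy with δ = z d/dz, and let σ be z ↦ z⁴.  By the functional
-- equation the value of a polynomial P at (x, y, x′, y′) is the value of βP at the σ-images of these
-- series, where β extends x ↦ p x - y, y ↦ z x with p = 1 + z + z².  Hence an integral relation P gives
-- relations P_r through βP = Σ_{r<4} z^r σ P_r.  In the coordinates x′ = τ x, y′ = τ y + t take P minimal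
-- for the degree in τ, then the degree in t, then the range of the degrees in the leading coefficient.
-- A combination of P and P_r whose leading coefficient vanishes on a line y = l x is divisible by
-- y - l x, so minimality makes the P_r proportional to P, and κ βP = ƛ σP.  The leading coefficient is
-- then a binary form that is invariant up to scalars; comparing degrees and leading coefficients in z
-- leaves only powers of x, and these are excluded by the next coefficient.
--
-- Equality in K need not be decidable, so the passage from ℤ to K is by elimination: an integer matrix
-- whose integral kernel is trivial has trivial kernel over K.  To apply it to finitely many rows, note
-- that the products of boundedly many of 1, F, F(z⁴), δF, σδF times bounded powers of z span a module
-- closed under sections; in such a module finitely many coefficients detect the zero series.

open import Defs
open import Level using (Level; 0ℓ)
open import Data.Nat as ℕ using (ℕ; zero; suc; _∸_; _≤_; _<_; z≤n; s≤s)
import Data.Nat.Properties as ℕP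
open import Data.Integer as ℤ using (ℤ; +_; -[1+_])
import Data.Integer.Properties as ℤP
open import Data.Fin using (Fin)
open import Data.Fin.Patterns using (0F; 1F; 2F; 3F)
open import Data.Product using (Σ; _×_; _,_; proj₁; proj₂)
open import Data.Sum as Sum using (_⊎_; inj₁; inj₂)
open import Data.Empty using (⊥; ⊥-elim)
open import Data.Bool using (true; false)
open import Relation.Nullary using (¬_; Dec; yes; no)
open import Relation.Binary.PropositionalEquality as ≡ using (_≡_)
open import Relation.Binary.Definitions using (tri<; tri≈; tri>)
open import Algebra.Bundles using (CommutativeRing)
open import Data.Nat.Induction using (<-wellFounded)
open import Induction.WellFounded using (Acc; acc)
open import Data.Nat.Solver using (module +-*-Solver)
open import Data.Nat.Tactic.RingSolver using (solve-∀)
open import Data.List as List using (List; []; _∷_; _++_)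
open import Data.List.Relation.Unary.All as All using (All; []; _∷_)
import Data.List.Relation.Unary.All.Properties as AllP
open import Data.Maybe using (Maybe; just; nothing)
import Algebra.Solver.Ring
open import Algebra.Solver.Ring.AlmostCommutativeRing using (fromCommutativeRing; _-Raw-AlmostCommutative⟶_)

-- In these coordinates τ is the logarithmic derivative x′/x and t = (x y′ - x′ y)/x is a Wronskian
-- divided by x; this makes the action of β on (t, τ) affine and triangular, so leading coefficients
-- change only by explicit factors. The two exclusions have different sources. An invariant form of
-- degree e has, after u = z² v, a leading coefficient in v with roots at 0, 1 and -1. Counting them
-- gives 2(μ + ν) ≤ e, where ν is the first index with a nonzero coefficient and μ the first at
-- which a certain degree is attained. Descent through sections bounds the scalars and gives 4e ≤
-- 6(μ + ν), so e = 0. A power of x in front of t is excluded because x y′ - x′ y would have to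
-- transform like a quadratic form in x and y, which the leading coefficients 1 and 2 of p and δp
-- refute. Vanishing of a series is not decidable either, so the ring of series is never treated as
-- a domain: only the linear forms y - k x with natural k are cancelled, where the first
-- coefficients show that this is possible.

CRing : Set₁
CRing = CommutativeRing 0ℓ 0ℓ

-- Finite sums, the image of ℤ, and power series over a commutative ring

module Sums {c ℓ : Level} (R : CommutativeRing c ℓ) where
  open CommutativeRing R
  open PowerSeries R
  open import Relation.Binary.Reasoning.Setoid setoid
  open import Algebra.Properties.Ring ring using (-‿+-comm; -0#≈0#; -‿distribˡ-*; -‿distribʳ-*; -‿involutive)
  open import Algebra.Properties.CommutativeSemigroup +-commutativeSemigroup using (interchange)

  Σ-cong : ∀ n {a b : ℕ → Carrier} → (∀ i → i < n → a i ≈ b i) → Σ< n a ≈ Σ< n b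
  Σ-cong zero    h = refl
  Σ-cong (suc n) h = +-cong (Σ-cong n (λ i i<n → h i (ℕP.m<n⇒m<1+n i<n))) (h n (ℕP.n<1+n n))

  Σ-cong′ : ∀ n {a b : ℕ → Carrier} → (∀ i → a i ≈ b i) → Σ< n a ≈ Σ< n b
  Σ-cong′ n h = Σ-cong n (λ i _ → h i)

  Σ-zero : ∀ n {a : ℕ → Carrier} → (∀ i → i < n → a i ≈ 0#) → Σ< n a ≈ 0#
  Σ-zero zero    h = refl
  Σ-zero (suc n) h = trans (+-cong (Σ-zero n (λ i i<n → h i (ℕP.m<n⇒m<1+n i<n))) (h n (ℕP.n<1+n n))) (+-identityˡ 0#)

  Σ-+ : ∀ n (a b : ℕ → Carrier) → Σ< n (λ i → a i + b i) ≈ Σ< n a + Σ< n b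
  Σ-+ zero    a b = sym (+-identityˡ 0#)
  Σ-+ (suc n) a b = trans (+-congʳ (Σ-+ n a b)) (interchange _ _ _ _)

  Σ-*ˡ : ∀ n x (a : ℕ → Carrier) → Σ< n (λ i → x * a i) ≈ x * Σ< n a
  Σ-*ˡ zero    x a = sym (zeroʳ x)
  Σ-*ˡ (suc n) x a = trans (+-congʳ (Σ-*ˡ n x a)) (sym (distribˡ x _ _))

  Σ-*ʳ : ∀ n x (a : ℕ → Carrier) → Σ< n (λ i → a i * x) ≈ Σ< n a * x
  Σ-*ʳ n x a = trans (Σ-cong′ n (λ i → *-comm (a i) x)) (trans (Σ-*ˡ n x a) (*-comm x _))

  Σ-first : ∀ n (a : ℕ → Carrier) → Σ< (suc n) a ≈ a 0 + Σ< n (λ i → a (suc i))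
  Σ-first zero    a = +-comm 0# (a 0)
  Σ-first (suc n) a = trans (+-congʳ (Σ-first n a)) (+-assoc _ _ _)

  Σ-swap : ∀ m n (a : ℕ → ℕ → Carrier) → Σ< m (λ i → Σ< n (a i)) ≈ Σ< n (λ j → Σ< m (λ i → a i j))
  Σ-swap zero    n a = sym (Σ-zero n (λ _ _ → refl))
  Σ-swap (suc m) n a = trans (+-congʳ (Σ-swap m n a)) (sym (Σ-+ n _ _))

  Σ-split : ∀ m n (a : ℕ → Carrier) → Σ< (m ℕ.+ n) a ≈ Σ< m a + Σ< n (λ i → a (m ℕ.+ i))
  Σ-split zero    n a = sym (+-identityˡ _)
  Σ-split (suc m) n a = begin
    Σ< (suc m ℕ.+ n) a                                     ≈⟨ Σ-first (m ℕ.+ n) a ⟩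
    a 0 + Σ< (m ℕ.+ n) (λ i → a (suc i))                   ≈⟨ +-congˡ (Σ-split m n _) ⟩
    a 0 + (Σ< m (λ i → a (suc i)) + _)                     ≈⟨ +-assoc _ _ _ ⟨
    (a 0 + Σ< m (λ i → a (suc i))) + _                     ≈⟨ +-congʳ (Σ-first m a) ⟨
    Σ< (suc m) a + Σ< n (λ i → a (suc m ℕ.+ i)) ∎

  Σ-single : ∀ n k (a : ℕ → Carrier) → k < n → (∀ i → ¬ i ≡ k → a i ≈ 0#) → Σ< n a ≈ a k
  Σ-single (suc n) k a k<sn h with k ℕ.≟ n
  ... | yes ≡.refl = trans (+-congʳ (Σ-zero n (λ i i<n → h i (λ e → ℕP.<⇒≢ i<n e)))) (+-identityˡ _)
  ... | no k≢n = trans (+-cong (Σ-single n k a (ℕP.≤∧≢⇒< (ℕP.≤-pred k<sn) k≢n) h) (h n (λ e → k≢n (≡.sym e)))) (+-identityʳ _)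

  natR-+ : ∀ m n → natR (m ℕ.+ n) ≈ natR m + natR n
  natR-+ zero    n = sym (+-identityˡ _)
  natR-+ (suc m) n = trans (+-congˡ (natR-+ m n)) (sym (+-assoc _ _ _))

  natR-* : ∀ m n → natR (m ℕ.* n) ≈ natR m * natR n
  natR-* zero    n = sym (zeroˡ _)
  natR-* (suc m) n = begin
    natR (n ℕ.+ m ℕ.* n)          ≈⟨ natR-+ n (m ℕ.* n) ⟩
    natR n + natR (m ℕ.* n)       ≈⟨ +-cong (sym (*-identityˡ _)) (natR-* m n) ⟩
    1# * natR n + natR m * natR n ≈⟨ distribʳ _ _ _ ⟨
    (1# + natR m) * natR n ∎

  intR-neg : ∀ i → intR (ℤ.- i) ≈ - intR i
  intR-neg (+ zero)  = sym -0#≈0#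
  intR-neg (+ suc n) = refl
  intR-neg -[1+ n ]  = sym (-‿involutive _)

  intR-⊖ : ∀ m n → intR (m ℤ.⊖ n) ≈ natR m - natR n
  intR-⊖ zero    zero    = sym (-‿inverseʳ 0#)
  intR-⊖ zero    (suc n) = sym (+-identityˡ _)
  intR-⊖ (suc m) zero    = trans (sym (+-identityʳ _)) (+-congˡ (sym -0#≈0#))
  intR-⊖ (suc m) (suc n) = begin
    intR (suc m ℤ.⊖ suc n)               ≡⟨ ≡.cong intR (ℤP.[1+m]⊖[1+n]≡m⊖n m n) ⟩
    intR (m ℤ.⊖ n)                       ≈⟨ intR-⊖ m n ⟩
    natR m - natR n                      ≈⟨ +-identityˡ _ ⟨
    0# + (natR m - natR n)               ≈⟨ +-congʳ (-‿inverseʳ 1#) ⟨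
    (1# - 1#) + (natR m - natR n)        ≈⟨ interchange _ _ _ _ ⟩
    (1# + natR m) + (- 1# + - natR n)    ≈⟨ +-congˡ (-‿+-comm _ _) ⟩
    (1# + natR m) - (1# + natR n) ∎

  intR-+ : ∀ i j → intR (i ℤ.+ j) ≈ intR i + intR j
  intR-+ (+ m)    (+ n)    = natR-+ m n
  intR-+ (+ m)    -[1+ n ] = intR-⊖ m (suc n)
  intR-+ -[1+ m ] (+ n)    = trans (intR-⊖ n (suc m)) (+-comm _ _)
  intR-+ -[1+ m ] -[1+ n ] = begin
    - natR (suc (suc (m ℕ.+ n)))      ≡⟨ ≡.cong (λ k → - natR (suc k)) (≡.sym (ℕP.+-suc m n)) ⟩
    - natR (suc m ℕ.+ suc n)          ≈⟨ -‿cong (natR-+ (suc m) (suc n)) ⟩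
    - (natR (suc m) + natR (suc n))   ≈⟨ -‿+-comm _ _ ⟨
    - natR (suc m) + - natR (suc n) ∎

  intR-* : ∀ i j → intR (i ℤ.* j) ≈ intR i * intR j
  intR-* (+ m) (+ n) = trans (reflexive (≡.cong intR (≡.sym (ℤP.pos-* m n)))) (natR-* m n)
  intR-* (+ m) -[1+ n ] = begin
    intR (+ m ℤ.* -[1+ n ])      ≡⟨ ≡.cong intR (≡.sym (ℤP.neg-distribʳ-* (+ m) (+ suc n))) ⟩
    intR (ℤ.- (+ m ℤ.* + suc n)) ≈⟨ intR-neg (+ m ℤ.* + suc n) ⟩
    - intR (+ m ℤ.* + suc n)     ≈⟨ -‿cong (intR-* (+ m) (+ suc n)) ⟩
    - (natR m * natR (suc n))    ≈⟨ -‿distribʳ-* _ _ ⟩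
    natR m * (- natR (suc n)) ∎
  intR-* -[1+ m ] (+ n) = begin
    intR (-[1+ m ] ℤ.* + n)      ≡⟨ ≡.cong intR (≡.sym (ℤP.neg-distribˡ-* (+ suc m) (+ n))) ⟩
    intR (ℤ.- (+ suc m ℤ.* + n)) ≈⟨ intR-neg (+ suc m ℤ.* + n) ⟩
    - intR (+ suc m ℤ.* + n)     ≈⟨ -‿cong (intR-* (+ suc m) (+ n)) ⟩
    - (natR (suc m) * natR n)    ≈⟨ -‿distribˡ-* _ _ ⟩
    (- natR (suc m)) * natR n ∎
  intR-* -[1+ m ] -[1+ n ] = begin
    intR (-[1+ m ] ℤ.* -[1+ n ])     ≈⟨ natR-* (suc m) (suc n) ⟩
    natR (suc m) * natR (suc n)      ≈⟨ -‿involutive _ ⟨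
    - - (natR (suc m) * natR (suc n)) ≈⟨ -‿cong (-‿distribˡ-* _ _) ⟩
    - ((- natR (suc m)) * natR (suc n)) ≈⟨ -‿distribʳ-* _ _ ⟩
    (- natR (suc m)) * (- natR (suc n)) ∎

  intR-1 : intR (+ 1) ≈ 1#
  intR-1 = +-identityʳ 1#

  private
    morphism : CommutativeRing.rawRing ℤring -Raw-AlmostCommutative⟶ fromCommutativeRing R
    morphism = record { ⟦_⟧ = intR ; +-homo = intR-+ ; *-homo = intR-* ; -‿homo = intR-neg ; 0-homo = refl ; 1-homo = intR-1 }

    weakDec : ∀ i j → Maybe (intR i ≈ intR j)
    weakDec i j with i ℤ.≟ j
    ... | yes e = just (reflexive (≡.cong intR e))
    ... | no _ = nothing

  -- The solver takes its coefficients in ℤ, acting through `intR`, so numerals can be compared over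
  -- every ring. In a solved equation `con (+ 1)` therefore stands for `intR (+ 1)`, which becomes
  -- `1#` only through `intR-1`.
  module Solver = Algebra.Solver.Ring (CommutativeRing.rawRing ℤring) (fromCommutativeRing R) morphism weakDec
    using (solve; _:=_; con; _:*_; _:+_; _:-_; :-_; _:^_)

  infixr 8 _^_
  _^_ : Carrier → ℕ → Carrier
  x ^ zero  = 1#
  x ^ suc n = x * x ^ n

  ^-cong : ∀ n {x y} → x ≈ y → x ^ n ≈ y ^ n
  ^-cong zero    e = refl
  ^-cong (suc n) e = *-cong e (^-cong n e)

  ^-+ : ∀ x m n → x ^ (m ℕ.+ n) ≈ x ^ m * x ^ n
  ^-+ x zero    n = sym (*-identityˡ _)
  ^-+ x (suc m) n = trans (*-congˡ (^-+ x m n)) (sym (*-assoc _ _ _))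

  ^-* : ∀ x y n → (x * y) ^ n ≈ x ^ n * y ^ n
  ^-* x y zero    = sym (*-identityˡ _)
  ^-* x y (suc n) = trans (*-congˡ (^-* x y n)) (let open Solver in solve 4 (λ a b c d → (a :* b) :* (c :* d) := (a :* c) :* (b :* d)) refl x y (x ^ n) (y ^ n))

  1^ : ∀ n → 1# ^ n ≈ 1#
  1^ zero    = refl
  1^ (suc n) = trans (*-identityˡ _) (1^ n)

module SeriesLaws {c ℓ : Level} (R : CommutativeRing c ℓ) where
  open CommutativeRing R
  open PowerSeries R
  open Sums R
  open import Relation.Binary.Reasoning.Setoid setoid

  tail : Series → Series
  tail f n = f (suc n)

  infixr 7 _·_
  _·_ : Carrier → Series → Series
  (a · f) n = a * f n

  ⊙-zero : ∀ f g → (f ⊙ g) 0 ≈ f 0 * g 0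
  ⊙-zero f g = +-identityˡ _

  -- This and `⊙-sucʳ` split off one boundary term of the Cauchy product. Commutativity and
  -- associativity then follow by induction on the index, without reindexing a double sum.
  ⊙-suc : ∀ f g n → (f ⊙ g) (suc n) ≈ f 0 * g (suc n) + (tail f ⊙ g) n
  ⊙-suc f g n = Σ-first (suc n) _

  ⊙-sucʳ : ∀ f g n → (f ⊙ g) (suc n) ≈ (f ⊙ tail g) n + f (suc n) * g 0
  ⊙-sucʳ f g n = +-cong
    (Σ-cong (suc n) (λ i i<sn → *-congˡ (reflexive (≡.cong g (ℕP.+-∸-assoc 1 (ℕP.≤-pred i<sn))))))
    (*-congˡ (reflexive (≡.cong g (ℕP.n∸n≡0 n))))

  ⊙-cong : ∀ {f f′ g g′} → f ≋ f′ → g ≋ g′ → (f ⊙ g) ≋ (f′ ⊙ g′)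
  ⊙-cong p q n = Σ-cong′ (suc n) (λ i → *-cong (p i) (q (n ∸ i)))

  ⊙-distribʳ : ∀ h f g → ((f ⊕ g) ⊙ h) ≋ ((f ⊙ h) ⊕ (g ⊙ h))
  ⊙-distribʳ h f g n = trans (Σ-cong′ (suc n) (λ i → distribʳ _ _ _)) (Σ-+ (suc n) _ _)

  ⊙-·ˡ : ∀ a f g → ((a · f) ⊙ g) ≋ (a · (f ⊙ g))
  ⊙-·ˡ a f g n = trans (Σ-cong′ (suc n) (λ i → *-assoc _ _ _)) (Σ-*ˡ (suc n) a _)

  ⊙-comm : ∀ f g → (f ⊙ g) ≋ (g ⊙ f)
  ⊙-comm f g zero    = +-congˡ (*-comm _ _)
  ⊙-comm f g (suc n) = begin
    (f ⊙ g) (suc n)                    ≈⟨ ⊙-suc f g n ⟩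
    f 0 * g (suc n) + (tail f ⊙ g) n   ≈⟨ +-cong (*-comm _ _) (⊙-comm (tail f) g n) ⟩
    g (suc n) * f 0 + (g ⊙ tail f) n   ≈⟨ +-comm _ _ ⟩
    (g ⊙ tail f) n + g (suc n) * f 0   ≈⟨ ⊙-sucʳ g f n ⟨
    (g ⊙ f) (suc n) ∎

  tail-⊙ : ∀ f g → tail (f ⊙ g) ≋ ((f 0 · tail g) ⊕ (tail f ⊙ g))
  tail-⊙ f g n = ⊙-suc f g n

  ⊙-assoc : ∀ f g h → ((f ⊙ g) ⊙ h) ≋ (f ⊙ (g ⊙ h))
  ⊙-assoc f g h zero    = begin
    ((f ⊙ g) ⊙ h) 0      ≈⟨ ⊙-zero (f ⊙ g) h ⟩
    (f ⊙ g) 0 * h 0      ≈⟨ *-congʳ (⊙-zero f g) ⟩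
    (f 0 * g 0) * h 0    ≈⟨ *-assoc _ _ _ ⟩
    f 0 * (g 0 * h 0)    ≈⟨ *-congˡ (⊙-zero g h) ⟨
    f 0 * (g ⊙ h) 0      ≈⟨ ⊙-zero f (g ⊙ h) ⟨
    (f ⊙ (g ⊙ h)) 0 ∎
  ⊙-assoc f g h (suc n) = begin
    ((f ⊙ g) ⊙ h) (suc n)                                              ≈⟨ ⊙-suc (f ⊙ g) h n ⟩
    (f ⊙ g) 0 * h (suc n) + (tail (f ⊙ g) ⊙ h) n                       ≈⟨ +-cong (*-congʳ (⊙-zero f g)) (⊙-cong {g = h} (tail-⊙ f g) (λ _ → refl) n) ⟩
    (f 0 * g 0) * h (suc n) + (((f 0 · tail g) ⊕ (tail f ⊙ g)) ⊙ h) n  ≈⟨ +-cong (*-assoc _ _ _) (⊙-distribʳ h _ _ n) ⟩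
    f 0 * (g 0 * h (suc n)) + (((f 0 · tail g) ⊙ h) n + ((tail f ⊙ g) ⊙ h) n)
      ≈⟨ +-congˡ (+-cong (⊙-·ˡ (f 0) (tail g) h n) (⊙-assoc (tail f) g h n)) ⟩
    f 0 * (g 0 * h (suc n)) + (f 0 * (tail g ⊙ h) n + (tail f ⊙ (g ⊙ h)) n) ≈⟨ +-assoc _ _ _ ⟨
    (f 0 * (g 0 * h (suc n)) + f 0 * (tail g ⊙ h) n) + (tail f ⊙ (g ⊙ h)) n ≈⟨ +-congʳ (distribˡ _ _ _) ⟨
    f 0 * (g 0 * h (suc n) + (tail g ⊙ h) n) + (tail f ⊙ (g ⊙ h)) n    ≈⟨ +-congʳ (*-congˡ (⊙-suc g h n)) ⟨
    f 0 * (g ⊙ h) (suc n) + (tail f ⊙ (g ⊙ h)) n                       ≈⟨ ⊙-suc f (g ⊙ h) n ⟨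
    (f ⊙ (g ⊙ h)) (suc n) ∎

  ⊙-zeroˡ : ∀ f g → (∀ n → f n ≈ 0#) → ∀ n → (f ⊙ g) n ≈ 0#
  ⊙-zeroˡ f g h n = Σ-zero (suc n) (λ i _ → trans (*-congʳ (h i)) (zeroˡ _))

  ⊙-van : ∀ m n f g → (∀ i → m ≤ i → f i ≈ 0#) → (∀ i → n ≤ i → g i ≈ 0#) → ∀ k → m ℕ.+ n ≤ k → (f ⊙ g) k ≈ 0#
  ⊙-van m n f g vf vg k h = Σ-zero (suc k) (λ i _ → vanish i)
    where
    vanish : ∀ i → f i * g (k ∸ i) ≈ 0#
    vanish i with m ℕ.≤? i
    ... | yes m≤i = trans (*-congʳ (vf i m≤i)) (zeroˡ _)
    ... | no m≰i = trans (*-congˡ (vg (k ∸ i) (ℕP.m+n≤o⇒m≤o∸n n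
      (ℕP.≤-trans (ℕP.≤-trans (ℕP.≤-reflexive (ℕP.+-comm n i)) (ℕP.+-monoˡ-≤ n (ℕP.<⇒≤ (ℕP.≰⇒> m≰i)))) h)))) (zeroʳ _)

  const : Carrier → Series
  const a zero    = a
  const a (suc n) = 0#

  ⊙-const : ∀ a f → (const a ⊙ f) ≋ (a · f)
  ⊙-const a f zero    = ⊙-zero (const a) f
  ⊙-const a f (suc n) = trans (⊙-suc (const a) f n) (trans (+-congˡ (⊙-zeroˡ _ f (λ _ → refl) n)) (+-identityʳ _))

  zpow0 : zpow 0 ≋ const 1#
  zpow0 zero    = refl
  zpow0 (suc n) = refl

  ⊙-identityˡ : ∀ f → (zpow 0 ⊙ f) ≋ f
  ⊙-identityˡ f n = trans (⊙-cong {g = f} zpow0 (λ _ → refl) n) (trans (⊙-const 1# f n) (*-identityˡ _))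

  shift : ℕ → Series → Series
  shift zero    f = f
  shift (suc k) f zero    = 0#
  shift (suc k) f (suc n) = shift k f n

  zpow-shift : ∀ k f → (zpow k ⊙ f) ≋ shift k f
  zpow-shift zero    f = ⊙-identityˡ f
  zpow-shift (suc k) f zero    = trans (⊙-zero (zpow (suc k)) f) (zeroˡ _)
  zpow-shift (suc k) f (suc n) = trans (⊙-suc (zpow (suc k)) f n)
    (trans (+-cong (zeroˡ _) (zpow-shift k f n)) (+-identityˡ _))

  series : CommutativeRing c ℓ
  series = record
    { Carrier = Series ; _≈_ = _≋_ ; _+_ = _⊕_ ; _*_ = _⊙_ ; -_ = λ f n → - f n ; 0# = λ _ → 0# ; 1# = zpow 0
    ; isCommutativeRing = record
      { isRing = record
        { +-isAbelianGroup = record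
          { isGroup = record
            { isMonoid = record
              { isSemigroup = record
                { isMagma = record
                  { isEquivalence = record { refl = λ _ → refl ; sym = λ e n → sym (e n) ; trans = λ e e′ n → trans (e n) (e′ n) }
                  ; ∙-cong = λ e e′ n → +-cong (e n) (e′ n) }
                ; assoc = λ f g h n → +-assoc _ _ _ }
              ; identity = (λ f n → +-identityˡ _) , (λ f n → +-identityʳ _) }
            ; inverse = (λ f n → -‿inverseˡ _) , (λ f n → -‿inverseʳ _)
            ; ⁻¹-cong = λ e n → -‿cong (e n) }
          ; comm = λ f g n → +-comm _ _ }
        ; *-cong = ⊙-cong
        ; *-assoc = ⊙-assoc
        ; *-identity = ⊙-identityˡ , (λ f n → trans (⊙-comm f (zpow 0) n) (⊙-identityˡ f n))
        ; distrib = (λ f g h n → trans (⊙-comm f (g ⊕ h) n) (trans (⊙-distribʳ f g h n) (+-cong (⊙-comm g f n) (⊙-comm h f n)))) , ⊙-distribʳ }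
      ; *-comm = ⊙-comm } }

-- Homomorphisms, domains and polynomials

record Hom (R S : CRing) : Set where
  private
    module R = CommutativeRing R
    module S = CommutativeRing S
  field
    ⟦_⟧    : R.Carrier → S.Carrier
    ⟦⟧-cong : ∀ {x y} → x R.≈ y → ⟦ x ⟧ S.≈ ⟦ y ⟧
    +-homo : ∀ x y → ⟦ x R.+ y ⟧ S.≈ ⟦ x ⟧ S.+ ⟦ y ⟧
    *-homo : ∀ x y → ⟦ x R.* y ⟧ S.≈ ⟦ x ⟧ S.* ⟦ y ⟧
    1-homo : ⟦ R.1# ⟧ S.≈ S.1#
  private
    module GS = Sums S
    module GR = Sums R
    module PS = PowerSeries S
    module PR = PowerSeries R
  open import Algebra.Properties.Ring S.ring using (x+x≈x⇒x≈0; +-inverseˡ-unique)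

  0-homo : ⟦ R.0# ⟧ S.≈ S.0#
  0-homo = x+x≈x⇒x≈0 _ (S.trans (S.sym (+-homo _ _)) (⟦⟧-cong (R.+-identityˡ _)))

  ≈0-homo : ∀ {x} → x R.≈ R.0# → ⟦ x ⟧ S.≈ S.0#
  ≈0-homo e = S.trans (⟦⟧-cong e) 0-homo

  neg-homo : ∀ x → ⟦ R.- x ⟧ S.≈ S.- ⟦ x ⟧
  neg-homo x = +-inverseˡ-unique _ _ (S.trans (S.sym (+-homo _ _)) (≈0-homo (R.-‿inverseˡ x)))

  sub-homo : ∀ x y → ⟦ x R.- y ⟧ S.≈ ⟦ x ⟧ S.- ⟦ y ⟧
  sub-homo x y = S.trans (+-homo _ _) (S.+-congˡ (neg-homo y))

  ^-homo : ∀ x n → ⟦ x GR.^ n ⟧ S.≈ ⟦ x ⟧ GS.^ n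
  ^-homo x zero    = 1-homo
  ^-homo x (suc n) = S.trans (*-homo _ _) (S.*-congˡ (^-homo x n))

  Σ-homo : ∀ n f → ⟦ PR.Σ< n f ⟧ S.≈ PS.Σ< n (λ i → ⟦ f i ⟧)
  Σ-homo zero    f = 0-homo
  Σ-homo (suc n) f = S.trans (+-homo _ _) (S.+-congʳ (Σ-homo n f))

  natR-homo : ∀ n → ⟦ PR.natR n ⟧ S.≈ PS.natR n
  natR-homo zero    = 0-homo
  natR-homo (suc n) = S.trans (+-homo _ _) (S.+-cong 1-homo (natR-homo n))

  intR-homo : ∀ i → ⟦ PR.intR i ⟧ S.≈ PS.intR i
  intR-homo (+ n)    = natR-homo n
  intR-homo -[1+ n ] = S.trans (neg-homo _) (S.-‿cong (natR-homo (suc n)))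

open Hom using (⟦_⟧) public

idHom : (R : CRing) → Hom R R
idHom R = record { ⟦_⟧ = λ x → x ; ⟦⟧-cong = λ e → e ; +-homo = λ _ _ → refl ; *-homo = λ _ _ → refl ; 1-homo = refl }
  where open CommutativeRing R

infixr 9 _∘H_
_∘H_ : {R S T : CRing} → Hom S T → Hom R S → Hom R T
_∘H_ {R} {S} {T} g f = record
  { ⟦_⟧ = λ x → ⟦ g ⟧ (⟦ f ⟧ x)
  ; ⟦⟧-cong = λ e → g.⟦⟧-cong (f.⟦⟧-cong e)
  ; +-homo = λ x y → trans (g.⟦⟧-cong (f.+-homo x y)) (g.+-homo _ _)
  ; *-homo = λ x y → trans (g.⟦⟧-cong (f.*-homo x y)) (g.*-homo _ _)
  ; 1-homo = trans (g.⟦⟧-cong f.1-homo) g.1-homo }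
  where
  open CommutativeRing T
  module g = Hom g
  module f = Hom f

intHom : (S : CRing) → Hom ℤring S
intHom S = record { ⟦_⟧ = PowerSeries.intR S ; ⟦⟧-cong = λ { ≡.refl → refl } ; +-homo = intR-+ ; *-homo = intR-* ; 1-homo = intR-1 }
  where
  open CommutativeRing S
  open Sums S

intR-ℤ : ∀ i → PowerSeries.intR ℤring i ≡ i
intR-ℤ (+ n) = natR-ℤ n
  where
  natR-ℤ : ∀ n → PowerSeries.natR ℤring n ≡ + n
  natR-ℤ zero    = ≡.refl
  natR-ℤ (suc n) = ≡.cong (ℤ._+_ (+ 1)) (natR-ℤ n)
intR-ℤ -[1+ n ] = ≡.cong ℤ.-_ (intR-ℤ (+ suc n))

ℤ-hom-unique : {S : CRing} (f g : Hom ℤring S) → let open CommutativeRing S in ∀ i → ⟦ f ⟧ i ≈ ⟦ g ⟧ i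
ℤ-hom-unique {S} f g i = trans (canon f) (sym (canon g))
  where
  open CommutativeRing S
  canon : (f : Hom ℤring S) → ⟦ f ⟧ i ≈ PowerSeries.intR S i
  canon f = trans (reflexive (≡.cong ⟦ f ⟧ (≡.sym (intR-ℤ i)))) (Hom.intR-homo f i)

-- A decision for being zero belongs to the notion because degrees, orders and first nonzero
-- coefficients are found by testing. It holds for ℤ and passes to polynomial rings; relations
-- between series are handled by `IsRelations` instead.
record Dom (R : CRing) : Set where
  open CommutativeRing R
  open PowerSeries R using (natR)
  field
    _≟0 : ∀ x → Dec (x ≈ 0#)
    noZD : ∀ x y → x * y ≈ 0# → x ≈ 0# ⊎ y ≈ 0#
    natR≉0 : ∀ n → ¬ (natR (suc n) ≈ 0#)

  1≉0 : ¬ (1# ≈ 0#)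
  1≉0 e = natR≉0 0 (trans (+-identityʳ _) e)

  *≉0 : ∀ {x y} → ¬ (x ≈ 0#) → ¬ (y ≈ 0#) → ¬ (x * y ≈ 0#)
  *≉0 {x} {y} p q e with noZD x y e
  ... | inj₁ h = p h
  ... | inj₂ h = q h

  open Sums R
  ^≉0 : ∀ {x} n → ¬ (x ≈ 0#) → ¬ (x ^ n ≈ 0#)
  ^≉0 zero    p = 1≉0
  ^≉0 (suc n) p = *≉0 p (^≉0 n p)

  cancel0 : ∀ {x y} → ¬ (x ≈ 0#) → x * y ≈ 0# → y ≈ 0#
  cancel0 {x} {y} p e with noZD x y e
  ... | inj₁ h = ⊥-elim (p h)
  ... | inj₂ h = h

  open import Algebra.Properties.Ring ring using (x∙y⁻¹≈ε⇒x≈y; -‿distribʳ-*)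

  cancelˡ : ∀ {x y z} → ¬ (x ≈ 0#) → x * y ≈ x * z → y ≈ z
  cancelˡ {x} {y} {z} p e = x∙y⁻¹≈ε⇒x≈y y z (cancel0 p
    (trans (distribˡ x y (- z)) (trans (+-cong e (sym (-‿distribʳ-* x z))) (-‿inverseʳ _))))

ℤ-dom : Dom ℤring
ℤ-dom = record
  { _≟0 = λ x → x ℤ.≟ + 0
  ; noZD = λ x y → ℤP.i*j≡0⇒i≡0∨j≡0 x
  ; natR≉0 = λ n e → case (≡.trans (≡.sym (intR-ℤ (+ suc n))) e) }
  where
  case : ∀ {n} → ¬ (+ suc n ≡ + 0)
  case ()

module Pol (R : CRing) where
  open CommutativeRing R
  open PowerSeries R
  open Sums R
  open SeriesLaws R
  private module 𝕊 = CommutativeRing series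

  -- The bound only witnesses finiteness and is ignored by equality, so it yields no more than an
  -- upper bound of the degree. Exact degrees are expressed by the predicates `Top` and `IsDeg` on
  -- coefficients.
  record Polynomial : Set where
    constructor mkPol
    field
      cf  : Series
      bnd : ℕ
      van : ∀ n → bnd ≤ n → cf n ≈ 0#
  open Polynomial

  abstract
    Poly : CRing
    Poly = record
      { Carrier = Polynomial ; _≈_ = λ p q → cf p ≋ cf q
      ; _+_ = λ p q → mkPol (cf p ⊕ cf q) (bnd p ℕ.⊔ bnd q) (λ n h → trans (+-cong (van p n (ℕP.m⊔n≤o⇒m≤o _ _ h)) (van q n (ℕP.m⊔n≤o⇒n≤o (bnd p) _ h))) (+-identityˡ _))
      ; _*_ = λ p q → mkPol (cf p ⊙ cf q) (bnd p ℕ.+ bnd q) (⊙-van (bnd p) (bnd q) (cf p) (cf q) (van p) (van q))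
      ; -_ = λ p → mkPol (λ n → - cf p n) (bnd p) (λ n h → trans (-‿cong (van p n h)) -0#≈0#)
      ; 0# = mkPol (λ _ → 0#) 0 (λ _ _ → refl)
      ; 1# = mkPol (zpow 0) 1 (λ { (suc n) _ → refl })
      ; isCommutativeRing = record
        { isRing = record
          { +-isAbelianGroup = record
            { isGroup = record
              { isMonoid = record
                { isSemigroup = record
                  { isMagma = record
                    { isEquivalence = record { refl = 𝕊.refl ; sym = 𝕊.sym ; trans = 𝕊.trans }
                    ; ∙-cong = 𝕊.+-cong }
                  ; assoc = λ p q r → 𝕊.+-assoc (cf p) (cf q) (cf r) }
                ; identity = (λ p → 𝕊.+-identityˡ (cf p)) , (λ p → 𝕊.+-identityʳ (cf p)) }
              ; inverse = (λ p → 𝕊.-‿inverseˡ (cf p)) , (λ p → 𝕊.-‿inverseʳ (cf p))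
              ; ⁻¹-cong = 𝕊.-‿cong }
            ; comm = λ p q → 𝕊.+-comm (cf p) (cf q) }
          ; *-cong = 𝕊.*-cong
          ; *-assoc = λ p q r → 𝕊.*-assoc (cf p) (cf q) (cf r)
          ; *-identity = (λ p → 𝕊.*-identityˡ (cf p)) , (λ p → 𝕊.*-identityʳ (cf p))
          ; distrib = (λ p q r → 𝕊.distribˡ (cf p) (cf q) (cf r)) , (λ p q r → 𝕊.distribʳ (cf p) (cf q) (cf r)) }
        ; *-comm = λ p q → 𝕊.*-comm (cf p) (cf q) } }
      where
      open import Algebra.Properties.Ring ring using (-0#≈0#)

  module P = CommutativeRing Poly

  abstract
    coef : P.Carrier → ℕ → Carrier
    coef p = cf p

    bound : P.Carrier → ℕ
    bound p = bnd p

    coef-bound : ∀ p n → bound p ≤ n → coef p n ≈ 0#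
    coef-bound p = van p

    tabulate : (f : ℕ → Carrier) (b : ℕ) → (∀ n → b ≤ n → f n ≈ 0#) → P.Carrier
    tabulate = mkPol

    coef-tabulate : ∀ f b v n → coef (tabulate f b v) n ≈ f n
    coef-tabulate f b v n = refl

    ext : ∀ {p q} → (∀ n → coef p n ≈ coef q n) → p P.≈ q
    ext h = h

    coef-cong : ∀ {p q} → p P.≈ q → ∀ n → coef p n ≈ coef q n
    coef-cong e n = e n

    coef-+ : ∀ p q n → coef (p P.+ q) n ≈ coef p n + coef q n
    coef-+ p q n = refl

    coef-neg : ∀ p n → coef (P.- p) n ≈ - coef p n
    coef-neg p n = refl

    coef-0 : ∀ n → coef P.0# n ≈ 0#
    coef-0 n = refl

    coef-* : ∀ p q n → coef (p P.* q) n ≈ (coef p ⊙ coef q) n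
    coef-* p q n = refl

    coef-1 : ∀ n → coef P.1# n ≈ zpow 0 n
    coef-1 n = refl

    K : Carrier → P.Carrier
    K a = mkPol (const a) 1 (λ { (suc n) _ → refl })

    coef-K0 : ∀ a → coef (K a) 0 ≈ a
    coef-K0 a = refl

    coef-Ksuc : ∀ a n → coef (K a) (suc n) ≈ 0#
    coef-Ksuc a n = refl

    X : P.Carrier
    X = mkPol (zpow 1) 2 (λ { (suc (suc n)) _ → refl ; (suc zero) (s≤s ()) })

    coef-K* : ∀ a p n → coef (K a P.* p) n ≈ a * coef p n
    coef-K* a p n = ⊙-const a (cf p) n

    coef-X*0 : ∀ p → coef (X P.* p) 0 ≈ 0#
    coef-X*0 p = zpow-shift 1 (cf p) 0

    coef-X*suc : ∀ p n → coef (X P.* p) (suc n) ≈ coef p n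
    coef-X*suc p n = zpow-shift 1 (cf p) (suc n)

    coef-X : ∀ n → coef X n ≈ zpow 1 n
    coef-X n = refl

  KHom : Hom R Poly
  KHom = record
    { ⟦_⟧ = K
    ; ⟦⟧-cong = λ e → ext (λ { zero → trans (coef-K0 _) (trans e (sym (coef-K0 _))) ; (suc n) → trans (coef-Ksuc _ n) (sym (coef-Ksuc _ n)) })
    ; +-homo = λ x y → ext (λ { zero → trans (coef-K0 _) (trans (+-cong (sym (coef-K0 _)) (sym (coef-K0 _))) (sym (coef-+ _ _ 0)))
                              ; (suc n) → trans (coef-Ksuc _ n) (trans (sym (+-identityˡ _)) (trans (+-cong (sym (coef-Ksuc _ n)) (sym (coef-Ksuc _ n))) (sym (coef-+ _ _ (suc n))))) })
    ; *-homo = λ x y → ext (λ { zero → trans (coef-K0 _) (trans (*-congˡ (sym (coef-K0 _))) (sym (coef-K* _ _ 0)))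
                              ; (suc n) → trans (coef-Ksuc _ n) (trans (sym (zeroʳ x)) (trans (*-congˡ (sym (coef-Ksuc _ n))) (sym (coef-K* _ _ (suc n))))) })
    ; 1-homo = ext (λ { zero → trans (coef-K0 _) (sym (coef-1 0)) ; (suc n) → trans (coef-Ksuc _ n) (sym (coef-1 (suc n))) }) }

  coef-sub : ∀ p q n → coef (p P.- q) n ≈ coef p n - coef q n
  coef-sub p q n = trans (coef-+ _ _ n) (+-congˡ (coef-neg q n))

  coef≈0 : ∀ {p} → p P.≈ P.0# → ∀ n → coef p n ≈ 0#
  coef≈0 e n = trans (coef-cong e n) (coef-0 n)

  ext0 : ∀ {p} → (∀ n → coef p n ≈ 0#) → p P.≈ P.0#
  ext0 h = ext (λ n → trans (h n) (sym (coef-0 n)))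

  coef-Σ : ∀ k (f : ℕ → P.Carrier) n → coef (PowerSeries.Σ< Poly k f) n ≈ Σ< k (λ i → coef (f i) n)
  coef-Σ zero    f n = coef-0 n
  coef-Σ (suc k) f n = trans (coef-+ _ _ n) (+-congʳ (coef-Σ k f n))

  shiftDown : P.Carrier → P.Carrier
  shiftDown p = tabulate (λ n → coef p (suc n)) (bound p) (λ n h → coef-bound p (suc n) (ℕP.m≤n⇒m≤1+n h))

  decompose : ∀ p → p P.≈ K (coef p 0) P.+ X P.* shiftDown p
  decompose p = ext λ
    { zero → trans (sym (+-identityʳ _)) (trans (+-cong (sym (coef-K0 _)) (sym (coef-X*0 _))) (sym (coef-+ _ _ 0)))
    ; (suc n) → trans (sym (+-identityˡ _)) (trans (+-cong (sym (coef-Ksuc _ n)) (sym (trans (coef-X*suc _ n) (coef-tabulate _ _ _ n)))) (sym (coef-+ _ _ (suc n)))) }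

  Deg≤ : ℕ → P.Carrier → Set
  Deg≤ n p = ∀ m → n < m → coef p m ≈ 0#

  Deg≤-shiftDown : ∀ {n p} → Deg≤ (suc n) p → Deg≤ n (shiftDown p)
  Deg≤-shiftDown h m n<m = trans (coef-tabulate _ _ _ m) (h (suc m) (s≤s n<m))

  Deg≤-bound : ∀ p → Deg≤ (bound p) p
  Deg≤-bound p m h = coef-bound p m (ℕP.<⇒≤ h)

  Deg≤0 : ∀ {p} → Deg≤ 0 p → p P.≈ K (coef p 0)
  Deg≤0 h = ext λ { zero → sym (coef-K0 _) ; (suc n) → trans (h (suc n) (s≤s z≤n)) (sym (coef-Ksuc _ n)) }

  induct : (Q : P.Carrier → Set) → (∀ {p q} → p P.≈ q → Q p → Q q) → Q P.0# →
           (∀ a p → Q p → Q (K a P.+ X P.* p)) → ∀ p → Q p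
  induct Q resp base step p = go (bound p) p (coef-bound p)
    where
    go : ∀ n p → (∀ m → n ≤ m → coef p m ≈ 0#) → Q p
    go zero    p h = resp (P.sym (ext0 (λ n → h n z≤n))) base
    go (suc n) p h = resp (P.sym (decompose p)) (step _ _ (go n (shiftDown p) (λ m n≤m → trans (coef-tabulate _ _ _ m) (h (suc m) (s≤s n≤m)))))

  -- The uniqueness half of the universal property. Through `extC` and `extA` it reduces identities
  -- between substitutions in several variables to the variables themselves.
  hom-ext : {S : CRing} (f g : Hom Poly S) → let open CommutativeRing S using () renaming (_≈_ to _≈ₛ_) in
            (∀ a → ⟦ f ⟧ (K a) ≈ₛ ⟦ g ⟧ (K a)) → ⟦ f ⟧ X ≈ₛ ⟦ g ⟧ X → ∀ p → ⟦ f ⟧ p ≈ₛ ⟦ g ⟧ p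
  hom-ext {S} f g hK hX = induct (λ p → ⟦ f ⟧ p S.≈ ⟦ g ⟧ p)
    (λ e h → S.trans (S.sym (f.⟦⟧-cong e)) (S.trans h (g.⟦⟧-cong e)))
    (S.trans f.0-homo (S.sym g.0-homo))
    (λ a p h → S.trans (f.+-homo _ _) (S.trans (S.+-cong (hK a) (S.trans (f.*-homo _ _) (S.trans (S.*-cong hX h) (S.sym (g.*-homo _ _))))) (S.sym (g.+-homo _ _))))
    where
    module S = CommutativeRing S
    module f = Hom f
    module g = Hom g

  coef-K-+ : ∀ a p n → coef (K a P.+ p) (suc n) ≈ coef p (suc n)
  coef-K-+ a p n = trans (coef-+ _ _ (suc n)) (trans (+-congʳ (coef-Ksuc a n)) (+-identityˡ _))

  *-expand : ∀ p q → p P.* q P.≈ K (coef p 0) P.* q P.+ X P.* (shiftDown p P.* q)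
  *-expand p q = P.trans (P.*-congʳ (decompose p)) (P.trans (P.distribʳ _ _ _) (P.+-congˡ (P.*-assoc _ _ _)))

  coef-*-top : ∀ n m p q → Deg≤ n p → Deg≤ m q → Deg≤ (n ℕ.+ m) (p P.* q) × (coef (p P.* q) (n ℕ.+ m) ≈ coef p n * coef q m)
  coef-*-top zero m p q dp dq = (λ k h → trans (lem k) (trans (*-congˡ (dq k h)) (zeroʳ _))) , lem m
    where
    lem : ∀ k → coef (p P.* q) k ≈ coef p 0 * coef q k
    lem k = trans (coef-cong (P.*-congʳ (Deg≤0 dp)) k) (coef-K* _ _ k)
  coef-*-top (suc n) m p q dp dq = dpq , trans (lem (n ℕ.+ m)) (trans (+-cong (trans (*-congˡ (dq _ (s≤s (ℕP.m≤n+m m n)))) (zeroʳ _)) (trans (proj₂ ih) (*-congʳ (coef-tabulate _ _ _ n)))) (+-identityˡ _))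
    where
    ih = coef-*-top n m (shiftDown p) q (Deg≤-shiftDown dp) dq
    lem : ∀ k → coef (p P.* q) (suc k) ≈ coef p 0 * coef q (suc k) + coef (shiftDown p P.* q) k
    lem k = trans (coef-cong (*-expand p q) (suc k)) (trans (coef-+ _ _ (suc k)) (+-cong (coef-K* _ _ (suc k)) (coef-X*suc _ k)))
    dpq : Deg≤ (suc n ℕ.+ m) (p P.* q)
    dpq (suc k) (s≤s h) = trans (lem k) (trans (+-cong (trans (*-congˡ (dq (suc k) (ℕP.≤-<-trans (ℕP.m≤n+m m n) (ℕP.m<n⇒m<1+n h)))) (zeroʳ _)) (proj₁ ih k h)) (+-identityˡ _))

  -- The coefficient `a` is allowed to be zero: `n` is a common upper bound at which coefficients of
  -- different terms are added, so cancellation can be followed without knowing exact degrees.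
  Top : ℕ → Carrier → P.Carrier → Set
  Top n a p = Deg≤ n p × (coef p n ≈ a)

  Top-* : ∀ {n m a b p q} → Top n a p → Top m b q → Top (n ℕ.+ m) (a * b) (p P.* q)
  Top-* {n} {m} (dp , ep) (dq , eq) = proj₁ t , trans (proj₂ t) (*-cong ep eq)
    where t = coef-*-top n m _ _ dp dq

  Top-+ : ∀ {n a b p q} → Top n a p → Top n b q → Top n (a + b) (p P.+ q)
  Top-+ (dp , ep) (dq , eq) = (λ m h → trans (coef-+ _ _ m) (trans (+-cong (dp m h) (dq m h)) (+-identityˡ _))) , trans (coef-+ _ _ _) (+-cong ep eq)

  Top-K : ∀ a → Top 0 a (K a)
  Top-K a = (λ { (suc m) _ → coef-Ksuc a m }) , coef-K0 a

  Top-X : Top 1 1# X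
  Top-X = (λ { (suc (suc m)) _ → coef-X (suc (suc m)) ; (suc zero) (s≤s ()) }) , coef-X 1

  Top-cong : ∀ {n a b p q} → a ≈ b → p P.≈ q → Top n a p → Top n b q
  Top-cong ea ep (d , e) = (λ m h → trans (sym (coef-cong ep m)) (d m h)) , trans (sym (coef-cong ep _)) (trans e ea)

  Top-< : ∀ {n m a p} → n < m → Top n a p → Top m 0# p
  Top-< n<m (d , e) = (λ k h → d k (ℕP.<-trans n<m h)) , d _ n<m

  Top-zero : ∀ {n p} → p P.≈ P.0# → Top n 0# p
  Top-zero e = (λ m _ → coef≈0 e m) , coef≈0 e _

  Top-^ : ∀ {n a p} k → Top n a p → Top (k ℕ.* n) (a ^ k) (Sums._^_ Poly p k)
  Top-^ zero    t = Top-cong refl (Hom.1-homo KHom) (Top-K 1#)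
  Top-^ (suc k) t = Top-* t (Top-^ k t)

  Top-Σ : ∀ {n} k (a : ℕ → Carrier) (p : ℕ → P.Carrier) → (∀ i → i < k → Top n (a i) (p i)) → Top n (Σ< k a) (PowerSeries.Σ< Poly k p)
  Top-Σ zero    a p h = Top-zero P.refl
  Top-Σ (suc k) a p h = Top-+ (Top-Σ k a p (λ i i<k → h i (ℕP.m<n⇒m<1+n i<k))) (h k (ℕP.n<1+n k))

  Top-unique : ∀ {n m a b p q} → p P.≈ q → Top n a p → Top m b q → ¬ (a ≈ 0#) → ¬ (b ≈ 0#) → n ≡ m
  Top-unique {n} {m} e (dp , ep) (dq , eq) a≉0 b≉0 with ℕP.<-cmp n m
  ... | tri< n<m _ _ = ⊥-elim (b≉0 (trans (sym eq) (trans (sym (coef-cong e m)) (dp m n<m))))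
  ... | tri≈ _ n≡m _ = n≡m
  ... | tri> _ _ n>m = ⊥-elim (a≉0 (trans (sym ep) (trans (coef-cong e n) (dq n n>m))))

  module WithDom (D : Dom R) where
    open Dom D

    abstract
      leading : ∀ p → (p P.≈ P.0#) ⊎ Σ ℕ (λ n → Deg≤ n p × ¬ (coef p n ≈ 0#))
      leading p = go (bound p) (coef-bound p)
        where
        go : ∀ b → (∀ m → b ≤ m → coef p m ≈ 0#) → (p P.≈ P.0#) ⊎ Σ ℕ (λ n → Deg≤ n p × ¬ (coef p n ≈ 0#))
        go zero    h = inj₁ (ext0 {p} (λ n → h n z≤n))
        go (suc b) h with coef p b ≟0
        ... | no ne = inj₂ (b , h , ne)
        ... | yes e = go b λ m b≤m → case m b≤m (ℕP.m≤n⇒m<n∨m≡n b≤m)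
          where
          case : ∀ m → b ≤ m → b < m ⊎ b ≡ m → coef p m ≈ 0#
          case m _ (inj₁ l)      = h m l
          case m _ (inj₂ ≡.refl) = e

      degree : ∀ {p} → ¬ (p P.≈ P.0#) → Σ ℕ (λ n → Deg≤ n p × ¬ (coef p n ≈ 0#))
      degree {p} ne with leading p
      ... | inj₁ e = ⊥-elim (ne e)
      ... | inj₂ r = r

      dom : Dom Poly
      dom = record
        { _≟0 = dec
        ; noZD = nzd
        ; natR≉0 = λ n e → natR≉0 n (trans (sym (coef-K0 _)) (coef≈0 {K (natR (suc n))} (P.trans {K (natR (suc n))} {PowerSeries.natR Poly (suc n)} {P.0#} (Hom.natR-homo KHom (suc n)) e) 0)) }
        where
        dec : ∀ p → Dec (p P.≈ P.0#)
        dec p with leading p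
        ... | inj₁ e = yes e
        ... | inj₂ (n , _ , ne) = no (λ e → ne (coef≈0 {p} e n))
        nzd : ∀ p q → p P.* q P.≈ P.0# → p P.≈ P.0# ⊎ q P.≈ P.0#
        nzd p q e with leading p
        ... | inj₁ h = inj₁ h
        ... | inj₂ (n , dp , np) with leading q
        ...   | inj₁ h = inj₂ h
        ...   | inj₂ (m , dq , nq) = ⊥-elim (*≉0 np nq (trans (sym (proj₂ (coef-*-top n m p q dp dq))) (coef≈0 {p P.* q} e (n ℕ.+ m))))

open Pol using (Poly) public

module Lift {R S : CRing} (h : Hom R S) (s : CommutativeRing.Carrier S) where
  private
    module R = CommutativeRing R
    module S = CommutativeRing S
    module h = Hom h
  open Pol R hiding (Poly)
  open SeriesLaws R
  open PowerSeries R using (_⊙_; _⊕_)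
  open Sums S using (module Solver)
  open import Relation.Binary.Reasoning.Setoid S.setoid

  private
    -- Horner evaluation of the first `n` coefficients. By `ev-ext` every length beyond the support
    -- gives the same value, so the choice of the stored bound does not affect the homomorphism.
    ev : ℕ → (ℕ → R.Carrier) → S.Carrier
    ev zero    f = S.0#
    ev (suc n) f = ⟦ h ⟧ (f 0) S.+ s S.* ev n (tail f)

    ev-0 : ∀ n {f} → (∀ i → f i R.≈ R.0#) → ev n f S.≈ S.0#
    ev-0 zero    e = S.refl
    ev-0 (suc n) e = S.trans (S.+-cong (h.≈0-homo (e 0)) (S.trans (S.*-congˡ (ev-0 n (λ i → e (suc i)))) (S.zeroʳ s))) (S.+-identityˡ _)

    ev-ext : ∀ n m {f g} → (∀ i → f i R.≈ g i) → (∀ i → n ≤ i → f i R.≈ R.0#) → (∀ i → m ≤ i → g i R.≈ R.0#) → ev n f S.≈ ev m g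
    ev-ext zero    m       e vf vg = S.sym (ev-0 m (λ i → R.trans (R.sym (e i)) (vf i z≤n)))
    ev-ext (suc n) zero    e vf vg = ev-0 (suc n) (λ i → R.trans (e i) (vg i z≤n))
    ev-ext (suc n) (suc m) e vf vg = S.+-cong (h.⟦⟧-cong (e 0)) (S.*-congˡ (ev-ext n m (λ i → e (suc i)) (λ i l → vf (suc i) (s≤s l)) (λ i l → vg (suc i) (s≤s l))))

    ev-cong : ∀ n {f g} → (∀ i → f i R.≈ g i) → ev n f S.≈ ev n g
    ev-cong zero    e = S.refl
    ev-cong (suc n) e = S.+-cong (h.⟦⟧-cong (e 0)) (S.*-congˡ (ev-cong n (λ i → e (suc i))))

    ev-+ : ∀ n f g → ev n (f ⊕ g) S.≈ ev n f S.+ ev n g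
    ev-+ zero    f g = S.sym (S.+-identityˡ _)
    ev-+ (suc n) f g = S.trans (S.+-cong (h.+-homo _ _) (S.*-congˡ (ev-+ n (tail f) (tail g))))
      (let open Solver in solve 5 (λ a b c d e → (a :+ b) :+ c :* (d :+ e) := (a :+ c :* d) :+ (b :+ c :* e)) S.refl _ _ s _ _)

    ev-· : ∀ n a f → ev n (a · f) S.≈ ⟦ h ⟧ a S.* ev n f
    ev-· zero    a f = S.sym (S.zeroʳ _)
    ev-· (suc n) a f = S.trans (S.+-cong (h.*-homo _ _) (S.*-congˡ (ev-· n a (tail f))))
      (let open Solver in solve 4 (λ a b c d → a :* b :+ c :* (a :* d) := a :* (b :+ c :* d)) S.refl _ _ s _)

    ev-* : ∀ n m f g → (∀ i → n ≤ i → f i R.≈ R.0#) → (∀ i → m ≤ i → g i R.≈ R.0#) → ev (n ℕ.+ m) (f ⊙ g) S.≈ ev n f S.* ev m g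
    ev-* zero    m f g vf vg = S.trans (ev-0 m (⊙-zeroˡ f g (λ i → vf i z≤n))) (S.sym (S.zeroˡ _))
    ev-* (suc n) m f g vf vg = begin
      ⟦ h ⟧ ((f ⊙ g) 0) S.+ s S.* ev (n ℕ.+ m) (tail (f ⊙ g))
        ≈⟨ S.+-cong (S.trans (h.⟦⟧-cong (⊙-zero f g)) (h.*-homo _ _)) (S.*-congˡ (S.trans (ev-cong (n ℕ.+ m) (tail-⊙ f g)) (ev-+ (n ℕ.+ m) _ _))) ⟩
      ⟦ h ⟧ (f 0) S.* ⟦ h ⟧ (g 0) S.+ s S.* (ev (n ℕ.+ m) (f 0 · tail g) S.+ ev (n ℕ.+ m) (tail f ⊙ g))
        ≈⟨ S.+-congˡ (S.*-congˡ (S.+-cong (ev-· (n ℕ.+ m) (f 0) (tail g)) (ev-* n m (tail f) g (λ i l → vf (suc i) (s≤s l)) vg))) ⟩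
      ⟦ h ⟧ (f 0) S.* ⟦ h ⟧ (g 0) S.+ s S.* (⟦ h ⟧ (f 0) S.* ev (n ℕ.+ m) (tail g) S.+ ev n (tail f) S.* ev m g)
        ≈⟨ (let open Solver in solve 6 (λ a b c d e f → a :* b :+ c :* (a :* d :+ e :* f) := a :* (b :+ c :* d) :+ (c :* e) :* f) S.refl _ _ s _ _ _) ⟩
      ⟦ h ⟧ (f 0) S.* ev (suc (n ℕ.+ m)) g S.+ (s S.* ev n (tail f)) S.* ev m g
        ≈⟨ S.+-congʳ (S.*-congˡ (ev-ext (suc (n ℕ.+ m)) m (λ _ → R.refl) (λ i l → vg i (ℕP.≤-trans (ℕP.m≤n+m m (suc n)) l)) vg)) ⟩
      ⟦ h ⟧ (f 0) S.* ev m g S.+ (s S.* ev n (tail f)) S.* ev m g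
        ≈⟨ S.distribʳ _ _ _ ⟨
      (⟦ h ⟧ (f 0) S.+ s S.* ev n (tail f)) S.* ev m g ∎

    evP : P.Carrier → S.Carrier
    evP p = ev (bound p) (coef p)

    evP-at : ∀ n f p → (∀ i → coef p i R.≈ f i) → (∀ i → n ≤ i → f i R.≈ R.0#) → evP p S.≈ ev n f
    evP-at n f p e v = ev-ext (bound p) n e (coef-bound p) v

  abstract
    lift : Hom (Poly R) S
    lift = record
      { ⟦_⟧ = evP
      ; ⟦⟧-cong = λ {p} {q} e → evP-at (bound q) (coef q) p (coef-cong e) (coef-bound q)
      ; +-homo = λ p q → let b = bound p ℕ.+ bound q
                             vp = λ i l → coef-bound p i (ℕP.≤-trans (ℕP.m≤m+n _ (bound q)) l)
                             vq = λ i l → coef-bound q i (ℕP.≤-trans (ℕP.m≤n+m _ (bound p)) l)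
          in S.trans (evP-at b (coef p ⊕ coef q) (p P.+ q) (coef-+ p q) (λ i l → R.trans (R.+-cong (vp i l) (vq i l)) (R.+-identityˡ _)))
             (S.trans (ev-+ b (coef p) (coef q)) (S.+-cong (S.sym (evP-at b _ p (λ _ → R.refl) vp)) (S.sym (evP-at b _ q (λ _ → R.refl) vq))))
      ; *-homo = λ p q → S.trans (evP-at (bound p ℕ.+ bound q) (coef p ⊙ coef q) (p P.* q) (coef-* p q)
                                   (⊙-van (bound p) (bound q) (coef p) (coef q) (coef-bound p) (coef-bound q)))
                                 (ev-* (bound p) (bound q) (coef p) (coef q) (coef-bound p) (coef-bound q))
      ; 1-homo = S.trans (evP-at 1 (const R.1#) P.1# (λ i → R.trans (coef-1 i) (zpow0 i)) (λ { (suc n) _ → R.refl }))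
                         (S.trans (S.+-congˡ (S.zeroʳ s)) (S.trans (S.+-identityʳ _) h.1-homo)) }

    lift-K : ∀ a → ⟦ lift ⟧ (K a) S.≈ ⟦ h ⟧ a
    lift-K a = S.trans (evP-at 1 (const a) (K a) (λ { zero → coef-K0 a ; (suc n) → coef-Ksuc a n }) (λ { (suc n) _ → R.refl }))
                       (S.trans (S.+-congˡ (S.zeroʳ s)) (S.+-identityʳ _))

    lift-X : ⟦ lift ⟧ X S.≈ s
    lift-X = S.trans (evP-at 2 _ X (λ _ → R.refl) (λ { (suc (suc n)) _ → coef-X (suc (suc n)) ; (suc zero) (s≤s ()) }))
      (S.trans (S.+-cong (h.≈0-homo (coef-X 0)) (S.*-congˡ (S.trans (S.+-cong (S.trans (h.⟦⟧-cong (coef-X 1)) h.1-homo) (S.zeroʳ s)) (S.+-identityʳ _)))) 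
        (S.trans (S.+-identityˡ _) (S.*-identityʳ s)))

  lift-step : ∀ a p → ⟦ lift ⟧ (K a P.+ X P.* p) S.≈ ⟦ h ⟧ a S.+ s S.* ⟦ lift ⟧ p
  lift-step a p = S.trans (Hom.+-homo lift _ _) (S.+-cong (lift-K a) (S.trans (Hom.*-homo lift _ _) (S.*-congʳ lift-X)))

  lift-decompose : ∀ p → ⟦ lift ⟧ p S.≈ ⟦ h ⟧ (coef p 0) S.+ s S.* ⟦ lift ⟧ (shiftDown p)
  lift-decompose p = S.trans (Hom.⟦⟧-cong lift (decompose p)) (lift-step _ _)

open Lift using (lift; lift-K; lift-X) public

module MapHom {R S : CRing} (h : Hom R S) where
  private
    module R = CommutativeRing R
    module S = CommutativeRing S
    module h = Hom h
    module PR = Pol R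
    module PS = Pol S

  abstract
    mapHom : Hom (Poly R) (Poly S)
    mapHom = record
      { ⟦_⟧ = mp
      ; ⟦⟧-cong = λ {p} {q} e → PS.ext (λ n → S.trans (at p n) (S.trans (h.⟦⟧-cong (PR.coef-cong e n)) (S.sym (at q n))))
      ; +-homo = λ p q → PS.ext (λ n → S.trans (at _ n) (S.trans (h.⟦⟧-cong (PR.coef-+ p q n)) (S.trans (h.+-homo _ _)
          (S.trans (S.+-cong (S.sym (at p n)) (S.sym (at q n))) (S.sym (PS.coef-+ _ _ n))))))
      ; *-homo = λ p q → PS.ext (λ n → S.trans (at _ n) (S.trans (h.⟦⟧-cong (PR.coef-* p q n)) (S.trans (h.Σ-homo (suc n) _)
          (S.trans (Sums.Σ-cong′ S (suc n) (λ i → S.trans (h.*-homo _ _) (S.*-cong (S.sym (at p i)) (S.sym (at q (n ∸ i)))))) (S.sym (PS.coef-* _ _ n))))))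
      ; 1-homo = PS.ext (λ { zero → S.trans (at _ 0) (S.trans (h.⟦⟧-cong (PR.coef-1 0)) (S.trans h.1-homo (S.sym (PS.coef-1 0))))
                           ; (suc n) → S.trans (at _ (suc n)) (S.trans (h.≈0-homo (PR.coef-1 (suc n))) (S.sym (PS.coef-1 (suc n)))) }) }
      where
      mp : PR.P.Carrier → PS.P.Carrier
      mp p = PS.tabulate (λ n → ⟦ h ⟧ (PR.coef p n)) (PR.bound p) (λ n l → h.≈0-homo (PR.coef-bound p n l))
      at : ∀ p n → PS.coef (mp p) n S.≈ ⟦ h ⟧ (PR.coef p n)
      at p n = PS.coef-tabulate _ _ _ n

    coef-map : ∀ p n → PS.coef (⟦ mapHom ⟧ p) n S.≈ ⟦ h ⟧ (PR.coef p n)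
    coef-map p n = PS.coef-tabulate _ _ _ n

  map-K : ∀ a → ⟦ mapHom ⟧ (PR.K a) PS.P.≈ PS.K (⟦ h ⟧ a)
  map-K a = PS.ext λ { zero → S.trans (coef-map _ 0) (S.trans (h.⟦⟧-cong (PR.coef-K0 a)) (S.sym (PS.coef-K0 _)))
                     ; (suc n) → S.trans (coef-map _ (suc n)) (S.trans (h.≈0-homo (PR.coef-Ksuc a n)) (S.sym (PS.coef-Ksuc _ n))) }

  map-X : ⟦ mapHom ⟧ PR.X PS.P.≈ PS.X
  map-X = PS.ext λ { zero → case 0 h.0-homo ; (suc zero) → case 1 h.1-homo ; (suc (suc n)) → case (suc (suc n)) h.0-homo }
    where
    case : ∀ n → ⟦ h ⟧ (PowerSeries.zpow R 1 n) S.≈ PowerSeries.zpow S 1 n → PS.coef (⟦ mapHom ⟧ PR.X) n S.≈ PS.coef PS.X n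
    case n e = S.trans (coef-map _ n) (S.trans (h.⟦⟧-cong (PR.coef-X n)) (S.trans e (S.sym (PS.coef-X n))))

open MapHom using (mapHom; coef-map; map-K; map-X) public

-- Substitutions X ↦ a X + b, with `h` acting on the coefficients. Their use lies in the two top
-- coefficients: the leading one only acquires a power of the slope `a`, and the shift `b` first
-- appears in the next one.
module Affine {R S : CRing} (h : Hom R S) (a b : CommutativeRing.Carrier S) where
  private
    module R = CommutativeRing R
    module S = CommutativeRing S
    module h = Hom h
    module PR = Pol R
    module PS = Pol S
    module Q = PS.P
  open Sums S using (_^_; module Solver)
  open PowerSeries S using (natR)
  open import Relation.Binary.Reasoning.Setoid S.setoid

  lin : Q.Carrier
  lin = PS.K a Q.* PS.X Q.+ PS.K b

  aff : Hom (Poly R) (Poly S)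
  aff = lift (PS.KHom ∘H h) lin

  aff-K : ∀ c → ⟦ aff ⟧ (PR.K c) Q.≈ PS.K (⟦ h ⟧ c)
  aff-K c = lift-K (PS.KHom ∘H h) lin c

  aff-X : ⟦ aff ⟧ PR.X Q.≈ lin
  aff-X = lift-X (PS.KHom ∘H h) lin

  private
    lin*-zero : ∀ q → PS.coef (lin Q.* q) 0 S.≈ b S.* PS.coef q 0
    lin*-zero q = begin
      PS.coef (lin Q.* q) 0 ≈⟨ PS.coef-cong (Q.trans (Q.distribʳ _ _ _) (Q.+-congʳ (Q.*-assoc _ _ _))) 0 ⟩
      PS.coef (PS.K a Q.* (PS.X Q.* q) Q.+ PS.K b Q.* q) 0 ≈⟨ PS.coef-+ _ _ 0 ⟩
      PS.coef (PS.K a Q.* (PS.X Q.* q)) 0 S.+ PS.coef (PS.K b Q.* q) 0 ≈⟨ S.+-cong (S.trans (PS.coef-K* _ _ 0) (S.trans (S.*-congˡ (PS.coef-X*0 q)) (S.zeroʳ a))) (PS.coef-K* _ _ 0) ⟩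
      S.0# S.+ b S.* PS.coef q 0 ≈⟨ S.+-identityˡ _ ⟩
      b S.* PS.coef q 0 ∎

    lin*-suc : ∀ q n → PS.coef (lin Q.* q) (suc n) S.≈ a S.* PS.coef q n S.+ b S.* PS.coef q (suc n)
    lin*-suc q n = begin
      PS.coef (lin Q.* q) (suc n) ≈⟨ PS.coef-cong (Q.trans (Q.distribʳ _ _ _) (Q.+-congʳ (Q.*-assoc _ _ _))) (suc n) ⟩
      PS.coef (PS.K a Q.* (PS.X Q.* q) Q.+ PS.K b Q.* q) (suc n) ≈⟨ PS.coef-+ _ _ _ ⟩
      _ ≈⟨ S.+-cong (S.trans (PS.coef-K* _ _ (suc n)) (S.*-congˡ (PS.coef-X*suc q n))) (PS.coef-K* _ _ (suc n)) ⟩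
      a S.* PS.coef q n S.+ b S.* PS.coef q (suc n) ∎

    expand : ∀ p → ⟦ aff ⟧ p Q.≈ PS.K (⟦ h ⟧ (PR.coef p 0)) Q.+ lin Q.* ⟦ aff ⟧ (PR.shiftDown p)
    expand p = Lift.lift-decompose (PS.KHom ∘H h) lin p

    coef0 : ∀ p → PS.coef (⟦ aff ⟧ p) 0 S.≈ ⟦ h ⟧ (PR.coef p 0) S.+ b S.* PS.coef (⟦ aff ⟧ (PR.shiftDown p)) 0
    coef0 p = S.trans (PS.coef-cong (expand p) 0) (S.trans (PS.coef-+ _ _ 0) (S.+-cong (PS.coef-K0 _) (lin*-zero _)))

    coefS : ∀ p n → PS.coef (⟦ aff ⟧ p) (suc n) S.≈ a S.* PS.coef (⟦ aff ⟧ (PR.shiftDown p)) n S.+ b S.* PS.coef (⟦ aff ⟧ (PR.shiftDown p)) (suc n)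
    coefS p n = S.trans (PS.coef-cong (expand p) (suc n)) (S.trans (PS.coef-K-+ _ _ n) (lin*-suc _ n))

    sd : ∀ p n → ⟦ h ⟧ (PR.coef (PR.shiftDown p) n) S.≈ ⟦ h ⟧ (PR.coef p (suc n))
    sd p n = h.⟦⟧-cong (PR.coef-tabulate _ _ _ n)

  aff-top : ∀ n p → PR.Deg≤ n p → PS.Top n (a ^ n S.* ⟦ h ⟧ (PR.coef p n)) (⟦ aff ⟧ p)
  aff-top zero p d = PS.Top-cong (S.sym (S.*-identityˡ _)) (Q.sym (Q.trans (Hom.⟦⟧-cong aff (PR.Deg≤0 d)) (aff-K _))) (PS.Top-K _)
  aff-top (suc n) p d = (λ { (suc m) (s≤s l) → S.trans (coefS p m) (S.trans (S.+-cong (S.trans (S.*-congˡ (proj₁ ih m l)) (S.zeroʳ a)) (S.trans (S.*-congˡ (proj₁ ih (suc m) (ℕP.m<n⇒m<1+n l))) (S.zeroʳ b))) (S.+-identityˡ _)) })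
      , (begin
        PS.coef (⟦ aff ⟧ p) (suc n) ≈⟨ coefS p n ⟩
        a S.* PS.coef (⟦ aff ⟧ (PR.shiftDown p)) n S.+ b S.* PS.coef (⟦ aff ⟧ (PR.shiftDown p)) (suc n)
          ≈⟨ S.+-cong (S.*-congˡ (S.trans (proj₂ ih) (S.*-congˡ (sd p n)))) (S.trans (S.*-congˡ (proj₁ ih (suc n) (ℕP.n<1+n n))) (S.zeroʳ b)) ⟩
        a S.* (a ^ n S.* ⟦ h ⟧ (PR.coef p (suc n))) S.+ S.0# ≈⟨ S.trans (S.+-identityʳ _) (S.sym (S.*-assoc _ _ _)) ⟩
        a ^ suc n S.* ⟦ h ⟧ (PR.coef p (suc n)) ∎)
    where ih = aff-top n (PR.shiftDown p) (PR.Deg≤-shiftDown d)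

  -- Of (a X + b)^(n+1) the part of degree n is (n + 1) a^n b X^n, which is the only contribution of
  -- the leading term.
  aff-second : ∀ n p → PR.Deg≤ (suc n) p →
    PS.coef (⟦ aff ⟧ p) n S.≈ a ^ n S.* (⟦ h ⟧ (PR.coef p n) S.+ natR (suc n) S.* (b S.* ⟦ h ⟧ (PR.coef p (suc n))))
  aff-second zero p d = begin
    PS.coef (⟦ aff ⟧ p) 0 ≈⟨ coef0 p ⟩
    ⟦ h ⟧ (PR.coef p 0) S.+ b S.* PS.coef (⟦ aff ⟧ (PR.shiftDown p)) 0 ≈⟨ S.+-congˡ (S.*-congˡ (S.trans (proj₂ (aff-top 0 (PR.shiftDown p) (PR.Deg≤-shiftDown d))) (S.*-congˡ (sd p 0)))) ⟩
    ⟦ h ⟧ (PR.coef p 0) S.+ b S.* (S.1# S.* ⟦ h ⟧ (PR.coef p 1)) ≈⟨ S.+-congˡ (S.*-congˡ (S.*-identityˡ _)) ⟩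
    ⟦ h ⟧ (PR.coef p 0) S.+ b S.* ⟦ h ⟧ (PR.coef p 1) ≈⟨ S.*-identityˡ _ ⟨
    S.1# S.* (⟦ h ⟧ (PR.coef p 0) S.+ b S.* ⟦ h ⟧ (PR.coef p 1)) ≈⟨ S.*-congˡ (S.+-congˡ (S.trans (S.*-congʳ (S.+-identityʳ S.1#)) (S.*-identityˡ _))) ⟨
    _ ∎
  aff-second (suc n) p d = begin
    PS.coef (⟦ aff ⟧ p) (suc n) ≈⟨ coefS p n ⟩
    a S.* PS.coef (⟦ aff ⟧ (PR.shiftDown p)) n S.+ b S.* PS.coef (⟦ aff ⟧ (PR.shiftDown p)) (suc n)
      ≈⟨ S.+-cong (S.*-congˡ (S.trans (aff-second n (PR.shiftDown p) d′) (S.*-congˡ (S.+-cong (sd p n) (S.*-congˡ (S.*-congˡ (sd p (suc n))))))))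
                  (S.*-congˡ (S.trans (proj₂ (aff-top (suc n) (PR.shiftDown p) d′)) (S.*-congˡ (sd p (suc n))))) ⟩
    a S.* (a ^ n S.* (⟦ h ⟧ (PR.coef p (suc n)) S.+ natR (suc n) S.* (b S.* ⟦ h ⟧ (PR.coef p (suc (suc n)))))) S.+ b S.* (a ^ suc n S.* ⟦ h ⟧ (PR.coef p (suc (suc n))))
      ≈⟨ (let open Solver in solve 6 (λ a an u v b w → a :* (an :* (u :+ v :* (b :* w))) :+ b :* ((a :* an) :* w) := (a :* an) :* (u :+ (con (+ 1) :+ v) :* (b :* w))) S.refl a (a ^ n) (⟦ h ⟧ (PR.coef p (suc n))) (natR (suc n)) b (⟦ h ⟧ (PR.coef p (suc (suc n))))) ⟩
    a ^ suc n S.* (⟦ h ⟧ (PR.coef p (suc n)) S.+ (PowerSeries.intR S (+ 1) S.+ natR (suc n)) S.* (b S.* ⟦ h ⟧ (PR.coef p (suc (suc n)))))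
      ≈⟨ S.*-congˡ (S.+-congˡ (S.*-congʳ (S.+-congʳ (Sums.intR-1 S)))) ⟩
    _ ∎
    where d′ = PR.Deg≤-shiftDown d

  aff-scale : b S.≈ S.0# → ∀ k p → PS.coef (⟦ aff ⟧ p) k S.≈ a ^ k S.* ⟦ h ⟧ (PR.coef p k)
  aff-scale b0 zero p = S.trans (coef0 p) (S.trans (S.+-congˡ (S.trans (S.*-congʳ b0) (S.zeroˡ _))) (S.trans (S.+-identityʳ _) (S.sym (S.*-identityˡ _))))
  aff-scale b0 (suc k) p = S.trans (coefS p k) (S.trans (S.+-cong (S.*-congˡ (S.trans (aff-scale b0 k (PR.shiftDown p)) (S.*-congˡ (sd p k)))) (S.trans (S.*-congʳ b0) (S.zeroˡ _)))
    (S.trans (S.+-identityʳ _) (S.sym (S.*-assoc _ _ _))))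

  module AffDom (DR : Dom R) (DS : Dom S) (a≉0 : ¬ (a S.≈ S.0#)) (h-refl : ∀ {x} → ⟦ h ⟧ x S.≈ S.0# → x R.≈ R.0#) where

    -- With a nonzero slope over a domain the leading coefficient cannot be lost, so the degree is
    -- preserved. This allows conclusions to be pulled back along `aff₁`, which has no polynomial
    -- inverse.
    aff-reflects-Deg : ∀ m p → PS.Deg≤ m (⟦ aff ⟧ p) → PR.Deg≤ m p
    aff-reflects-Deg m p d with PR.WithDom.leading DR p
    ... | inj₁ e = λ k _ → PR.coef≈0 e k
    ... | inj₂ (n , dn , ne) with n ℕ.≤? m
    ...   | yes n≤m = λ k l → dn k (ℕP.≤-<-trans n≤m l)
    ...   | no n≰m = ⊥-elim (Dom.*≉0 DS (Dom.^≉0 DS n a≉0) (λ e → ne (h-refl e)) (S.trans (S.sym (proj₂ (aff-top n p dn))) (d n (ℕP.≰⇒> n≰m))))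

    aff-reflects-0 : ∀ p → ⟦ aff ⟧ p Q.≈ Q.0# → p PR.P.≈ PR.P.0#
    aff-reflects-0 p e with PR.WithDom.leading DR p
    ... | inj₁ e′ = e′
    ... | inj₂ (n , dn , ne) = ⊥-elim (Dom.*≉0 DS (Dom.^≉0 DS n a≉0) (λ e → ne (h-refl e)) (S.trans (S.sym (proj₂ (aff-top n p dn))) (PS.coef≈0 e n)))

module Roots (R : CRing) where
  open CommutativeRing R
  open Pol R hiding (Poly)
  open Sums R using (module Solver)
  open PowerSeries R using (natR)

  evalAt : Carrier → Hom (Poly R) R
  evalAt a = lift (idHom R) a

  private module SP = Sums.Solver (Poly R)

  remainder : ∀ a p → Σ P.Carrier λ q → p P.≈ K (⟦ evalAt a ⟧ p) P.+ (X P.- K a) P.* q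
  remainder a = induct (λ p → Σ P.Carrier λ q → p P.≈ K (⟦ evalAt a ⟧ p) P.+ (X P.- K a) P.* q)
    (λ e (q , h) → q , P.trans (P.sym e) (P.trans h (P.+-congʳ (Hom.⟦⟧-cong KHom (Hom.⟦⟧-cong (evalAt a) e)))))
    (P.0# , P.sym (P.trans (P.+-cong (Hom.≈0-homo KHom (Hom.0-homo (evalAt a))) (P.zeroʳ _)) (P.+-identityˡ _)))
    (λ c p (q , h) → K (⟦ evalAt a ⟧ p) P.+ X P.* q , step c p q h)
    where
    step : ∀ c p q → p P.≈ K (⟦ evalAt a ⟧ p) P.+ (X P.- K a) P.* q →
           K c P.+ X P.* p P.≈ K (⟦ evalAt a ⟧ (K c P.+ X P.* p)) P.+ (X P.- K a) P.* (K (⟦ evalAt a ⟧ p) P.+ X P.* q)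
    step c p q h = P.trans (P.+-congˡ (P.*-congˡ h)) (P.trans
      (let open SP in solve 5 (λ c x e a q → c :+ x :* (e :+ (x :- a) :* q) := (c :+ a :* e) :+ (x :- a) :* (e :+ x :* q)) P.refl (K c) X (K (⟦ evalAt a ⟧ p)) (K a) q)
      (P.+-congʳ (P.sym (P.trans (Hom.⟦⟧-cong KHom (Lift.lift-step (idHom R) a c p)) (P.trans (Hom.+-homo KHom _ _) (P.+-congˡ (Hom.*-homo KHom _ _)))))))

  factor : ∀ a p → ⟦ evalAt a ⟧ p ≈ 0# → Σ P.Carrier λ q → p P.≈ (X P.- K a) P.* q
  factor a p e = let (q , h) = remainder a p in q , P.trans h (P.trans (P.+-congʳ (Hom.≈0-homo KHom e)) (P.+-identityˡ _))

  coef-X-K* : ∀ a q n → coef ((X P.- K a) P.* q) (suc n) ≈ coef q n - a * coef q (suc n)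
  coef-X-K* a q n = trans (coef-cong (P.trans (P.distribʳ _ _ _) (P.+-congˡ (P.sym (-‿distribˡ-* _ _)))) (suc n))
    (trans (coef-sub _ _ (suc n)) (+-cong (coef-X*suc q n) (-‿cong (coef-K* a q (suc n)))))
    where open import Algebra.Properties.Ring P.ring using (-‿distribˡ-*)

  divisible : ∀ c p → (∀ n → Σ Carrier λ q → coef p n ≈ c * q) → Σ P.Carrier λ q → p P.≈ K c P.* q
  divisible c p f = tabulate g (bound p) g-van , ext (λ n → trans (g-eq n) (sym (trans (coef-K* _ _ n) (*-congˡ (coef-tabulate _ _ _ n)))))
    where
    -- Beyond the bound the quotients are replaced by 0: the ones supplied by `f` for zero
    -- coefficients need not vanish.
    g : ℕ → Carrier
    g n with n ℕ.<? bound p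
    ... | yes _ = proj₁ (f n)
    ... | no _  = 0#
    g-van : ∀ n → bound p ≤ n → g n ≈ 0#
    g-van n l with n ℕ.<? bound p
    ... | yes l′ = ⊥-elim (ℕP.<⇒≱ l′ l)
    ... | no _   = refl
    g-eq : ∀ n → coef p n ≈ c * g n
    g-eq n with n ℕ.<? bound p
    ... | yes _ = proj₂ (f n)
    ... | no l  = trans (coef-bound p n (ℕP.≮⇒≥ l)) (sym (zeroʳ c))

  module RootsDom (D : Dom R) where
    open Dom D
    open Pol.WithDom R D using (leading)
    open import Algebra.Properties.Ring ring using (x∙y⁻¹≈ε⇒x≈y; -0#≈0#)

    natR-≢ : ∀ j k → ¬ (natR j - natR (suc (j ℕ.+ k)) ≈ 0#)
    natR-≢ j k e = natR≉0 k (+-cancelˡ (natR j) (natR (suc k)) 0# (begin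
      natR j + natR (suc k)   ≈⟨ Sums.natR-+ R j (suc k) ⟨
      natR (j ℕ.+ suc k)      ≡⟨ ≡.cong natR (ℕP.+-suc j k) ⟩
      natR (suc (j ℕ.+ k))    ≈⟨ x∙y⁻¹≈ε⇒x≈y (natR j) (natR (suc (j ℕ.+ k))) e ⟨
      natR j                  ≈⟨ +-identityʳ (natR j) ⟨
      natR j + 0# ∎))
      where
      open import Relation.Binary.Reasoning.Setoid setoid
      open import Algebra.Properties.Ring ring using (+-cancelˡ)

    quotient-Deg : ∀ n a p q → p P.≈ (X P.- K a) P.* q → Deg≤ (suc n) p → Deg≤ n q
    quotient-Deg n a p q pq d with leading q
    ... | inj₁ e = λ k _ → coef≈0 e k
    ... | inj₂ (m , dm , nm) with m ℕ.≤? n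
    ...   | yes m≤n = λ k l → dm k (ℕP.≤-<-trans m≤n l)
    ...   | no m≰n = ⊥-elim (nm (begin
      coef q m                              ≈⟨ +-identityʳ _ ⟨
      coef q m + 0#                         ≈⟨ +-congˡ -0#≈0# ⟨
      coef q m - 0#                         ≈⟨ +-congˡ (-‿cong (trans (*-congˡ (dm (suc m) (ℕP.n<1+n m))) (zeroʳ a))) ⟨
      coef q m - a * coef q (suc m)         ≈⟨ coef-X-K* a q m ⟨
      coef ((X P.- K a) P.* q) (suc m)      ≈⟨ coef-cong pq (suc m) ⟨
      coef p (suc m)                        ≈⟨ d (suc m) (s≤s (ℕP.≰⇒> m≰n)) ⟩
      0# ∎))
      where open import Relation.Binary.Reasoning.Setoid setoid

    evalAt-factor : ∀ a b p q → p P.≈ (X P.- K b) P.* q → ⟦ evalAt a ⟧ p ≈ (a - b) * ⟦ evalAt a ⟧ q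
    evalAt-factor a b p q pq = trans (Hom.⟦⟧-cong (evalAt a) pq) (trans (Hom.*-homo (evalAt a) (X P.- K b) q)
      (*-congʳ (trans (Hom.sub-homo (evalAt a) X (K b)) (+-cong (lift-X (idHom R) a) (-‿cong (lift-K (idHom R) a b))))))

    -- In characteristic zero 0, ..., n are n + 1 distinct points. They are tried from the largest
    -- downwards; if that one is a root, its linear factor is split off, and this factor does not
    -- vanish at the smaller points.
    nonroot₀ : ∀ n p → Deg≤ n p → ¬ (p P.≈ P.0#) → Σ ℕ λ k → k ≤ n × ¬ (⟦ evalAt (natR k) ⟧ p ≈ 0#)
    nonroot₀ zero p d ne = 0 , z≤n , λ e → ne (P.trans (Deg≤0 d) (Hom.≈0-homo KHom (coef0≈0 e)))
      where
      coef0≈0 : ⟦ evalAt (natR 0) ⟧ p ≈ 0# → coef p 0 ≈ 0#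
      coef0≈0 e = trans (sym (lift-K (idHom R) (natR 0) (coef p 0))) (trans (Hom.⟦⟧-cong (evalAt (natR 0)) (P.sym (Deg≤0 d))) e)
    nonroot₀ (suc n) p d ne = go (⟦ evalAt (natR (suc n)) ⟧ p ≟0)
      where
      go : Dec (⟦ evalAt (natR (suc n)) ⟧ p ≈ 0#) → Σ ℕ λ k → k ≤ suc n × ¬ (⟦ evalAt (natR k) ⟧ p ≈ 0#)
      go (no h)  = suc n , ℕP.≤-refl , h
      go (yes e) = k , ℕP.m≤n⇒m≤1+n k≤n , λ e′ → *≉0 k≢ hk (trans (sym (evalAt-factor _ _ p q pq)) e′)
        where
        q = proj₁ (factor (natR (suc n)) p e)
        pq = proj₂ (factor (natR (suc n)) p e)
        ih = nonroot₀ n q (quotient-Deg n _ p q pq d) (λ e → ne (P.trans pq (P.trans (P.*-congˡ e) (P.zeroʳ _))))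
        k = proj₁ ih
        k≤n = proj₁ (proj₂ ih)
        hk = proj₂ (proj₂ ih)
        k≢ : ¬ (natR k - natR (suc n) ≈ 0#)
        k≢ = ≡.subst (λ m → ¬ (natR k - natR (suc m) ≈ 0#)) (ℕP.m+[n∸m]≡n k≤n) (natR-≢ k (n ∸ k))

    abstract
      nonroot : ∀ n p → Deg≤ n p → ¬ (p P.≈ P.0#) → Σ ℕ λ k → k ≤ n × ¬ (⟦ evalAt (natR k) ⟧ p ≈ 0#)
      nonroot = nonroot₀

-- Sections with respect to z ↦ z⁴

comb : (R : CRing) (σ : Hom R R) (z : CommutativeRing.Carrier R) (s : Fin 4 → CommutativeRing.Carrier R) → CommutativeRing.Carrier R
comb R σ z s = ⟦ σ ⟧ (s 0F) + z * (⟦ σ ⟧ (s 1F) + z * (⟦ σ ⟧ (s 2F) + z * ⟦ σ ⟧ (s 3F)))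
  where open CommutativeRing R

-- Every element is uniquely Σ_{r<4} z^r σ(s_r).
record Sections (R : CRing) (σ : Hom R R) (z : CommutativeRing.Carrier R) : Set where
  open CommutativeRing R
  field
    sec      : Carrier → Fin 4 → Carrier
    sec-comb : ∀ x → x ≈ comb R σ z (sec x)
    sec-uniq : ∀ s → comb R σ z s ≈ 0# → ∀ i → s i ≈ 0#

module CombHom {R S : CRing} (h : Hom R S) (σ : Hom R R) (σ′ : Hom S S) (z : CommutativeRing.Carrier R) (z′ : CommutativeRing.Carrier S) where
  private
    module R = CommutativeRing R
    module S = CommutativeRing S
    module h = Hom h

  comb-hom : (∀ x → ⟦ h ⟧ (⟦ σ ⟧ x) S.≈ ⟦ σ′ ⟧ (⟦ h ⟧ x)) → ⟦ h ⟧ z S.≈ z′ → ∀ s → ⟦ h ⟧ (comb R σ z s) S.≈ comb S σ′ z′ (λ i → ⟦ h ⟧ (s i))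
  comb-hom hσ hz s = step _ _ (step _ _ (step _ _ (hσ _)))
    where
    step : ∀ x y {w} → ⟦ h ⟧ y S.≈ w → ⟦ h ⟧ (⟦ σ ⟧ x R.+ z R.* y) S.≈ ⟦ σ′ ⟧ (⟦ h ⟧ x) S.+ z′ S.* w
    step x y e = S.trans (h.+-homo _ _) (S.+-cong (hσ x) (S.trans (h.*-homo _ _) (S.*-cong hz e)))

open CombHom using (comb-hom) public

module CombLaws (R : CRing) (σ : Hom R R) (z : CommutativeRing.Carrier R) where
  open CommutativeRing R
  open Sums R using (module Solver)
  open import Algebra.Properties.Ring ring using (x∙y⁻¹≈ε⇒x≈y; x≈y⇒x∙y⁻¹≈ε)

  comb-cong : ∀ {s s′} → (∀ i → s i ≈ s′ i) → comb R σ z s ≈ comb R σ z s′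
  comb-cong e = +-cong (Hom.⟦⟧-cong σ (e _)) (*-congˡ (+-cong (Hom.⟦⟧-cong σ (e _)) (*-congˡ (+-cong (Hom.⟦⟧-cong σ (e _)) (*-congˡ (Hom.⟦⟧-cong σ (e _)))))))

  comb-sub : ∀ s s′ → comb R σ z (λ i → s i - s′ i) ≈ comb R σ z s - comb R σ z s′
  comb-sub s s′ = step (step (step (Hom.sub-homo σ _ _)))
    where
    step : ∀ {x x′ y y′ w} → w ≈ y - y′ → ⟦ σ ⟧ (x - x′) + z * w ≈ (⟦ σ ⟧ x + z * y) - (⟦ σ ⟧ x′ + z * y′)
    step e = trans (+-cong (Hom.sub-homo σ _ _) (*-congˡ e))
      (let open Solver in solve 5 (λ a a′ b b′ z → (a :- a′) :+ z :* (b :- b′) := (a :+ z :* b) :- (a′ :+ z :* b′)) refl _ _ _ _ z)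

  comb-σ* : ∀ a s → comb R σ z (λ i → a * s i) ≈ ⟦ σ ⟧ a * comb R σ z s
  comb-σ* a s = step (step (step (Hom.*-homo σ _ _)))
    where
    step : ∀ {x y w} → w ≈ ⟦ σ ⟧ a * y → ⟦ σ ⟧ (a * x) + z * w ≈ ⟦ σ ⟧ a * (⟦ σ ⟧ x + z * y)
    step e = trans (+-cong (Hom.*-homo σ _ _) (*-congˡ e))
      (let open Solver in solve 4 (λ k a b z → k :* a :+ z :* (k :* b) := k :* (a :+ z :* b)) refl _ _ _ z)

  module _ (S : Sections R σ z) where
    open Sections S
    comb-inj : ∀ s s′ → comb R σ z s ≈ comb R σ z s′ → ∀ i → s i ≈ s′ i
    comb-inj s s′ e i = x∙y⁻¹≈ε⇒x≈y _ _ (sec-uniq (λ i → s i - s′ i) (trans (comb-sub s s′) (x≈y⇒x∙y⁻¹≈ε e)) i)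

-- Here the endomorphism acts on coefficients and fixes the variable, so sections are taken
-- coefficientwise. Four iterations give the sections of ℤ[z][x,y,t,τ].
module PolySections {R : CRing} (σ : Hom R R) (z : CommutativeRing.Carrier R) (S : Sections R σ z) where
  open CommutativeRing R
  open Pol R hiding (Poly)
  open Sections S
  open CombLaws R σ z

  coef-comb : ∀ s n → coef (comb (Poly R) (mapHom σ) (K z) s) n ≈ comb R σ z (λ i → coef (s i) n)
  coef-comb s n = step _ _ (step _ _ (step _ _ (coef-map σ _ n)))
    where
    step : ∀ x y {w} → coef y n ≈ w → coef (⟦ mapHom σ ⟧ x P.+ K z P.* y) n ≈ ⟦ σ ⟧ (coef x n) + z * w
    step x y e = trans (coef-+ _ _ n) (+-cong (coef-map σ x n) (trans (coef-K* z y n) (*-congˡ e)))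

  polySections : Sections (Poly R) (mapHom σ) (K z)
  polySections = record
    { sec = sec′
    ; sec-comb = λ p → ext (λ n → sym (trans (coef-comb (sec′ p) n) (trans (comb-cong {s = λ i → coef (sec′ p i) n} {s′ = sec (coef p n)} (at p n)) (sym (sec-comb (coef p n))))))
    ; sec-uniq = λ s e i → ext0 (λ n → sec-uniq (λ i → coef (s i) n) (trans (sym (coef-comb s n)) (coef≈0 e n)) i) }
    where
    sec′ : P.Carrier → Fin 4 → P.Carrier
    sec′ p i = tabulate (λ n → sec (coef p n) i) (bound p) (λ n l → sec-uniq (sec (coef p n)) (trans (sym (sec-comb _)) (coef-bound p n l)) i)
    at : ∀ p n i → coef (sec′ p i) n ≈ sec (coef p n) i
    at p n i = coef-tabulate _ _ _ n

-- Dilation z ↦ z⁴ and sections of power series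

module Dilation (R : CRing) where
  open CommutativeRing R hiding (zero)
  open PowerSeries R
  open Sums R
  open SeriesLaws R
  open import Relation.Binary.Reasoning.Setoid setoid

  𝕊 : CRing
  𝕊 = series

  -- Recursion in steps of four, instead of division of the index, makes multiplicativity an
  -- induction; `dilate≋dil` identifies the result with `dilate 4`.
  dil : Series → Series
  dil f 0 = f 0
  dil f 1 = 0#
  dil f 2 = 0#
  dil f 3 = 0#
  dil f (suc (suc (suc (suc n)))) = dil (tail f) n

  dil-cong : ∀ {f g} → f ≋ g → dil f ≋ dil g
  dil-cong e 0 = e 0
  dil-cong e 1 = refl
  dil-cong e 2 = refl
  dil-cong e 3 = refl
  dil-cong e (suc (suc (suc (suc n)))) = dil-cong (λ i → e (suc i)) n

  dil-+ : ∀ f g → dil (f ⊕ g) ≋ (dil f ⊕ dil g)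
  dil-+ f g 0 = refl
  dil-+ f g 1 = sym (+-identityˡ _)
  dil-+ f g 2 = sym (+-identityˡ _)
  dil-+ f g 3 = sym (+-identityˡ _)
  dil-+ f g (suc (suc (suc (suc n)))) = dil-+ (tail f) (tail g) n

  dil-· : ∀ a f → dil (a · f) ≋ (a · dil f)
  dil-· a f 0 = refl
  dil-· a f 1 = sym (zeroʳ a)
  dil-· a f 2 = sym (zeroʳ a)
  dil-· a f 3 = sym (zeroʳ a)
  dil-· a f (suc (suc (suc (suc n)))) = dil-· a (tail f) n

  dil-0 : ∀ {f} → (∀ n → f n ≈ 0#) → ∀ n → dil f n ≈ 0#
  dil-0 e 0 = e 0
  dil-0 e 1 = refl
  dil-0 e 2 = refl
  dil-0 e 3 = refl
  dil-0 e (suc (suc (suc (suc n)))) = dil-0 (λ i → e (suc i)) n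

  dil-⊙ : ∀ f g → dil (f ⊙ g) ≋ (dil f ⊙ dil g)
  dil-⊙ f g 0 = refl
  dil-⊙ f g 1 = sym (Σ-zero 2 {λ i → dil f i * dil g (1 ∸ i)} λ { 0 _ → zeroʳ _ ; 1 _ → zeroˡ _ ; (suc (suc _)) (s≤s (s≤s ())) })
  dil-⊙ f g 2 = sym (Σ-zero 3 {λ i → dil f i * dil g (2 ∸ i)} λ { 0 _ → zeroʳ _ ; 1 _ → zeroˡ _ ; 2 _ → zeroˡ _ ; (suc (suc (suc _))) (s≤s (s≤s (s≤s ()))) })
  dil-⊙ f g 3 = sym (Σ-zero 4 {λ i → dil f i * dil g (3 ∸ i)} λ { 0 _ → zeroʳ _ ; 1 _ → zeroˡ _ ; 2 _ → zeroˡ _ ; 3 _ → zeroˡ _ ; (suc (suc (suc (suc _)))) (s≤s (s≤s (s≤s (s≤s ())))) })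
  dil-⊙ f g (suc (suc (suc (suc n)))) = sym (begin
    (dil f ⊙ dil g) (4 ℕ.+ n)                              ≈⟨ ⊙-suc (dil f) (dil g) (3 ℕ.+ n) ⟩
    f 0 * dil (tail g) n + (tail (dil f) ⊙ dil g) (3 ℕ.+ n) ≈⟨ +-congˡ (drop (tail (dil f)) (2 ℕ.+ n) refl) ⟩
    f 0 * dil (tail g) n + (tail (tail (dil f)) ⊙ dil g) (2 ℕ.+ n) ≈⟨ +-congˡ (drop (tail (tail (dil f))) (1 ℕ.+ n) refl) ⟩
    f 0 * dil (tail g) n + (tail (tail (tail (dil f))) ⊙ dil g) (1 ℕ.+ n) ≈⟨ +-congˡ (drop (tail (tail (tail (dil f)))) n refl) ⟩
    f 0 * dil (tail g) n + (dil (tail f) ⊙ dil g) n        ≈⟨ +-cong (dil-· (f 0) (tail g) n) (dil-⊙ (tail f) g n) ⟨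
    dil (f 0 · tail g) n + dil (tail f ⊙ g) n              ≈⟨ dil-+ _ _ n ⟨
    dil ((f 0 · tail g) ⊕ (tail f ⊙ g)) n                  ≈⟨ dil-cong (tail-⊙ f g) n ⟨
    dil (tail (f ⊙ g)) n ∎)
    where
    drop : ∀ h k → h 0 ≈ 0# → (h ⊙ dil g) (suc k) ≈ (tail h ⊙ dil g) k
    drop h k e = trans (⊙-suc h (dil g) k) (trans (+-congʳ (trans (*-congʳ e) (zeroˡ _))) (+-identityˡ _))

  dil-1 : dil (zpow 0) ≋ zpow 0
  dil-1 0 = refl
  dil-1 1 = refl
  dil-1 2 = refl
  dil-1 3 = refl
  dil-1 (suc (suc (suc (suc n)))) = dil-0 (λ _ → refl) n

  σS : Hom 𝕊 𝕊
  σS = record { ⟦_⟧ = dil ; ⟦⟧-cong = dil-cong ; +-homo = dil-+ ; *-homo = dil-⊙ ; 1-homo = dil-1 }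

  -- A series described by its subsequences on the residue classes modulo 4. Multiplication by z
  -- moves each class to the next one, so the four summands of a `comb` fall into place one after
  -- the other.
  record Vals (G v₀ v₁ v₂ v₃ : Series) : Set where
    constructor vals
    field
      at0 : ∀ k → G (k ℕ.* 4) ≈ v₀ k
      at1 : ∀ k → G (1 ℕ.+ k ℕ.* 4) ≈ v₁ k
      at2 : ∀ k → G (2 ℕ.+ k ℕ.* 4) ≈ v₂ k
      at3 : ∀ k → G (3 ℕ.+ k ℕ.* 4) ≈ v₃ k
  open Vals

  𝟘 : Series
  𝟘 _ = 0#

  dil-vals : ∀ f → Vals (dil f) f 𝟘 𝟘 𝟘
  dil-vals f = vals (go0 f) (go1 f) (go2 f) (go3 f)
    where
    go0 : ∀ f k → dil f (k ℕ.* 4) ≈ f k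
    go0 f zero    = refl
    go0 f (suc k) = go0 (tail f) k
    go1 : ∀ f k → dil f (1 ℕ.+ k ℕ.* 4) ≈ 0#
    go1 f zero    = refl
    go1 f (suc k) = go1 (tail f) k
    go2 : ∀ f k → dil f (2 ℕ.+ k ℕ.* 4) ≈ 0#
    go2 f zero    = refl
    go2 f (suc k) = go2 (tail f) k
    go3 : ∀ f k → dil f (3 ℕ.+ k ℕ.* 4) ≈ 0#
    go3 f zero    = refl
    go3 f (suc k) = go3 (tail f) k

  z* : ∀ G n → (zpow 1 ⊙ G) (suc n) ≈ G n
  z* G n = zpow-shift 1 G (suc n)

  z*0 : ∀ G → (zpow 1 ⊙ G) 0 ≈ 0#
  z*0 G = zpow-shift 1 G 0

  shift-vals : ∀ f {G v₀ v₁ v₂} → Vals G v₀ v₁ v₂ 𝟘 → Vals (dil f ⊕ (zpow 1 ⊙ G)) f v₀ v₁ v₂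
  shift-vals f {G} V = vals
    (λ { zero → trans (+-cong (at0 (dil-vals f) 0) (z*0 G)) (+-identityʳ _)
       ; (suc k) → trans (+-cong (at0 (dil-vals f) (suc k)) (trans (z* G (3 ℕ.+ k ℕ.* 4)) (at3 V k))) (+-identityʳ _) })
    (λ k → trans (+-cong (at1 (dil-vals f) k) (trans (z* G (k ℕ.* 4)) (at0 V k))) (+-identityˡ _))
    (λ k → trans (+-cong (at2 (dil-vals f) k) (trans (z* G (1 ℕ.+ k ℕ.* 4)) (at1 V k))) (+-identityˡ _))
    (λ k → trans (+-cong (at3 (dil-vals f) k) (trans (z* G (2 ℕ.+ k ℕ.* 4)) (at2 V k))) (+-identityˡ _))

  comb-vals : ∀ s → Vals (comb 𝕊 σS (zpow 1) s) (s 0F) (s 1F) (s 2F) (s 3F)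
  comb-vals s = shift-vals (s 0F) (shift-vals (s 1F) (shift-vals (s 2F) (dil-vals (s 3F))))

  by4 : ∀ f g → (∀ k → f (k ℕ.* 4) ≈ g (k ℕ.* 4)) → (∀ k → f (1 ℕ.+ k ℕ.* 4) ≈ g (1 ℕ.+ k ℕ.* 4)) →
        (∀ k → f (2 ℕ.+ k ℕ.* 4) ≈ g (2 ℕ.+ k ℕ.* 4)) → (∀ k → f (3 ℕ.+ k ℕ.* 4) ≈ g (3 ℕ.+ k ℕ.* 4)) → f ≋ g
  by4 f g a b c d 0 = a 0
  by4 f g a b c d 1 = b 0
  by4 f g a b c d 2 = c 0
  by4 f g a b c d 3 = d 0
  by4 f g a b c d (suc (suc (suc (suc n)))) = by4 (λ i → f (4 ℕ.+ i)) (λ i → g (4 ℕ.+ i)) (λ k → a (suc k)) (λ k → b (suc k)) (λ k → c (suc k)) (λ k → d (suc k)) n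

  secS : Series → Fin 4 → Series
  secS f 0F k = f (k ℕ.* 4)
  secS f 1F k = f (1 ℕ.+ k ℕ.* 4)
  secS f 2F k = f (2 ℕ.+ k ℕ.* 4)
  secS f 3F k = f (3 ℕ.+ k ℕ.* 4)

  secS-comb : ∀ f → f ≋ comb 𝕊 σS (zpow 1) (secS f)
  secS-comb f = by4 f _ (λ k → sym (at0 V k)) (λ k → sym (at1 V k)) (λ k → sym (at2 V k)) (λ k → sym (at3 V k))
    where V = comb-vals (secS f)

  secS-comb⁻¹ : ∀ s i → secS (comb 𝕊 σS (zpow 1) s) i ≋ s i
  secS-comb⁻¹ s 0F = at0 (comb-vals s)
  secS-comb⁻¹ s 1F = at1 (comb-vals s)
  secS-comb⁻¹ s 2F = at2 (comb-vals s)
  secS-comb⁻¹ s 3F = at3 (comb-vals s)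

  secS-0 : ∀ {f} → f ≋ 𝟘 → ∀ i → secS f i ≋ 𝟘
  secS-0 e 0F k = e _
  secS-0 e 1F k = e _
  secS-0 e 2F k = e _
  secS-0 e 3F k = e _

  seriesSections : Sections 𝕊 σS (zpow 1)
  seriesSections = record
    { sec = secS
    ; sec-comb = secS-comb
    ; sec-uniq = λ s e i k → trans (sym (secS-comb⁻¹ s i k)) (secS-0 e i k) }

  open Pol R hiding (Poly)

  ζ : Hom (Poly R) 𝕊
  ζ = record { ⟦_⟧ = coef ; ⟦⟧-cong = coef-cong ; +-homo = coef-+ ; *-homo = coef-* ; 1-homo = coef-1 }

  private
    dil-van : ∀ b f → (∀ n → b ≤ n → f n ≈ 0#) → ∀ n → b ℕ.* 4 ≤ n → dil f n ≈ 0#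
    dil-van zero    f v n l = dil-0 (λ i → v i z≤n) n
    dil-van (suc b) f v (suc (suc (suc (suc n)))) (s≤s (s≤s (s≤s (s≤s l)))) = dil-van b (tail f) (λ i l → v (suc i) (s≤s l)) n l

    dilP : P.Carrier → P.Carrier
    dilP p = tabulate (dil (coef p)) (bound p ℕ.* 4) (dil-van (bound p) (coef p) (coef-bound p))

    at : ∀ p n → coef (dilP p) n ≈ dil (coef p) n
    at p n = coef-tabulate _ _ _ n

  abstract
    σP : Hom (Poly R) (Poly R)
    σP = record
      { ⟦_⟧ = dilP
      ; ⟦⟧-cong = λ {p} {q} e → ext (λ n → trans (at p n) (trans (dil-cong (coef-cong e) n) (sym (at q n))))
      ; +-homo = λ p q → ext (λ n → trans (at (p P.+ q) n) (trans (dil-cong (coef-+ p q) n) (trans (dil-+ (coef p) (coef q) n)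
          (trans (+-cong (sym (at p n)) (sym (at q n))) (sym (coef-+ (dilP p) (dilP q) n))))))
      ; *-homo = λ p q → ext (λ n → trans (at (p P.* q) n) (trans (dil-cong (coef-* p q) n) (trans (dil-⊙ (coef p) (coef q) n)
          (trans (⊙-cong {dil (coef p)} {coef (dilP p)} {dil (coef q)} {coef (dilP q)} (λ i → sym (at p i)) (λ i → sym (at q i)) n) (sym (coef-* (dilP p) (dilP q) n))))))
      ; 1-homo = ext (λ n → trans (at P.1# n) (trans (dil-cong coef-1 n) (trans (dil-1 n) (sym (coef-1 n))))) }

    coef-σ : ∀ p → coef (⟦ σP ⟧ p) ≋ dil (coef p)
    coef-σ p n = coef-tabulate _ _ _ n

  ζ-comb : ∀ s → coef (comb (Poly R) σP X s) ≋ comb 𝕊 σS (zpow 1) (λ i → coef (s i))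
  ζ-comb = comb-hom ζ σP σS X (zpow 1) coef-σ coef-X

  private
    secP : P.Carrier → Fin 4 → P.Carrier
    secP p i = tabulate (secS (coef p) i) (bound p) (van i)
      where
      van : ∀ i n → bound p ≤ n → secS (coef p) i n ≈ 0#
      le : ∀ k n → n ≤ k ℕ.+ n ℕ.* 4
      le k n = ℕP.≤-trans (ℕP.m≤m*n n 4) (ℕP.m≤n+m _ k)
      van 0F n l = coef-bound p _ (ℕP.≤-trans l (le 0 n))
      van 1F n l = coef-bound p _ (ℕP.≤-trans l (le 1 n))
      van 2F n l = coef-bound p _ (ℕP.≤-trans l (le 2 n))
      van 3F n l = coef-bound p _ (ℕP.≤-trans l (le 3 n))

    at-sec : ∀ p i → coef (secP p i) ≋ secS (coef p) i
    at-sec p i k = coef-tabulate _ _ _ k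

    combS-cong : ∀ {s s′ : Fin 4 → Series} → (∀ i → s i ≋ s′ i) → comb 𝕊 σS (zpow 1) s ≋ comb 𝕊 σS (zpow 1) s′
    combS-cong = CombLaws.comb-cong 𝕊 σS (zpow 1)

  abstract
    polySections₀ : Sections (Poly R) σP X
    polySections₀ = record
      { sec = secP
      ; sec-comb = λ p → ext (λ n → trans (secS-comb (coef p) n) (sym (trans (ζ-comb (secP p) n) (combS-cong {λ i → coef (secP p i)} {secS (coef p)} (at-sec p) n))))
      ; sec-uniq = λ s e i → ext0 (Sections.sec-uniq seriesSections (λ i → coef (s i)) (λ n → trans (sym (ζ-comb s n)) (coef≈0 e n)) i) }

    coef-sec : ∀ p i k → coef (Sections.sec polySections₀ p i) k ≈ secS (coef p) i k
    coef-sec p i k = coef-tabulate _ _ _ k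

elim4 : (Q : ℕ → Set) → (∀ k → Q (k ℕ.* 4)) → (∀ k → Q (1 ℕ.+ k ℕ.* 4)) → (∀ k → Q (2 ℕ.+ k ℕ.* 4)) → (∀ k → Q (3 ℕ.+ k ℕ.* 4)) → ∀ n → Q n
elim4 Q a b c d 0 = a 0
elim4 Q a b c d 1 = b 0
elim4 Q a b c d 2 = c 0
elim4 Q a b c d 3 = d 0
elim4 Q a b c d (suc (suc (suc (suc n)))) = elim4 (λ m → Q (4 ℕ.+ m)) (λ k → a (suc k)) (λ k → b (suc k)) (λ k → c (suc k)) (λ k → d (suc k)) n

module PolyAux (R : CRing) where
  open CommutativeRing R hiding (zero)
  open Pol R hiding (Poly)
  open Sums R
  private module SP = Sums (Poly R)
  open SP using () renaming (_^_ to _^ₚ_) public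

  X^-+ : ∀ p m k → coef (X ^ₚ m P.* p) (m ℕ.+ k) ≈ coef p k
  X^-+ p zero    k = coef-cong (P.*-identityˡ p) k
  X^-+ p (suc m) k = trans (coef-cong (P.*-assoc X (X ^ₚ m) p) (suc (m ℕ.+ k))) (trans (coef-X*suc _ (m ℕ.+ k)) (X^-+ p m k))

  X^-< : ∀ p m k → k < m → coef (X ^ₚ m P.* p) k ≈ 0#
  X^-< p (suc m) zero    l       = trans (coef-cong (P.*-assoc X (X ^ₚ m) p) 0) (coef-X*0 _)
  X^-< p (suc m) (suc k) (s≤s l) = trans (coef-cong (P.*-assoc X (X ^ₚ m) p) (suc k)) (trans (coef-X*suc _ k) (X^-< p m k l))

  coef-*X^-+ : ∀ p m k → coef (p P.* X ^ₚ m) (m ℕ.+ k) ≈ coef p k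
  coef-*X^-+ p m k = trans (coef-cong (P.*-comm _ _) _) (X^-+ p m k)

  coef-*X^-< : ∀ p m k → k < m → coef (p P.* X ^ₚ m) k ≈ 0#
  coef-*X^-< p m k l = trans (coef-cong (P.*-comm _ _) _) (X^-< p m k l)

  mon-same : ∀ a m → coef (K a P.* X ^ₚ m) m ≈ a
  mon-same a m = trans (reflexive (≡.cong (coef (K a P.* X ^ₚ m)) (≡.sym (ℕP.+-identityʳ m)))) (trans (coef-*X^-+ (K a) m 0) (coef-K0 a))

  mon-other : ∀ a m k → ¬ k ≡ m → coef (K a P.* X ^ₚ m) k ≈ 0#
  mon-other a m k ne with k ℕ.<? m
  ... | yes l = coef-*X^-< (K a) m k l
  ... | no l with k ∸ m in eq
  ...   | zero  = ⊥-elim (ne (ℕP.≤-antisym (ℕP.m∸n≡0⇒m≤n eq) (ℕP.≮⇒≥ l)))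
  ...   | suc j = trans (reflexive (≡.cong (coef (K a P.* X ^ₚ m)) (≡.trans (≡.sym (ℕP.m+[n∸m]≡n (ℕP.≮⇒≥ l))) (≡.cong (m ℕ.+_) eq)))) (trans (coef-*X^-+ (K a) m (suc j)) (coef-Ksuc a j))

  coef-Σrev : ∀ e (a : ℕ → Carrier) l → l ≤ e → coef (PowerSeries.Σ< (Poly R) (suc e) (λ n → K (a n) P.* X ^ₚ (e ∸ n))) (e ∸ l) ≈ a l
  coef-Σrev e a l l≤e = trans (coef-Σ (suc e) _ (e ∸ l))
    (trans (Σ-cong (suc e) {b = b} (λ i i<se → b-eq i (ℕP.≤-pred i<se)))
      (trans (Σ-single (suc e) l b (s≤s l≤e) (λ i ne → b-other i ne)) b-same))
    where
    b : ℕ → Carrier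
    b i with i ℕ.≟ l
    ... | yes _ = a i
    ... | no _ = 0#
    b-eq : ∀ i → i ≤ e → coef (K (a i) P.* X ^ₚ (e ∸ i)) (e ∸ l) ≈ b i
    b-eq i i≤e with i ℕ.≟ l
    ... | yes ≡.refl = mon-same (a i) (e ∸ i)
    ... | no ne = mon-other (a i) (e ∸ i) (e ∸ l) (λ q → ne (ℕP.∸-cancelˡ-≡ i≤e l≤e (≡.sym q)))
    b-other : ∀ i → ¬ i ≡ l → b i ≈ 0#
    b-other i ne with i ℕ.≟ l
    ... | yes q = ⊥-elim (ne q)
    ... | no _ = refl
    b-same : b l ≈ a l
    b-same with l ℕ.≟ l
    ... | yes _ = refl
    ... | no ne = ⊥-elim (ne ≡.refl)

  coef-Σmon : ∀ e (a : ℕ → Carrier) l → l ≤ e → coef (PowerSeries.Σ< (Poly R) (suc e) (λ n → K (a n) P.* X ^ₚ n)) l ≈ a l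
  coef-Σmon e a l l≤e = trans (coef-Σ (suc e) _ l)
    (trans (Σ-single (suc e) l _ (s≤s l≤e) (λ i ne → mon-other (a i) i l (λ q → ne (≡.sym q)))) (mon-same (a l) l))

  coef-Σmon-> : ∀ e (a : ℕ → Carrier) l → e < l → coef (PowerSeries.Σ< (Poly R) (suc e) (λ n → K (a n) P.* X ^ₚ n)) l ≈ 0#
  coef-Σmon-> e a l e<l = trans (coef-Σ (suc e) _ l) (Σ-zero (suc e) (λ i i<se → mon-other (a i) i l (λ q → ℕP.<⇒≢ (ℕP.<-≤-trans i<se e<l) (≡.sym q))))

  coef-Σrev-> : ∀ e (a : ℕ → Carrier) l → e < l → coef (PowerSeries.Σ< (Poly R) (suc e) (λ n → K (a n) P.* X ^ₚ (e ∸ n))) l ≈ 0#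
  coef-Σrev-> e a l e<l = trans (coef-Σ (suc e) _ l) (Σ-zero (suc e) (λ i i<se → mon-other (a i) (e ∸ i) l (λ q → ℕP.<⇒≢ (ℕP.≤-<-trans (ℕP.m∸n≤m e i) e<l) (≡.sym q))))

  Top-neg : ∀ {n a p} → Top n a p → Top n (- a) (P.- p)
  Top-neg (d , e) = (λ m l → trans (coef-neg _ m) (trans (-‿cong (d m l)) -0#≈0#)) , trans (coef-neg _ _) (-‿cong e)
    where open import Algebra.Properties.Ring ring using (-0#≈0#)

  IsDeg : ℕ → P.Carrier → Set
  IsDeg n p = Deg≤ n p × ¬ (coef p n ≈ 0#)

  IsDeg-unique : ∀ {n m p q} → p P.≈ q → IsDeg n p → IsDeg m q → n ≡ m
  IsDeg-unique e (dp , np) (dq , nq) = Top-unique e (dp , refl) (dq , refl) np nq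

  IsDeg-cong : ∀ {n p q} → p P.≈ q → IsDeg n p → IsDeg n q
  IsDeg-cong e (d , n) = (λ m l → trans (sym (coef-cong e m)) (d m l)) , λ h → n (trans (coef-cong e _) h)

  IsDeg≉0 : ∀ {n p} → IsDeg n p → ¬ (p P.≈ P.0#)
  IsDeg≉0 (d , n) e = n (coef≈0 e _)

  module AuxDom (D : Dom R) where
    open Dom D
    open Roots R
    open RootsDom D

    IsDeg-* : ∀ {n m p q} → IsDeg n p → IsDeg m q → IsDeg (n ℕ.+ m) (p P.* q)
    IsDeg-* {n} {m} {p} {q} (dp , np) (dq , nq) = proj₁ t , λ e → *≉0 np nq (trans (sym (proj₂ t)) e)
      where t = coef-*-top n m p q dp dq

    private
      D′ = Pol.WithDom.dom R D
      module D′ = Dom D′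

    X-K≉0 : ∀ a → ¬ (X P.- K a P.≈ P.0#)
    X-K≉0 a e = 1≉0 (trans (sym (trans (coef-X-K* a P.1# 0) (trans (+-cong (coef-1 0) (-‿cong (trans (*-congˡ (coef-1 1)) (zeroʳ a)))) (trans (+-congˡ -0#≈0#) (+-identityʳ _)))))
                       (coef≈0 (P.trans (P.*-identityʳ _) e) 1))
      where open import Algebra.Properties.Ring ring using (-0#≈0#)

    Mult : ℕ → Carrier → P.Carrier → Set
    Mult m a p = Σ P.Carrier λ q → p P.≈ (X P.- K a) ^ₚ m P.* q

    private
      mult-step : ∀ a b c m w → ¬ (b - a ≈ 0#) → (X P.- K a) P.* c P.≈ (X P.- K b) ^ₚ m P.* w → Mult m b c
      mult-step a b c zero    w ne e = c , P.sym (P.*-identityˡ c)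
      mult-step a b c (suc m) w ne e = proj₁ ih , P.trans hc (P.trans (P.*-congˡ (proj₂ ih)) (P.sym (P.*-assoc _ _ _)))
        where
        cb≈0 : ⟦ evalAt b ⟧ c ≈ 0#
        cb≈0 = cancel0 ne (trans (sym (evalAt-factor b a _ c P.refl)) (trans (Hom.⟦⟧-cong (evalAt b) (P.trans e (P.*-assoc _ _ _)))
          (trans (evalAt-factor b b _ _ P.refl) (trans (*-congʳ (-‿inverseʳ b)) (zeroˡ _)))))
        c₁ = proj₁ (factor b c cb≈0)
        hc = proj₂ (factor b c cb≈0)
        e₁ : (X P.- K a) P.* c₁ P.≈ (X P.- K b) ^ₚ m P.* w
        e₁ = D′.cancelˡ (X-K≉0 b) (P.trans (swap _ _ _) (P.trans (P.*-congˡ (P.sym hc)) (P.trans e (P.*-assoc _ _ _))))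
          where
          swap : ∀ x y z → x P.* (y P.* z) P.≈ y P.* (x P.* z)
          swap x y z = P.trans (P.sym (P.*-assoc _ _ _)) (P.trans (P.*-congʳ (P.*-comm _ _)) (P.*-assoc _ _ _))
        ih = mult-step a b c₁ m w ne e₁

    -- Evaluation at `b`, where X - a does not vanish, shows that a root at `b` of the product is a
    -- root of the cofactor; the factors at `b` are moved over one at a time.
    mult-coprime : ∀ a b m c n p → ¬ (b - a ≈ 0#) → p P.≈ (X P.- K a) ^ₚ m P.* c → Mult n b p → Mult n b c
    mult-coprime a b zero    c n p ne e (w , h) = w , P.trans (P.sym (P.trans e (P.*-identityˡ c))) h
    mult-coprime a b (suc m) c n p ne e (w , h) = mult-coprime a b m c n ((X P.- K a) ^ₚ m P.* c) ne P.refl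
      (mult-step a b _ n w ne (P.trans (P.sym (P.*-assoc _ _ _)) (P.trans (P.sym e) h)))

    Top-X-K : ∀ a → Top 1 1# (X P.- K a)
    Top-X-K a = Top-cong (+-identityʳ 1#) (P.+-congˡ (Hom.neg-homo KHom a)) (Top-+ Top-X (Top-< (s≤s z≤n) (Top-K (- a))))

    Mult-deg : ∀ {m a p q n} → p P.≈ (X P.- K a) ^ₚ m P.* q → IsDeg n q → IsDeg (m ℕ.+ n) p
    Mult-deg {m} {a} {p} {q} {n} e dq = IsDeg-cong (P.sym e) (IsDeg-* top dq)
      where
      t = Top-^ m (Top-X-K a)
      top : IsDeg m ((X P.- K a) ^ₚ m)
      top = ≡.subst (λ k → IsDeg k ((X P.- K a) ^ₚ m)) (ℕP.*-identityʳ m)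
        (proj₁ t , λ e → ^≉0 m 1≉0 (trans (sym (proj₂ t)) e))

    X^Mult : ∀ m p → (∀ k → k < m → coef p k ≈ 0#) → Mult m 0# p
    X^Mult zero    p h = p , P.sym (P.*-identityˡ p)
    X^Mult (suc m) p h = q , P.trans (decompose p) (P.trans (P.+-congʳ (Hom.≈0-homo KHom (h 0 (s≤s z≤n)))) (P.trans (P.+-identityˡ _)
        (P.trans (P.*-cong X≈ (proj₂ ih)) (P.sym (P.*-assoc _ _ _)))))
      where
      ih = X^Mult m (shiftDown p) (λ k l → trans (coef-tabulate _ _ _ k) (h (suc k) (s≤s l)))
      q = proj₁ ih
      open import Algebra.Properties.Ring P.ring using (-0#≈0#)
      X≈ : X P.≈ X P.- K 0#
      X≈ = P.sym (P.trans (P.+-congˡ (P.trans (P.-‿cong (Hom.0-homo KHom)) -0#≈0#)) (P.+-identityʳ X))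

    order₀ : ∀ p → ¬ (p P.≈ P.0#) → Σ ℕ λ n → (∀ k → k < n → coef p k ≈ 0#) × ¬ (coef p n ≈ 0#)
    order₀ p ne = go (bound p) 0 (λ k ()) (λ k l → coef-bound p k (ℕP.≤-trans (ℕP.≤-reflexive (≡.sym (ℕP.+-identityʳ _))) l))
      where
      go : ∀ fuel n → (∀ k → k < n → coef p k ≈ 0#) → (∀ k → fuel ℕ.+ n ≤ k → coef p k ≈ 0#) → Σ ℕ λ n → (∀ k → k < n → coef p k ≈ 0#) × ¬ (coef p n ≈ 0#)
      go zero n h v = ⊥-elim (ne (ext0 λ k → case k (k ℕ.<? n)))
        where
        case : ∀ k → Dec (k < n) → coef p k ≈ 0#
        case k (yes l) = h k l
        case k (no l)  = v k (ℕP.≮⇒≥ l)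
      go (suc fuel) n h v = split (coef p n ≟0)
        where
        split : Dec (coef p n ≈ 0#) → Σ ℕ λ n → (∀ k → k < n → coef p k ≈ 0#) × ¬ (coef p n ≈ 0#)
        split (no q)  = n , h , q
        split (yes q) = go fuel (suc n) (λ k l → case k (ℕP.m≤n⇒m<n∨m≡n (ℕP.≤-pred l))) (λ k l → v k (ℕP.≤-trans (ℕP.≤-reflexive (≡.sym (ℕP.+-suc fuel n))) l))
          where
          case : ∀ k → k < n ⊎ k ≡ n → coef p k ≈ 0#
          case k (inj₁ l)      = h k l
          case k (inj₂ ≡.refl) = q

    abstract
      order : ∀ p → ¬ (p P.≈ P.0#) → Σ ℕ λ n → (∀ k → k < n → coef p k ≈ 0#) × ¬ (coef p n ≈ 0#)
      order = order₀

-- The ring ℤ[z] and one further variable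

Z : CRing
Z = Poly ℤring

-- The outer variable has no fixed meaning: it is u = y/x in `compForm`, and Y = p - u in `FormEq`.
V : CRing
V = Poly Z

module Zr = CommutativeRing Z
module Vr = CommutativeRing V
module Zp = Pol ℤring
module Vp = Pol Z
module Zs = Sums Z
module Vs = Sums V
module ZA = PolyAux ℤring
module VA = PolyAux Z
module ZD = Dilation ℤring

domZ : Dom Z
domZ = Pol.WithDom.dom ℤring ℤ-dom

domV : Dom V
domV = Pol.WithDom.dom Z domZ

module ZAD = PolyAux.AuxDom ℤring ℤ-dom
module VAD = PolyAux.AuxDom Z domZ
module dZ = Dom domZ
module dV = Dom domV

σ : Hom Z Z
σ = ZD.σP

module σ = Hom σ

secZ : Sections Z σ Zp.X
secZ = ZD.polySections₀

zᵖ : Zr.Carrier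
zᵖ = Zp.X

pᵖ : Zr.Carrier
pᵖ = Zr.1# Zr.+ (zᵖ Zr.+ zᵖ Zr.* zᵖ)

IsDeg-σ : ∀ {n q} → ZA.IsDeg n q → ZA.IsDeg (n ℕ.* 4) (⟦ σ ⟧ q)
IsDeg-σ {n} {q} (d , ne) = elim4 (λ m → n ℕ.* 4 < m → Zp.coef (⟦ σ ⟧ q) m ≡ + 0)
    (λ k l → ≡.trans (ZD.coef-σ q _) (≡.trans (at0 k) (d k (ℕP.*-cancelʳ-< 4 n k l))))
    (λ k _ → ≡.trans (ZD.coef-σ q _) (at1 k)) (λ k _ → ≡.trans (ZD.coef-σ q _) (at2 k)) (λ k _ → ≡.trans (ZD.coef-σ q _) (at3 k))
  , λ e → ne (≡.trans (≡.sym (at0 n)) (≡.trans (≡.sym (ZD.coef-σ q _)) e))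
  where open ZD.Vals (ZD.dil-vals (Zp.coef q))

σ≉0 : ∀ {q} → ¬ (q Zr.≈ Zr.0#) → ¬ (⟦ σ ⟧ q Zr.≈ Zr.0#)
σ≉0 ne = ZA.IsDeg≉0 (IsDeg-σ (proj₂ (Zp.WithDom.degree ℤ-dom ne)))

-- Rigidity of binary forms under (x , y) ↦ (p x - y , z x)

module _ where
  open PowerSeries V using (Σ<)
  open Sums V using () renaming (_^_ to _^ᵛ_)
  open Sums Z using () renaming (_^_ to _^ᶻ_)

  -- The form Σ r_n x^n y^(e-n) composed with x ↦ p x - y, y ↦ z x, at x = 1, y = u.
  compForm : ℕ → (ℕ → Zr.Carrier) → Vr.Carrier
  compForm e r = Σ< (suc e) (λ n → Vp.K (r n Zr.* zᵖ ^ᶻ (e ∸ n)) Vr.* (Vp.K pᵖ Vr.- Vp.X) ^ᵛ n)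

  -- For the form h = Σ r_n x^n y^(e-n) this is the invariance κ h(p x - y, z x) = λ′ h^σ(x, y),
  -- compared at x^l y^(e-l); h^σ has the coefficients σ(r_n).
  Rel : ℕ → (κ λ′ : Zr.Carrier) (r : ℕ → Zr.Carrier) → Set
  Rel e κ λ′ r = ∀ l → l ≤ e → κ Zr.* Vp.coef (compForm e r) (e ∸ l) Zr.≈ λ′ Zr.* ⟦ σ ⟧ (r l)

  compForm-cross : ∀ e a b r q → (∀ n → n ≤ e → a Zr.* q n Zr.≈ b Zr.* r n) → Vp.K a Vr.* compForm e q Vr.≈ Vp.K b Vr.* compForm e r
  compForm-cross e a b r q h = Vr.trans (Vr.sym (Vs.Σ-*ˡ (suc e) (Vp.K a) _)) (Vr.trans (Vs.Σ-cong (suc e) (λ n l → term n (h n (ℕP.≤-pred l)))) (Vs.Σ-*ˡ (suc e) (Vp.K b) _))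
    where
    term : ∀ n → a Zr.* q n Zr.≈ b Zr.* r n → Vp.K a Vr.* (Vp.K (q n Zr.* zᵖ ^ᶻ (e ∸ n)) Vr.* (Vp.K pᵖ Vr.- Vp.X) ^ᵛ n) Vr.≈ Vp.K b Vr.* (Vp.K (r n Zr.* zᵖ ^ᶻ (e ∸ n)) Vr.* (Vp.K pᵖ Vr.- Vp.X) ^ᵛ n)
    term n e′ = Vr.trans (lem a (q n)) (Vr.trans (Vr.*-congʳ (Hom.⟦⟧-cong Vp.KHom (Zr.trans (Zr.sym (Zr.*-assoc _ _ _)) (Zr.trans (Zr.*-congʳ e′) (Zr.*-assoc _ _ _))))) (Vr.sym (lem b (r n))))
      where
      lem : ∀ a x → Vp.K a Vr.* (Vp.K (x Zr.* zᵖ ^ᶻ (e ∸ n)) Vr.* (Vp.K pᵖ Vr.- Vp.X) ^ᵛ n) Vr.≈ Vp.K (a Zr.* (x Zr.* zᵖ ^ᶻ (e ∸ n))) Vr.* (Vp.K pᵖ Vr.- Vp.X) ^ᵛ n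
      lem a x = Vr.trans (Vr.sym (Vr.*-assoc _ _ _)) (Vr.*-congʳ (Vr.sym (Hom.*-homo Vp.KHom _ _)))

module Descent (e : ℕ) where
  module C = CombLaws Z σ zᵖ
  open Sections secZ

  T : (ℕ → Zr.Carrier) → ℕ → Zr.Carrier
  T r n = Vp.coef (compForm e r) (e ∸ n)

  -- Passing to a section of T r replaces r by a proportional vector of smaller degree.
  module Step (κ ƛ : Zr.Carrier) (κ≉0 : ¬ (κ Zr.≈ Zr.0#)) (r : ℕ → Zr.Carrier) (rel : Rel e κ ƛ r) (l : ℕ) (l≤e : l ≤ e) (i : Fin 4) where
    q : ℕ → Zr.Carrier
    q n = sec (T r n) i

    -- `rel` at n and at l gives σ(r_l) T_n = σ(r_n) T_l after cancelling κ. The factors lie in the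
    -- image of σ, so the same proportion holds between r and any section of `T r`.
    cross : ∀ n → n ≤ e → r l Zr.* q n Zr.≈ q l Zr.* r n
    cross n n≤e = Zr.trans (C.comb-inj secZ (λ j → r l Zr.* sec (T r n) j) (λ j → r n Zr.* sec (T r l) j) eq i) (Zr.*-comm _ _)
      where
      eq₀ : ⟦ σ ⟧ (r l) Zr.* T r n Zr.≈ ⟦ σ ⟧ (r n) Zr.* T r l
      eq₀ = dZ.cancelˡ κ≉0 (Zr.trans (swap _ _ _) (Zr.trans (Zr.*-congˡ (rel n n≤e)) (Zr.trans (swap′ _ _ _) (Zr.trans (Zr.*-congˡ (Zr.sym (rel l l≤e))) (swap _ _ _)))))
        where
        open Zs.Solver
        swap : ∀ x y z → x Zr.* (y Zr.* z) Zr.≈ y Zr.* (x Zr.* z)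
        swap = solve 3 (λ x y z → x :* (y :* z) := y :* (x :* z)) Zr.refl
        swap′ : ∀ x y z → x Zr.* (y Zr.* z) Zr.≈ z Zr.* (y Zr.* x)
        swap′ = solve 3 (λ x y z → x :* (y :* z) := z :* (y :* x)) Zr.refl
      eq : comb Z σ zᵖ (λ j → r l Zr.* sec (T r n) j) Zr.≈ comb Z σ zᵖ (λ j → r n Zr.* sec (T r l) j)
      eq = Zr.trans (C.comb-σ* (r l) (sec (T r n))) (Zr.trans (Zr.*-congˡ (Zr.sym (sec-comb (T r n)))) (Zr.trans eq₀ (Zr.trans (Zr.*-congˡ (sec-comb (T r l))) (Zr.sym (C.comb-σ* (r n) (sec (T r l)))))))

    Tq : ∀ n → r l Zr.* T q n Zr.≈ q l Zr.* T r n
    Tq n = Zr.trans (Zr.sym (Vp.coef-K* _ _ _)) (Zr.trans (Vp.coef-cong (compForm-cross e (r l) (q l) r q cross) _) (Vp.coef-K* _ _ _))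

    -- Replacing r by a r multiplies κ/ƛ by σ(a)/a. Here a = q_l / r_l, and denominators are
    -- cleared.
    κ′ ƛ′ : Zr.Carrier
    κ′ = κ Zr.* (r l Zr.* ⟦ σ ⟧ (q l))
    ƛ′ = ƛ Zr.* (q l Zr.* ⟦ σ ⟧ (r l))

    rel′ : Rel e κ′ ƛ′ q
    rel′ n n≤e = begin
      (κ Zr.* (r l Zr.* ⟦ σ ⟧ (q l))) Zr.* T q n         ≈⟨ solve 4 (λ k r s t → (k :* (r :* s)) :* t := (k :* s) :* (r :* t)) Zr.refl κ (r l) (⟦ σ ⟧ (q l)) (T q n) ⟩
      (κ Zr.* ⟦ σ ⟧ (q l)) Zr.* (r l Zr.* T q n)         ≈⟨ Zr.*-congˡ (Tq n) ⟩
      (κ Zr.* ⟦ σ ⟧ (q l)) Zr.* (q l Zr.* T r n)         ≈⟨ solve 4 (λ k r s t → (k :* s) :* (r :* t) := (r :* s) :* (k :* t)) Zr.refl κ (q l) (⟦ σ ⟧ (q l)) (T r n) ⟩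
      (q l Zr.* ⟦ σ ⟧ (q l)) Zr.* (κ Zr.* T r n)         ≈⟨ Zr.*-congˡ (rel n n≤e) ⟩
      (q l Zr.* ⟦ σ ⟧ (q l)) Zr.* (ƛ Zr.* ⟦ σ ⟧ (r n))   ≈⟨ solve 4 (λ a b c d → (a :* b) :* (c :* d) := (c :* a) :* (b :* d)) Zr.refl (q l) (⟦ σ ⟧ (q l)) ƛ (⟦ σ ⟧ (r n)) ⟩
      (ƛ Zr.* q l) Zr.* (⟦ σ ⟧ (q l) Zr.* ⟦ σ ⟧ (r n))   ≈⟨ Zr.*-congˡ (σ.*-homo (q l) (r n)) ⟨
      (ƛ Zr.* q l) Zr.* ⟦ σ ⟧ (q l Zr.* r n)             ≈⟨ Zr.*-congˡ (σ.⟦⟧-cong (cross n n≤e)) ⟨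
      (ƛ Zr.* q l) Zr.* ⟦ σ ⟧ (r l Zr.* q n)             ≈⟨ Zr.*-congˡ (σ.*-homo (r l) (q n)) ⟩
      (ƛ Zr.* q l) Zr.* (⟦ σ ⟧ (r l) Zr.* ⟦ σ ⟧ (q n))   ≈⟨ solve 4 (λ a b c d → (a :* b) :* (c :* d) := (a :* (b :* c)) :* d) Zr.refl ƛ (q l) (⟦ σ ⟧ (r l)) (⟦ σ ⟧ (q n)) ⟩
      (ƛ Zr.* (q l Zr.* ⟦ σ ⟧ (r l))) Zr.* ⟦ σ ⟧ (q n) ∎
      where
      open Zs.Solver
      open import Relation.Binary.Reasoning.Setoid Zr.setoid

  secIndex : Fin 4 → ℕ → ℕ
  secIndex 0F k = k ℕ.* 4
  secIndex 1F k = 1 ℕ.+ k ℕ.* 4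
  secIndex 2F k = 2 ℕ.+ k ℕ.* 4
  secIndex 3F k = 3 ℕ.+ k ℕ.* 4

  k*4≤secIndex : ∀ i k → k ℕ.* 4 ≤ secIndex i k
  k*4≤secIndex 0F k = ℕP.≤-refl
  k*4≤secIndex 1F k = ℕP.m≤n+m _ 1
  k*4≤secIndex 2F k = ℕP.m≤n+m _ 2
  k*4≤secIndex 3F k = ℕP.m≤n+m _ 3

  coef-sec : ∀ x i k → Zp.coef (sec x i) k ≡ Zp.coef x (secIndex i k)
  coef-sec x 0F k = ZD.coef-sec x 0F k
  coef-sec x 1F k = ZD.coef-sec x 1F k
  coef-sec x 2F k = ZD.coef-sec x 2F k
  coef-sec x 3F k = ZD.coef-sec x 3F k

  sec-deg : ∀ x i t k → Zp.Deg≤ t x → ¬ (Zp.coef (sec x i) k ≡ + 0) → k ℕ.* 4 ≤ t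
  sec-deg x i t k dx ne with k ℕ.* 4 ℕ.≤? t
  ... | yes le = le
  ... | no nle = ⊥-elim (ne (≡.trans (coef-sec x i k) (dx (secIndex i k) (ℕP.<-≤-trans (ℕP.≰⇒> nle) (k*4≤secIndex i k)))))

  nonzeroSection₀ : ∀ x → ¬ (x Zr.≈ Zr.0#) → Σ (Fin 4) λ i → ¬ (sec x i Zr.≈ Zr.0#)
  nonzeroSection₀ x ne = go (dZ._≟0 (sec x 0F)) (dZ._≟0 (sec x 1F)) (dZ._≟0 (sec x 2F)) (dZ._≟0 (sec x 3F))
    where
    allZero : (∀ i → sec x i Zr.≈ Zr.0#) → ⊥
    allZero h = ne (Zr.trans (sec-comb x) (Zr.trans (C.comb-cong {sec x} {λ i → Zr.0# Zr.* sec x i} (λ i → Zr.trans (h i) (Zr.sym (Zr.zeroˡ _))))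
      (Zr.trans (C.comb-σ* Zr.0# (sec x)) (Zr.trans (Zr.*-congʳ σ.0-homo) (Zr.zeroˡ _)))))
    go : Dec (sec x 0F Zr.≈ Zr.0#) → Dec (sec x 1F Zr.≈ Zr.0#) → Dec (sec x 2F Zr.≈ Zr.0#) → Dec (sec x 3F Zr.≈ Zr.0#) → Σ (Fin 4) λ i → ¬ (sec x i Zr.≈ Zr.0#)
    go (no h) _ _ _ = 0F , h
    go (yes _) (no h) _ _ = 1F , h
    go (yes _) (yes _) (no h) _ = 2F , h
    go (yes _) (yes _) (yes _) (no h) = 3F , h
    go (yes a) (yes b) (yes c) (yes d) = ⊥-elim (allZero λ { 0F → a ; 1F → b ; 2F → c ; 3F → d })

  abstract
    nonzeroSection : ∀ x → ¬ (x Zr.≈ Zr.0#) → Σ (Fin 4) λ i → ¬ (sec x i Zr.≈ Zr.0#)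
    nonzeroSection = nonzeroSection₀

  -- The factor σ(a)/a has degree 3 deg a, so the inequality is insensitive to rescaling r. If deg κ
  -- > deg ƛ, then T_l has degree below 4d, and a nonzero section of it has degree d′ < d. The
  -- corresponding sections of all T_n form a rescaled solution of smaller degree, to which
  -- induction applies.
  degBound : ∀ {d} → Acc _<_ d → ∀ κ ƛ r → Rel e κ ƛ r → ∀ l → l ≤ e → ∀ {dκ dƛ} → ZA.IsDeg dκ κ → ZA.IsDeg dƛ ƛ → ZA.IsDeg d (r l) → dκ ≤ dƛ ℕ.+ 3 ℕ.* d
  degBound {d} (acc rs) κ ƛ r rel l l≤e {dκ} {dƛ} degκ degƛ degr with dκ ℕ.≤? dƛ
  ... | yes le = ℕP.≤-trans le (ℕP.m≤m+n dƛ _)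
  ... | no nle = ℕP.+-cancelˡ-≤ (d ℕ.+ d′ ℕ.* 4) _ _ (ℕP.≤-trans (ℕP.≤-reflexive eq₁) (ℕP.≤-trans ih (ℕP.≤-reflexive eq₂)))
    where
    κ≉0 = ZA.IsDeg≉0 degκ
    degσr = IsDeg-σ degr
    Tl≉0 : ¬ (T r l Zr.≈ Zr.0#)
    Tl≉0 h = dZ.*≉0 (ZA.IsDeg≉0 degƛ) (ZA.IsDeg≉0 degσr) (Zr.trans (Zr.sym (rel l l≤e)) (Zr.trans (Zr.*-congˡ h) (Zr.zeroʳ κ)))
    degT = Zp.WithDom.degree ℤ-dom Tl≉0
    t = proj₁ degT
    i,h = nonzeroSection (T r l) Tl≉0
    i = proj₁ i,h
    open Step κ ƛ κ≉0 r rel l l≤e i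
    degq = Zp.WithDom.degree ℤ-dom (proj₂ i,h)
    d′ = proj₁ degq
    sum-eq : dκ ℕ.+ t ≡ dƛ ℕ.+ d ℕ.* 4
    sum-eq = ZA.IsDeg-unique (rel l l≤e) (ZAD.IsDeg-* degκ (proj₂ degT)) (ZAD.IsDeg-* degƛ degσr)
    d′4≤t : d′ ℕ.* 4 ≤ t
    d′4≤t = sec-deg (T r l) i t d′ (proj₁ (proj₂ degT)) (proj₂ (proj₂ degq))
    t<4d : t < d ℕ.* 4
    t<4d = ℕP.+-cancelˡ-< dƛ t (d ℕ.* 4) (ℕP.<-≤-trans (ℕP.+-monoˡ-< t (ℕP.≰⇒> nle)) (ℕP.≤-reflexive sum-eq))
    d′<d : d′ < d
    d′<d = ℕP.*-cancelʳ-< 4 d′ d (ℕP.≤-<-trans d′4≤t t<4d)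
    degσq = IsDeg-σ (proj₂ degq)
    ih : dκ ℕ.+ (d ℕ.+ d′ ℕ.* 4) ≤ (dƛ ℕ.+ (d′ ℕ.+ d ℕ.* 4)) ℕ.+ 3 ℕ.* d′
    ih = degBound (rs d′<d) κ′ ƛ′ q rel′ l l≤e (ZAD.IsDeg-* degκ (ZAD.IsDeg-* degr degσq)) (ZAD.IsDeg-* degƛ (ZAD.IsDeg-* (proj₂ degq) degσr)) (proj₂ degq)
    open +-*-Solver
    eq₁ : (d ℕ.+ d′ ℕ.* 4) ℕ.+ dκ ≡ dκ ℕ.+ (d ℕ.+ d′ ℕ.* 4)
    eq₁ = ℕP.+-comm _ dκ
    eq₂ : (dƛ ℕ.+ (d′ ℕ.+ d ℕ.* 4)) ℕ.+ 3 ℕ.* d′ ≡ (d ℕ.+ d′ ℕ.* 4) ℕ.+ (dƛ ℕ.+ 3 ℕ.* d)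
    eq₂ = solve 3 (λ a b c → (a :+ (b :+ c :* con 4)) :+ con 3 :* b := (c :+ b :* con 4) :+ (a :+ con 3 :* c)) ≡.refl dƛ d′ d

σ-index : ∀ q k → ¬ (Zp.coef (⟦ σ ⟧ q) k ≡ + 0) → Σ ℕ λ c → k ≡ c ℕ.* 4
σ-index q = elim4 (λ k → ¬ (Zp.coef (⟦ σ ⟧ q) k ≡ + 0) → Σ ℕ λ c → k ≡ c ℕ.* 4)
  (λ k _ → k , ≡.refl)
  (λ k ne → ⊥-elim (ne (≡.trans (ZD.coef-σ q _) (at1 k))))
  (λ k ne → ⊥-elim (ne (≡.trans (ZD.coef-σ q _) (at2 k))))
  (λ k ne → ⊥-elim (ne (≡.trans (ZD.coef-σ q _) (at3 k))))
  where open ZD.Vals (ZD.dil-vals (Zp.coef q))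

coef-σ-4 : ∀ q c → Zp.coef (⟦ σ ⟧ q) (c ℕ.* 4) ≡ Zp.coef q c
coef-σ-4 q c = ≡.trans (ZD.coef-σ q _) (ZD.Vals.at0 (ZD.dil-vals (Zp.coef q)) c)

-- Here Z plays the role of ℤ[v], and V that of ℤ[v][z].
emb : Hom Z V
emb = mapHom Zp.KHom

coef-emb* : ∀ a q k → Vp.coef (⟦ emb ⟧ a Vr.* Vp.K q) k Zr.≈ Zp.K (Zp.coef a k) Zr.* q
coef-emb* a q k = Zr.trans (Vp.coef-cong (Vr.*-comm _ _) k) (Zr.trans (Vp.coef-K* q _ k) (Zr.trans (Zr.*-comm _ _) (Zr.*-congʳ (coef-map Zp.KHom a k))))

emb-Top : ∀ {n a q} → Zp.Top n a q → Vp.Top n (Zp.K a) (⟦ emb ⟧ q)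
emb-Top {n} {a} {q} (d , e) = (λ m l → Zr.trans (coef-map Zp.KHom q m) (Hom.≈0-homo Zp.KHom (d m l))) , Zr.trans (coef-map Zp.KHom q n) (Hom.⟦⟧-cong Zp.KHom e)

emb-IsDeg≉0 : ∀ {n q} → ZA.IsDeg n q → ¬ (Zp.K (Zp.coef q n) Zr.≈ Zr.0#)
emb-IsDeg≉0 (d , ne) e = ne (≡.trans (≡.sym (Zp.coef-K0 _)) (Zp.coef≈0 e 0))

p-Top : Zp.Top 2 (+ 1) pᵖ
p-Top = Zp.Top-+ (Zp.Top-cong ≡.refl (Hom.1-homo Zp.KHom) (Zp.Top-< (s≤s z≤n) (Zp.Top-K (+ 1)))) (Zp.Top-+ (Zp.Top-< (s≤s (s≤s z≤n)) Zp.Top-X) (Zp.Top-* Zp.Top-X Zp.Top-X))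

module Valuation (e : ℕ) (r : ℕ → Zr.Carrier) where
  open PowerSeries V using () renaming (Σ< to ΣV)
  open PowerSeries Z using () renaming (Σ< to ΣZ)
  open Vs using () renaming (_^_ to _^ᵛ_)
  open Zs using () renaming (_^_ to _^ᶻ_)

  v : Zr.Carrier
  v = Zp.X

  -- Since p has degree 2, u = z² v is the scale at which p and u are of equal size: the leading
  -- coefficient of p - z² v in z is 1 - v. Comparing top degrees in z thus yields an identity
  -- between polynomials in v.
  w : Vr.Carrier
  w = ⟦ emb ⟧ (zᵖ Zr.* zᵖ) Vr.* Vp.K v

  G : Vr.Carrier
  G = ΣV (suc e) (λ n → ⟦ emb ⟧ (⟦ σ ⟧ (r n)) Vr.* w ^ᵛ (e ∸ n))

  gc : ℕ → ℕ → ℤ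
  gc k n = Zp.coef (⟦ σ ⟧ (r n) Zr.* zᵖ ^ᶻ ((e ∸ n) ℕ.+ (e ∸ n))) k

  private
    zz^ : ∀ j → (zᵖ Zr.* zᵖ) ^ᶻ j Zr.≈ zᵖ ^ᶻ (j ℕ.+ j)
    zz^ j = Zr.trans (Zs.^-* zᵖ zᵖ j) (Zr.sym (Zs.^-+ zᵖ j j))

    w^ : ∀ j → w ^ᵛ j Vr.≈ ⟦ emb ⟧ (zᵖ ^ᶻ (j ℕ.+ j)) Vr.* Vp.K (v ^ᶻ j)
    w^ j = Vr.trans (Vs.^-* _ _ j) (Vr.*-cong (Vr.trans (Vr.sym (Hom.^-homo emb _ j)) (Hom.⟦⟧-cong emb (zz^ j))) (Vr.sym (Hom.^-homo Vp.KHom v j)))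

    gterm : ∀ n → ⟦ emb ⟧ (⟦ σ ⟧ (r n)) Vr.* w ^ᵛ (e ∸ n) Vr.≈ ⟦ emb ⟧ (⟦ σ ⟧ (r n) Zr.* zᵖ ^ᶻ ((e ∸ n) ℕ.+ (e ∸ n))) Vr.* Vp.K (v ^ᶻ (e ∸ n))
    gterm n = Vr.trans (Vr.*-congˡ (w^ (e ∸ n))) (Vr.trans (Vr.sym (Vr.*-assoc _ _ _)) (Vr.*-congʳ (Vr.sym (Hom.*-homo emb _ _))))

  coef-G : ∀ k → Vp.coef G k Zr.≈ ΣZ (suc e) (λ n → Zp.K (gc k n) Zr.* v ^ᶻ (e ∸ n))
  coef-G k = Zr.trans (Vp.coef-Σ (suc e) _ k) (Zs.Σ-cong′ (suc e) (λ n → Zr.trans (Vp.coef-cong (gterm n) k) (coef-emb* _ _ k)))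

  coef²-G : ∀ k n → n ≤ e → Zp.coef (Vp.coef G k) (e ∸ n) ≡ gc k n
  coef²-G k n n≤e = ≡.trans (Zp.coef-cong (coef-G k) (e ∸ n)) (ZA.coef-Σrev e (gc k) n n≤e)

  gc-lower : ∀ n c → ¬ (Zp.coef (r n) c ≡ + 0) → ¬ (gc (((e ∸ n) ℕ.+ (e ∸ n)) ℕ.+ c ℕ.* 4) n ≡ + 0)
  gc-lower n c ne h = ne (≡.trans (≡.sym (coef-σ-4 (r n) c)) (≡.trans (≡.sym (ZA.coef-*X^-+ (⟦ σ ⟧ (r n)) _ (c ℕ.* 4))) h))

  gc-bound : ∀ L → Vp.Deg≤ L G → ∀ n → n ≤ e → ∀ c → ¬ (Zp.coef (r n) c ≡ + 0) → ((e ∸ n) ℕ.+ (e ∸ n)) ℕ.+ c ℕ.* 4 ≤ L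
  gc-bound L d n n≤e c ne with (((e ∸ n) ℕ.+ (e ∸ n)) ℕ.+ c ℕ.* 4) ℕ.≤? L
  ... | yes le = le
  ... | no nle = ⊥-elim (gc-lower n c ne (≡.trans (≡.sym (coef²-G _ n n≤e)) (Zp.coef≈0 (d _ (ℕP.≰⇒> nle)) _)))

  -- σ(r_n) has only exponents divisible by 4, and the power of `w` adds 2(e - n). For a fixed `k`
  -- this determines the parity of e - n, so the coefficient of z^k in `G` is an even or an odd
  -- polynomial in v.
  gc-index : ∀ k n → ¬ (gc k n ≡ + 0) → Σ ℕ λ c → k ≡ ((e ∸ n) ℕ.+ (e ∸ n)) ℕ.+ c ℕ.* 4
  gc-index k n ne with k ℕ.<? ((e ∸ n) ℕ.+ (e ∸ n))
  ... | yes l = ⊥-elim (ne (ZA.coef-*X^-< (⟦ σ ⟧ (r n)) _ k l))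
  ... | no l = proj₁ ix , ≡.trans (≡.sym k≡) (≡.cong (j2 ℕ.+_) (proj₂ ix))
    where
    j2 = (e ∸ n) ℕ.+ (e ∸ n)
    k≡ : j2 ℕ.+ (k ∸ j2) ≡ k
    k≡ = ℕP.m+[n∸m]≡n (ℕP.≮⇒≥ l)
    ix = σ-index (r n) (k ∸ j2) (λ h → ne (≡.trans (≡.cong (λ m → gc m n) (≡.sym k≡)) (≡.trans (ZA.coef-*X^-+ (⟦ σ ⟧ (r n)) j2 (k ∸ j2)) h)))

  gc-zero : ∀ k n → r n Zr.≈ Zr.0# → gc k n ≡ + 0
  gc-zero k n h = Zp.coef≈0 (Zr.trans (Zr.*-congʳ (σ.≈0-homo h)) (Zr.zeroˡ _)) k

  -- A nonzero term of `H` has degree deg r_n + n + e in z and carries (1 - v)^n in front. `H₁` is a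
  -- model of this with the common e removed and v for 1 - v, so its leading coefficient β(v) turns
  -- into β(1 - v) for `H`.
  H₁ : Vr.Carrier
  H₁ = ΣV (suc e) (λ n → ⟦ emb ⟧ (r n Zr.* zᵖ ^ᶻ n) Vr.* Vp.K (v ^ᶻ n))

  hc : ℕ → ℕ → ℤ
  hc k n = Zp.coef (r n Zr.* zᵖ ^ᶻ n) k

  coef-H₁ : ∀ k → Vp.coef H₁ k Zr.≈ ΣZ (suc e) (λ n → Zp.K (hc k n) Zr.* v ^ᶻ n)
  coef-H₁ k = Zr.trans (Vp.coef-Σ (suc e) _ k) (Zs.Σ-cong′ (suc e) (λ n → coef-emb* _ _ k))

  coef²-H₁ : ∀ k n → n ≤ e → Zp.coef (Vp.coef H₁ k) n ≡ hc k n
  coef²-H₁ k n n≤e = ≡.trans (Zp.coef-cong (coef-H₁ k) n) (ZA.coef-Σmon e (hc k) n n≤e)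

  module ω = Affine (idHom ℤring) -[1+ 0 ] (+ 1)
  ω : Hom Z Z
  ω = ω.aff

  H : Vr.Carrier
  H = ΣV (suc e) (λ n → ⟦ emb ⟧ (r n Zr.* zᵖ ^ᶻ (e ∸ n)) Vr.* (⟦ emb ⟧ pᵖ Vr.- w) ^ᵛ n)

  private

    o : Zr.Carrier
    o = Zp.K (+ 1) Zr.+ Zr.- (Zp.K (+ 1) Zr.* v)

    w-Top : Vp.Top 2 (Zp.K (+ 1) Zr.* v) w
    w-Top = Vp.Top-* {2} {0} (emb-Top (Zp.Top-* Zp.Top-X Zp.Top-X)) (Vp.Top-K v)

    pw-Top : Vp.Top 2 o (⟦ emb ⟧ pᵖ Vr.- w)
    pw-Top = Vp.Top-+ (emb-Top p-Top) (VA.Top-neg w-Top)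

    o≈lin : o Zr.≈ ω.lin
    o≈lin = Zr.trans (Zr.+-comm _ _) (Zr.+-congʳ (Zr.trans (-‿distribˡ-* _ _) (Zr.*-congʳ (Zr.sym (Hom.neg-homo Zp.KHom (+ 1))))))
      where open import Algebra.Properties.Ring Zr.ring using (-‿distribˡ-*)

  ω-sum : ∀ k → ⟦ ω ⟧ (Vp.coef H₁ k) Zr.≈ ΣZ (suc e) (λ n → Zp.K (hc k n) Zr.* o ^ᶻ n)
  ω-sum k = Zr.trans (Hom.⟦⟧-cong ω (coef-H₁ k)) (Zr.trans (Hom.Σ-homo ω (suc e) _)
    (Zs.Σ-cong′ (suc e) (λ n → Zr.trans (Hom.*-homo ω _ _) (Zr.*-cong (ω.aff-K _) (Zr.trans (Hom.^-homo ω v n) (Zs.^-cong n (Zr.trans ω.aff-X (Zr.sym o≈lin))))))))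

  H-Top : ∀ N → Vp.Deg≤ N H₁ → Vp.Top (N ℕ.+ e) (⟦ ω ⟧ (Vp.coef H₁ N)) H
  H-Top N d = Vp.Top-cong (Zr.sym (ω-sum N)) Vr.refl (Vp.Top-Σ (suc e) _ _ (λ n l → term n (ℕP.≤-pred l)))
    where
    hc0 : ∀ n → n ≤ e → ∀ k → N < k → hc k n ≡ + 0
    hc0 n n≤e k l = ≡.trans (≡.sym (coef²-H₁ k n n≤e)) (Zp.coef≈0 (d k l) n)
    r-coef : ∀ n k → hc (n ℕ.+ k) n ≡ Zp.coef (r n) k
    r-coef n k = ZA.coef-*X^-+ (r n) n k
    term : ∀ n → n ≤ e → Vp.Top (N ℕ.+ e) (Zp.K (hc N n) Zr.* o ^ᶻ n) (⟦ emb ⟧ (r n Zr.* zᵖ ^ᶻ (e ∸ n)) Vr.* (⟦ emb ⟧ pᵖ Vr.- w) ^ᵛ n)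
    term n n≤e with n ℕ.≤? N
    ... | yes n≤N = ≡.subst (λ m → Vp.Top m (Zp.K (hc N n) Zr.* o ^ᶻ n) (⟦ emb ⟧ (r n Zr.* zᵖ ^ᶻ (e ∸ n)) Vr.* (⟦ emb ⟧ pᵖ Vr.- w) ^ᵛ n)) index
        (Vp.Top-* (emb-Top (Zp.Top-cong (ℤP.*-identityʳ _) Zr.refl (Zp.Top-* r-Top z-Top))) (Vp.Top-^ n pw-Top))
      where
      a = N ∸ n
      r-Top : Zp.Top a (hc N n) (r n)
      r-Top = (λ m l → ≡.trans (≡.sym (r-coef n m)) (hc0 n n≤e (n ℕ.+ m) (ℕP.≤-<-trans (ℕP.≤-reflexive (≡.sym (ℕP.m+[n∸m]≡n n≤N))) (ℕP.+-monoʳ-< n l))))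
            , ≡.trans (≡.sym (r-coef n a)) (≡.cong (λ m → hc m n) (ℕP.m+[n∸m]≡n n≤N))
      z-Top : Zp.Top (e ∸ n) (+ 1) (zᵖ ^ᶻ (e ∸ n))
      z-Top = ≡.subst (λ m → Zp.Top m (+ 1) (zᵖ ^ᶻ (e ∸ n))) (ℕP.*-identityʳ _) (Zp.Top-cong (Sums.1^ ℤring (e ∸ n)) Zr.refl (Zp.Top-^ (e ∸ n) Zp.Top-X))
      index : (a ℕ.+ (e ∸ n)) ℕ.+ n ℕ.* 2 ≡ N ℕ.+ e
      index = ≡.trans (solve 3 (λ a b n → (a :+ b) :+ n :* con 2 := (n :+ a) :+ (n :+ b)) ≡.refl a (e ∸ n) n) (≡.cong₂ ℕ._+_ (ℕP.m+[n∸m]≡n n≤N) (ℕP.m+[n∸m]≡n n≤e))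
        where open +-*-Solver
    -- A nonzero r_n would give `H₁` degree at least n > N, so the whole term is zero.
    ... | no n≰N = Vp.Top-cong (Zr.sym (Zr.trans (Zr.*-congʳ (Hom.≈0-homo Zp.KHom hcN≡0)) (Zr.zeroˡ _))) Vr.refl (Vp.Top-zero
        (Vr.trans (Vr.*-congʳ (Hom.≈0-homo emb (Zr.trans (Zr.*-congʳ rn≈0) (Zr.zeroˡ _)))) (Vr.zeroˡ _)))
      where
      rn≈0 : r n Zr.≈ Zr.0#
      rn≈0 = Zp.ext0 (λ k → ≡.trans (≡.sym (r-coef n k)) (hc0 n n≤e (n ℕ.+ k) (ℕP.<-≤-trans (ℕP.≰⇒> n≰N) (ℕP.m≤m+n n k))))
      hcN≡0 : hc N n ≡ + 0
      hcN≡0 = Zp.coef≈0 (Zr.trans (Zr.*-congʳ rn≈0) (Zr.zeroˡ _)) N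

-- Here μ + a is the degree of `H₁` and L that of `G`. The last two hypotheses give L ≤ 3 dν + (μ +
-- a) + e; four times this, plus h₁, plus three times h₂ is the claim, once `S` is cancelled.
arith₁ : ∀ e μ ν jμ jν a dν dκ dƛ L → μ ℕ.+ jμ ≡ e → ν ℕ.+ jν ≡ e → (jμ ℕ.+ jμ) ℕ.+ a ℕ.* 4 ≤ L → (jν ℕ.+ jν) ℕ.+ dν ℕ.* 4 ≤ L →
         dκ ≤ dƛ ℕ.+ 3 ℕ.* dν → dκ ℕ.+ ((μ ℕ.+ a) ℕ.+ e) ≡ dƛ ℕ.+ L → 4 ℕ.* e ≤ 6 ℕ.* (μ ℕ.+ ν)
arith₁ e μ ν jμ jν a dν dκ dƛ L μe νe h₁ h₂ h₃ h₄ = ℕP.+-cancelˡ-≤ S _ _ (ℕP.≤-trans (ℕP.≤-reflexive eq₁) (ℕP.≤-trans sum (ℕP.≤-reflexive eq₂)))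
  where
  S = 4 ℕ.* L ℕ.+ (4 ℕ.* a ℕ.+ (12 ℕ.* dν ℕ.+ 4 ℕ.* e))
  h₃₄ : L ≤ 3 ℕ.* dν ℕ.+ ((μ ℕ.+ a) ℕ.+ e)
  h₃₄ = ℕP.+-cancelˡ-≤ dƛ _ _ (ℕP.≤-trans (ℕP.≤-reflexive (≡.sym h₄)) (ℕP.≤-trans (ℕP.+-monoˡ-≤ _ h₃) (ℕP.≤-reflexive (ℕP.+-assoc dƛ _ _))))
  sum : 4 ℕ.* L ℕ.+ (((jμ ℕ.+ jμ) ℕ.+ a ℕ.* 4) ℕ.+ (3 ℕ.* ((jν ℕ.+ jν) ℕ.+ dν ℕ.* 4) ℕ.+ (2 ℕ.* μ ℕ.+ 6 ℕ.* ν))) ≤ 4 ℕ.* (3 ℕ.* dν ℕ.+ ((μ ℕ.+ a) ℕ.+ e)) ℕ.+ (L ℕ.+ (3 ℕ.* L ℕ.+ (2 ℕ.* μ ℕ.+ 6 ℕ.* ν)))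
  sum = ℕP.+-mono-≤ (ℕP.*-monoʳ-≤ 4 h₃₄) (ℕP.+-mono-≤ h₁ (ℕP.+-monoˡ-≤ _ (ℕP.*-monoʳ-≤ 3 h₂)))
  eq₁ : S ℕ.+ 4 ℕ.* e ≡ 4 ℕ.* L ℕ.+ (((jμ ℕ.+ jμ) ℕ.+ a ℕ.* 4) ℕ.+ (3 ℕ.* ((jν ℕ.+ jν) ℕ.+ dν ℕ.* 4) ℕ.+ (2 ℕ.* μ ℕ.+ 6 ℕ.* ν)))
  eq₁ = ≡.trans (split L a dν e) (≡.trans (≡.cong₂ (λ x y → 4 ℕ.* L ℕ.+ (4 ℕ.* a ℕ.+ 12 ℕ.* dν) ℕ.+ (2 ℕ.* x ℕ.+ 6 ℕ.* y)) (≡.sym μe) (≡.sym νe)) (join L a dν μ jμ ν jν))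
    where
    split : ∀ L a d e → (4 ℕ.* L ℕ.+ (4 ℕ.* a ℕ.+ (12 ℕ.* d ℕ.+ 4 ℕ.* e))) ℕ.+ 4 ℕ.* e ≡ 4 ℕ.* L ℕ.+ (4 ℕ.* a ℕ.+ 12 ℕ.* d) ℕ.+ (2 ℕ.* e ℕ.+ 6 ℕ.* e)
    split = solve-∀
    join : ∀ L a d μ jμ ν jν → 4 ℕ.* L ℕ.+ (4 ℕ.* a ℕ.+ 12 ℕ.* d) ℕ.+ (2 ℕ.* (μ ℕ.+ jμ) ℕ.+ 6 ℕ.* (ν ℕ.+ jν)) ≡ 4 ℕ.* L ℕ.+ (((jμ ℕ.+ jμ) ℕ.+ a ℕ.* 4) ℕ.+ (3 ℕ.* ((jν ℕ.+ jν) ℕ.+ d ℕ.* 4) ℕ.+ (2 ℕ.* μ ℕ.+ 6 ℕ.* ν)))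
    join = solve-∀
  eq₂ : 4 ℕ.* (3 ℕ.* dν ℕ.+ ((μ ℕ.+ a) ℕ.+ e)) ℕ.+ (L ℕ.+ (3 ℕ.* L ℕ.+ (2 ℕ.* μ ℕ.+ 6 ℕ.* ν))) ≡ S ℕ.+ 6 ℕ.* (μ ℕ.+ ν)
  eq₂ = merge dν μ a e L ν
    where
    merge : ∀ d μ a e L ν → 4 ℕ.* (3 ℕ.* d ℕ.+ ((μ ℕ.+ a) ℕ.+ e)) ℕ.+ (L ℕ.+ (3 ℕ.* L ℕ.+ (2 ℕ.* μ ℕ.+ 6 ℕ.* ν))) ≡ (4 ℕ.* L ℕ.+ (4 ℕ.* a ℕ.+ (12 ℕ.* d ℕ.+ 4 ℕ.* e))) ℕ.+ 6 ℕ.* (μ ℕ.+ ν)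
    merge = solve-∀

-- The upper bound says 2(μ + ν) ≤ e; three times this against the lower bound gives 4e ≤ 3e.
arith₂ : ∀ e μ ν → ν ≤ e → 4 ℕ.* e ≤ 6 ℕ.* (μ ℕ.+ ν) → ν ℕ.+ (μ ℕ.+ μ) ≤ e ∸ ν → e ≡ 0
arith₂ e μ ν ν≤e lo up = ℕP.n≤0⇒n≡0 (ℕP.+-cancelˡ-≤ (3 ℕ.* e) e 0 (ℕP.≤-trans (ℕP.≤-reflexive (e₁ e)) (ℕP.≤-trans lo (ℕP.≤-trans (ℕP.≤-reflexive (e₂ μ ν)) (ℕP.≤-trans (ℕP.*-monoʳ-≤ 3 up′) (ℕP.≤-reflexive (≡.sym (ℕP.+-identityʳ _))))))))
  where
  up′ : (ν ℕ.+ (μ ℕ.+ μ)) ℕ.+ ν ≤ e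
  up′ = ℕP.≤-trans (ℕP.+-monoˡ-≤ ν up) (ℕP.≤-reflexive (ℕP.m∸n+n≡m ν≤e))
  e₁ : ∀ e → 3 ℕ.* e ℕ.+ e ≡ 4 ℕ.* e
  e₁ = solve-∀
  e₂ : ∀ μ ν → 6 ℕ.* (μ ℕ.+ ν) ≡ 3 ℕ.* ((ν ℕ.+ (μ ℕ.+ μ)) ℕ.+ ν)
  e₂ = solve-∀

-- The polynomial b is divisible by v^ν. By `B≈` it vanishes at v = 1 to the order μ to which β
-- vanishes at 0, because ω substitutes 1 - v for v; by parity it vanishes to the same order at v =
-- -1. These roots are counted against the degree.
module RootCount (e ν : ℕ) (ν≤e : ν ≤ e) (L : ℕ) (b β : Zr.Carrier) (κ₀ ƛ₀ : ℤ) (μ : ℕ)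
  (ƛ₀≢0 : ¬ (ƛ₀ ≡ + 0)) (b≉0 : ¬ (b Zr.≈ Zr.0#))
  (b-low : ∀ k → k < ν → Zp.coef b k ≡ + 0) (b-deg : Zp.Deg≤ (e ∸ ν) b)
  (b-par : ∀ k → ¬ (Zp.coef b k ≡ + 0) → Σ ℕ λ c → L ≡ (k ℕ.+ k) ℕ.+ c ℕ.* 4)
  (B≈ : Zp.K ƛ₀ Zr.* b Zr.≈ Zp.K κ₀ Zr.* ⟦ Affine.aff (idHom ℤring) -[1+ 0 ] (+ 1) ⟧ β)
  (β-low : ∀ k → k < μ → Zp.coef β k ≡ + 0) where
  open Zs using () renaming (_^_ to _^ᶻ_)
  private
        module ω = Affine (idHom ℤring) -[1+ 0 ] (+ 1)
        ω = ω.aff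
        B = Zp.K ƛ₀ Zr.* b

        B≉0 : ¬ (B Zr.≈ Zr.0#)
        B≉0 = dZ.*≉0 (λ h → ƛ₀≢0 (≡.trans (≡.sym (Zp.coef-K0 _)) (Zp.coef≈0 h 0))) b≉0

        B0 : ∀ k → Zp.coef b k ≡ + 0 → Zp.coef B k ≡ + 0
        B0 k h = ≡.trans (Zp.coef-K* ƛ₀ b k) (≡.trans (≡.cong (ƛ₀ ℤ.*_) h) (ℤP.*-zeroʳ ƛ₀))

        mult0 : ZAD.Mult ν (+ 0) B
        mult0 = ZAD.X^Mult ν B (λ k l → B0 k (b-low k l))

        fac = ZAD.X^Mult μ β β-low
        β° = proj₁ fac

        neg1 : Zr.Carrier
        neg1 = Zr.- Zr.1#

        ωβ≈ : ⟦ ω ⟧ β Zr.≈ (Zp.X Zr.- Zp.K (+ 1)) ^ᶻ μ Zr.* (neg1 ^ᶻ μ Zr.* ⟦ ω ⟧ β°)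
        ωβ≈ = Zr.trans (Hom.⟦⟧-cong ω (proj₂ fac)) (Zr.trans (Hom.*-homo ω _ _) (Zr.trans (Zr.*-congʳ (Zr.trans (Hom.^-homo ω _ μ)
            (Zr.trans (Zs.^-cong μ lin≈) (Zs.^-* _ _ μ)))) (Zr.*-assoc _ _ _)))
          where
          open Zs.Solver
          lin≈ : ⟦ ω ⟧ (Zp.X Zr.- Zp.K (+ 0)) Zr.≈ (Zp.X Zr.- Zp.K (+ 1)) Zr.* neg1
          lin≈ = Zr.trans (Hom.sub-homo ω _ _) (Zr.trans (Zr.+-cong ω.aff-X (Zr.-‿cong (Zr.trans (ω.aff-K (+ 0)) (Hom.0-homo Zp.KHom))))
            (Zr.trans (Zr.+-congʳ (Zr.+-congʳ (Zr.*-congʳ (Zr.trans (Hom.neg-homo Zp.KHom (+ 1)) (Zr.-‿cong (Hom.1-homo Zp.KHom))))))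
              (Zr.trans (solve 3 (λ x k o → ((:- o) :* x :+ k) :- con (+ 0) := (o :* x :- k) :* (:- con (+ 1))) Zr.refl Zp.X (Zp.K (+ 1)) Zr.1#)
                (Zr.*-cong (Zr.+-congʳ (Zr.*-identityˡ _)) (Zr.-‿cong Zs.intR-1)))))

        mult1 : ZAD.Mult μ (+ 1) B
        mult1 = Zp.K κ₀ Zr.* (neg1 ^ᶻ μ Zr.* ⟦ ω ⟧ β°) , Zr.trans B≈ (Zr.trans (Zr.*-congˡ ωβ≈)
          (let open Zs.Solver in solve 3 (λ a b c → a :* (b :* c) := b :* (a :* c)) Zr.refl _ _ _))

        module π = Affine (idHom ℤring) -[1+ 0 ] (+ 0)

        m1 : ℤ
        m1 = -[1+ 0 ]
        open Sums ℤring using () renaming (_^_ to _^ⁱ_)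

        ordb = ZAD.order b b≉0

        -- Every exponent k of b satisfies L = 2k + 4c, so all of them are congruent modulo 2. The
        -- witness is L / 2, obtained without division from the lowest exponent.
        parity : Σ ℕ λ h → ∀ k → ¬ (Zp.coef b k ≡ + 0) → Σ ℕ λ c → h ≡ k ℕ.+ 2 ℕ.* c
        parity = k₀ ℕ.+ 2 ℕ.* proj₁ (idx k₀ k₀≢) , λ k ne → proj₁ (idx k ne) , half k k₀ (proj₁ (idx k ne)) (proj₁ (idx k₀ k₀≢)) (≡.trans (≡.sym (proj₂ (idx k ne))) (proj₂ (idx k₀ k₀≢)))
          where
          k₀ = proj₁ ordb
          k₀≢ = proj₂ (proj₂ ordb)
          idx = b-par
          half : ∀ k k₀ c c₀ → (k ℕ.+ k) ℕ.+ c ℕ.* 4 ≡ (k₀ ℕ.+ k₀) ℕ.+ c₀ ℕ.* 4 → k₀ ℕ.+ 2 ℕ.* c₀ ≡ k ℕ.+ 2 ℕ.* c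
          half k k₀ c c₀ q = ℕP.*-cancelˡ-≡ (k₀ ℕ.+ 2 ℕ.* c₀) (k ℕ.+ 2 ℕ.* c) 2 (≡.trans (dbl k₀ c₀) (≡.trans (≡.sym q) (≡.sym (dbl k c))))
            where
            open +-*-Solver
            dbl : ∀ k c → 2 ℕ.* (k ℕ.+ 2 ℕ.* c) ≡ (k ℕ.+ k) ℕ.+ c ℕ.* 4
            dbl = solve 2 (λ k c → con 2 :* (k :+ con 2 :* c) := (k :+ k) :+ c :* con 4) ≡.refl

        h = proj₁ parity

        m1^2c : ∀ c → m1 ^ⁱ (2 ℕ.* c) ≡ + 1
        m1^2c zero = ≡.refl
        m1^2c (suc c) = ≡.trans (≡.cong (λ m → m1 ℤ.* m1 ^ⁱ m) (ℕP.+-suc c (c ℕ.+ 0))) (≡.trans (≡.sym (ℤP.*-assoc m1 m1 _)) (≡.trans (ℤP.*-identityˡ _) (m1^2c c)))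

        πB : ⟦ π.aff ⟧ B Zr.≈ Zp.K (m1 ^ⁱ h) Zr.* B
        πB = Zp.ext λ k → ≡.trans (π.aff-scale ≡.refl k B) (≡.trans (sign k (Zp.coef b k ℤ.≟ + 0)) (≡.sym (Zp.coef-K* (m1 ^ⁱ h) B k)))
          where
          sign : ∀ k → Dec (Zp.coef b k ≡ + 0) → m1 ^ⁱ k ℤ.* Zp.coef B k ≡ m1 ^ⁱ h ℤ.* Zp.coef B k
          sign k (yes z) = ≡.trans (≡.cong (m1 ^ⁱ k ℤ.*_) (B0 k z)) (≡.trans (ℤP.*-zeroʳ (m1 ^ⁱ k)) (≡.sym (≡.trans (≡.cong (m1 ^ⁱ h ℤ.*_) (B0 k z)) (ℤP.*-zeroʳ (m1 ^ⁱ h)))))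
          sign k (no ne) = ≡.cong (ℤ._* Zp.coef B k) (≡.sym (≡.trans (≡.cong (m1 ^ⁱ_) (proj₂ (proj₂ parity k ne)))
            (≡.trans (Sums.^-+ ℤring m1 k (2 ℕ.* c)) (≡.trans (≡.cong (m1 ^ⁱ k ℤ.*_) (m1^2c c)) (ℤP.*-identityʳ (m1 ^ⁱ k))))))
            where c = proj₁ (proj₂ parity k ne)

        m1^h² : m1 ^ⁱ h ℤ.* m1 ^ⁱ h ≡ + 1
        m1^h² = ≡.trans (≡.sym (Sums.^-+ ℤring m1 h h)) (≡.trans (≡.cong (λ m → m1 ^ⁱ (h ℕ.+ m)) (≡.sym (ℕP.+-identityʳ h))) (m1^2c h))

        mult-1 : ZAD.Mult μ m1 B
        mult-1 = q , (begin
            B                                              ≈⟨ Zr.*-identityˡ B ⟨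
            Zr.1# Zr.* B                                   ≈⟨ Zr.*-congʳ (Zr.trans (Zr.sym (Hom.1-homo Zp.KHom)) (Zr.trans (Hom.⟦⟧-cong Zp.KHom (≡.sym m1^h²)) (Hom.*-homo Zp.KHom _ _))) ⟩
            (S Zr.* S) Zr.* B                              ≈⟨ Zr.*-assoc _ _ _ ⟩
            S Zr.* (S Zr.* B)                              ≈⟨ Zr.*-congˡ πB ⟨
            S Zr.* ⟦ π.aff ⟧ B                             ≈⟨ Zr.*-congˡ (Zr.trans (Hom.⟦⟧-cong π.aff (proj₂ mult1)) (Hom.*-homo π.aff _ _)) ⟩
            S Zr.* (⟦ π.aff ⟧ ((Zp.X Zr.- Zp.K (+ 1)) ^ᶻ μ) Zr.* ⟦ π.aff ⟧ (proj₁ mult1)) ≈⟨ Zr.*-congˡ (Zr.*-congʳ (Zr.trans (Hom.^-homo π.aff _ μ) (Zr.trans (Zs.^-cong μ lin≈) (Zs.^-* _ _ μ)))) ⟩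
            S Zr.* (((Zp.X Zr.- Zp.K m1) ^ᶻ μ Zr.* neg1 ^ᶻ μ) Zr.* ⟦ π.aff ⟧ (proj₁ mult1)) ≈⟨ solve 4 (λ s a b c → s :* ((a :* b) :* c) := a :* (s :* (b :* c))) Zr.refl _ _ _ _ ⟩
            (Zp.X Zr.- Zp.K m1) ^ᶻ μ Zr.* q ∎)
          where
          open Zs.Solver
          open import Relation.Binary.Reasoning.Setoid Zr.setoid
          S = Zp.K (m1 ^ⁱ h)
          q = S Zr.* (neg1 ^ᶻ μ Zr.* ⟦ π.aff ⟧ (proj₁ mult1))
          Km1 : Zp.K m1 Zr.≈ Zr.- Zr.1#
          Km1 = Zr.trans (Hom.neg-homo Zp.KHom (+ 1)) (Zr.-‿cong (Hom.1-homo Zp.KHom))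
          lin≈ : ⟦ π.aff ⟧ (Zp.X Zr.- Zp.K (+ 1)) Zr.≈ (Zp.X Zr.- Zp.K m1) Zr.* neg1
          lin≈ = Zr.trans (Hom.sub-homo π.aff _ _) (Zr.trans (Zr.+-cong (Zr.trans π.aff-X (Zr.+-cong (Zr.*-congʳ Km1) (Hom.0-homo Zp.KHom))) (Zr.-‿cong (Zr.trans (π.aff-K (+ 1)) (Hom.1-homo Zp.KHom))))
            (Zr.trans (solve 2 (λ x o → ((:- o) :* x :+ con (+ 0)) :- o := (x :- (:- con (+ 1))) :* (:- o)) Zr.refl Zp.X Zr.1#)
              (Zr.*-congʳ (Zr.+-congˡ (Zr.-‿cong (Zr.trans (Zr.-‿cong Zs.intR-1) (Zr.sym Km1)))))))

  rootCount : ν ℕ.+ (μ ℕ.+ μ) ≤ e ∸ ν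
  rootCount = go (ZAD.mult-coprime (+ 0) (+ 1) ν c₁ μ B (λ ()) B≈₁ mult1)
    where
    c₁ = proj₁ mult0
    B≈₁ = proj₂ mult0
    go : ZAD.Mult μ (+ 1) c₁ → ν ℕ.+ (μ ℕ.+ μ) ≤ e ∸ ν
    go (c₂ , c₁≈) = go₂ (ZAD.mult-coprime (+ 1) m1 μ c₂ μ c₁ (λ ()) c₁≈ (ZAD.mult-coprime (+ 0) m1 ν c₁ μ B (λ ()) B≈₁ mult-1))
      where
      go₂ : ZAD.Mult μ m1 c₂ → ν ℕ.+ (μ ℕ.+ μ) ≤ e ∸ ν
      go₂ (c₃ , c₂≈) = final (Zp.WithDom.degree ℤ-dom c₃≉0)
        where
        c₃≉0 : ¬ (c₃ Zr.≈ Zr.0#)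
        c₃≉0 q = B≉0 (Zr.trans B≈₁ (Zr.trans (Zr.*-congˡ (Zr.trans c₁≈ (Zr.trans (Zr.*-congˡ (Zr.trans c₂≈ (Zr.trans (Zr.*-congˡ q) (Zr.zeroʳ _)))) (Zr.zeroʳ _)))) (Zr.zeroʳ _)))
        final : Σ ℕ (λ n → ZA.IsDeg n c₃) → ν ℕ.+ (μ ℕ.+ μ) ≤ e ∸ ν
        final (n , dn) = ℕP.≤-trans (ℕP.+-monoʳ-≤ ν (ℕP.+-monoʳ-≤ μ (ℕP.m≤m+n μ n))) (le (ZAD.Mult-deg {ν} {+ 0} B≈₁ (ZAD.Mult-deg {μ} {+ 1} c₁≈ (ZAD.Mult-deg {μ} {m1} c₂≈ dn))))
          where
          le : ∀ {m} → ZA.IsDeg m B → m ≤ e ∸ ν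
          le {m} (_ , ne) with m ℕ.≤? (e ∸ ν)
          ... | yes l = l
          ... | no l = ⊥-elim (ne (B0 m (b-deg m (ℕP.≰⇒> l))))

module Rigidity (e : ℕ) (κ ƛ : Zr.Carrier) (κ≉0 : ¬ (κ Zr.≈ Zr.0#)) (r : ℕ → Zr.Carrier) where
  open PowerSeries V using () renaming (Σ< to ΣV)
  open Vs using () renaming (_^_ to _^ᵛ_)
  open Zs using () renaming (_^_ to _^ᶻ_)
  open Valuation e r

  -- The invariance of the form in the variable Y = p - u, in which the substituted side is the one
  -- written in monomials. The involution Y ↦ p - Y leads back to `Rel`.
  FormEq : Set
  FormEq = Vp.K κ Vr.* ΣV (suc e) (λ n → Vp.K (r n Zr.* zᵖ ^ᶻ (e ∸ n)) Vr.* Vp.X ^ᵛ n)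
           Vr.≈ Vp.K ƛ Vr.* ΣV (suc e) (λ n → Vp.K (⟦ σ ⟧ (r n)) Vr.* (Vp.K pᵖ Vr.- Vp.X) ^ᵛ (e ∸ n))

  module Eqs (eqY : FormEq) where
    private
      flip : Hom V V
      flip = lift Vp.KHom (Vp.K pᵖ Vr.- Vp.X)
      flip-K = lift-K Vp.KHom (Vp.K pᵖ Vr.- Vp.X)
      flip-X = lift-X Vp.KHom (Vp.K pᵖ Vr.- Vp.X)
      flip-flip : ⟦ flip ⟧ (Vp.K pᵖ Vr.- Vp.X) Vr.≈ Vp.X
      flip-flip = Vr.trans (Hom.sub-homo flip _ _) (Vr.trans (Vr.+-cong (flip-K pᵖ) (Vr.-‿cong flip-X))
        (let open Vs.Solver in solve 2 (λ p x → p :- (p :- x) := x) Vr.refl (Vp.K pᵖ) Vp.X))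

    eqU : Vp.K κ Vr.* compForm e r Vr.≈ Vp.K ƛ Vr.* ΣV (suc e) (λ n → Vp.K (⟦ σ ⟧ (r n)) Vr.* Vp.X ^ᵛ (e ∸ n))
    eqU = Vr.trans (Vr.sym lhs) (Vr.trans (Hom.⟦⟧-cong flip eqY) rhs)
      where
      lhs : ⟦ flip ⟧ (Vp.K κ Vr.* ΣV (suc e) (λ n → Vp.K (r n Zr.* zᵖ ^ᶻ (e ∸ n)) Vr.* Vp.X ^ᵛ n)) Vr.≈ Vp.K κ Vr.* compForm e r
      lhs = Vr.trans (Hom.*-homo flip _ _) (Vr.*-cong (flip-K κ) (Vr.trans (Hom.Σ-homo flip (suc e) _) (Vs.Σ-cong′ (suc e)
        (λ n → Vr.trans (Hom.*-homo flip _ _) (Vr.*-cong (flip-K _) (Vr.trans (Hom.^-homo flip _ n) (Vs.^-cong n flip-X)))))))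
      rhs : ⟦ flip ⟧ (Vp.K ƛ Vr.* ΣV (suc e) (λ n → Vp.K (⟦ σ ⟧ (r n)) Vr.* (Vp.K pᵖ Vr.- Vp.X) ^ᵛ (e ∸ n))) Vr.≈ Vp.K ƛ Vr.* ΣV (suc e) (λ n → Vp.K (⟦ σ ⟧ (r n)) Vr.* Vp.X ^ᵛ (e ∸ n))
      rhs = Vr.trans (Hom.*-homo flip _ _) (Vr.*-cong (flip-K ƛ) (Vr.trans (Hom.Σ-homo flip (suc e) _) (Vs.Σ-cong′ (suc e)
        (λ n → Vr.trans (Hom.*-homo flip _ _) (Vr.*-cong (flip-K _) (Vr.trans (Hom.^-homo flip _ (e ∸ n)) (Vs.^-cong (e ∸ n) flip-flip)))))))

    rel : Rel e κ ƛ r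
    rel l l≤e = Zr.trans (Zr.sym (Vp.coef-K* _ _ _)) (Zr.trans (Vp.coef-cong eqU (e ∸ l)) (Zr.trans (Vp.coef-K* _ _ _) (Zr.*-congˡ (VA.coef-Σrev e (λ n → ⟦ σ ⟧ (r n)) l l≤e))))

    -- substitute u = z² v
    eqW : ⟦ emb ⟧ κ Vr.* H Vr.≈ ⟦ emb ⟧ ƛ Vr.* G
    eqW = Vr.trans (Vr.sym lhs) (Vr.trans (Hom.⟦⟧-cong θ eqU) rhs)
      where
      θ : Hom V V
      θ = lift emb w
      θ-K = lift-K emb w
      θ-X = lift-X emb w
      lhs : ⟦ θ ⟧ (Vp.K κ Vr.* compForm e r) Vr.≈ ⟦ emb ⟧ κ Vr.* H
      lhs = Vr.trans (Hom.*-homo θ _ _) (Vr.*-cong (θ-K κ) (Vr.trans (Hom.Σ-homo θ (suc e) _) (Vs.Σ-cong′ (suc e)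
        (λ n → Vr.trans (Hom.*-homo θ _ _) (Vr.*-cong (θ-K _) (Vr.trans (Hom.^-homo θ _ n) (Vs.^-cong n (Vr.trans (Hom.sub-homo θ _ _) (Vr.+-cong (θ-K _) (Vr.-‿cong θ-X))))))))))
      rhs : ⟦ θ ⟧ (Vp.K ƛ Vr.* ΣV (suc e) (λ n → Vp.K (⟦ σ ⟧ (r n)) Vr.* Vp.X ^ᵛ (e ∸ n))) Vr.≈ ⟦ emb ⟧ ƛ Vr.* G
      rhs = Vr.trans (Hom.*-homo θ _ _) (Vr.*-cong (θ-K ƛ) (Vr.trans (Hom.Σ-homo θ (suc e) _) (Vs.Σ-cong′ (suc e)
        (λ n → Vr.trans (Hom.*-homo θ _ _) (Vr.*-cong (θ-K _) (Vr.trans (Hom.^-homo θ _ (e ∸ n)) (Vs.^-cong (e ∸ n) θ-X)))))))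

    module _ (ν : ℕ) (ν≤e : ν ≤ e) (below : ∀ n → n < ν → r n Zr.≈ Zr.0#) (rν≉0 : ¬ (r ν Zr.≈ Zr.0#)) where

      -- The sum on the right starts at the index ν, hence has degree at most e - ν in Y, while the
      -- left side has a multiple of r_n at Y^n.
      above : ∀ n → n ≤ e → e < n ℕ.+ ν → r n Zr.≈ Zr.0#
      above n n≤e e<n+ν = dZ.cancel0 (dZ.^≉0 (e ∸ n) z≉0) (Zr.trans (Zr.*-comm _ _) (dZ.cancel0 κ≉0 (Zr.trans (Zr.sym lhs) (Zr.trans (Vp.coef-cong eqY n) rhs))))
        where
        z≉0 : ¬ (zᵖ Zr.≈ Zr.0#)
        z≉0 h = case (≡.trans (≡.sym (Zp.coef-X 1)) (Zp.coef≈0 h 1))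
          where
          case : ¬ (+ 1 ≡ + 0)
          case ()
        lhs : Vp.coef (Vp.K κ Vr.* ΣV (suc e) (λ n → Vp.K (r n Zr.* zᵖ ^ᶻ (e ∸ n)) Vr.* Vp.X ^ᵛ n)) n Zr.≈ κ Zr.* (r n Zr.* zᵖ ^ᶻ (e ∸ n))
        lhs = Zr.trans (Vp.coef-K* _ _ n) (Zr.*-congˡ (VA.coef-Σmon e (λ n → r n Zr.* zᵖ ^ᶻ (e ∸ n)) n n≤e))
        pX : ∀ j → Vp.Deg≤ j ((Vp.K pᵖ Vr.- Vp.X) ^ᵛ j)
        pX j = proj₁ (≡.subst (λ m → Vp.Top m ((Zr.0# Zr.+ Zr.- Zr.1#) ^ᶻ j) ((Vp.K pᵖ Vr.- Vp.X) ^ᵛ j)) (ℕP.*-identityʳ j) (Vp.Top-^ j (Vp.Top-+ (Vp.Top-< (s≤s z≤n) (Vp.Top-K pᵖ)) (VA.Top-neg Vp.Top-X))))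
        term : ∀ m → m ≤ e → Vp.coef (Vp.K (⟦ σ ⟧ (r m)) Vr.* (Vp.K pᵖ Vr.- Vp.X) ^ᵛ (e ∸ m)) n Zr.≈ Zr.0#
        term m m≤e with m ℕ.<? ν
        ... | yes l = Zr.trans (Vp.coef-K* _ _ n) (Zr.trans (Zr.*-congʳ (σ.≈0-homo (below m l))) (Zr.zeroˡ _))
        ... | no l = Zr.trans (Vp.coef-K* _ _ n) (Zr.trans (Zr.*-congˡ (pX (e ∸ m) n (ℕP.+-cancelʳ-< m (e ∸ m) n (ℕP.<-≤-trans (ℕP.≤-<-trans (ℕP.≤-reflexive (ℕP.m∸n+n≡m m≤e)) e<n+ν) (ℕP.+-monoʳ-≤ n (ℕP.≮⇒≥ l)))))) (Zr.zeroʳ _))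
        rhs : Vp.coef (Vp.K ƛ Vr.* ΣV (suc e) (λ n → Vp.K (⟦ σ ⟧ (r n)) Vr.* (Vp.K pᵖ Vr.- Vp.X) ^ᵛ (e ∸ n))) n Zr.≈ Zr.0#
        rhs = Zr.trans (Vp.coef-K* _ _ n) (Zr.trans (Zr.*-congˡ (Zr.trans (Vp.coef-Σ (suc e) _ n) (Zs.Σ-zero (suc e) (λ m l → term m (ℕP.≤-pred l))))) (Zr.zeroʳ _))

      module WithDegrees (dν : ℕ) (degν : ZA.IsDeg dν (r ν)) (L : ℕ) (degG : VA.IsDeg L G) (N : ℕ) (degH₁ : VA.IsDeg N H₁)
        (dκ : ℕ) (degκ : ZA.IsDeg dκ κ) (dƛ : ℕ) (degƛ : ZA.IsDeg dƛ ƛ) (μ : ℕ)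
        (β-low : ∀ k → k < μ → Zp.coef (Vp.coef H₁ N) k ≡ + 0) (βμ : ¬ (Zp.coef (Vp.coef H₁ N) μ ≡ + 0)) where

        private
          b = Vp.coef G L
          β = Vp.coef H₁ N
          κ₀ = Zp.coef κ dκ
          ƛ₀ = Zp.coef ƛ dƛ

          ωβ≉0 : ¬ (⟦ ω ⟧ β Zr.≈ Zr.0#)
          ωβ≉0 h = proj₂ degH₁ (ω.AffDom.aff-reflects-0 ℤ-dom ℤ-dom (λ ()) (λ x → x) β h)

          lhsTop : Vp.Top (dκ ℕ.+ (N ℕ.+ e)) (Zp.K κ₀ Zr.* ⟦ ω ⟧ β) (⟦ emb ⟧ κ Vr.* H)
          lhsTop = Vp.Top-* (emb-Top (proj₁ degκ , ≡.refl)) (H-Top N (proj₁ degH₁))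

          lhs≉0 : ¬ (Zp.K κ₀ Zr.* ⟦ ω ⟧ β Zr.≈ Zr.0#)
          lhs≉0 = dZ.*≉0 (emb-IsDeg≉0 degκ) ωβ≉0

          rhsTop : Vp.Top (dƛ ℕ.+ L) (Zp.K ƛ₀ Zr.* b) (⟦ emb ⟧ ƛ Vr.* G)
          rhsTop = Vp.Top-* (emb-Top (proj₁ degƛ , ≡.refl)) (proj₁ degG , Zr.refl)

          degEq : dκ ℕ.+ (N ℕ.+ e) ≡ dƛ ℕ.+ L
          degEq = Vp.Top-unique eqW lhsTop rhsTop lhs≉0 (dZ.*≉0 (emb-IsDeg≉0 degƛ) (proj₂ degG))

          B≈ : Zp.K ƛ₀ Zr.* b Zr.≈ Zp.K κ₀ Zr.* ⟦ ω ⟧ β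
          B≈ = Zr.trans (Zr.sym (proj₂ rhsTop)) (Zr.trans (Zr.sym (Vp.coef-cong eqW _)) (Zr.trans (Zr.reflexive (≡.cong (Vp.coef (⟦ emb ⟧ κ Vr.* H)) (≡.sym degEq))) (proj₂ lhsTop)))

          μ≤e : μ ≤ e
          μ≤e with μ ℕ.≤? e
          ... | yes l = l
          ... | no l = ⊥-elim (βμ (≡.trans (Zp.coef-cong (coef-H₁ N) μ) (ZA.coef-Σmon-> e (hc N) μ (ℕP.≰⇒> l))))

          hcμ≢0 : ¬ (hc N μ ≡ + 0)
          hcμ≢0 h = βμ (≡.trans (coef²-H₁ N μ μ≤e) h)

          μ≤N : μ ≤ N
          μ≤N with N ℕ.<? μ
          ... | yes l = ⊥-elim (hcμ≢0 (ZA.coef-*X^-< (r μ) μ N l))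
          ... | no l = ℕP.≮⇒≥ l

          coefb : ∀ k → k ≤ e → Zp.coef b k ≡ gc L (e ∸ k)
          coefb k k≤e = ≡.trans (≡.cong (Zp.coef b) (≡.sym (ℕP.m∸[m∸n]≡n k≤e))) (coef²-G L (e ∸ k) (ℕP.m∸n≤m e k))

          coefb> : ∀ k → e < k → Zp.coef b k ≡ + 0
          coefb> k l = ≡.trans (Zp.coef-cong (coef-G L) k) (ZA.coef-Σrev-> e (gc L) k l)

          b-low : ∀ k → k < ν → Zp.coef b k ≡ + 0
          b-low k k<ν = ≡.trans (coefb k k≤e) (gc-zero L (e ∸ k) (above (e ∸ k) (ℕP.m∸n≤m e k)
              (ℕP.≤-<-trans (ℕP.≤-reflexive (≡.sym (ℕP.m∸n+n≡m k≤e))) (ℕP.+-monoʳ-< (e ∸ k) k<ν))))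
            where k≤e = ℕP.≤-trans (ℕP.<⇒≤ k<ν) ν≤e

          b-deg : Zp.Deg≤ (e ∸ ν) b
          b-deg k l with k ℕ.≤? e
          ... | no k≰e = coefb> k (ℕP.≰⇒> k≰e)
          ... | yes k≤e = ≡.trans (coefb k k≤e) (gc-zero L (e ∸ k) (below (e ∸ k)
                (ℕP.+-cancelʳ-< k (e ∸ k) ν (ℕP.≤-<-trans (ℕP.≤-reflexive (≡.trans (ℕP.m∸n+n≡m k≤e) (≡.sym (ℕP.m+[n∸m]≡n ν≤e)))) (ℕP.+-monoʳ-< ν l)))))

          b-par : ∀ k → ¬ (Zp.coef b k ≡ + 0) → Σ ℕ λ c → L ≡ (k ℕ.+ k) ℕ.+ c ℕ.* 4
          b-par k ne with k ℕ.≤? e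
          ... | no k≰e = ⊥-elim (ne (coefb> k (ℕP.≰⇒> k≰e)))
          ... | yes k≤e = proj₁ g , ≡.trans (proj₂ g) (≡.cong (λ m → (m ℕ.+ m) ℕ.+ proj₁ g ℕ.* 4) (ℕP.m∸[m∸n]≡n k≤e))
            where g = gc-index L (e ∸ k) (λ h → ne (≡.trans (coefb k k≤e) h))

          -- By the choice of μ, the coefficient of r_μ at N - μ is nonzero, so it contributes to
          -- `G` in degree 2(e - μ) + 4(N - μ); r_ν contributes likewise with its degree dν. Both
          -- numbers are at most L.
          lower : 4 ℕ.* e ≤ 6 ℕ.* (μ ℕ.+ ν)
          lower = arith₁ e μ ν (e ∸ μ) (e ∸ ν) (N ∸ μ) dν dκ dƛ L (ℕP.m+[n∸m]≡n μ≤e) (ℕP.m+[n∸m]≡n ν≤e)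
            (gc-bound L (proj₁ degG) μ μ≤e (N ∸ μ) (λ h → hcμ≢0 (≡.trans (≡.cong (λ m → hc m μ) (≡.sym (ℕP.m+[n∸m]≡n μ≤N))) (≡.trans (ZA.coef-*X^-+ (r μ) μ (N ∸ μ)) h))))
            (gc-bound L (proj₁ degG) ν ν≤e dν (proj₂ degν))
            (Descent.degBound e (<-wellFounded dν) κ ƛ r rel ν ν≤e degκ degƛ degν)
            (≡.trans (≡.cong (λ m → dκ ℕ.+ (m ℕ.+ e)) (ℕP.m+[n∸m]≡n μ≤N)) degEq)

          upper : ν ℕ.+ (μ ℕ.+ μ) ≤ e ∸ ν
          upper = RootCount.rootCount e ν ν≤e L b β κ₀ ƛ₀ μ (proj₂ degƛ) (proj₂ degG) b-low b-deg b-par B≈ β-low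

        e≡0 : e ≡ 0
        e≡0 = arith₂ e μ ν ν≤e lower upper

      trivial : e ≡ 0
      trivial = stage₁ (Zp.WithDom.degree ℤ-dom rν≉0)
        where
        stage₁ : Σ ℕ (λ n → ZA.IsDeg n (r ν)) → e ≡ 0
        stage₁ (dν , degν) = stage₂ (Vp.WithDom.degree domZ G≉0) (Vp.WithDom.degree domZ H₁≉0) (Zp.WithDom.degree ℤ-dom κ≉0)
          where
          G≉0 : ¬ (G Vr.≈ Vr.0#)
          G≉0 h = gc-lower ν dν (proj₂ degν) (≡.trans (≡.sym (coef²-G k ν ν≤e)) (Zp.coef≈0 (Vp.coef≈0 h k) _))
            where k = ((e ∸ ν) ℕ.+ (e ∸ ν)) ℕ.+ dν ℕ.* 4
          H₁≉0 : ¬ (H₁ Vr.≈ Vr.0#)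
          H₁≉0 h = proj₂ degν (≡.trans (≡.sym (ZA.coef-*X^-+ (r ν) ν dν)) (≡.trans (≡.sym (coef²-H₁ k ν ν≤e)) (Zp.coef≈0 (Vp.coef≈0 h k) ν)))
            where k = ν ℕ.+ dν
          stage₂ : Σ ℕ (λ L → VA.IsDeg L G) → Σ ℕ (λ N → VA.IsDeg N H₁) → Σ ℕ (λ n → ZA.IsDeg n κ) → e ≡ 0
          stage₂ (L , degG) (N , degH₁) (dκ , degκ) = stage₃ (Zp.WithDom.degree ℤ-dom ƛ≉0) (ZAD.order (Vp.coef H₁ N) (proj₂ degH₁))
            where
            ƛ≉0 : ¬ (ƛ Zr.≈ Zr.0#)
            ƛ≉0 h = dZ.*≉0 (emb-IsDeg≉0 degκ) (λ h → proj₂ degH₁ (ω.AffDom.aff-reflects-0 ℤ-dom ℤ-dom (λ ()) (λ x → x) _ h))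
              (Zr.trans (Zr.sym (proj₂ (Vp.Top-* (emb-Top (proj₁ degκ , ≡.refl)) (H-Top N (proj₁ degH₁))))) (Vp.coef≈0 (Vr.trans eqW (Vr.trans (Vr.*-congʳ (Hom.≈0-homo emb h)) (Vr.zeroˡ _))) _))
            stage₃ : Σ ℕ (λ n → ZA.IsDeg n ƛ) → Σ ℕ (λ μ → (∀ k → k < μ → Zp.coef (Vp.coef H₁ N) k ≡ + 0) × ¬ (Zp.coef (Vp.coef H₁ N) μ ≡ + 0)) → e ≡ 0
            stage₃ (dƛ , degƛ) (μ , low , top) = WithDegrees.e≡0 dν degν L degG N degH₁ dκ degκ dƛ degƛ μ low top

σ-Top : ∀ {n c q} → Zp.Top n c q → Zp.Top (n ℕ.* 4) c (⟦ σ ⟧ q)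
σ-Top {n} {c} {q} (d , e) = elim4 (λ m → n ℕ.* 4 < m → Zp.coef (⟦ σ ⟧ q) m ≡ + 0)
    (λ k l → ≡.trans (coef-σ-4 q k) (d k (ℕP.*-cancelʳ-< 4 n k l)))
    (λ k _ → ≡.trans (ZD.coef-σ q _) (at1 k)) (λ k _ → ≡.trans (ZD.coef-σ q _) (at2 k)) (λ k _ → ≡.trans (ZD.coef-σ q _) (at3 k))
  , ≡.trans (coef-σ-4 q n) e
  where open ZD.Vals (ZD.dil-vals (Zp.coef q))

z≉0 : ¬ (zᵖ Zr.≈ Zr.0#)
z≉0 h = case (≡.trans (≡.sym (Zp.coef-X 1)) (Zp.coef≈0 h 1))
  where
  case : ¬ (+ 1 ≡ + 0)
  case ()

firstNonzero : ∀ e (r : ℕ → Zr.Carrier) → (∀ n → n ≤ e → r n Zr.≈ Zr.0#) ⊎ Σ ℕ λ ν → ν ≤ e × (∀ n → n < ν → r n Zr.≈ Zr.0#) × ¬ (r ν Zr.≈ Zr.0#)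
firstNonzero e r = go e (λ n l → ℕP.≤-trans l ℕP.≤-refl)
  where
  go : ∀ k → (∀ n → n ≤ k → n ≤ e) → (∀ n → n ≤ k → r n Zr.≈ Zr.0#) ⊎ Σ ℕ λ ν → ν ≤ e × (∀ n → n < ν → r n Zr.≈ Zr.0#) × ¬ (r ν Zr.≈ Zr.0#)
  go zero h with dZ._≟0 (r 0)
  ... | yes q = inj₁ (λ { zero _ → q })
  ... | no q = inj₂ (0 , h 0 z≤n , (λ n ()) , q)
  go (suc k) h with go k (λ n l → h n (ℕP.m≤n⇒m≤1+n l))
  ... | inj₂ x = inj₂ x
  ... | inj₁ low with dZ._≟0 (r (suc k))
  ...   | no q = inj₂ (suc k , h (suc k) ℕP.≤-refl , (λ n l → low n (ℕP.≤-pred l)) , q)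
  ...   | yes q = inj₁ λ n l → case n (ℕP.m≤n⇒m<n∨m≡n l)
    where
    case : ∀ n → n < suc k ⊎ n ≡ suc k → r n Zr.≈ Zr.0#
    case n (inj₁ l)      = low n (ℕP.≤-pred l)
    case n (inj₂ ≡.refl) = q

formEq-zero : ∀ e κ ƛ → (κ≉0 : ¬ (κ Zr.≈ Zr.0#)) → ∀ r → Rigidity.FormEq (suc e) κ ƛ κ≉0 r → ∀ n → n ≤ suc e → r n Zr.≈ Zr.0#
formEq-zero e κ ƛ κ≉0 r eq = go (firstNonzero (suc e) r)
  where
  go : _ → ∀ n → n ≤ suc e → r n Zr.≈ Zr.0#
  go (inj₁ h) = h
  go (inj₂ (ν , ν≤e , low , ne)) = ⊥-elim (case (Rigidity.Eqs.trivial (suc e) κ ƛ κ≉0 r eq ν ν≤e low ne))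
    where
    case : ¬ (suc e ≡ 0)
    case ()

-- A solution of the twisted equation vanishes unless e = K, and then only the coefficient of x^K survives.
module FormRigid (e K : ℕ) (κ ƛ : Zr.Carrier) (κ≉0 : ¬ (κ Zr.≈ Zr.0#)) (r : ℕ → Zr.Carrier) where
  open PowerSeries V using () renaming (Σ< to ΣV)
  open Vs using () renaming (_^_ to _^ᵛ_)
  open Zs using () renaming (_^_ to _^ᶻ_)

  TwistedEq : Set
  TwistedEq = Vp.K κ Vr.* ΣV (suc e) (λ n → Vp.K (r n Zr.* zᵖ ^ᶻ (e ∸ n)) Vr.* Vp.X ^ᵛ n)
              Vr.≈ Vp.K ƛ Vr.* (Vp.X ^ᵛ K Vr.* ΣV (suc e) (λ n → Vp.K (⟦ σ ⟧ (r n)) Vr.* (Vp.K pᵖ Vr.- Vp.X) ^ᵛ (e ∸ n)))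

  module _ (eq : TwistedEq) where
    -- The right side is divisible by Y^K.
    lowZero : ∀ n → n ≤ e → n < K → r n Zr.≈ Zr.0#
    lowZero n n≤e n<K = dZ.cancel0 (dZ.^≉0 (e ∸ n) z≉0) (Zr.trans (Zr.*-comm _ _) (dZ.cancel0 κ≉0 (Zr.trans (Zr.sym lhs) (Zr.trans (Vp.coef-cong eq n) rhs))))
      where
      lhs : Vp.coef (Vp.K κ Vr.* ΣV (suc e) (λ n → Vp.K (r n Zr.* zᵖ ^ᶻ (e ∸ n)) Vr.* Vp.X ^ᵛ n)) n Zr.≈ κ Zr.* (r n Zr.* zᵖ ^ᶻ (e ∸ n))
      lhs = Zr.trans (Vp.coef-K* _ _ n) (Zr.*-congˡ (VA.coef-Σmon e (λ n → r n Zr.* zᵖ ^ᶻ (e ∸ n)) n n≤e))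
      rhs : Vp.coef (Vp.K ƛ Vr.* (Vp.X ^ᵛ K Vr.* ΣV (suc e) (λ n → Vp.K (⟦ σ ⟧ (r n)) Vr.* (Vp.K pᵖ Vr.- Vp.X) ^ᵛ (e ∸ n)))) n Zr.≈ Zr.0#
      rhs = Zr.trans (Vp.coef-K* _ _ n) (Zr.trans (Zr.*-congˡ (VA.X^-< _ K n n<K)) (Zr.zeroʳ _))

    module Shift (e′ : ℕ) (e≡ : e ≡ K ℕ.+ e′) where
      r′ : ℕ → Zr.Carrier
      r′ n = r (K ℕ.+ n)

      e-K-n : ∀ n → e ∸ (K ℕ.+ n) ≡ e′ ∸ n
      e-K-n n = ≡.trans (≡.cong (_∸ (K ℕ.+ n)) e≡) (ℕP.[m+n]∸[m+o]≡n∸o K e′ n)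

      split : ∀ (f : ℕ → Vr.Carrier) → (∀ n → n < K → f n Vr.≈ Vr.0#) → ΣV (suc e) f Vr.≈ ΣV (suc e′) (λ n → f (K ℕ.+ n))
      split f h = Vr.trans (Vr.reflexive (≡.cong (λ m → ΣV m f) (≡.trans (≡.cong suc e≡) (≡.sym (ℕP.+-suc K e′))))) (Vr.trans (Vs.Σ-split K (suc e′) f)
        (Vr.trans (Vr.+-congʳ (Vs.Σ-zero K h)) (Vr.+-identityˡ _)))

      r-low : ∀ n → n < K → r n Zr.≈ Zr.0#
      r-low n l = lowZero n (ℕP.≤-trans (ℕP.<⇒≤ l) (ℕP.≤-trans (ℕP.m≤m+n K e′) (ℕP.≤-reflexive (≡.sym e≡)))) l

      lhs : ΣV (suc e) (λ n → Vp.K (r n Zr.* zᵖ ^ᶻ (e ∸ n)) Vr.* Vp.X ^ᵛ n) Vr.≈ Vp.X ^ᵛ K Vr.* ΣV (suc e′) (λ n → Vp.K (r′ n Zr.* zᵖ ^ᶻ (e′ ∸ n)) Vr.* Vp.X ^ᵛ n)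
      lhs = Vr.trans (split _ (λ n l → Vr.trans (Vr.*-congʳ (Hom.≈0-homo Vp.KHom (Zr.trans (Zr.*-congʳ (r-low n l)) (Zr.zeroˡ _)))) (Vr.zeroˡ _)))
        (Vr.trans (Vs.Σ-cong′ (suc e′) term) (Vs.Σ-*ˡ (suc e′) (Vp.X ^ᵛ K) _))
        where
        term : ∀ n → Vp.K (r (K ℕ.+ n) Zr.* zᵖ ^ᶻ (e ∸ (K ℕ.+ n))) Vr.* Vp.X ^ᵛ (K ℕ.+ n) Vr.≈ Vp.X ^ᵛ K Vr.* (Vp.K (r′ n Zr.* zᵖ ^ᶻ (e′ ∸ n)) Vr.* Vp.X ^ᵛ n)
        term n = Vr.trans (Vr.*-cong (Vr.reflexive (≡.cong (λ j → Vp.K (r (K ℕ.+ n) Zr.* zᵖ ^ᶻ j)) (e-K-n n))) (Vs.^-+ Vp.X K n))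
          (let open Vs.Solver in solve 3 (λ a b c → a :* (b :* c) := b :* (a :* c)) Vr.refl _ _ _)

      rhs : ΣV (suc e) (λ n → Vp.K (⟦ σ ⟧ (r n)) Vr.* (Vp.K pᵖ Vr.- Vp.X) ^ᵛ (e ∸ n)) Vr.≈ ΣV (suc e′) (λ n → Vp.K (⟦ σ ⟧ (r′ n)) Vr.* (Vp.K pᵖ Vr.- Vp.X) ^ᵛ (e′ ∸ n))
      rhs = Vr.trans (split _ (λ n l → Vr.trans (Vr.*-congʳ (Hom.≈0-homo Vp.KHom (σ.≈0-homo (r-low n l)))) (Vr.zeroˡ _)))
        (Vs.Σ-cong′ (suc e′) (λ n → Vr.*-congˡ (Vr.reflexive (≡.cong ((Vp.K pᵖ Vr.- Vp.X) ^ᵛ_) (e-K-n n)))))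

      X^K≉0 : ¬ (Vp.X ^ᵛ K Vr.≈ Vr.0#)
      X^K≉0 = dV.^≉0 K (λ h → dZ.1≉0 (Zr.trans (Zr.sym (Vp.coef-X 1)) (Vp.coef≈0 h 1)))

      reduced : Rigidity.FormEq e′ κ ƛ κ≉0 r′
      reduced = dV.cancelˡ X^K≉0 (Vr.trans (swap _ _ _) (Vr.trans (Vr.*-congˡ (Vr.sym lhs)) (Vr.trans eq (Vr.trans (Vr.*-congˡ (Vr.*-congˡ rhs)) (swap _ _ _)))))
        where
        swap : ∀ a b c → a Vr.* (b Vr.* c) Vr.≈ b Vr.* (a Vr.* c)
        swap = let open Vs.Solver in solve 3 (λ a b c → a :* (b :* c) := b :* (a :* c)) Vr.refl

    allZero : ¬ (e ≡ K) → ∀ n → n ≤ e → r n Zr.≈ Zr.0#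
    allZero e≢K n n≤e with ℕP.<-cmp e K
    ... | tri< e<K _ _ = lowZero n n≤e (ℕP.≤-<-trans n≤e e<K)
    ... | tri≈ _ e≡K _ = ⊥-elim (e≢K e≡K)
    ... | tri> _ _ K<e = case (n ℕ.<? K)
      where
      e′ = e ∸ suc K
      e≡ : e ≡ K ℕ.+ suc e′
      e≡ = ≡.trans (≡.sym (ℕP.m+[n∸m]≡n K<e)) (≡.sym (ℕP.+-suc K e′))
      case : Dec (n < K) → r n Zr.≈ Zr.0#
      case (yes l) = lowZero n n≤e l
      case (no l) = Zr.trans (Zr.reflexive (≡.cong r (≡.sym (ℕP.m+[n∸m]≡n (ℕP.≮⇒≥ l)))))
        (formEq-zero e′ κ ƛ κ≉0 (Shift.r′ (suc e′) e≡) (Shift.reduced (suc e′) e≡) (n ∸ K)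
          (ℕP.+-cancelˡ-≤ K _ _ (ℕP.≤-trans (ℕP.≤-reflexive (ℕP.m+[n∸m]≡n (ℕP.≮⇒≥ l))) (ℕP.≤-trans n≤e (ℕP.≤-reflexive e≡)))))

    scalarEq : e ≡ K → κ Zr.* r K Zr.≈ ƛ Zr.* ⟦ σ ⟧ (r K)
    scalarEq e≡K = Zr.trans (Zr.sym l₀) (Zr.trans (Vp.coef-cong (Shift.reduced 0 e≡) 0) r₀)
      where
      e≡ : e ≡ K ℕ.+ 0
      e≡ = ≡.trans e≡K (≡.sym (ℕP.+-identityʳ K))
      rK : r (K ℕ.+ 0) Zr.≈ r K
      rK = Zr.reflexive (≡.cong r (ℕP.+-identityʳ K))
      c₀ : ∀ a → Vp.coef (Vr.0# Vr.+ Vp.K a Vr.* Vr.1#) 0 Zr.≈ a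
      c₀ a = Zr.trans (Vp.coef-cong (Vr.trans (Vr.+-identityˡ _) (Vr.*-identityʳ _)) 0) (Vp.coef-K0 a)
      l₀ : Vp.coef (Vp.K κ Vr.* ΣV 1 (λ n → Vp.K (r (K ℕ.+ n) Zr.* zᵖ ^ᶻ (0 ∸ n)) Vr.* Vp.X ^ᵛ n)) 0 Zr.≈ κ Zr.* r K
      l₀ = Zr.trans (Vp.coef-K* _ _ 0) (Zr.*-congˡ (Zr.trans (c₀ _) (Zr.trans (Zr.*-identityʳ _) rK)))
      r₀ : Vp.coef (Vp.K ƛ Vr.* ΣV 1 (λ n → Vp.K (⟦ σ ⟧ (r (K ℕ.+ n))) Vr.* (Vp.K pᵖ Vr.- Vp.X) ^ᵛ (0 ∸ n))) 0 Zr.≈ ƛ Zr.* ⟦ σ ⟧ (r K)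
      r₀ = Zr.trans (Vp.coef-K* _ _ 0) (Zr.*-congˡ (Zr.trans (c₀ _) (σ.⟦⟧-cong rK)))

δpᵖ : Zr.Carrier
δpᵖ = zᵖ Zr.+ Zp.K (+ 2) Zr.* (zᵖ Zr.* zᵖ)

δp-Top : Zp.Top 2 (+ 2) δpᵖ
δp-Top = Zp.Top-+ (Zp.Top-< (s≤s (s≤s z≤n)) Zp.Top-X) (Zp.Top-* (Zp.Top-K (+ 2)) (Zp.Top-* Zp.Top-X Zp.Top-X))

-- Comparing degrees in z excludes the equations that the subleading coefficient in t would have to satisfy.
module Quad (μ γ₀ γ₁ γ₂ : Zr.Carrier) (N : ℤ) (N≢0 : ¬ (N ≡ + 0)) (m : ℕ) (degμ : ZA.IsDeg m μ) where
  private
    σ′ = ⟦ σ ⟧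
    k = Zp.K
    μl = Zp.coef μ m
    topμ : Zp.Top m μl μ
    topμ = proj₁ degμ , ≡.refl
    topσμ = σ-Top topμ

  T₁ T₂ T₃ T₄ : Zr.Carrier
  T₁ = k (+ 8) Zr.* (pᵖ Zr.* (μ Zr.* σ′ γ₀))
  T₂ = σ′ μ Zr.* γ₁
  T₃ = k (+ 4) Zr.* (μ Zr.* σ′ γ₁)
  T₄ = k N Zr.* (μ Zr.* σ′ μ)

  private
    top₁ : ∀ {a c} → Zp.Top a c γ₀ → Zp.Top (2 ℕ.+ (m ℕ.+ a ℕ.* 4)) (+ 8 ℤ.* (+ 1 ℤ.* (μl ℤ.* c))) T₁
    top₁ t = Zp.Top-* (Zp.Top-K (+ 8)) (Zp.Top-* p-Top (Zp.Top-* topμ (σ-Top t)))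
    top₂ : ∀ {b c} → Zp.Top b c γ₁ → Zp.Top (m ℕ.* 4 ℕ.+ b) (μl ℤ.* c) T₂
    top₂ t = Zp.Top-* topσμ t
    top₃ : ∀ {b c} → Zp.Top b c γ₁ → Zp.Top (m ℕ.+ b ℕ.* 4) (+ 4 ℤ.* (μl ℤ.* c)) T₃
    top₃ t = Zp.Top-* (Zp.Top-K (+ 4)) (Zp.Top-* topμ (σ-Top t))
    top₄ : Zp.Top (m ℕ.+ m ℕ.* 4) (N ℤ.* (μl ℤ.* μl)) T₄
    top₄ = Zp.Top-* (Zp.Top-K N) (Zp.Top-* topμ topσμ)

    nz* : ∀ a b → ¬ (a ≡ + 0) → ¬ (b ≡ + 0) → ¬ (a ℤ.* b ≡ + 0)
    nz* a b = Dom.*≉0 ℤ-dom {a} {b}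

  module _ (eq₁ : k (+ 4) Zr.* (zᵖ Zr.* (μ Zr.* σ′ γ₀)) Zr.≈ σ′ μ Zr.* γ₂)
           (eq₂ : (T₁ Zr.+ T₂) Zr.+ (T₃ Zr.+ T₄) Zr.≈ Zr.0#)
           (eq₃ : (k (+ 4) Zr.* ((pᵖ Zr.* pᵖ) Zr.* (μ Zr.* σ′ γ₀)) Zr.+ k (+ 4) Zr.* (pᵖ Zr.* (μ Zr.* σ′ γ₁)))
                  Zr.+ (k (+ 4) Zr.* (μ Zr.* σ′ γ₂) Zr.+ k N Zr.* (δpᵖ Zr.* (μ Zr.* σ′ μ))) Zr.≈ zᵖ Zr.* (σ′ μ Zr.* γ₀)) where
    private
      coefSum : ∀ {n a b c d} → Zp.Top n a T₁ → Zp.Top n b T₂ → Zp.Top n c T₃ → Zp.Top n d T₄ → (a ℤ.+ b) ℤ.+ (c ℤ.+ d) ≡ + 0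
      coefSum {n} t₁ t₂ t₃ t₄ = ≡.trans (≡.sym (proj₂ (Zp.Top-+ (Zp.Top-+ t₁ t₂) (Zp.Top-+ t₃ t₄)))) (Zp.coef≈0 eq₂ n)

      only₁ : ∀ {n a} → ¬ (a ≡ + 0) → Zp.Top n a T₁ → Zp.Top n (+ 0) T₂ → Zp.Top n (+ 0) T₃ → Zp.Top n (+ 0) T₄ → ⊥
      only₁ {a = a} ne t₁ t₂ t₃ t₄ = ne (≡.trans (≡.sym (≡.trans (ℤP.+-identityʳ _) (ℤP.+-identityʳ a))) (coefSum t₁ t₂ t₃ t₄))

      only₃ : ∀ {n c} → ¬ (c ≡ + 0) → Zp.Top n (+ 0) T₁ → Zp.Top n (+ 0) T₂ → Zp.Top n c T₃ → Zp.Top n (+ 0) T₄ → ⊥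
      only₃ {c = c} ne t₁ t₂ t₃ t₄ = ne (≡.trans (≡.sym (≡.trans (ℤP.+-identityˡ _) (ℤP.+-identityʳ c))) (coefSum t₁ t₂ t₃ t₄))

      5m<t : ∀ {a} → m ≤ a → m ℕ.+ m ℕ.* 4 < 2 ℕ.+ (m ℕ.+ a ℕ.* 4)
      5m<t m≤a = s≤s (ℕP.m≤n⇒m≤1+n (ℕP.+-monoʳ-≤ m (ℕP.*-monoˡ-≤ 4 m≤a)))

      top₁-0 : γ₀ Zr.≈ Zr.0# → ∀ n → Zp.Top n (+ 0) T₁
      top₁-0 h n = Zp.Top-zero (Zr.trans (Zr.*-congˡ (Zr.trans (Zr.*-congˡ (Zr.trans (Zr.*-congˡ (σ.≈0-homo h)) (Zr.zeroʳ _))) (Zr.zeroʳ _))) (Zr.zeroʳ _))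
      top₂-0 : γ₁ Zr.≈ Zr.0# → ∀ n → Zp.Top n (+ 0) T₂
      top₂-0 h n = Zp.Top-zero (Zr.trans (Zr.*-congˡ h) (Zr.zeroʳ _))
      top₃-0 : γ₁ Zr.≈ Zr.0# → ∀ n → Zp.Top n (+ 0) T₃
      top₃-0 h n = Zp.Top-zero (Zr.trans (Zr.*-congˡ (Zr.trans (Zr.*-congˡ (σ.≈0-homo h)) (Zr.zeroʳ _))) (Zr.zeroʳ _))

      nz₁ : ∀ {c} → ¬ (c ≡ + 0) → ¬ (+ 8 ℤ.* (+ 1 ℤ.* (μl ℤ.* c)) ≡ + 0)
      nz₁ {c} c≢0 = nz* (+ 8) (+ 1 ℤ.* (μl ℤ.* c)) (λ ()) (nz* (+ 1) (μl ℤ.* c) (λ ()) (nz* μl c (proj₂ degμ) c≢0))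
      nz₃ : ∀ {c} → ¬ (c ≡ + 0) → ¬ (+ 4 ℤ.* (μl ℤ.* c) ≡ + 0)
      nz₃ {c} c≢0 = nz* (+ 4) (μl ℤ.* c) (λ ()) (nz* μl c (proj₂ degμ) c≢0)

      no2mod4 : ∀ a b → ¬ (2 ℕ.+ a ℕ.* 4 ≡ b ℕ.* 4)
      no2mod4 zero (suc b) ()
      no2mod4 (suc a) (suc b) q = no2mod4 a b (ℕP.suc-injective (ℕP.suc-injective (ℕP.suc-injective (ℕP.suc-injective q))))

      -- If a ≥ m, then `T₁` has degree 2 + m + 4a, which exceeds that of `T₄`. Only `T₁` and `T₃`
      -- can dominate, and they cannot cancel: `T₃` has degree m + 4b, and the two degrees differ by
      -- 2 modulo 4.
      γ₀-small : ∀ {a} → ZA.IsDeg a γ₀ → a < m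
      γ₀-small {a} (da , na) with a ℕ.<? m
      ... | yes l = l
      ... | no nl = ⊥-elim (go (Zp.WithDom.leading ℤ-dom γ₁))
        where
        m≤a = ℕP.≮⇒≥ nl
        t₁ = top₁ (da , ≡.refl)
        t₄ = Zp.Top-< (5m<t m≤a) top₄
        go : (γ₁ Zr.≈ Zr.0#) ⊎ Σ ℕ (λ n → ZA.IsDeg n γ₁) → ⊥
        go (inj₁ h) = only₁ (nz₁ {Zp.coef γ₀ a} na) t₁ (top₂-0 h _) (top₃-0 h _) t₄
        go (inj₂ (b , db , nb)) with ℕP.<-cmp (m ℕ.+ b ℕ.* 4) (2 ℕ.+ (m ℕ.+ a ℕ.* 4))
        ... | tri≈ _ q _ = no2mod4 a b (ℕP.+-cancelˡ-≡ m _ _ (≡.trans (≡.trans (ℕP.+-suc m _) (≡.cong suc (ℕP.+-suc m _))) (≡.sym q)))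
        ... | tri< l _ _ = only₁ (nz₁ {Zp.coef γ₀ a} na) t₁ (Zp.Top-< l₂ (top₂ (db , ≡.refl))) (Zp.Top-< l (top₃ (db , ≡.refl))) t₄
          where
          b≤a : b ≤ a
          b≤a with b ℕ.≤? a
          ... | yes q = q
          ... | no q = ⊥-elim (ℕP.<⇒≱ l (ℕP.≤-trans (ℕP.≤-reflexive (≡.sym (≡.trans (ℕP.+-suc m _) (≡.cong suc (ℕP.+-suc m _))))) (ℕP.+-monoʳ-≤ m (ℕP.≤-trans (s≤s (s≤s (ℕP.m≤n+m _ 2))) (ℕP.*-monoˡ-≤ 4 (ℕP.≰⇒> q))))))
          l₂ : m ℕ.* 4 ℕ.+ b < 2 ℕ.+ (m ℕ.+ a ℕ.* 4)
          l₂ = s≤s (ℕP.m≤n⇒m≤1+n (ℕP.≤-trans (ℕP.≤-reflexive (f₁ m b)) (ℕP.+-monoʳ-≤ m (ℕP.≤-trans (ℕP.+-mono-≤ (ℕP.*-monoˡ-≤ 3 m≤a) b≤a) (ℕP.≤-reflexive (f₂ a))))))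
            where
            f₁ : ∀ m b → m ℕ.* 4 ℕ.+ b ≡ m ℕ.+ (m ℕ.* 3 ℕ.+ b)
            f₁ = solve-∀
            f₂ : ∀ a → a ℕ.* 3 ℕ.+ a ≡ a ℕ.* 4
            f₂ = solve-∀
        ... | tri> _ _ l = only₃ (nz₃ {Zp.coef γ₁ b} nb) (Zp.Top-< l t₁) (Zp.Top-< l₂ (top₂ (db , ≡.refl))) (top₃ (db , ≡.refl)) (Zp.Top-< (ℕP.<-trans (5m<t m≤a) l) top₄)
          where
          a<b : a < b
          a<b = ℕP.*-cancelʳ-< 4 a b (ℕP.+-cancelˡ-< m _ _ (ℕP.<-trans (ℕP.m<n⇒m<1+n (ℕP.n<1+n _)) l))
          m<b = ℕP.≤-<-trans m≤a a<b
          l₂ : m ℕ.* 4 ℕ.+ b < m ℕ.+ b ℕ.* 4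
          l₂ = ℕP.<-≤-trans (ℕP.≤-<-trans (ℕP.≤-reflexive (f₁ m b)) (ℕP.+-monoʳ-< m (ℕP.+-monoˡ-< b (ℕP.*-monoˡ-< 3 m<b)))) (ℕP.≤-reflexive (f₂ m b))
            where
            f₁ : ∀ m b → m ℕ.* 4 ℕ.+ b ≡ m ℕ.+ (m ℕ.* 3 ℕ.+ b)
            f₁ = solve-∀
            f₂ : ∀ m b → m ℕ.+ (b ℕ.* 3 ℕ.+ b) ≡ m ℕ.+ b ℕ.* 4
            f₂ = solve-∀

      γ₀-case : (γ₀ Zr.≈ Zr.0#) ⊎ Σ ℕ (λ a → a < m × Zp.Deg≤ a γ₀)
      γ₀-case with Zp.WithDom.leading ℤ-dom γ₀
      ... | inj₁ h = inj₁ h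
      ... | inj₂ (a , d) = inj₂ (a , γ₀-small d , proj₁ d)

      T₁-Top : ∀ {n} → m ℕ.+ m ℕ.* 4 ≤ n → Zp.Top n (+ 0) T₁
      T₁-Top {n} l with γ₀-case
      ... | inj₁ h = top₁-0 h n
      ... | inj₂ (a , a<m , d) = Zp.Top-< (ℕP.<-≤-trans (lt a<m) l) (top₁ (d , ≡.refl))
        where
        lt : a < m → 2 ℕ.+ (m ℕ.+ a ℕ.* 4) < m ℕ.+ m ℕ.* 4
        lt a<m = ℕP.<-≤-trans (ℕP.≤-<-trans (ℕP.≤-reflexive (f m a)) (ℕP.+-monoʳ-< m (ℕP.+-monoˡ-< (a ℕ.* 4) {2} {4} (s≤s (s≤s (s≤s z≤n)))))) (ℕP.+-monoʳ-≤ m (ℕP.*-monoˡ-≤ 4 a<m))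
          where
          f : ∀ m a → 2 ℕ.+ (m ℕ.+ a ℕ.* 4) ≡ m ℕ.+ (2 ℕ.+ a ℕ.* 4)
          f = solve-∀

      -- For deg γ₁ = b > m the term `T₃` alone would reach degree m + 4b.
      γ₁-Deg : Zp.Deg≤ m γ₁
      γ₁-Deg with Zp.WithDom.leading ℤ-dom γ₁
      ... | inj₁ h = λ j _ → Zp.coef≈0 h j
      ... | inj₂ (b , db , nb) with b ℕ.≤? m
      ...   | yes l = λ j q → db j (ℕP.≤-<-trans l q)
      ...   | no nl = ⊥-elim (only₃ (nz₃ {Zp.coef γ₁ b} nb) (T₁-Top (ℕP.<⇒≤ l₄)) (Zp.Top-< l₂ (top₂ (db , ≡.refl))) (top₃ (db , ≡.refl)) (Zp.Top-< l₄ top₄))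
        where
        m<b = ℕP.≰⇒> nl
        l₄ : m ℕ.+ m ℕ.* 4 < m ℕ.+ b ℕ.* 4
        l₄ = ℕP.+-monoʳ-< m (ℕP.*-monoˡ-< 4 m<b)
        l₂ : m ℕ.* 4 ℕ.+ b < m ℕ.+ b ℕ.* 4
        l₂ = ℕP.<-≤-trans (ℕP.≤-<-trans (ℕP.≤-reflexive (f₁ m b)) (ℕP.+-monoʳ-< m (ℕP.+-monoˡ-< b (ℕP.*-monoˡ-< 3 m<b)))) (ℕP.≤-reflexive (f₂ m b))
          where
          f₁ : ∀ m b → m ℕ.* 4 ℕ.+ b ≡ m ℕ.+ (m ℕ.* 3 ℕ.+ b)
          f₁ = solve-∀
          f₂ : ∀ m b → m ℕ.+ (b ℕ.* 3 ℕ.+ b) ≡ m ℕ.+ b ℕ.* 4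
          f₂ = solve-∀

      β = Zp.coef γ₁ m

      sum₂ : (+ 0 ℤ.+ μl ℤ.* β) ℤ.+ (+ 4 ℤ.* (μl ℤ.* β) ℤ.+ N ℤ.* (μl ℤ.* μl)) ≡ + 0
      sum₂ = coefSum (T₁-Top ℕP.≤-refl) (≡.subst (λ n → Zp.Top n (μl ℤ.* β) T₂) (ℕP.+-comm (m ℕ.* 4) m) (top₂ (γ₁-Deg , ≡.refl))) (top₃ (γ₁-Deg , ≡.refl)) top₄

      2+5m = 2 ℕ.+ (m ℕ.+ m ℕ.* 4)

      S₁-Top : Zp.Top 2+5m (+ 0) (k (+ 4) Zr.* ((pᵖ Zr.* pᵖ) Zr.* (μ Zr.* σ′ γ₀)))
      S₁-Top with γ₀-case
      ... | inj₁ h = Zp.Top-zero (Zr.trans (Zr.*-congˡ (Zr.trans (Zr.*-congˡ (Zr.trans (Zr.*-congˡ (σ.≈0-homo h)) (Zr.zeroʳ _))) (Zr.zeroʳ _))) (Zr.zeroʳ _))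
      ... | inj₂ (a , a<m , d) = Zp.Top-< lt (Zp.Top-* (Zp.Top-K (+ 4)) (Zp.Top-* (Zp.Top-* p-Top p-Top) (Zp.Top-* topμ (σ-Top (d , ≡.refl)))))
        where
        lt : 4 ℕ.+ (m ℕ.+ a ℕ.* 4) < 2+5m
        lt = s≤s (ℕP.≤-trans (ℕP.≤-reflexive (f m a)) (ℕP.m≤n⇒m≤1+n (ℕP.+-monoʳ-≤ m (ℕP.*-monoˡ-≤ 4 a<m))))
          where
          f : ∀ m a → 4 ℕ.+ (m ℕ.+ a ℕ.* 4) ≡ m ℕ.+ (4 ℕ.+ a ℕ.* 4)
          f = solve-∀

      S₂-Top : Zp.Top 2+5m (+ 4 ℤ.* (+ 1 ℤ.* (μl ℤ.* β))) (k (+ 4) Zr.* (pᵖ Zr.* (μ Zr.* σ′ γ₁)))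
      S₂-Top = Zp.Top-* (Zp.Top-K (+ 4)) (Zp.Top-* p-Top (Zp.Top-* topμ (σ-Top (γ₁-Deg , ≡.refl))))

      -- `eq₁` balances 1 + m + 4a against 4m + deg γ₂, where a < m bounds the degree of γ₀.
      γ₂-Deg : Zp.Deg≤ m γ₂
      γ₂-Deg with Zp.WithDom.leading ℤ-dom γ₂ | γ₀-case
      ... | inj₁ h | _ = λ j _ → Zp.coef≈0 h j
      ... | inj₂ (g , dg) | inj₁ h = ⊥-elim (ZA.IsDeg≉0 (ZAD.IsDeg-* (IsDeg-σ degμ) dg) (Zr.trans (Zr.sym eq₁) (Zr.trans (Zr.*-congˡ (Zr.trans (Zr.*-congˡ (Zr.trans (Zr.*-congˡ (σ.≈0-homo h)) (Zr.zeroʳ _))) (Zr.zeroʳ _))) (Zr.zeroʳ _))))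
      ... | inj₂ (g , dg) | inj₂ (a , a<m , d) with g ℕ.≤? m
      ...   | yes l = λ j q → proj₁ dg j (ℕP.≤-<-trans l q)
      ...   | no nl = ⊥-elim (proj₂ (ZAD.IsDeg-* (IsDeg-σ degμ) dg) (≡.trans (≡.sym (Zp.coef-cong eq₁ _)) (proj₁ (Zp.Top-* (Zp.Top-K (+ 4)) (Zp.Top-* Zp.Top-X (Zp.Top-* topμ (σ-Top (d , ≡.refl))))) _ lt)))
        where
        lt : 1 ℕ.+ (m ℕ.+ a ℕ.* 4) < m ℕ.* 4 ℕ.+ g
        lt = ℕP.≤-<-trans (ℕP.≤-reflexive (f m a)) (ℕP.≤-<-trans (ℕP.+-monoʳ-≤ m (ℕP.≤-trans (s≤s (ℕP.m≤n+m _ 3)) (ℕP.*-monoˡ-≤ 4 a<m))) (ℕP.<-≤-trans (ℕP.+-monoˡ-< (m ℕ.* 4) (ℕP.≰⇒> nl)) (ℕP.≤-reflexive (ℕP.+-comm g _))))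
          where
          f : ∀ m a → 1 ℕ.+ (m ℕ.+ a ℕ.* 4) ≡ m ℕ.+ (1 ℕ.+ a ℕ.* 4)
          f = solve-∀

      S₃-Top : Zp.Top 2+5m (+ 0) (k (+ 4) Zr.* (μ Zr.* σ′ γ₂))
      S₃-Top = Zp.Top-< {m ℕ.+ m ℕ.* 4} (ℕP.m<n⇒m<1+n (ℕP.n<1+n _)) (Zp.Top-* (Zp.Top-K (+ 4)) (Zp.Top-* topμ (σ-Top (γ₂-Deg , ≡.refl))))

      S₄-Top : Zp.Top 2+5m (N ℤ.* (+ 2 ℤ.* (μl ℤ.* μl))) (k N Zr.* (δpᵖ Zr.* (μ Zr.* σ′ μ)))
      S₄-Top = Zp.Top-* (Zp.Top-K N) (Zp.Top-* δp-Top (Zp.Top-* topμ topσμ))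

      S₅-Top : Zp.Top 2+5m (+ 0) (zᵖ Zr.* (σ′ μ Zr.* γ₀))
      S₅-Top with γ₀-case
      ... | inj₁ h = Zp.Top-zero (Zr.trans (Zr.*-congˡ (Zr.trans (Zr.*-congˡ h) (Zr.zeroʳ _))) (Zr.zeroʳ _))
      ... | inj₂ (a , a<m , d) = Zp.Top-< (s≤s (s≤s (ℕP.≤-trans (ℕP.+-monoʳ-≤ (m ℕ.* 4) (ℕP.<⇒≤ a<m)) (ℕP.≤-reflexive (ℕP.+-comm _ m))))) (Zp.Top-* Zp.Top-X (Zp.Top-* topσμ (d , ≡.refl)))

      -- In degree 5m + 2 only the terms with p γ₁ and with δp survive. The leading coefficients 1
      -- of p and 2 of δp make this 4β + 2N μl = 0, up to the factor μl.
      sum₃ : (+ 0 ℤ.+ + 4 ℤ.* (+ 1 ℤ.* (μl ℤ.* β))) ℤ.+ (+ 0 ℤ.+ N ℤ.* (+ 2 ℤ.* (μl ℤ.* μl))) ≡ + 0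
      sum₃ = ≡.trans (≡.sym (proj₂ (Zp.Top-+ (Zp.Top-+ S₁-Top S₂-Top) (Zp.Top-+ S₃-Top S₄-Top)))) (≡.trans (Zp.coef-cong eq₃ 2+5m) (proj₂ S₅-Top))

    contradiction : ⊥
    -- `sum₂` and `sum₃` say 5β + N μl = 0 and 4β + 2N μl = 0, up to the factor μl. Five times the
    -- second minus four times the first leaves 6N μl, which is not zero.
    contradiction = nz* (+ 6) (N ℤ.* (μl ℤ.* μl)) (λ ()) (nz* N (μl ℤ.* μl) N≢0 (nz* μl μl (proj₂ degμ) (proj₂ degμ))) (≡.trans (combine μl β N) (≡.cong₂ (λ x y → + 5 ℤ.* x ℤ.- + 4 ℤ.* y) sum₃ sum₂))
      where
      open Sums.Solver ℤring
      combine : ∀ u b n → + 6 ℤ.* (n ℤ.* (u ℤ.* u)) ≡ + 5 ℤ.* ((+ 0 ℤ.+ + 4 ℤ.* (+ 1 ℤ.* (u ℤ.* b))) ℤ.+ (+ 0 ℤ.+ n ℤ.* (+ 2 ℤ.* (u ℤ.* u)))) ℤ.- + 4 ℤ.* ((+ 0 ℤ.+ u ℤ.* b) ℤ.+ (+ 4 ℤ.* (u ℤ.* b) ℤ.+ n ℤ.* (u ℤ.* u)))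
      combine = solve 3 (λ u b n → con (+ 6) :* (n :* (u :* u)) := con (+ 5) :* ((con (+ 0) :+ con (+ 4) :* (con (+ 1) :* (u :* b))) :+ (con (+ 0) :+ n :* (con (+ 2) :* (u :* u)))) :- con (+ 4) :* ((con (+ 0) :+ u :* b) :+ (con (+ 4) :* (u :* b) :+ n :* (u :* u)))) ≡.refl

-- The ring of relations and the substitution β

B₁ C C₁ A : CRing
B₁ = Poly Z
C  = Poly B₁
C₁ = Poly C
A  = Poly C₁

module Bp = Pol Z
module Cp = Pol B₁
module Tp = Pol C
module Ap = Pol C₁
module Br = CommutativeRing B₁
module Cr = CommutativeRing C
module Tr = CommutativeRing C₁
module Ar = CommutativeRing A
module Cs = Sums C
module Ts = Sums C₁
module As = Sums A

domC : Dom C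
domC = Pol.WithDom.dom B₁ domV
domC₁ : Dom C₁
domC₁ = Pol.WithDom.dom C domC

module dC = Dom domC

ιC : Hom Z C
ιC = Cp.KHom ∘H Bp.KHom
jA : Hom C A
jA = Ap.KHom ∘H Tp.KHom
ιA : Hom Z A
ιA = jA ∘H ιC

xC yC : Cr.Carrier
xC = Cp.K Bp.X
yC = Cp.X

tA τA : Ar.Carrier
tA = Ap.K Tp.X
τA = Ap.X

module LiftC {S : CRing} (h : Hom Z S) (a b : CommutativeRing.Carrier S) where
  private module S = CommutativeRing S
  liftC : Hom C S
  liftC = lift (lift h a) b
  liftC-ι : ∀ q → ⟦ liftC ⟧ (⟦ ιC ⟧ q) S.≈ ⟦ h ⟧ q
  liftC-ι q = S.trans (lift-K (lift h a) b _) (lift-K h a q)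
  liftC-x : ⟦ liftC ⟧ xC S.≈ a
  liftC-x = S.trans (lift-K (lift h a) b _) (lift-X h a)
  liftC-y : ⟦ liftC ⟧ yC S.≈ b
  liftC-y = lift-X (lift h a) b

module LiftA {S : CRing} (h : Hom C S) (a b : CommutativeRing.Carrier S) where
  private module S = CommutativeRing S
  liftA : Hom A S
  liftA = lift (lift h a) b
  liftA-j : ∀ q → ⟦ liftA ⟧ (⟦ jA ⟧ q) S.≈ ⟦ h ⟧ q
  liftA-j q = S.trans (lift-K (lift h a) b _) (lift-K h a q)
  liftA-t : ⟦ liftA ⟧ tA S.≈ a
  liftA-t = S.trans (lift-K (lift h a) b _) (lift-X h a)
  liftA-τ : ⟦ liftA ⟧ τA S.≈ b
  liftA-τ = lift-X (lift h a) b

extC : {S : CRing} (f g : Hom C S) → let open CommutativeRing S using (_≈_) in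
       (∀ q → ⟦ f ⟧ (⟦ ιC ⟧ q) ≈ ⟦ g ⟧ (⟦ ιC ⟧ q)) → ⟦ f ⟧ xC ≈ ⟦ g ⟧ xC → ⟦ f ⟧ yC ≈ ⟦ g ⟧ yC → ∀ q → ⟦ f ⟧ q ≈ ⟦ g ⟧ q
extC f g hz hx hy = Cp.hom-ext f g (Bp.hom-ext (f ∘H Cp.KHom) (g ∘H Cp.KHom) hz hx) hy

extA : {S : CRing} (f g : Hom A S) → let open CommutativeRing S using (_≈_) in
       (∀ q → ⟦ f ⟧ (⟦ jA ⟧ q) ≈ ⟦ g ⟧ (⟦ jA ⟧ q)) → ⟦ f ⟧ tA ≈ ⟦ g ⟧ tA → ⟦ f ⟧ τA ≈ ⟦ g ⟧ τA → ∀ q → ⟦ f ⟧ q ≈ ⟦ g ⟧ q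
extA f g hj ht hτ = Ap.hom-ext f g (Tp.hom-ext (f ∘H Ap.KHom) (g ∘H Ap.KHom) hj ht) hτ

four : Zr.Carrier
four = Zp.K (+ 4)

pC δC zC 4C dC′ zxC δxC 4zxC : Cr.Carrier
pC  = ⟦ ιC ⟧ pᵖ
δC  = ⟦ ιC ⟧ δpᵖ
zC  = ⟦ ιC ⟧ zᵖ
4C  = ⟦ ιC ⟧ four
dC′ = pC Cr.* xC Cr.- yC
zxC = zC Cr.* xC
δxC = δC Cr.* xC
4zxC = 4C Cr.* zxC

α : Hom C C
α = LiftC.liftC ιC dC′ zxC

module αL = LiftC ιC dC′ zxC

σC : Hom C C
σC = mapHom (mapHom σ)
σT : Hom C₁ C₁
σT = mapHom σC
σA : Hom A A
σA = mapHom σT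

-- t plays the role of 4 δy, τ that of 4 δx.
xβ yβ : Ar.Carrier
xβ = (⟦ jA ⟧ (4C Cr.* δxC) Ar.+ ⟦ jA ⟧ (4C Cr.* pC) Ar.* τA) Ar.- ⟦ jA ⟧ 4C Ar.* tA
yβ = ⟦ jA ⟧ (4C Cr.* zC) Ar.* (⟦ jA ⟧ xC Ar.+ τA)

-- The images of τ and t come from applying 4δ to x = p σx - σy and y = z σx. Since δσ = 4σδ, the
-- derivatives on the right become the σ-images of 4δx and 4δy.
module βL = LiftA (jA ∘H α) yβ xβ
β : Hom A A
β = βL.liftA

-- (x′ , y′) = τ (x , y) + t (0 , 1)
module ΘL = LiftA jA (tA Ar.+ τA Ar.* ⟦ jA ⟧ yC) (τA Ar.* ⟦ jA ⟧ xC)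
Θ : Hom A A
Θ = ΘL.liftA

-- `A₁`, `A₂` and `A₃` result from solving for τ = x′/x and t = y′ - τ y. The new x is d = p x - y,
-- so τ becomes 4τ + 4(δp x - t)/d. With t = d t₁ + δp x this is 4τ - 4t₁, and t itself becomes 4 z
-- x (t₁ + 1).
module A₁ = Affine (idHom C) dC′ δxC
aff₁ : Hom C₁ C₁
aff₁ = A₁.aff
module A₂ = Affine α 4zxC 4zxC
aff₂ : Hom C₁ C₁
aff₂ = A₂.aff

4T : Tr.Carrier
4T = Tp.K 4C

module A₃ = Affine aff₂ 4T (Tr.- (4T Tr.* Tp.X))
αT : Hom A A
αT = A₃.aff

sub₁ : Hom A A
sub₁ = mapHom aff₁

private
  jτ : ∀ q → ⟦ sub₁ ⟧ (⟦ jA ⟧ q) Ar.≈ ⟦ jA ⟧ q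
  jτ q = Ar.trans (map-K aff₁ _) (Hom.⟦⟧-cong Ap.KHom (A₁.aff-K q))

  sub₁-t : ⟦ sub₁ ⟧ tA Ar.≈ ⟦ jA ⟧ dC′ Ar.* tA Ar.+ ⟦ jA ⟧ δxC
  sub₁-t = Ar.trans (map-K aff₁ _) (Ar.trans (Hom.⟦⟧-cong Ap.KHom A₁.aff-X) (Ar.trans (Hom.+-homo Ap.KHom _ _) (Ar.+-congʳ (Hom.*-homo Ap.KHom _ _))))

  sub₁-τ : ⟦ sub₁ ⟧ τA Ar.≈ τA
  sub₁-τ = map-X aff₁

  αT-j : ∀ q → ⟦ αT ⟧ (⟦ jA ⟧ q) Ar.≈ ⟦ jA ⟧ (⟦ α ⟧ q)
  αT-j q = Ar.trans (A₃.aff-K _) (Hom.⟦⟧-cong Ap.KHom (A₂.aff-K q))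

  αT-t : ⟦ αT ⟧ tA Ar.≈ ⟦ jA ⟧ 4zxC Ar.* tA Ar.+ ⟦ jA ⟧ 4zxC
  αT-t = Ar.trans (A₃.aff-K _) (Ar.trans (Hom.⟦⟧-cong Ap.KHom A₂.aff-X) (Ar.trans (Hom.+-homo Ap.KHom _ _) (Ar.+-congʳ (Hom.*-homo Ap.KHom _ _))))

  αT-τ : ⟦ αT ⟧ τA Ar.≈ ⟦ jA ⟧ 4C Ar.* τA Ar.- ⟦ jA ⟧ 4C Ar.* tA
  αT-τ = Ar.trans A₃.aff-X (Ar.+-congˡ (Ar.trans (Hom.neg-homo Ap.KHom _) (Ar.-‿cong (Hom.*-homo Ap.KHom _ _))))

  sub₁Θ-τ : ⟦ sub₁ ⟧ (⟦ Θ ⟧ τA) Ar.≈ τA Ar.* ⟦ jA ⟧ xC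
  sub₁Θ-τ = Ar.trans (Hom.⟦⟧-cong sub₁ ΘL.liftA-τ) (Ar.trans (Hom.*-homo sub₁ _ _) (Ar.*-cong sub₁-τ (jτ xC)))

  sub₁Θ-t : ⟦ sub₁ ⟧ (⟦ Θ ⟧ tA) Ar.≈ (⟦ jA ⟧ dC′ Ar.* tA Ar.+ ⟦ jA ⟧ δxC) Ar.+ τA Ar.* ⟦ jA ⟧ yC
  sub₁Θ-t = Ar.trans (Hom.⟦⟧-cong sub₁ ΘL.liftA-t) (Ar.trans (Hom.+-homo sub₁ _ _) (Ar.+-cong sub₁-t (Ar.trans (Hom.*-homo sub₁ _ _) (Ar.*-cong sub₁-τ (jτ yC)))))

  sΘ : Hom A A
  sΘ = sub₁ ∘H Θ
  module sΘ = Hom sΘ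

  sΘ-j : ∀ q → ⟦ sΘ ⟧ (⟦ jA ⟧ q) Ar.≈ ⟦ jA ⟧ q
  sΘ-j q = Ar.trans (Hom.⟦⟧-cong sub₁ (ΘL.liftA-j q)) (jτ q)

  dA≈ : ⟦ jA ⟧ dC′ Ar.≈ ⟦ jA ⟧ pC Ar.* ⟦ jA ⟧ xC Ar.- ⟦ jA ⟧ yC
  dA≈ = Ar.trans (Hom.sub-homo jA _ _) (Ar.+-congʳ (Hom.*-homo jA _ _))

  case-τ : ⟦ sΘ ⟧ (⟦ β ⟧ τA) Ar.≈ ⟦ αT ⟧ (⟦ Θ ⟧ τA)
  case-τ = Ar.trans lhs (Ar.trans (identity (⟦ jA ⟧ 4C) (⟦ jA ⟧ δxC) (⟦ jA ⟧ pC) (⟦ jA ⟧ xC) (⟦ jA ⟧ yC) (⟦ jA ⟧ dC′) dA≈) (Ar.sym rhs))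
    where
    lhs : ⟦ sΘ ⟧ (⟦ β ⟧ τA) Ar.≈ ((⟦ jA ⟧ 4C Ar.* ⟦ jA ⟧ δxC Ar.+ (⟦ jA ⟧ 4C Ar.* ⟦ jA ⟧ pC) Ar.* (τA Ar.* ⟦ jA ⟧ xC)) Ar.- ⟦ jA ⟧ 4C Ar.* ((⟦ jA ⟧ dC′ Ar.* tA Ar.+ ⟦ jA ⟧ δxC) Ar.+ τA Ar.* ⟦ jA ⟧ yC))
    lhs = Ar.trans (sΘ.⟦⟧-cong βL.liftA-τ) (Ar.trans (sΘ.sub-homo _ _) (Ar.+-cong
      (Ar.trans (sΘ.+-homo _ _) (Ar.+-cong (Ar.trans (sΘ-j _) (Hom.*-homo jA _ _)) (Ar.trans (sΘ.*-homo _ _) (Ar.*-cong (Ar.trans (sΘ-j _) (Hom.*-homo jA _ _)) sub₁Θ-τ))))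
      (Ar.-‿cong (Ar.trans (sΘ.*-homo _ _) (Ar.*-cong (sΘ-j _) sub₁Θ-t)))))
    rhs : ⟦ αT ⟧ (⟦ Θ ⟧ τA) Ar.≈ (⟦ jA ⟧ 4C Ar.* τA Ar.- ⟦ jA ⟧ 4C Ar.* tA) Ar.* ⟦ jA ⟧ dC′
    rhs = Ar.trans (Hom.⟦⟧-cong αT ΘL.liftA-τ) (Ar.trans (Hom.*-homo αT _ _) (Ar.*-cong αT-τ (Ar.trans (αT-j xC) (Hom.⟦⟧-cong jA αL.liftC-x))))
    identity : ∀ f D p x y d → d Ar.≈ p Ar.* x Ar.- y → (f Ar.* D Ar.+ (f Ar.* p) Ar.* (τA Ar.* x)) Ar.- f Ar.* ((d Ar.* tA Ar.+ D) Ar.+ τA Ar.* y) Ar.≈ (f Ar.* τA Ar.- f Ar.* tA) Ar.* d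
    identity f D p x y d e = Ar.trans step₁
      (Ar.trans (Ar.+-congˡ (Ar.*-congˡ (Ar.sym e))) (step₂ f d))
      where
      open As.Solver
      step₁ : (f Ar.* D Ar.+ (f Ar.* p) Ar.* (τA Ar.* x)) Ar.- f Ar.* ((d Ar.* tA Ar.+ D) Ar.+ τA Ar.* y) Ar.≈ Ar.- (f Ar.* (d Ar.* tA)) Ar.+ (f Ar.* τA) Ar.* (p Ar.* x Ar.- y)
      step₁ = pull f D (p Ar.* x) (d Ar.* tA) y (assoc f x)
        where
        assoc : ∀ f x → (f Ar.* p) Ar.* (τA Ar.* x) Ar.≈ f Ar.* (τA Ar.* (p Ar.* x))
        assoc f x = solve 4 (λ f p t x → (f :* p) :* (t :* x) := f :* (t :* (p :* x))) Ar.refl f p τA x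
        pull : ∀ f D q w y {l} → l Ar.≈ f Ar.* (τA Ar.* q) → (f Ar.* D Ar.+ l) Ar.- f Ar.* ((w Ar.+ D) Ar.+ τA Ar.* y) Ar.≈ Ar.- (f Ar.* w) Ar.+ (f Ar.* τA) Ar.* (q Ar.- y)
        pull f D q w y e = Ar.trans (Ar.+-congʳ (Ar.+-congˡ e)) (solve 6 (λ f D q w y t → (f :* D :+ f :* (t :* q)) :- f :* ((w :+ D) :+ t :* y) := (:- (f :* w)) :+ (f :* t) :* (q :- y)) Ar.refl f D q w y τA)
      step₂ : ∀ f d → Ar.- (f Ar.* (d Ar.* tA)) Ar.+ (f Ar.* τA) Ar.* d Ar.≈ (f Ar.* τA Ar.- f Ar.* tA) Ar.* d
      step₂ f d = solve 4 (λ f d t τ → (:- (f :* (d :* t))) :+ (f :* τ) :* d := (f :* τ :- f :* t) :* d) Ar.refl f d tA τA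

  case-t : ⟦ sΘ ⟧ (⟦ β ⟧ tA) Ar.≈ ⟦ αT ⟧ (⟦ Θ ⟧ tA)
  case-t = Ar.trans lhs (Ar.trans (solve 5 (λ f z x τ t → (f :* z) :* (x :+ τ :* x) := ((f :* (z :* x)) :* t :+ f :* (z :* x)) :+ (f :* τ :- f :* t) :* (z :* x)) Ar.refl (⟦ jA ⟧ 4C) (⟦ jA ⟧ zC) (⟦ jA ⟧ xC) τA tA) (Ar.sym rhs))
    where
    open As.Solver
    lhs : ⟦ sΘ ⟧ (⟦ β ⟧ tA) Ar.≈ (⟦ jA ⟧ 4C Ar.* ⟦ jA ⟧ zC) Ar.* (⟦ jA ⟧ xC Ar.+ τA Ar.* ⟦ jA ⟧ xC)
    lhs = Ar.trans (sΘ.⟦⟧-cong βL.liftA-t) (Ar.trans (sΘ.*-homo _ _) (Ar.*-cong (Ar.trans (sΘ-j _) (Hom.*-homo jA _ _)) (Ar.trans (sΘ.+-homo _ _) (Ar.+-cong (sΘ-j _) sub₁Θ-τ))))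
    zx≈ : ⟦ jA ⟧ 4zxC Ar.≈ ⟦ jA ⟧ 4C Ar.* (⟦ jA ⟧ zC Ar.* ⟦ jA ⟧ xC)
    zx≈ = Ar.trans (Hom.*-homo jA _ _) (Ar.*-congˡ (Hom.*-homo jA _ _))
    rhs : ⟦ αT ⟧ (⟦ Θ ⟧ tA) Ar.≈ ((⟦ jA ⟧ 4C Ar.* (⟦ jA ⟧ zC Ar.* ⟦ jA ⟧ xC)) Ar.* tA Ar.+ ⟦ jA ⟧ 4C Ar.* (⟦ jA ⟧ zC Ar.* ⟦ jA ⟧ xC)) Ar.+ (⟦ jA ⟧ 4C Ar.* τA Ar.- ⟦ jA ⟧ 4C Ar.* tA) Ar.* (⟦ jA ⟧ zC Ar.* ⟦ jA ⟧ xC)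
    rhs = Ar.trans (Hom.⟦⟧-cong αT ΘL.liftA-t) (Ar.trans (Hom.+-homo αT _ _) (Ar.+-cong (Ar.trans αT-t (Ar.+-cong (Ar.*-congʳ zx≈) zx≈))
      (Ar.trans (Hom.*-homo αT _ _) (Ar.*-cong αT-τ (Ar.trans (αT-j yC) (Ar.trans (Hom.⟦⟧-cong jA αL.liftC-y) (Hom.*-homo jA _ _)))))))

-- The change of variables t ↦ d t + δp x makes the action of β on (t , τ) triangular with polynomial coefficients.
sub-Θ-β : ∀ q → ⟦ sub₁ ⟧ (⟦ Θ ⟧ (⟦ β ⟧ q)) Ar.≈ ⟦ αT ⟧ (⟦ Θ ⟧ q)
sub-Θ-β = extA (sΘ ∘H β) (αT ∘H Θ)
  (λ q → Ar.trans (sΘ.⟦⟧-cong (βL.liftA-j q)) (Ar.trans (sΘ-j _) (Ar.sym (Ar.trans (Hom.⟦⟧-cong αT (ΘL.liftA-j q)) (αT-j q)))))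
  case-t case-τ

σA-j : ∀ q → ⟦ σA ⟧ (⟦ jA ⟧ q) Ar.≈ ⟦ jA ⟧ (⟦ σC ⟧ q)
σA-j q = Ar.trans (map-K σT _) (Hom.⟦⟧-cong Ap.KHom (map-K σC q))

σA-t : ⟦ σA ⟧ tA Ar.≈ tA
σA-t = Ar.trans (map-K σT _) (Hom.⟦⟧-cong Ap.KHom (map-X σC))

σC-ι : ∀ q → ⟦ σC ⟧ (⟦ ιC ⟧ q) Cr.≈ ⟦ ιC ⟧ (⟦ σ ⟧ q)
σC-ι q = Cr.trans (map-K (mapHom σ) _) (Hom.⟦⟧-cong Cp.KHom (map-K σ q))

σC-x : ⟦ σC ⟧ xC Cr.≈ xC
σC-x = Cr.trans (map-K (mapHom σ) _) (Hom.⟦⟧-cong Cp.KHom (map-X σ))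

σC-y : ⟦ σC ⟧ yC Cr.≈ yC
σC-y = map-X (mapHom σ)

Θ-σ : ∀ q → ⟦ Θ ⟧ (⟦ σA ⟧ q) Ar.≈ ⟦ σA ⟧ (⟦ Θ ⟧ q)
Θ-σ = extA (Θ ∘H σA) (σA ∘H Θ)
  (λ q → Ar.trans (Hom.⟦⟧-cong Θ (σA-j q)) (Ar.trans (ΘL.liftA-j _) (Ar.sym (Ar.trans (Hom.⟦⟧-cong σA (ΘL.liftA-j q)) (σA-j q)))))
  (Ar.trans (Hom.⟦⟧-cong Θ σA-t) (Ar.trans ΘL.liftA-t (Ar.sym (Ar.trans (Hom.⟦⟧-cong σA ΘL.liftA-t)
    (Ar.trans (Hom.+-homo σA _ _) (Ar.+-cong σA-t (Ar.trans (Hom.*-homo σA _ _) (Ar.*-cong (map-X σT) (Ar.trans (σA-j yC) (Hom.⟦⟧-cong jA σC-y))))))))))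
  (Ar.trans (Hom.⟦⟧-cong Θ (map-X σT)) (Ar.trans ΘL.liftA-τ (Ar.sym (Ar.trans (Hom.⟦⟧-cong σA ΘL.liftA-τ)
    (Ar.trans (Hom.*-homo σA _ _) (Ar.*-cong (map-X σT) (Ar.trans (σA-j xC) (Hom.⟦⟧-cong jA σC-x))))))))

xC≉0 : ¬ (xC Cr.≈ Cr.0#)
xC≉0 h = dZ.1≉0 (Zr.trans (Zr.sym (Bp.coef-X 1)) (Bp.coef≈0 (Br.trans (Br.sym (Cp.coef-K0 _)) (Cp.coef≈0 h 0)) 1))

-- The shear t ↦ t - τ y undoes the second part of Θ. What remains multiplies τ by x, which is
-- injective though not invertible.
Θ-injective : ∀ q → ⟦ Θ ⟧ q Ar.≈ Ar.0# → q Ar.≈ Ar.0#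
Θ-injective q h = Sc.AffDom.aff-reflects-0 domC₁ domC₁ Kx≉0 (λ e → e) q (Ar.trans (Ar.sym (same q)) (Hom.≈0-homo shear h))
  where
  module Sh = LiftA jA (tA Ar.- τA Ar.* ⟦ jA ⟧ yC) τA
  shear = Sh.liftA
  module Sc = Affine (idHom C₁) (Tp.K xC) Tr.0#
  Kx≉0 : ¬ (Tp.K xC Tr.≈ Tr.0#)
  Kx≉0 h = xC≉0 (Cr.trans (Cr.sym (Tp.coef-K0 _)) (Tp.coef≈0 h 0))
  same : ∀ q → ⟦ shear ⟧ (⟦ Θ ⟧ q) Ar.≈ ⟦ Sc.aff ⟧ q
  same = extA (shear ∘H Θ) Sc.aff
    (λ q → Ar.trans (Hom.⟦⟧-cong shear (ΘL.liftA-j q)) (Ar.trans (Sh.liftA-j q) (Ar.sym (Sc.aff-K _))))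
    (Ar.trans (Hom.⟦⟧-cong shear ΘL.liftA-t) (Ar.trans (Hom.+-homo shear _ _) (Ar.trans (Ar.+-cong Sh.liftA-t (Ar.trans (Hom.*-homo shear _ _) (Ar.*-cong Sh.liftA-τ (Sh.liftA-j yC))))
      (Ar.trans (solve 2 (λ t w → (t :- w) :+ w := t) Ar.refl tA (τA Ar.* ⟦ jA ⟧ yC)) (Ar.sym (Sc.aff-K _))))))
    (Ar.trans (Hom.⟦⟧-cong shear ΘL.liftA-τ) (Ar.trans (Hom.*-homo shear _ _) (Ar.trans (Ar.*-cong Sh.liftA-τ (Sh.liftA-j xC))
      (Ar.trans (Ar.*-comm _ _) (Ar.sym (Ar.trans Sc.aff-X (Ar.trans (Ar.+-congˡ (Hom.0-homo Ap.KHom)) (Ar.+-identityʳ _))))))))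
    where open As.Solver

-- Homogeneous components in x and y

VV : CRing
VV = Poly V
module VVp = Pol V
module VVr = CommutativeRing VV
module VVs = Sums VV

rc : Cr.Carrier → ℕ → ℕ → Zr.Carrier
rc φ n k = Bp.coef (Cp.coef φ k) n

-- Along a line through the origin the parameter s records the total degree, so homogeneous
-- components of a polynomial in x and y become the coefficients of powers of s. Homogeneous
-- substitutions are then compared one degree at a time.
module Component (a b : Vr.Carrier) where
  open PowerSeries V using () renaming (Σ< to ΣV)
  open Vs using () renaming (_^_ to _^ᵛ_)
  private
    module F = Affine Vp.KHom a Vr.0#

  ys : VVr.Carrier
  ys = VVp.K b VVr.* VVp.X

  -- x ↦ a s, y ↦ b s
  χ : Hom C VV
  χ = lift F.aff ys

  comp : ℕ → Cr.Carrier → Vr.Carrier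
  comp e φ = ΣV (suc e) (λ n → Vp.K (rc φ n (e ∸ n)) Vr.* (a ^ᵛ n Vr.* b ^ᵛ (e ∸ n)))

  χ-ι : ∀ q → ⟦ χ ⟧ (⟦ ιC ⟧ q) VVr.≈ VVp.K (Vp.K q)
  χ-ι q = VVr.trans (lift-K F.aff ys _) (F.aff-K q)

  χ-x : ⟦ χ ⟧ xC VVr.≈ VVp.K a VVr.* VVp.X
  χ-x = VVr.trans (lift-K F.aff ys _) (VVr.trans F.aff-X (VVr.trans (VVr.+-congˡ (Hom.0-homo VVp.KHom)) (VVr.+-identityʳ _)))

  χ-y : ⟦ χ ⟧ yC VVr.≈ VVp.K b VVr.* VVp.X
  χ-y = lift-X F.aff ys

  private
    ys*-zero : ∀ q → VVp.coef (ys VVr.* q) 0 Vr.≈ Vr.0#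
    ys*-zero q = Vr.trans (VVp.coef-cong (VVr.*-assoc _ _ _) 0) (Vr.trans (VVp.coef-K* _ _ 0) (Vr.trans (Vr.*-congˡ (VVp.coef-X*0 q)) (Vr.zeroʳ b)))
    ys*-suc : ∀ q n → VVp.coef (ys VVr.* q) (suc n) Vr.≈ b Vr.* VVp.coef q n
    ys*-suc q n = Vr.trans (VVp.coef-cong (VVr.*-assoc _ _ _) (suc n)) (Vr.trans (VVp.coef-K* _ _ (suc n)) (Vr.*-congˡ (VVp.coef-X*suc q n)))

    first : ∀ e φ → VVp.coef (⟦ F.aff ⟧ (Cp.coef φ 0)) e Vr.≈ Vp.K (rc φ e 0) Vr.* (a ^ᵛ e Vr.* Vr.1#)
    first e φ = Vr.trans (F.aff-scale Vr.refl e (Cp.coef φ 0)) (Vr.trans (Vr.*-comm _ _) (Vr.*-congˡ (Vr.sym (Vr.*-identityʳ _))))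

  coef-χ : ∀ e φ → VVp.coef (⟦ χ ⟧ φ) e Vr.≈ comp e φ
  coef-χ zero φ = Vr.trans (VVp.coef-cong (Lift.lift-decompose F.aff ys φ) 0) (Vr.trans (VVp.coef-+ _ _ 0)
    (Vr.trans (Vr.+-cong (first 0 φ) (ys*-zero _)) (Vr.+-comm _ _)))
  coef-χ (suc e) φ = begin
    VVp.coef (⟦ χ ⟧ φ) (suc e) ≈⟨ VVp.coef-cong (Lift.lift-decompose F.aff ys φ) (suc e) ⟩
    VVp.coef (⟦ F.aff ⟧ (Cp.coef φ 0) VVr.+ ys VVr.* ⟦ χ ⟧ φ′) (suc e) ≈⟨ VVp.coef-+ _ _ (suc e) ⟩
    VVp.coef (⟦ F.aff ⟧ (Cp.coef φ 0)) (suc e) Vr.+ VVp.coef (ys VVr.* ⟦ χ ⟧ φ′) (suc e)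
      ≈⟨ Vr.+-cong (first (suc e) φ) (Vr.trans (ys*-suc _ e) (Vr.*-congˡ (coef-χ e φ′))) ⟩
    Vp.K (rc φ (suc e) 0) Vr.* (a ^ᵛ suc e Vr.* Vr.1#) Vr.+ b Vr.* comp e φ′
      ≈⟨ Vr.+-comm _ _ ⟩
    b Vr.* comp e φ′ Vr.+ Vp.K (rc φ (suc e) 0) Vr.* (a ^ᵛ suc e Vr.* Vr.1#)
      ≈⟨ Vr.+-cong (Vr.trans (Vr.sym (Vs.Σ-*ˡ (suc e) b _)) (Vs.Σ-cong (suc e) (λ n l → term n (ℕP.≤-pred l))))
                   (Vr.reflexive (≡.cong (λ j → Vp.K (rc φ (suc e) j) Vr.* (a ^ᵛ suc e Vr.* b ^ᵛ j)) (≡.sym (ℕP.n∸n≡0 e)))) ⟩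
    comp (suc e) φ ∎
    where
    open import Relation.Binary.Reasoning.Setoid Vr.setoid
    φ′ = Cp.shiftDown φ
    term : ∀ n → n ≤ e → b Vr.* (Vp.K (rc φ′ n (e ∸ n)) Vr.* (a ^ᵛ n Vr.* b ^ᵛ (e ∸ n))) Vr.≈ Vp.K (rc φ n (suc e ∸ n)) Vr.* (a ^ᵛ n Vr.* b ^ᵛ (suc e ∸ n))
    term n n≤e = Vr.trans (let open Vs.Solver in solve 4 (λ b k a c → b :* (k :* (a :* c)) := k :* (a :* (b :* c))) Vr.refl b (Vp.K (rc φ′ n (e ∸ n))) (a ^ᵛ n) (b ^ᵛ (e ∸ n)))
      (Vr.trans (Vr.*-congʳ (Hom.⟦⟧-cong Vp.KHom (Bp.coef-cong (Cp.coef-tabulate _ _ _ (e ∸ n)) n)))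
        (Vr.reflexive (≡.cong (λ j → Vp.K (rc φ n j) Vr.* (a ^ᵛ n Vr.* b ^ᵛ j)) (≡.sym (ℕP.+-∸-assoc 1 n≤e)))))

  comp-zero : ∀ e φ → (∀ n → n ≤ e → rc φ n (e ∸ n) Zr.≈ Zr.0#) → comp e φ Vr.≈ Vr.0#
  comp-zero e φ h = Vs.Σ-zero (suc e) (λ n l → Vr.trans (Vr.*-congʳ (Hom.≈0-homo Vp.KHom (h n (ℕP.≤-pred l)))) (Vr.zeroˡ _))

Zero : ℕ → Cr.Carrier → Set
Zero e φ = ∀ n → n ≤ e → rc φ n (e ∸ n) Zr.≈ Zr.0#

allZero⇒0 : ∀ φ → (∀ e → Zero e φ) → φ Cr.≈ Cr.0#
allZero⇒0 φ h = Cp.ext0 (λ k → Bp.ext0 (λ n → Zr.trans (Zr.reflexive (≡.cong (rc φ n) (≡.sym (ℕP.m+n∸m≡n n k)))) (h (n ℕ.+ k) n (ℕP.m≤m+n n k))))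

-- the dehomogenisation x = s, y = u s
module U = Component Vr.1# Vp.X

R : ℕ → Cr.Carrier → Vr.Carrier
R e φ = VVp.coef (⟦ U.χ ⟧ φ) e

R-sum : ∀ e φ → R e φ Vr.≈ PowerSeries.Σ< V (suc e) (λ n → Vp.K (rc φ n (e ∸ n)) Vr.* Vp.X Vs.^ (e ∸ n))
R-sum e φ = Vr.trans (U.coef-χ e φ) (Vs.Σ-cong′ (suc e) (λ n → Vr.*-congˡ (Vr.trans (Vr.*-congʳ (Vs.1^ n)) (Vr.*-identityˡ _))))

R≈0⇒Zero : ∀ e φ → R e φ Vr.≈ Vr.0# → Zero e φ
R≈0⇒Zero e φ h n n≤e = Zr.trans (Zr.sym (VA.coef-Σrev e (λ n → rc φ n (e ∸ n)) n n≤e)) (Vp.coef≈0 (Vr.trans (Vr.sym (R-sum e φ)) h) (e ∸ n))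

Zero⇒R≈0 : ∀ e φ → Zero e φ → R e φ Vr.≈ Vr.0#
Zero⇒R≈0 e φ h = Vr.trans (U.coef-χ e φ) (U.comp-zero e φ h)

module Form where
  open PowerSeries C using () renaming (Σ< to ΣC)
  open Cs using () renaming (_^_ to _^ᶜ_)

  form : ℕ → Cr.Carrier → Cr.Carrier
  form e φ = ΣC (suc e) (λ n → ⟦ ιC ⟧ (rc φ n (e ∸ n)) Cr.* (xC ^ᶜ n Cr.* yC ^ᶜ (e ∸ n)))

  module FormHom {S : CRing} (h : Hom C S) (T b : CommutativeRing.Carrier S) where
    private
      module S = CommutativeRing S
      module Ss = Sums S
    open Ss using (_^_)

    form-hom : ⟦ h ⟧ xC S.≈ T → ⟦ h ⟧ yC S.≈ b S.* T → ∀ e φ →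
      ⟦ h ⟧ (form e φ) S.≈ T ^ e S.* PowerSeries.Σ< S (suc e) (λ n → ⟦ h ⟧ (⟦ ιC ⟧ (rc φ n (e ∸ n))) S.* b ^ (e ∸ n))
    form-hom hx hy e φ = S.trans (Hom.Σ-homo h (suc e) _) (S.trans (Ss.Σ-cong (suc e) (λ n l → term n (ℕP.≤-pred l))) (Ss.Σ-*ˡ (suc e) (T ^ e) _))
      where
      term : ∀ n → n ≤ e → ⟦ h ⟧ (⟦ ιC ⟧ (rc φ n (e ∸ n)) Cr.* (xC ^ᶜ n Cr.* yC ^ᶜ (e ∸ n))) S.≈ T ^ e S.* (⟦ h ⟧ (⟦ ιC ⟧ (rc φ n (e ∸ n))) S.* b ^ (e ∸ n))
      term n n≤e = S.trans (Hom.*-homo h _ _) (S.trans (S.*-congˡ (S.trans (Hom.*-homo h _ _) (S.*-cong (S.trans (Hom.^-homo h xC n) (Ss.^-cong n hx))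
          (S.trans (Hom.^-homo h yC (e ∸ n)) (S.trans (Ss.^-cong (e ∸ n) hy) (Ss.^-* b T (e ∸ n)))))))
        (S.trans (let open Ss.Solver in solve 4 (λ r p q s → r :* (p :* (q :* s)) := (p :* s) :* (r :* q)) S.refl _ (T ^ n) (b ^ (e ∸ n)) (T ^ (e ∸ n)))
          (S.*-congʳ (S.trans (S.sym (Ss.^-+ T n (e ∸ n))) (S.reflexive (≡.cong (T ^_) (ℕP.m+[n∸m]≡n n≤e)))))))

  χ-form : ∀ e φ → ⟦ U.χ ⟧ (form e φ) VVr.≈ VVp.X VVs.^ e VVr.* VVp.K (R e φ)
  χ-form e φ = VVr.trans (FormHom.form-hom U.χ VVp.X (VVp.K Vp.X) (VVr.trans U.χ-x (VVr.trans (VVr.*-congʳ (Hom.1-homo VVp.KHom)) (VVr.*-identityˡ _))) U.χ-y e φ)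
    (VVr.*-congˡ (VVr.sym (VVr.trans (Hom.⟦⟧-cong VVp.KHom (R-sum e φ)) (VVr.trans (Hom.Σ-homo VVp.KHom (suc e) _)
      (VVs.Σ-cong′ (suc e) (λ n → VVr.trans (Hom.*-homo VVp.KHom _ _) (VVr.*-cong (VVr.sym (U.χ-ι _)) (Hom.^-homo VVp.KHom Vp.X (e ∸ n)))))))))

  -- restriction to the line y = l x
  module Line (l : Zr.Carrier) where
    η : Hom C B₁
    η = Roots.evalAt B₁ (Bp.K l Br.* Bp.X)

    η-form : ∀ e φ → ⟦ η ⟧ (form e φ) Br.≈ Bp.X Vs.^ e Br.* Bp.K (⟦ Roots.evalAt Z l ⟧ (R e φ))
    η-form e φ = Br.trans (FormHom.form-hom η Bp.X (Bp.K l) (lift-K (idHom B₁) _ _) (lift-X (idHom B₁) _) e φ)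
      (Br.*-congˡ (Br.sym (Br.trans (Hom.⟦⟧-cong Bp.KHom (Zr.trans (Hom.⟦⟧-cong ev (R-sum e φ)) (Zr.trans (Hom.Σ-homo ev (suc e) _)
          (Zs.Σ-cong′ (suc e) (λ n → Zr.trans (Hom.*-homo ev _ _) (Zr.*-cong (lift-K (idHom Z) l _) (Zr.trans (Hom.^-homo ev _ (e ∸ n)) (Zs.^-cong (e ∸ n) (lift-X (idHom Z) l)))))))))
        (Br.trans (Hom.Σ-homo Bp.KHom (suc e) _) (Vs.Σ-cong′ (suc e) (λ n → Br.trans (Hom.*-homo Bp.KHom _ _) (Br.*-cong (Br.sym (lift-K (idHom B₁) _ _)) (Hom.^-homo Bp.KHom l (e ∸ n)))))))))
      where ev = Roots.evalAt Z l

open Form using (form; χ-form; module Line) public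

abstract
  secB : Sections B₁ (mapHom σ) (Bp.K zᵖ)
  secB = PolySections.polySections σ zᵖ secZ
  secC : Sections C σC zC
  secC = PolySections.polySections (mapHom σ) (Bp.K zᵖ) secB
  secT : Sections C₁ σT (Tp.K zC)
  secT = PolySections.polySections σC zC secC
  secA : Sections A σA (Ap.K (Tp.K zC))
  secA = PolySections.polySections σT (Tp.K zC) secT

zA : Ar.Carrier
zA = Ap.K (Tp.K zC)

dC′≉0 : ¬ (dC′ Cr.≈ Cr.0#)
dC′≉0 h = dV.1≉0 (Br.trans (Br.sym (-‿involutive _)) (Br.trans (Br.-‿cong (Br.trans (Br.sym (Br.trans (Cp.coef-sub _ _ 1) (Br.trans (Br.+-cong lhs (Br.-‿cong (Cp.coef-X 1))) (Br.+-identityˡ _)))) (Cp.coef≈0 h 1))) -0#≈0#))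
  where
  open import Algebra.Properties.Ring Br.ring using (-‿involutive; -0#≈0#)
  lhs : Cp.coef (pC Cr.* xC) 1 Br.≈ Br.0#
  lhs = Br.trans (Cp.coef-K* _ _ 1) (Br.trans (Br.*-congˡ (Cp.coef-Ksuc _ 0)) (Br.zeroʳ _))

-- Leading coefficients of a relation under β

module Lead (K K′ : ℕ) (P : Ar.Carrier) (dτ : Ap.Deg≤ K (⟦ Θ ⟧ P)) (dt : Tp.Deg≤ K′ (Ap.coef (⟦ Θ ⟧ P) K)) where
  open Cs using () renaming (_^_ to _^ᶜ_)
  private
    G = ⟦ Θ ⟧ P
    G′ = ⟦ Θ ⟧ (⟦ β ⟧ P)
    g = Ap.coef G K
    g′ = Ap.coef G′ K
    module D₁ = A₁.AffDom domC domC dC′≉0 (λ e → e)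

    aff₁-coef : ∀ j → ⟦ aff₁ ⟧ (Ap.coef G′ j) Tr.≈ Ap.coef (⟦ αT ⟧ G) j
    aff₁-coef j = Tr.trans (Tr.sym (coef-map aff₁ G′ j)) (Ap.coef-cong (sub-Θ-β P) j)

    αT-top = A₃.aff-top K G dτ

    4T^K : 4T Ts.^ K Tr.≈ Tp.K (4C ^ᶜ K)
    4T^K = Tr.sym (Hom.^-homo Tp.KHom 4C K)

    aff₁-g′ : ⟦ aff₁ ⟧ g′ Tr.≈ Tp.K (4C ^ᶜ K) Tr.* ⟦ aff₂ ⟧ g
    aff₁-g′ = Tr.trans (aff₁-coef K) (Tr.trans (proj₂ αT-top) (Tr.*-congʳ 4T^K))

    coef-rhs : ∀ i → Tp.coef (⟦ aff₁ ⟧ g′) i Cr.≈ 4C ^ᶜ K Cr.* Tp.coef (⟦ aff₂ ⟧ g) i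
    coef-rhs i = Cr.trans (Tp.coef-cong aff₁-g′ i) (Tp.coef-K* _ _ i)

    g-top = A₂.aff-top K′ g dt

  degτ : Ap.Deg≤ K G′
  degτ j l = D₁.aff-reflects-0 _ (Tr.trans (aff₁-coef j) (proj₁ αT-top j l))

  degt : Tp.Deg≤ K′ g′
  degt = D₁.aff-reflects-Deg K′ g′ (λ i l → Cr.trans (coef-rhs i) (Cr.trans (Cr.*-congˡ (proj₁ g-top i l)) (Cr.zeroʳ _)))

  -- The coefficient of τ^K t^K′ in `sub-Θ-β`: affine substitutions contribute only powers of their
  -- slopes, d on the left, 4 and 4 z x on the right.
  lead : dC′ ^ᶜ K′ Cr.* Tp.coef g′ K′ Cr.≈ 4C ^ᶜ K Cr.* (4zxC ^ᶜ K′ Cr.* ⟦ α ⟧ (Tp.coef g K′))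
  lead = Cr.trans (Cr.sym (proj₂ (A₁.aff-top K′ g′ degt))) (Cr.trans (coef-rhs K′) (Cr.*-congˡ (proj₂ g-top)))

  -- One degree lower in t the shifts δp x and 4 z x of the affine substitutions enter, each
  -- multiplied by the exponent k + 1 of the leading term.
  second : ∀ k → K′ ≡ suc k → dC′ ^ᶜ k Cr.* (Tp.coef g′ k Cr.+ PowerSeries.natR C (suc k) Cr.* (δxC Cr.* Tp.coef g′ (suc k)))
    Cr.≈ 4C ^ᶜ K Cr.* (4zxC ^ᶜ k Cr.* (⟦ α ⟧ (Tp.coef g k) Cr.+ PowerSeries.natR C (suc k) Cr.* (4zxC Cr.* ⟦ α ⟧ (Tp.coef g (suc k)))))
  second k ≡.refl = Cr.trans (Cr.sym (A₁.aff-second k g′ degt)) (Cr.trans (coef-rhs k) (Cr.*-congˡ (A₂.aff-second k g dt)))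

-- The component of degree k + 2 of the subleading coefficient turns out to be x^k (γ₀ y² + γ₁ x y +
-- γ₂ x²). For k = 0 the prototype is a relation equating the Wronskian x y′ - x′ y with a quadratic
-- form in x and y. After division by Y^k three equations remain, from which `h₀` eliminates κ and
-- ƛ; they are the hypotheses of `Quad.contradiction`.
module QuadExtract (k : ℕ) (κ ƛ μ : Zr.Carrier) (κ≉0 : ¬ (κ Zr.≈ Zr.0#)) (μ≉0 : ¬ (μ Zr.≈ Zr.0#)) (ρ : ℕ → Zr.Carrier) where
  open PowerSeries V using () renaming (Σ< to ΣV)
  open Vs using () renaming (_^_ to _^ᵛ_)
  open Zs using () renaming (_^_ to _^ᶻ_)

  n : Zr.Carrier
  n = Zp.K (+ suc k)

  f : Zr.Carrier
  f = four

  w : Zr.Carrier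
  w = n Zr.* (f Zr.* (zᵖ Zr.* μ))

  c : Zr.Carrier
  c = n Zr.* (δpᵖ Zr.* ⟦ σ ⟧ μ)

  q : Vr.Carrier
  q = Vp.K pᵖ Vr.- Vp.X

  QuadEq : Set
  QuadEq = Vp.K κ Vr.* (ΣV (suc (2 ℕ.+ k)) (λ i → Vp.K (ρ i Zr.* zᵖ ^ᶻ ((2 ℕ.+ k) ∸ i)) Vr.* Vp.X ^ᵛ i) Vr.+ Vp.K w Vr.* Vp.X ^ᵛ suc k)
           Vr.≈ Vp.K ƛ Vr.* (Vp.X ^ᵛ k Vr.* (ΣV (suc (2 ℕ.+ k)) (λ i → Vp.K (⟦ σ ⟧ (ρ i)) Vr.* q ^ᵛ ((2 ℕ.+ k) ∸ i)) Vr.+ Vp.K c))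

  module _ (eq : QuadEq) (h₀ : κ Zr.* (f Zr.* (zᵖ Zr.* μ)) Zr.≈ ƛ Zr.* ⟦ σ ⟧ μ) where
    private
      lhsCoef : ∀ i → i ≤ 2 ℕ.+ k → Vp.coef (Vp.K κ Vr.* (ΣV (suc (2 ℕ.+ k)) (λ i → Vp.K (ρ i Zr.* zᵖ ^ᶻ ((2 ℕ.+ k) ∸ i)) Vr.* Vp.X ^ᵛ i) Vr.+ Vp.K w Vr.* Vp.X ^ᵛ suc k)) i
                Zr.≈ κ Zr.* (ρ i Zr.* zᵖ ^ᶻ ((2 ℕ.+ k) ∸ i) Zr.+ Vp.coef (Vp.K w Vr.* Vp.X ^ᵛ suc k) i)
      lhsCoef i l = Zr.trans (Vp.coef-K* _ _ i) (Zr.*-congˡ (Zr.trans (Vp.coef-+ _ _ i) (Zr.+-congʳ (VA.coef-Σmon (2 ℕ.+ k) (λ i → ρ i Zr.* zᵖ ^ᶻ ((2 ℕ.+ k) ∸ i)) i l))))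

      lhsOther : ∀ i → i ≤ 2 ℕ.+ k → ¬ i ≡ suc k → Vp.coef (Vp.K ƛ Vr.* (Vp.X ^ᵛ k Vr.* (ΣV (suc (2 ℕ.+ k)) (λ i → Vp.K (⟦ σ ⟧ (ρ i)) Vr.* q ^ᵛ ((2 ℕ.+ k) ∸ i)) Vr.+ Vp.K c))) i
                Zr.≈ κ Zr.* (ρ i Zr.* zᵖ ^ᶻ ((2 ℕ.+ k) ∸ i))
      lhsOther i l ne = Zr.trans (Zr.sym (Vp.coef-cong eq i)) (Zr.trans (lhsCoef i l) (Zr.*-congˡ (Zr.trans (Zr.+-congˡ (VA.mon-other w (suc k) i ne)) (Zr.+-identityʳ _))))

      low : ∀ i → i < k → ρ i Zr.≈ Zr.0#
      low i l = dZ.cancel0 (dZ.^≉0 ((2 ℕ.+ k) ∸ i) z≉0) (Zr.trans (Zr.*-comm _ _) (dZ.cancel0 κ≉0 (Zr.trans (Zr.sym (lhsOther i (ℕP.≤-trans (ℕP.<⇒≤ l) (ℕP.m≤n+m k 2)) (λ e → ℕP.<⇒≢ (ℕP.m<n⇒m<1+n l) e)))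
        (Zr.trans (Vp.coef-K* _ _ i) (Zr.trans (Zr.*-congˡ (VA.X^-< _ k i l)) (Zr.zeroʳ _))))))

      γ₀ γ₁ γ₂ s₀ s₁ s₂ s : Zr.Carrier
      γ₀ = ρ (k ℕ.+ 0)
      γ₁ = ρ (k ℕ.+ 1)
      γ₂ = ρ (k ℕ.+ 2)
      s₀ = ⟦ σ ⟧ γ₀
      s₁ = ⟦ σ ⟧ γ₁
      s₂ = ⟦ σ ⟧ γ₂
      s  = ⟦ σ ⟧ μ

      a : ℕ → Zr.Carrier
      a 0 = ((s₀ Zr.* (pᵖ Zr.* pᵖ) Zr.+ s₁ Zr.* pᵖ) Zr.+ s₂) Zr.+ c
      a 1 = Zr.- ((s₀ Zr.* pᵖ Zr.+ s₀ Zr.* pᵖ) Zr.+ s₁)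
      a _ = s₀

      inner : ΣV (suc (2 ℕ.+ k)) (λ i → Vp.K (⟦ σ ⟧ (ρ i)) Vr.* q ^ᵛ ((2 ℕ.+ k) ∸ i)) Vr.+ Vp.K c Vr.≈ ΣV 3 (λ i → Vp.K (a i) Vr.* Vp.X ^ᵛ i)
      inner = Vr.trans (Vr.+-congʳ (Vr.trans (Vr.reflexive (≡.cong (λ m → ΣV m g) (ℕP.+-comm 3 k))) (Vr.trans (Vs.Σ-split k 3 g) (Vr.trans (Vr.+-congʳ (Vs.Σ-zero k gz)) (Vr.trans (Vr.+-identityˡ _) (Vs.Σ-cong′ 3 idx))))))
          (Vr.trans (expand (Vp.K s₀) (Vp.K s₁) (Vp.K s₂) (Vp.K c) (Vp.K pᵖ) Vp.X)
            (Vr.+-cong (Vr.+-cong (Vr.+-congˡ (Vr.*-congʳ (Vr.sym K0))) (Vr.*-congʳ (Vr.sym K1))) Vr.refl))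
        where
        open Vs.Solver
        g : ℕ → Vr.Carrier
        g i = Vp.K (⟦ σ ⟧ (ρ i)) Vr.* q ^ᵛ ((2 ℕ.+ k) ∸ i)
        gz : ∀ i → i < k → g i Vr.≈ Vr.0#
        gz i l = Vr.trans (Vr.*-congʳ (Hom.≈0-homo Vp.KHom (σ.≈0-homo (low i l)))) (Vr.zeroˡ _)
        idx : ∀ j → g (k ℕ.+ j) Vr.≈ Vp.K (⟦ σ ⟧ (ρ (k ℕ.+ j))) Vr.* q ^ᵛ (2 ∸ j)
        idx j = Vr.*-congˡ (Vr.reflexive (≡.cong (q ^ᵛ_) (≡.trans (≡.cong (_∸ (k ℕ.+ j)) (ℕP.+-comm 2 k)) (ℕP.[m+n]∸[m+o]≡n∸o k 2 j))))
        expand : ∀ S₀ S₁ S₂ c p Y → (((Vr.0# Vr.+ S₀ Vr.* ((p Vr.- Y) Vr.* ((p Vr.- Y) Vr.* Vr.1#))) Vr.+ S₁ Vr.* ((p Vr.- Y) Vr.* Vr.1#)) Vr.+ S₂ Vr.* Vr.1#) Vr.+ c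
          Vr.≈ ((Vr.0# Vr.+ (((S₀ Vr.* (p Vr.* p) Vr.+ S₁ Vr.* p) Vr.+ S₂) Vr.+ c) Vr.* Vr.1#) Vr.+ (Vr.- ((S₀ Vr.* p Vr.+ S₀ Vr.* p) Vr.+ S₁)) Vr.* (Y Vr.* Vr.1#)) Vr.+ S₀ Vr.* (Y Vr.* (Y Vr.* Vr.1#))
        expand S₀ S₁ S₂ c p Y = Vr.trans (Vr.+-congʳ (Vr.+-cong (Vr.+-cong (Vr.trans (Vr.+-identityˡ _) (Vr.*-congˡ (Vr.*-congˡ (Vr.*-identityʳ _)))) (Vr.*-congˡ (Vr.*-identityʳ _))) (Vr.*-identityʳ _)))
          (Vr.trans (solve 6 (λ S₀ S₁ S₂ c p Y → ((S₀ :* ((p :- Y) :* (p :- Y)) :+ S₁ :* (p :- Y)) :+ S₂) :+ c := ((((S₀ :* (p :* p) :+ S₁ :* p) :+ S₂) :+ c) :+ (:- ((S₀ :* p :+ S₀ :* p) :+ S₁)) :* Y) :+ S₀ :* (Y :* Y)) Vr.refl S₀ S₁ S₂ c p Y)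
            (Vr.sym (Vr.+-cong (Vr.+-cong (Vr.trans (Vr.+-identityˡ _) (Vr.*-identityʳ _)) (Vr.*-congˡ (Vr.*-identityʳ _))) (Vr.*-congˡ (Vr.*-congˡ (Vr.*-identityʳ _))))))
        module H = Hom Vp.KHom
        K0 : Vp.K (a 0) Vr.≈ ((Vp.K s₀ Vr.* (Vp.K pᵖ Vr.* Vp.K pᵖ) Vr.+ Vp.K s₁ Vr.* Vp.K pᵖ) Vr.+ Vp.K s₂) Vr.+ Vp.K c
        K0 = Vr.trans (H.+-homo _ _) (Vr.+-congʳ (Vr.trans (H.+-homo _ _) (Vr.+-congʳ (Vr.trans (H.+-homo _ _) (Vr.+-cong (Vr.trans (H.*-homo _ _) (Vr.*-congˡ (H.*-homo _ _))) (H.*-homo _ _))))))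
        K1 : Vp.K (a 1) Vr.≈ Vr.- ((Vp.K s₀ Vr.* Vp.K pᵖ Vr.+ Vp.K s₀ Vr.* Vp.K pᵖ) Vr.+ Vp.K s₁)
        K1 = Vr.trans (H.neg-homo _) (Vr.-‿cong (Vr.trans (H.+-homo _ _) (Vr.+-congʳ (Vr.trans (H.+-homo _ _) (Vr.+-cong (H.*-homo _ _) (H.*-homo _ _))))))

      rhsCoef : ∀ j → j ≤ 2 → Vp.coef (Vp.K ƛ Vr.* (Vp.X ^ᵛ k Vr.* (ΣV (suc (2 ℕ.+ k)) (λ i → Vp.K (⟦ σ ⟧ (ρ i)) Vr.* q ^ᵛ ((2 ℕ.+ k) ∸ i)) Vr.+ Vp.K c))) (k ℕ.+ j) Zr.≈ ƛ Zr.* a j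
      rhsCoef j l = Zr.trans (Vp.coef-K* _ _ (k ℕ.+ j)) (Zr.*-congˡ (Zr.trans (VA.X^-+ _ k j) (Zr.trans (Vp.coef-cong inner j) (VA.coef-Σmon 2 a j l))))

      exps : ∀ j → (2 ℕ.+ k) ∸ (k ℕ.+ j) ≡ 2 ∸ j
      exps j = ≡.trans (≡.cong (_∸ (k ℕ.+ j)) (ℕP.+-comm 2 k)) (ℕP.[m+n]∸[m+o]≡n∸o k 2 j)

      eqj : ∀ j → j ≤ 2 → ¬ (k ℕ.+ j ≡ suc k) → ƛ Zr.* a j Zr.≈ κ Zr.* (ρ (k ℕ.+ j) Zr.* zᵖ ^ᶻ (2 ∸ j))
      eqj j l ne = Zr.trans (Zr.sym (rhsCoef j l)) (Zr.trans (lhsOther (k ℕ.+ j) (ℕP.≤-trans (ℕP.+-monoʳ-≤ k l) (ℕP.≤-reflexive (ℕP.+-comm k 2))) ne)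
        (Zr.reflexive (≡.cong (λ m → κ Zr.* (ρ (k ℕ.+ j) Zr.* zᵖ ^ᶻ m)) (exps j))))

      E₂ : ƛ Zr.* s₀ Zr.≈ κ Zr.* γ₂
      E₂ = Zr.trans (eqj 2 ℕP.≤-refl (λ e → case (ℕP.+-cancelˡ-≡ k 2 1 (≡.trans e (ℕP.+-comm 1 k))))) (Zr.*-congˡ (Zr.*-identityʳ _))
        where
        case : ¬ (2 ≡ 1)
        case ()

      E₀ : ƛ Zr.* a 0 Zr.≈ κ Zr.* (γ₀ Zr.* (zᵖ Zr.* zᵖ))
      E₀ = Zr.trans (eqj 0 z≤n (λ e → case (ℕP.+-cancelˡ-≡ k 0 1 (≡.trans e (ℕP.+-comm 1 k))))) (Zr.*-congˡ (Zr.*-congˡ (Zr.*-congˡ (Zr.*-identityʳ _))))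
        where
        case : ¬ (0 ≡ 1)
        case ()

      E₁ : ƛ Zr.* a 1 Zr.≈ κ Zr.* (γ₁ Zr.* zᵖ Zr.+ w)
      E₁ = Zr.trans (Zr.sym (rhsCoef 1 (s≤s z≤n))) (Zr.trans (Zr.sym (Vp.coef-cong eq (k ℕ.+ 1))) (Zr.trans (lhsCoef (k ℕ.+ 1) (ℕP.≤-trans (ℕP.≤-reflexive (ℕP.+-comm k 1)) (ℕP.n≤1+n _)))
        (Zr.*-congˡ (Zr.+-cong (Zr.trans (Zr.reflexive (≡.cong (λ m → γ₁ Zr.* zᵖ ^ᶻ m) (exps 1))) (Zr.*-congˡ (Zr.*-identityʳ _)))
          (Zr.trans (Zr.reflexive (≡.cong (Vp.coef (Vp.K w Vr.* Vp.X ^ᵛ suc k)) (ℕP.+-comm k 1))) (VA.mon-same w (suc k)))))))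

      elim : ∀ {u v} → ƛ Zr.* u Zr.≈ κ Zr.* v → (f Zr.* (zᵖ Zr.* μ)) Zr.* u Zr.≈ s Zr.* v
      elim {u} {v} e = dZ.cancelˡ κ≉0 (Zr.trans (Zr.sym (Zr.*-assoc _ _ _)) (Zr.trans (Zr.*-congʳ h₀)
        (Zr.trans (solve 3 (λ l s u → (l :* s) :* u := s :* (l :* u)) Zr.refl ƛ s u) (Zr.trans (Zr.*-congˡ e) (solve 3 (λ s k v → s :* (k :* v) := k :* (s :* v)) Zr.refl s κ v)))))
        where open Zs.Solver

      open Zs.Solver

      N : ℤ
      N = + 4 ℤ.* + suc k

      KN : Zp.K N Zr.≈ f Zr.* n
      KN = Hom.*-homo Zp.KHom (+ 4) (+ suc k)

      K8 : Zp.K (+ 8) Zr.≈ f Zr.+ f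
      K8 = Hom.+-homo Zp.KHom (+ 4) (+ 4)

      Q₁ : f Zr.* (zᵖ Zr.* (μ Zr.* s₀)) Zr.≈ s Zr.* γ₂
      Q₁ = Zr.trans (solve 4 (λ f z m s → f :* (z :* (m :* s)) := (f :* (z :* m)) :* s) Zr.refl f zᵖ μ s₀) (elim E₂)

      Q₂′ : (f Zr.* μ) Zr.* a 1 Zr.≈ s Zr.* (γ₁ Zr.+ n Zr.* (f Zr.* μ))
      Q₂′ = dZ.cancelˡ z≉0 (Zr.trans (solve 4 (λ z f m a → z :* ((f :* m) :* a) := (f :* (z :* m)) :* a) Zr.refl zᵖ f μ (a 1)) (Zr.trans (elim E₁)
        (solve 6 (λ s g z n f m → s :* (g :* z :+ n :* (f :* (z :* m))) := z :* (s :* (g :+ n :* (f :* m)))) Zr.refl s γ₁ zᵖ n f μ)))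

      Q₂ : (Zp.K (+ 8) Zr.* (pᵖ Zr.* (μ Zr.* s₀)) Zr.+ s Zr.* γ₁) Zr.+ (f Zr.* (μ Zr.* s₁) Zr.+ Zp.K N Zr.* (μ Zr.* s)) Zr.≈ Zr.0#
      Q₂ = Zr.trans (Zr.+-cong (Zr.+-congʳ (Zr.*-congʳ K8)) (Zr.+-congˡ (Zr.*-congʳ KN)))
        (Zr.trans (regroup f (s₀ Zr.* pᵖ) s₁ μ (s Zr.* γ₁) (s Zr.* (n Zr.* (f Zr.* μ))) (solve 3 (λ p m s → p :* (m :* s) := m :* (s :* p)) Zr.refl pᵖ μ s₀) (solve 4 (λ f n m s → (f :* n) :* (m :* s) := s :* (n :* (f :* m))) Zr.refl f n μ s))
          (Zr.trans (Zr.+-congʳ (Zr.trans (Zr.sym (Zr.distribˡ s _ _)) (Zr.sym Q₂′))) (cancel (f Zr.* μ) (s₀ Zr.* pᵖ) s₁)))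
        where
        regroup : ∀ f a s₁ m g w {x y} → x Zr.≈ m Zr.* a → y Zr.≈ w → ((f Zr.+ f) Zr.* x Zr.+ g) Zr.+ (f Zr.* (m Zr.* s₁) Zr.+ y) Zr.≈ (g Zr.+ w) Zr.+ (f Zr.* m) Zr.* ((a Zr.+ a) Zr.+ s₁)
        regroup f a s₁ m g w ex ey = Zr.trans (Zr.+-cong (Zr.+-congʳ (Zr.*-congˡ ex)) (Zr.+-congˡ ey))
          (solve 6 (λ f a s m g w → ((f :+ f) :* (m :* a) :+ g) :+ (f :* (m :* s) :+ w) := (g :+ w) :+ (f :* m) :* ((a :+ a) :+ s)) Zr.refl f a s₁ m g w)
        cancel : ∀ u a s₁ → u Zr.* (Zr.- ((a Zr.+ a) Zr.+ s₁)) Zr.+ u Zr.* ((a Zr.+ a) Zr.+ s₁) Zr.≈ Zr.0#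
        cancel u a s₁ = Zr.trans (Zr.sym (Zr.distribˡ u _ _)) (Zr.trans (Zr.*-congˡ (Zr.-‿inverseˡ _)) (Zr.zeroʳ u))

      Q₃ : (f Zr.* ((pᵖ Zr.* pᵖ) Zr.* (μ Zr.* s₀)) Zr.+ f Zr.* (pᵖ Zr.* (μ Zr.* s₁))) Zr.+ (f Zr.* (μ Zr.* s₂) Zr.+ Zp.K N Zr.* (δpᵖ Zr.* (μ Zr.* s))) Zr.≈ zᵖ Zr.* (s Zr.* γ₀)
      Q₃ = Zr.trans (Zr.+-congˡ (Zr.+-congˡ (Zr.trans (Zr.*-congʳ KN) (solve 5 (λ f n d m s → (f :* n) :* (d :* (m :* s)) := f :* (m :* (n :* (d :* s)))) Zr.refl f n δpᵖ μ s))))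
        (Zr.trans (collect f μ (pᵖ Zr.* pᵖ) s₀ pᵖ s₁ s₂ c)
          (dZ.cancelˡ z≉0 (Zr.trans (solve 4 (λ z f m a → z :* ((f :* m) :* a) := (f :* (z :* m)) :* a) Zr.refl zᵖ f μ (a 0)) (Zr.trans (elim E₀)
            (solve 3 (λ s g z → s :* (g :* (z :* z)) := z :* (z :* (s :* g))) Zr.refl s γ₀ zᵖ)))))
        where
        collect : ∀ f m pp s₀ p s₁ s₂ c → (f Zr.* (pp Zr.* (m Zr.* s₀)) Zr.+ f Zr.* (p Zr.* (m Zr.* s₁))) Zr.+ (f Zr.* (m Zr.* s₂) Zr.+ f Zr.* (m Zr.* c)) Zr.≈ (f Zr.* m) Zr.* (((s₀ Zr.* pp Zr.+ s₁ Zr.* p) Zr.+ s₂) Zr.+ c)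
        collect f m pp s₀ p s₁ s₂ c = Zr.trans (Zr.+-congʳ (Zr.+-cong (e f pp m s₀) (e f p m s₁)))
          (solve 6 (λ f m a b s c → (f :* (m :* a) :+ f :* (m :* b)) :+ (f :* (m :* s) :+ f :* (m :* c)) := (f :* m) :* (((a :+ b) :+ s) :+ c)) Zr.refl f m (s₀ Zr.* pp) (s₁ Zr.* p) s₂ c)
          where
          e : ∀ f p m s → f Zr.* (p Zr.* (m Zr.* s)) Zr.≈ f Zr.* (m Zr.* (s Zr.* p))
          e = solve 4 (λ f p m s → f :* (p :* (m :* s)) := f :* (m :* (s :* p))) Zr.refl

    quadContradiction : ⊥
    quadContradiction = go (Zp.WithDom.degree ℤ-dom μ≉0)
      where
      go : Σ ℕ (λ m → ZA.IsDeg m μ) → ⊥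
      go (m , dm) = Quad.contradiction μ γ₀ γ₁ γ₂ N (Dom.*≉0 ℤ-dom {+ 4} {+ suc k} (λ ()) (λ ())) m dm Q₁ Q₂ Q₃

module VVA = PolyAux V

ιVV : Hom Z VV
ιVV = VVp.KHom ∘H Vp.KHom

coef-ι* : ∀ q f e → VVp.coef (⟦ ιVV ⟧ q VVr.* f) e Vr.≈ Vp.K q Vr.* VVp.coef f e
coef-ι* q f e = VVp.coef-K* (Vp.K q) f e

four≉0 : ¬ (four Zr.≈ Zr.0#)
four≉0 h = case (≡.trans (≡.sym (Zp.coef-K0 _)) (Zp.coef≈0 h 0))
  where
  case : ¬ (+ 4 ≡ + 0)
  case ()

module Contr (K K′ : ℕ) (P : Ar.Carrier) (dτ : Ap.Deg≤ K (⟦ Θ ⟧ P)) (dt : Tp.Deg≤ K′ (Ap.coef (⟦ Θ ⟧ P) K))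
  (κ ƛ : Zr.Carrier) (κ≉0 : ¬ (κ Zr.≈ Zr.0#)) (eq : ⟦ ιA ⟧ κ Ar.* ⟦ β ⟧ P Ar.≈ ⟦ ιA ⟧ ƛ Ar.* ⟦ σA ⟧ P) where
  open PowerSeries V using () renaming (Σ< to ΣV)
  open Cs using () renaming (_^_ to _^ᶜ_)
  open Vs using () renaming (_^_ to _^ᵛ_)
  open Zs using () renaming (_^_ to _^ᶻ_)
  open VVs using () renaming (_^_ to _^ʷ_)
  open Lead K K′ P dτ dt

  G G′ : Ar.Carrier
  G = ⟦ Θ ⟧ P
  G′ = ⟦ Θ ⟧ (⟦ β ⟧ P)

  φ : ℕ → Cr.Carrier
  φ i = Tp.coef (Ap.coef G K) i

  private
    φ′ : ℕ → Cr.Carrier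
    φ′ i = Tp.coef (Ap.coef G′ K) i

    scale : ∀ i → ⟦ ιC ⟧ κ Cr.* φ′ i Cr.≈ ⟦ ιC ⟧ ƛ Cr.* ⟦ σC ⟧ (φ i)
    scale i = Cr.trans (Cr.sym (cc κ G′)) (Cr.trans (Tp.coef-cong (Ap.coef-cong eqΘ K) i) (Cr.trans (cc ƛ (⟦ σA ⟧ G)) (Cr.*-congˡ (Cr.trans (Tp.coef-cong (coef-map σT G K) i) (coef-map σC _ i)))))
      where
      cc : ∀ q H → Tp.coef (Ap.coef (⟦ ιA ⟧ q Ar.* H) K) i Cr.≈ ⟦ ιC ⟧ q Cr.* Tp.coef (Ap.coef H K) i
      cc q H = Cr.trans (Tp.coef-cong (Ap.coef-K* _ H K) i) (Tp.coef-K* _ _ i)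
      eqΘ : ⟦ ιA ⟧ κ Ar.* G′ Ar.≈ ⟦ ιA ⟧ ƛ Ar.* ⟦ σA ⟧ G
      eqΘ = Ar.trans (Ar.*-congʳ (Ar.sym (ΘL.liftA-j _))) (Ar.trans (Ar.sym (Hom.*-homo Θ _ _)) (Ar.trans (Hom.⟦⟧-cong Θ eq)
        (Ar.trans (Hom.*-homo Θ _ _) (Ar.*-cong (ΘL.liftA-j _) (Θ-σ P)))))

    E₀ : ⟦ ιC ⟧ κ Cr.* (4C ^ᶜ K Cr.* (4zxC ^ᶜ K′ Cr.* ⟦ α ⟧ (φ K′))) Cr.≈ ⟦ ιC ⟧ ƛ Cr.* (dC′ ^ᶜ K′ Cr.* ⟦ σC ⟧ (φ K′))
    E₀ = Cr.trans (Cr.*-congˡ (Cr.sym lead)) (Cr.trans (swap _ _ _) (Cr.trans (Cr.*-congˡ (scale K′)) (swap _ _ _)))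
      where
      swap : ∀ a b c → a Cr.* (b Cr.* c) Cr.≈ b Cr.* (a Cr.* c)
      swap = let open Cs.Solver in solve 3 (λ a b c → a :* (b :* c) := b :* (a :* c)) Cr.refl

    nC : ℕ → Cr.Carrier
    nC k = PowerSeries.natR C (suc k)

    E₁ : ∀ k → K′ ≡ suc k → ⟦ ιC ⟧ κ Cr.* (4C ^ᶜ K Cr.* (4zxC ^ᶜ k Cr.* (⟦ α ⟧ (φ k) Cr.+ nC k Cr.* (4zxC Cr.* ⟦ α ⟧ (φ (suc k))))))
              Cr.≈ ⟦ ιC ⟧ ƛ Cr.* (dC′ ^ᶜ k Cr.* (⟦ σC ⟧ (φ k) Cr.+ nC k Cr.* (δxC Cr.* ⟦ σC ⟧ (φ (suc k)))))
    E₁ k e = Cr.trans (Cr.*-congˡ (Cr.sym (second k e))) (Cr.trans (dist (⟦ ιC ⟧ κ) (dC′ ^ᶜ k) (φ′ k) (nC k) δxC (φ′ (suc k)))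
      (Cr.trans (Cr.*-congˡ (Cr.+-cong (scale k) (Cr.*-congˡ (Cr.*-congˡ (scale (suc k)))))) (Cr.sym (dist (⟦ ιC ⟧ ƛ) (dC′ ^ᶜ k) (⟦ σC ⟧ (φ k)) (nC k) δxC (⟦ σC ⟧ (φ (suc k)))))))
      where
      dist : ∀ a b c n x y → a Cr.* (b Cr.* (c Cr.+ n Cr.* (x Cr.* y))) Cr.≈ b Cr.* (a Cr.* c Cr.+ n Cr.* (x Cr.* (a Cr.* y)))
      dist = let open Cs.Solver in solve 6 (λ a b c n x y → a :* (b :* (c :+ n :* (x :* y))) := b :* (a :* c :+ n :* (x :* (a :* y)))) Cr.refl

    -- For x = s and y = (p - Y) s the linear form d = p x - y becomes the monomial Y s. The power
    -- of d in `E₀` and `E₁` thus turns into a power of Y, and α becomes the substitution x = Y s, y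
    -- = z s.
    Y q : Vr.Carrier
    Y = Vp.X
    q = Vp.K pᵖ Vr.- Y

    module χ₁ = Component Vr.1# q
    module χ₂ = Component Y (Vp.K zᵖ)
    s = VVp.X

    χ₁-x : ⟦ χ₁.χ ⟧ xC VVr.≈ s
    χ₁-x = VVr.trans χ₁.χ-x (VVr.trans (VVr.*-congʳ (Hom.1-homo VVp.KHom)) (VVr.*-identityˡ _))

    χ₁-d : ⟦ χ₁.χ ⟧ dC′ VVr.≈ VVp.K Y VVr.* s
    χ₁-d = VVr.trans (Hom.sub-homo χ₁.χ _ _) (VVr.trans (VVr.+-cong (VVr.trans (Hom.*-homo χ₁.χ _ _) (VVr.*-cong (χ₁.χ-ι pᵖ) χ₁-x)) (VVr.-‿cong (VVr.trans χ₁.χ-y (VVr.*-congʳ (Hom.sub-homo VVp.KHom _ _)))))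
      (let open VVs.Solver in solve 3 (λ p y s → p :* s :- (p :- y) :* s := y :* s) VVr.refl (VVp.K (Vp.K pᵖ)) (VVp.K Y) s))

    χ₁-zx : ⟦ χ₁.χ ⟧ zxC VVr.≈ VVp.K (Vp.K zᵖ) VVr.* s
    χ₁-zx = VVr.trans (Hom.*-homo χ₁.χ _ _) (VVr.*-cong (χ₁.χ-ι zᵖ) χ₁-x)

    χ₁-α : ∀ ψ → ⟦ χ₁.χ ⟧ (⟦ α ⟧ ψ) VVr.≈ ⟦ χ₂.χ ⟧ ψ
    χ₁-α = extC (χ₁.χ ∘H α) χ₂.χ
      (λ c → VVr.trans (Hom.⟦⟧-cong χ₁.χ (αL.liftC-ι c)) (VVr.trans (χ₁.χ-ι c) (VVr.sym (χ₂.χ-ι c))))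
      (VVr.trans (Hom.⟦⟧-cong χ₁.χ αL.liftC-x) (VVr.trans χ₁-d (VVr.sym χ₂.χ-x)))
      (VVr.trans (Hom.⟦⟧-cong χ₁.χ αL.liftC-y) (VVr.trans χ₁-zx (VVr.sym χ₂.χ-y)))

    4z : Zr.Carrier
    4z = four Zr.* zᵖ

    χ₁-4zx : ⟦ χ₁.χ ⟧ 4zxC VVr.≈ ⟦ ιVV ⟧ 4z VVr.* s
    χ₁-4zx = VVr.trans (Hom.*-homo χ₁.χ _ _) (VVr.trans (VVr.*-cong (χ₁.χ-ι four) χ₁-zx) (VVr.trans (VVr.sym (VVr.*-assoc _ _ _)) (VVr.*-congʳ (VVr.sym (Hom.*-homo ιVV _ _)))))

    χ₁-4zx^ : ∀ n → ⟦ χ₁.χ ⟧ (4zxC ^ᶜ n) VVr.≈ ⟦ ιVV ⟧ (4z ^ᶻ n) VVr.* s ^ʷ n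
    χ₁-4zx^ n = VVr.trans (Hom.^-homo χ₁.χ _ n) (VVr.trans (VVs.^-cong n χ₁-4zx) (VVr.trans (VVs.^-* _ _ n) (VVr.*-congʳ (VVr.sym (Hom.^-homo ιVV 4z n)))))

    χ₁-d^ : ∀ n → ⟦ χ₁.χ ⟧ (dC′ ^ᶜ n) VVr.≈ VVp.K (Y ^ᵛ n) VVr.* s ^ʷ n
    χ₁-d^ n = VVr.trans (Hom.^-homo χ₁.χ _ n) (VVr.trans (VVs.^-cong n χ₁-d) (VVr.trans (VVs.^-* _ _ n) (VVr.*-congʳ (VVr.sym (Hom.^-homo VVp.KHom Y n)))))

  -- κ together with the constants that the slopes 4 and 4 z x leave behind once s is split off.
  κ̂ : ℕ → Zr.Carrier
  κ̂ n = κ Zr.* (four ^ᶻ K Zr.* 4z ^ᶻ n)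

  κ̂≉0 : ∀ n → ¬ (κ̂ n Zr.≈ Zr.0#)
  κ̂≉0 n = dZ.*≉0 κ≉0 (dZ.*≉0 (dZ.^≉0 K four≉0) (dZ.^≉0 n (dZ.*≉0 four≉0 z≉0)))

  private
    image : ∀ n u v → ⟦ ιC ⟧ κ Cr.* (4C ^ᶜ K Cr.* (4zxC ^ᶜ n Cr.* u)) Cr.≈ ⟦ ιC ⟧ ƛ Cr.* (dC′ ^ᶜ n Cr.* v) →
            ∀ e → Vp.K (κ̂ n) Vr.* VVp.coef (⟦ χ₁.χ ⟧ u) e Vr.≈ Vp.K ƛ Vr.* (Y ^ᵛ n Vr.* VVp.coef (⟦ χ₁.χ ⟧ v) e)
    image n u v h e = Vr.trans (Vr.sym lhs) (Vr.trans (VVp.coef-cong (Hom.⟦⟧-cong χ₁.χ h) (n ℕ.+ e)) rhs)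
      where
      lhs : VVp.coef (⟦ χ₁.χ ⟧ (⟦ ιC ⟧ κ Cr.* (4C ^ᶜ K Cr.* (4zxC ^ᶜ n Cr.* u)))) (n ℕ.+ e) Vr.≈ Vp.K (κ̂ n) Vr.* VVp.coef (⟦ χ₁.χ ⟧ u) e
      lhs = Vr.trans (VVp.coef-cong shape (n ℕ.+ e)) (Vr.trans (coef-ι* (κ̂ n) _ (n ℕ.+ e)) (Vr.*-congˡ (VVA.X^-+ _ n e)))
        where
        shape : ⟦ χ₁.χ ⟧ (⟦ ιC ⟧ κ Cr.* (4C ^ᶜ K Cr.* (4zxC ^ᶜ n Cr.* u))) VVr.≈ ⟦ ιVV ⟧ (κ̂ n) VVr.* (s ^ʷ n VVr.* ⟦ χ₁.χ ⟧ u)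
        shape = VVr.trans (Hom.*-homo χ₁.χ _ _) (VVr.trans (VVr.*-cong (χ₁.χ-ι κ) (VVr.trans (Hom.*-homo χ₁.χ _ _) (VVr.*-cong
            (VVr.trans (Hom.^-homo χ₁.χ 4C K) (VVr.trans (VVs.^-cong K (χ₁.χ-ι four)) (VVr.sym (Hom.^-homo ιVV four K))))
            (VVr.trans (Hom.*-homo χ₁.χ _ _) (VVr.*-congʳ (χ₁-4zx^ n))))))
          (VVr.trans (let open VVs.Solver in solve 5 (λ a b c d e → a :* (b :* ((c :* d) :* e)) := (a :* (b :* c)) :* (d :* e)) VVr.refl (⟦ ιVV ⟧ κ) (⟦ ιVV ⟧ (four ^ᶻ K)) (⟦ ιVV ⟧ (4z ^ᶻ n)) (s ^ʷ n) (⟦ χ₁.χ ⟧ u))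
            (VVr.*-congʳ (VVr.sym (VVr.trans (Hom.*-homo ιVV _ _) (VVr.*-congˡ (Hom.*-homo ιVV _ _)))))))
      rhs : VVp.coef (⟦ χ₁.χ ⟧ (⟦ ιC ⟧ ƛ Cr.* (dC′ ^ᶜ n Cr.* v))) (n ℕ.+ e) Vr.≈ Vp.K ƛ Vr.* (Y ^ᵛ n Vr.* VVp.coef (⟦ χ₁.χ ⟧ v) e)
      rhs = Vr.trans (VVp.coef-cong shape (n ℕ.+ e)) (Vr.trans (coef-ι* ƛ _ (n ℕ.+ e)) (Vr.*-congˡ (Vr.trans (VVp.coef-K* _ _ (n ℕ.+ e)) (Vr.*-congˡ (VVA.X^-+ _ n e)))))
        where
        shape : ⟦ χ₁.χ ⟧ (⟦ ιC ⟧ ƛ Cr.* (dC′ ^ᶜ n Cr.* v)) VVr.≈ ⟦ ιVV ⟧ ƛ VVr.* (VVp.K (Y ^ᵛ n) VVr.* (s ^ʷ n VVr.* ⟦ χ₁.χ ⟧ v))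
        shape = VVr.trans (Hom.*-homo χ₁.χ _ _) (VVr.*-cong (χ₁.χ-ι ƛ) (VVr.trans (Hom.*-homo χ₁.χ _ _) (VVr.trans (VVr.*-congʳ (χ₁-d^ n)) (VVr.*-assoc _ _ _))))

    rc-σ : ∀ ψ n k → rc (⟦ σC ⟧ ψ) n k Zr.≈ ⟦ σ ⟧ (rc ψ n k)
    rc-σ ψ n k = Zr.trans (Bp.coef-cong (coef-map (mapHom σ) ψ k) n) (coef-map σ _ n)

    comp₂ : ∀ e ψ → VVp.coef (⟦ χ₁.χ ⟧ (⟦ α ⟧ ψ)) e Vr.≈ ΣV (suc e) (λ n → Vp.K (rc ψ n (e ∸ n) Zr.* zᵖ ^ᶻ (e ∸ n)) Vr.* Y ^ᵛ n)
    comp₂ e ψ = Vr.trans (VVp.coef-cong (χ₁-α ψ) e) (Vr.trans (χ₂.coef-χ e ψ) (Vs.Σ-cong′ (suc e) (λ n →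
      Vr.trans (Vr.*-congˡ (Vr.*-congˡ (Vr.sym (Hom.^-homo Vp.KHom zᵖ (e ∸ n))))) (Vr.trans (let open Vs.Solver in solve 3 (λ a b c → a :* (b :* c) := (a :* c) :* b) Vr.refl _ _ _) (Vr.*-congʳ (Vr.sym (Hom.*-homo Vp.KHom _ _)))))))

    comp₁ : ∀ e ψ → VVp.coef (⟦ χ₁.χ ⟧ (⟦ σC ⟧ ψ)) e Vr.≈ ΣV (suc e) (λ n → Vp.K (⟦ σ ⟧ (rc ψ n (e ∸ n))) Vr.* q ^ᵛ (e ∸ n))
    comp₁ e ψ = Vr.trans (χ₁.coef-χ e (⟦ σC ⟧ ψ)) (Vs.Σ-cong′ (suc e) (λ n → Vr.*-cong (Hom.⟦⟧-cong Vp.KHom (rc-σ ψ n (e ∸ n))) (Vr.trans (Vr.*-congʳ (Vs.1^ n)) (Vr.*-identityˡ _))))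

    r : ℕ → ℕ → Zr.Carrier
    r e n = rc (φ K′) n (e ∸ n)

    twisted : ∀ e → FormRigid.TwistedEq e K′ (κ̂ K′) ƛ (κ̂≉0 K′) (r e)
    twisted e = Vr.trans (Vr.*-congˡ (Vr.sym (comp₂ e (φ K′)))) (Vr.trans (image K′ _ _ E₀ e) (Vr.*-congˡ (Vr.*-congˡ (comp₁ e (φ K′)))))

  μ : Zr.Carrier
  μ = rc (φ K′) K′ 0

  module _ where
    μ≡ : r K′ K′ Zr.≈ μ
    μ≡ = Zr.reflexive (≡.cong (rc (φ K′) K′) (ℕP.n∸n≡0 K′))

    otherZero : ∀ n k → ¬ (n ≡ K′ × k ≡ 0) → rc (φ K′) n k Zr.≈ Zr.0#
    otherZero n k ne = Zr.trans (Zr.reflexive (≡.cong (rc (φ K′) n) (≡.sym (ℕP.m+n∸m≡n n k)))) (go ((n ℕ.+ k) ℕ.≟ K′))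
      where
      n≤ = ℕP.m≤m+n n k
      go : Dec (n ℕ.+ k ≡ K′) → r (n ℕ.+ k) n Zr.≈ Zr.0#
      go (no q) = FormRigid.allZero (n ℕ.+ k) K′ (κ̂ K′) ƛ (κ̂≉0 K′) (r (n ℕ.+ k)) (twisted _) q n n≤
      go (yes q) = FormRigid.lowZero (n ℕ.+ k) K′ (κ̂ K′) ƛ (κ̂≉0 K′) (r (n ℕ.+ k)) (twisted _) n n≤ (lt k ≡.refl)
        where
        lt : ∀ j → k ≡ j → n < K′
        lt zero e = ⊥-elim (ne (≡.trans (≡.sym (≡.trans (≡.cong (n ℕ.+_) e) (ℕP.+-identityʳ n))) q , e))
        lt (suc j) e = ℕP.≤-trans (ℕP.≤-trans (s≤s (ℕP.m≤m+n n j)) (ℕP.≤-reflexive (≡.trans (≡.sym (ℕP.+-suc n j)) (≡.cong (n ℕ.+_) (≡.sym e))))) (ℕP.≤-reflexive q)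

  φ-zero : μ Zr.≈ Zr.0# → φ K′ Cr.≈ Cr.0#
  φ-zero h = Cp.ext0 (λ k → Bp.ext0 (λ n → go n k (n ℕ.≟ K′) (k ℕ.≟ 0)))
    where
    go : ∀ n k → Dec (n ≡ K′) → Dec (k ≡ 0) → rc (φ K′) n k Zr.≈ Zr.0#
    go n k (yes ≡.refl) (yes ≡.refl) = h
    go n k (no q) _ = otherZero n k (λ p → q (proj₁ p))
    go n k (yes _) (no q) = otherZero n k (λ p → q (proj₂ p))

  scalar : κ̂ K′ Zr.* μ Zr.≈ ƛ Zr.* ⟦ σ ⟧ μ
  scalar = Zr.trans (Zr.*-congˡ (Zr.sym μ≡)) (Zr.trans (FormRigid.scalarEq K′ K′ (κ̂ K′) ƛ (κ̂≉0 K′) (r K′) (twisted K′) ≡.refl) (Zr.*-congˡ (σ.⟦⟧-cong μ≡)))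

  private
    single : ∀ (h : ℕ → Vr.Carrier) → (∀ n → ¬ n ≡ K′ → h n Vr.≈ Vr.0#) → ΣV (suc K′) h Vr.≈ h K′
    single h z = Vs.Σ-single (suc K′) K′ h (ℕP.n<1+n K′) z

    r0 : ∀ n → ¬ n ≡ K′ → r K′ n Zr.≈ Zr.0#
    r0 n ne = otherZero n (K′ ∸ n) (λ p → ne (proj₁ p))

    term₂ term₁ : ℕ → Vr.Carrier
    term₂ n = Vp.K (r K′ n Zr.* zᵖ ^ᶻ (K′ ∸ n)) Vr.* Y ^ᵛ n
    term₁ n = Vp.K (⟦ σ ⟧ (r K′ n)) Vr.* q ^ᵛ (K′ ∸ n)

    term₂-0 : ∀ n → ¬ n ≡ K′ → term₂ n Vr.≈ Vr.0#
    term₂-0 n ne = Vr.trans (Vr.*-congʳ (Hom.≈0-homo Vp.KHom (Zr.trans (Zr.*-congʳ (r0 n ne)) (Zr.zeroˡ _)))) (Vr.zeroˡ _)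

    term₁-0 : ∀ n → ¬ n ≡ K′ → term₁ n Vr.≈ Vr.0#
    term₁-0 n ne = Vr.trans (Vr.*-congʳ (Hom.≈0-homo Vp.KHom (σ.≈0-homo (r0 n ne)))) (Vr.zeroˡ _)

    z^0 : zᵖ ^ᶻ (K′ ∸ K′) Zr.≈ Zr.1#
    z^0 = Zr.reflexive (≡.cong (zᵖ ^ᶻ_) (ℕP.n∸n≡0 K′))

    q^0 : q ^ᵛ (K′ ∸ K′) Vr.≈ Vr.1#
    q^0 = Vr.reflexive (≡.cong (q ^ᵛ_) (ℕP.n∸n≡0 K′))

    comp₂-φ : VVp.coef (⟦ χ₁.χ ⟧ (⟦ α ⟧ (φ K′))) K′ Vr.≈ Vp.K μ Vr.* Y ^ᵛ K′
    comp₂-φ = Vr.trans (comp₂ K′ (φ K′)) (Vr.trans (single term₂ term₂-0) (Vr.*-congʳ (Hom.⟦⟧-cong Vp.KHom (Zr.trans (Zr.*-cong μ≡ z^0) (Zr.*-identityʳ μ)))))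

    comp₁-φ : VVp.coef (⟦ χ₁.χ ⟧ (⟦ σC ⟧ (φ K′))) K′ Vr.≈ Vp.K (⟦ σ ⟧ μ)
    comp₁-φ = Vr.trans (comp₁ K′ (φ K′)) (Vr.trans (single term₁ term₁-0) (Vr.trans (Vr.*-cong (Hom.⟦⟧-cong Vp.KHom (σ.⟦⟧-cong μ≡)) q^0) (Vr.*-identityʳ _)))

  -- The leading coefficient is μ x^(k+1), and `second` multiplies it by x. It therefore meets the
  -- subleading coefficient in degree k + 2, where `E₁` becomes an instance of `QuadEq`.
  noQuad : ∀ k → K′ ≡ suc k → μ Zr.≈ Zr.0#
  noQuad k e = go (dZ._≟0 μ)
    where
    go : Dec (μ Zr.≈ Zr.0#) → μ Zr.≈ Zr.0#
    go (yes h) = h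
    go (no μ≉0) = ⊥-elim (QuadExtract.quadContradiction k (κ̂ k) ƛ μ (κ̂≉0 k) μ≉0 ρ quadEq h₀)
      where
      ρ : ℕ → Zr.Carrier
      ρ i = rc (φ k) i ((2 ℕ.+ k) ∸ i)
      n = Zp.K (+ suc k)
      nat : ⟦ χ₁.χ ⟧ (nC k) VVr.≈ ⟦ ιVV ⟧ n
      nat = VVr.trans (Hom.natR-homo χ₁.χ (suc k)) (VVr.sym (VVr.trans (Hom.⟦⟧-cong ιVV (Hom.⟦⟧-cong Zp.KHom (≡.sym (intR-ℤ (+ suc k))))) (Hom.natR-homo (ιVV ∘H Zp.KHom) (suc k))))
      h₀ : κ̂ k Zr.* (four Zr.* (zᵖ Zr.* μ)) Zr.≈ ƛ Zr.* ⟦ σ ⟧ μ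
      h₀ = Zr.trans (let open Zs.Solver in solve 6 (λ k f g z w m → (k :* (f :* w)) :* (g :* (z :* m)) := (k :* (f :* ((g :* z) :* w))) :* m) Zr.refl κ (four ^ᶻ K) four zᵖ (4z ^ᶻ k) μ)
        (Zr.trans (Zr.*-congʳ (Zr.reflexive (≡.cong κ̂ (≡.sym e)))) scalar)
      -- coefficient of s^(k+2) in χ (ψ + n (c x ψ′))
      inner : ∀ ψ ψ′ c lead′ → VVp.coef (⟦ χ₁.χ ⟧ ψ′) (suc k) Vr.≈ lead′ → ∀ cx → ⟦ χ₁.χ ⟧ cx VVr.≈ ⟦ ιVV ⟧ c VVr.* s →
        VVp.coef (⟦ χ₁.χ ⟧ (ψ Cr.+ nC k Cr.* (cx Cr.* ψ′))) (2 ℕ.+ k) Vr.≈ VVp.coef (⟦ χ₁.χ ⟧ ψ) (2 ℕ.+ k) Vr.+ Vp.K n Vr.* (Vp.K c Vr.* lead′)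
      inner ψ ψ′ c lead′ hl cx hc = Vr.trans (VVp.coef-cong (VVr.trans (Hom.+-homo χ₁.χ _ _) (VVr.+-congˡ (VVr.trans (Hom.*-homo χ₁.χ _ _) (VVr.*-cong nat (VVr.trans (Hom.*-homo χ₁.χ _ _) (VVr.trans (VVr.*-congʳ hc) (VVr.*-assoc _ _ _))))))) (2 ℕ.+ k))
        (Vr.trans (VVp.coef-+ _ _ (2 ℕ.+ k)) (Vr.+-congˡ (Vr.trans (coef-ι* n _ (2 ℕ.+ k)) (Vr.*-congˡ (Vr.trans (coef-ι* c _ (2 ℕ.+ k)) (Vr.*-congˡ (Vr.trans (VVp.coef-X*suc _ (suc k)) hl)))))))
      top₂ : VVp.coef (⟦ χ₁.χ ⟧ (⟦ α ⟧ (φ (suc k)))) (suc k) Vr.≈ Vp.K μ Vr.* Y ^ᵛ suc k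
      top₂ = ≡.subst (λ m → VVp.coef (⟦ χ₁.χ ⟧ (⟦ α ⟧ (φ m))) m Vr.≈ Vp.K μ Vr.* Y ^ᵛ m) e comp₂-φ
      top₁ : VVp.coef (⟦ χ₁.χ ⟧ (⟦ σC ⟧ (φ (suc k)))) (suc k) Vr.≈ Vp.K (⟦ σ ⟧ μ)
      top₁ = ≡.subst (λ m → VVp.coef (⟦ χ₁.χ ⟧ (⟦ σC ⟧ (φ m))) m Vr.≈ Vp.K (⟦ σ ⟧ μ)) e comp₁-φ
      χ₁-δx : ⟦ χ₁.χ ⟧ δxC VVr.≈ ⟦ ιVV ⟧ δpᵖ VVr.* s
      χ₁-δx = VVr.trans (Hom.*-homo χ₁.χ _ _) (VVr.*-cong (χ₁.χ-ι δpᵖ) χ₁-x)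
      module H = Hom Vp.KHom
      quadEq : QuadExtract.QuadEq k (κ̂ k) ƛ μ (κ̂≉0 k) μ≉0 ρ
      quadEq = Vr.trans (Vr.*-congˡ (Vr.sym (Vr.trans (inner _ _ 4z _ top₂ 4zxC χ₁-4zx) (Vr.+-cong (comp₂ (2 ℕ.+ k) (φ k)) wEq))))
        (Vr.trans (image k _ _ (E₁ k e) (2 ℕ.+ k)) (Vr.*-congˡ (Vr.*-congˡ (Vr.trans (inner _ _ δpᵖ _ top₁ δxC χ₁-δx) (Vr.+-cong (comp₁ (2 ℕ.+ k) (φ k)) cEq)))))
        where
        wEq : Vp.K n Vr.* (Vp.K 4z Vr.* (Vp.K μ Vr.* Y ^ᵛ suc k)) Vr.≈ Vp.K (n Zr.* (four Zr.* (zᵖ Zr.* μ))) Vr.* Y ^ᵛ suc k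
        wEq = Vr.trans (let open Vs.Solver in solve 4 (λ a b c d → a :* (b :* (c :* d)) := (a :* (b :* c)) :* d) Vr.refl _ _ _ _)
          (Vr.*-congʳ (Vr.sym (Vr.trans (H.*-homo _ _) (Vr.*-congˡ (Vr.trans (H.⟦⟧-cong (Zr.sym (Zr.*-assoc _ _ _))) (H.*-homo _ _))))))
        cEq : Vp.K n Vr.* (Vp.K δpᵖ Vr.* Vp.K (⟦ σ ⟧ μ)) Vr.≈ Vp.K (n Zr.* (δpᵖ Zr.* ⟦ σ ⟧ μ))
        cEq = Vr.sym (Vr.trans (H.*-homo _ _) (Vr.*-congˡ (H.*-homo _ _)))

  -- at x = y = 0 the image of Θ does not involve τ
  noτ : ∀ k → K ≡ suc k → K′ ≡ 0 → μ Zr.≈ Zr.0#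
  noτ k e e′ = Zr.trans (Zr.reflexive (≡.cong (λ m → rc (φ K′) m 0) e′)) (Zr.trans (Zr.sym (value (φ K′))) vanish)
    where
    module OL = LiftC (idHom Z) Zr.0# Zr.0#
    O : Hom C Z
    O = OL.liftC
    value : ∀ ψ → ⟦ O ⟧ ψ Zr.≈ rc ψ 0 0
    value ψ = Zr.trans (Lift.lift-decompose (lift (idHom Z) Zr.0#) Zr.0# ψ) (Zr.trans (Zr.+-congˡ (Zr.zeroˡ _)) (Zr.trans (Zr.+-identityʳ _)
      (Zr.trans (Lift.lift-decompose (idHom Z) Zr.0# (Cp.coef ψ 0)) (Zr.trans (Zr.+-congˡ (Zr.zeroˡ _)) (Zr.+-identityʳ _)))))
    O₂ : Hom A (Poly (Poly Z))
    O₂ = mapHom (mapHom O)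
    kill : Hom A VV
    kill = VVp.KHom ∘H (lift (Vp.KHom ∘H O) Vp.X ∘H lift (idHom C₁) Tr.0#)
    O₂-j : ∀ c → ⟦ O₂ ⟧ (⟦ jA ⟧ c) VVr.≈ VVp.K (Vp.K (⟦ O ⟧ c))
    O₂-j c = VVr.trans (map-K (mapHom O) _) (Hom.⟦⟧-cong VVp.KHom (map-K O c))
    O₂-0 : ∀ c → ⟦ O ⟧ c Zr.≈ Zr.0# → ⟦ O₂ ⟧ (τA Ar.* ⟦ jA ⟧ c) VVr.≈ VVr.0#
    O₂-0 c h = VVr.trans (Hom.*-homo O₂ _ _) (VVr.trans (VVr.*-congˡ (VVr.trans (O₂-j c) (Hom.≈0-homo ιVV h))) (VVr.zeroʳ _))
    kill-K : ∀ g → ⟦ lift (idHom C₁) Tr.0# ⟧ (Ap.K g) Tr.≈ g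
    kill-K g = lift-K (idHom C₁) Tr.0# g
    constant : ∀ Q → ⟦ O₂ ⟧ (⟦ Θ ⟧ Q) VVr.≈ ⟦ kill ⟧ Q
    constant = extA (O₂ ∘H Θ) kill
      (λ c → VVr.trans (Hom.⟦⟧-cong O₂ (ΘL.liftA-j c)) (VVr.trans (O₂-j c) (VVr.sym (Hom.⟦⟧-cong VVp.KHom (Vr.trans (Hom.⟦⟧-cong (lift (Vp.KHom ∘H O) Vp.X) (kill-K _)) (lift-K (Vp.KHom ∘H O) Vp.X c))))))
      (VVr.trans (Hom.⟦⟧-cong O₂ ΘL.liftA-t) (VVr.trans (Hom.+-homo O₂ _ _) (VVr.trans (VVr.+-cong (VVr.trans (map-K (mapHom O) _) (Hom.⟦⟧-cong VVp.KHom (map-X O))) (O₂-0 yC OL.liftC-y)) (VVr.trans (VVr.+-identityʳ _)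
        (VVr.sym (Hom.⟦⟧-cong VVp.KHom (Vr.trans (Hom.⟦⟧-cong (lift (Vp.KHom ∘H O) Vp.X) (kill-K _)) (lift-X (Vp.KHom ∘H O) Vp.X))))))))
      (VVr.trans (Hom.⟦⟧-cong O₂ ΘL.liftA-τ) (VVr.trans (O₂-0 xC OL.liftC-x)
        (VVr.sym (Hom.≈0-homo VVp.KHom (Hom.≈0-homo (lift (Vp.KHom ∘H O) Vp.X) (lift-X (idHom C₁) Tr.0#))))))
    vanish : ⟦ O ⟧ (φ K′) Zr.≈ Zr.0#
    vanish = Zr.trans (Zr.sym (coef-map O _ K′)) (Zr.trans (Vp.coef-cong (Vr.sym (coef-map (mapHom O) G K)) K′)
      (Vp.coef≈0 (Vr.trans (VVp.coef-cong (constant P) K) (Vr.trans (Vr.reflexive (≡.cong (VVp.coef (⟦ kill ⟧ P)) e)) (VVp.coef-Ksuc _ k))) K′))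

-- Minimal relations and their sections

coef² : Ar.Carrier → ℕ → ℕ → Cr.Carrier
coef² H j i = Tp.coef (Ap.coef H j) i

coef²-ext0 : ∀ {H} → (∀ j i → coef² H j i Cr.≈ Cr.0#) → H Ar.≈ Ar.0#
coef²-ext0 h = Ap.ext0 (λ j → Tp.ext0 (h j))

coef²-j* : ∀ c H j i → coef² (⟦ jA ⟧ c Ar.* H) j i Cr.≈ c Cr.* coef² H j i
coef²-j* c H j i = Cr.trans (Tp.coef-cong (Ap.coef-K* _ H j) i) (Tp.coef-K* c _ i)

ΘC : Ar.Carrier → ℕ → ℕ → Cr.Carrier
ΘC P = coef² (⟦ Θ ⟧ P)

ΘC-cong : ∀ {P Q} → P Ar.≈ Q → ∀ j i → ΘC P j i Cr.≈ ΘC Q j i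
ΘC-cong e j i = Tp.coef-cong (Ap.coef-cong (Hom.⟦⟧-cong Θ e) j) i

ΘC-j* : ∀ c P j i → ΘC (⟦ jA ⟧ c Ar.* P) j i Cr.≈ c Cr.* ΘC P j i
ΘC-j* c P j i = Cr.trans (Tp.coef-cong (Ap.coef-cong (Ar.trans (Hom.*-homo Θ _ _) (Ar.*-congʳ (ΘL.liftA-j c))) j) i) (coef²-j* c _ j i)

ΘC-lin : ∀ c c′ P Q j i → ΘC (⟦ jA ⟧ c Ar.* P Ar.- ⟦ jA ⟧ c′ Ar.* Q) j i Cr.≈ c Cr.* ΘC P j i Cr.- c′ Cr.* ΘC Q j i
ΘC-lin c c′ P Q j i = Cr.trans (Tp.coef-cong (Ap.coef-cong (Hom.sub-homo Θ _ _) j) i) (Cr.trans (Tp.coef-cong (Ap.coef-sub _ _ j) i)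
  (Cr.trans (Tp.coef-sub _ _ i) (Cr.+-cong (ΘC-j* c P j i) (Cr.-‿cong (ΘC-j* c′ Q j i)))))

ℓC : Zr.Carrier → Cr.Carrier
ℓC l = Cp.X Cr.- Cp.K (Bp.K l Br.* Bp.X)

ℓC≉0 : ∀ l → ¬ (ℓC l Cr.≈ Cr.0#)
ℓC≉0 l = PolyAux.AuxDom.X-K≉0 B₁ domV _

module χU = Hom U.χ

χ-ℓ : ∀ l → ⟦ U.χ ⟧ (ℓC l) VVr.≈ VVp.K (Vp.X Vr.- Vp.K l) VVr.* VVp.X
χ-ℓ l = VVr.trans (χU.sub-homo _ _) (VVr.trans (VVr.+-cong U.χ-y (VVr.-‿cong (VVr.trans (χU.⟦⟧-cong (Hom.*-homo Cp.KHom _ _)) (VVr.trans (χU.*-homo _ _)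
    (VVr.*-cong (U.χ-ι l) (VVr.trans U.χ-x (VVr.trans (VVr.*-congʳ (Hom.1-homo VVp.KHom)) (VVr.*-identityˡ _))))))))
  (VVr.trans (let open VVs.Solver in solve 3 (λ u l x → u :* x :- l :* x := (u :- l) :* x) VVr.refl (VVp.K Vp.X) (VVp.K (Vp.K l)) VVp.X) (VVr.*-congʳ (VVr.sym (Hom.sub-homo VVp.KHom _ _)))))

R-ℓ* : ∀ l ψ e → R (suc e) (ℓC l Cr.* ψ) Vr.≈ (Vp.X Vr.- Vp.K l) Vr.* R e ψ
R-ℓ* l ψ e = Vr.trans (VVp.coef-cong (VVr.trans (χU.*-homo _ _) (VVr.trans (VVr.*-congʳ (χ-ℓ l)) (VVr.*-assoc _ _ _))) (suc e))
  (Vr.trans (VVp.coef-K* _ _ (suc e)) (Vr.*-congˡ (VVp.coef-X*suc _ e)))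

R-cong : ∀ {φ ψ} → φ Cr.≈ ψ → ∀ e → R e φ Vr.≈ R e ψ
R-cong h e = VVp.coef-cong (χU.⟦⟧-cong h) e

R-zero : ∀ {φ} → φ Cr.≈ Cr.0# → ∀ e → R e φ Vr.≈ Vr.0#
R-zero h e = VVp.coef≈0 (χU.≈0-homo h) e

R-sub : ∀ φ ψ e → R e (φ Cr.- ψ) Vr.≈ R e φ Vr.- R e ψ
R-sub φ ψ e = Vr.trans (VVp.coef-cong (χU.sub-homo φ ψ) e) (VVp.coef-sub _ _ e)

R-ι* : ∀ q φ e → R e (⟦ ιC ⟧ q Cr.* φ) Vr.≈ Vp.K q Vr.* R e φ
R-ι* q φ e = Vr.trans (VVp.coef-cong (VVr.trans (χU.*-homo _ _) (VVr.*-congʳ (U.χ-ι q))) e) (VVp.coef-K* _ _ e)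

R-form* : ∀ D ψ φ e → R (D ℕ.+ e) (form D ψ Cr.* φ) Vr.≈ R D ψ Vr.* R e φ
R-form* D ψ φ e = Vr.trans (VVp.coef-cong shape (D ℕ.+ e)) (Vr.trans (VVA.X^-+ _ D e) (VVp.coef-K* _ _ e))
  where
  shape : ⟦ U.χ ⟧ (form D ψ Cr.* φ) VVr.≈ VVp.X VVs.^ D VVr.* (VVp.K (R D ψ) VVr.* ⟦ U.χ ⟧ φ)
  shape = VVr.trans (χU.*-homo _ _) (VVr.trans (VVr.*-congʳ (χ-form D ψ)) (VVr.*-assoc _ _ _))

R-form*< : ∀ D ψ φ e → e < D → R e (form D ψ Cr.* φ) Vr.≈ Vr.0#
R-form*< D ψ φ e l = Vr.trans (VVp.coef-cong shape e) (VVA.X^-< _ D e l)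
  where
  shape : ⟦ U.χ ⟧ (form D ψ Cr.* φ) VVr.≈ VVp.X VVs.^ D VVr.* (VVp.K (R D ψ) VVr.* ⟦ U.χ ⟧ φ)
  shape = VVr.trans (χU.*-homo _ _) (VVr.trans (VVr.*-congʳ (χ-form D ψ)) (VVr.*-assoc _ _ _))

βsec : Ar.Carrier → Fin 4 → Ar.Carrier
βsec P = Sections.sec secA (⟦ β ⟧ P)

-- What the algebraic argument uses of the set of relations. Cancellation is asked only for y - k x
-- with natural k, where it can be seen from the first coefficients of the series; `nonroot`
-- supplies lines of exactly this kind.
record IsRelations (rel : Ar.Carrier → Set) : Set where
  field
    rel-sub   : ∀ {P Q} → rel P → rel Q → rel (P Ar.- Q)
    rel-mul   : ∀ Q {P} → rel P → rel (Q Ar.* P)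
    rel-line  : ∀ k {P Q} → rel Q → Q Ar.≈ ⟦ jA ⟧ (ℓC (PowerSeries.natR Z k)) Ar.* P → rel P
    rel-sec   : ∀ {P} → rel P → ∀ i → rel (βsec P i)
    rel-const : ∀ {P} q → rel P → P Ar.≈ ⟦ ιA ⟧ q → q Zr.≈ Zr.0#

lin-zero : ∀ c c′ x y → x Cr.≈ Cr.0# → y Cr.≈ Cr.0# → c Cr.* x Cr.- c′ Cr.* y Cr.≈ Cr.0#
lin-zero c c′ x y h h′ = Cr.trans (Cr.+-cong (Cr.trans (Cr.*-congˡ h) (Cr.zeroʳ c)) (Cr.-‿cong (Cr.trans (Cr.*-congˡ h′) (Cr.zeroʳ c′)))) (Cr.-‿inverseʳ Cr.0#)

module Main (rel : Ar.Carrier → Set) (rels : IsRelations rel) where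
  open IsRelations rels

  module Fixed (K K′ : ℕ) where
    record Cls (P : Ar.Carrier) : Set where
      constructor cls
      field
        isRel : rel P
        dτ : ∀ j → K < j → ∀ i → ΘC P j i Cr.≈ Cr.0#
        dt : ∀ i → K′ < i → ΘC P K i Cr.≈ Cr.0#
    open Cls

    φ : Ar.Carrier → Cr.Carrier
    φ P = ΘC P K K′

    -- A window for the degrees of the leading coefficient, whose width `W` and start `a` are the
    -- last two induction parameters: combining two relations narrows the window, dividing by a
    -- linear form moves it down.
    Supp : ℕ → ℕ → Ar.Carrier → Set
    Supp a W P = ∀ e → e < a ⊎ a ℕ.+ W ≤ e → R e (φ P) Vr.≈ Vr.0#

    cls-lin : ∀ c c′ P Q → Cls P → Cls Q → Cls (⟦ jA ⟧ c Ar.* P Ar.- ⟦ jA ⟧ c′ Ar.* Q)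
    cls-lin c c′ P Q p q = cls (rel-sub (rel-mul (⟦ jA ⟧ c) (isRel p)) (rel-mul (⟦ jA ⟧ c′) (isRel q)))
      (λ j l i → Cr.trans (ΘC-lin c c′ P Q j i) (lin-zero c c′ (ΘC P j i) (ΘC Q j i) (dτ p j l i) (dτ q j l i)))
      (λ i l → Cr.trans (ΘC-lin c c′ P Q K i) (lin-zero c c′ (ΘC P K i) (ΘC Q K i) (dt p i l) (dt q i l)))

    cls-line : ∀ k {P Q} → Cls Q → Q Ar.≈ ⟦ jA ⟧ (ℓC (PowerSeries.natR Z k)) Ar.* P → Cls P
    cls-line k {P} {Q} q h = cls (rel-line k (isRel q) h) (λ j lt i → cancel j i (dτ q j lt i)) (λ i lt → cancel K i (dt q i lt))
      where
      l = PowerSeries.natR Z k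
      cancel : ∀ j i → ΘC Q j i Cr.≈ Cr.0# → ΘC P j i Cr.≈ Cr.0#
      cancel j i z = dC.cancel0 (ℓC≉0 l) (Cr.trans (Cr.sym (Cr.trans (ΘC-cong h j i) (ΘC-j* (ℓC l) P j i))) z)

    module Sec (P : Ar.Carrier) (p : Cls P) where
      open Lead K K′ P (λ j l → Tp.ext0 (dτ p j l)) (dt p) public
      module CA = CombLaws A σA zA

      βP≈ : ⟦ β ⟧ P Ar.≈ comb A σA zA (βsec P)
      βP≈ = Sections.sec-comb secA _

      ΘC-comb : ∀ j i → ΘC (⟦ β ⟧ P) j i Cr.≈ comb C σC zC (λ r → ΘC (βsec P r) j i)
      ΘC-comb j i = Cr.trans (ΘC-cong βP≈ j i) (Cr.trans (Tp.coef-cong (Ap.coef-cong (comb-hom Θ σA σA zA zA Θ-σ (ΘL.liftA-j _) (βsec P)) j) i)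
        (Cr.trans (Tp.coef-cong (PolySections.coef-comb σT (Tp.K zC) secT (λ r → ⟦ Θ ⟧ (βsec P r)) j) i) (PolySections.coef-comb σC zC secC (λ r → Ap.coef (⟦ Θ ⟧ (βsec P r)) j) i)))

      sec0 : ∀ j i → ΘC (⟦ β ⟧ P) j i Cr.≈ Cr.0# → ∀ r → ΘC (βsec P r) j i Cr.≈ Cr.0#
      sec0 j i h = Sections.sec-uniq secC (λ r → ΘC (βsec P r) j i) (Cr.trans (Cr.sym (ΘC-comb j i)) h)

      cls-sec : ∀ r → Cls (βsec P r)
      cls-sec r = cls (rel-sec (isRel p) r) (λ j l i → sec0 j i (Tp.coef≈0 (degτ j l) i) r) (λ i l → sec0 K i (degt i l) r)

      rc-comb : ∀ n k → rc (ΘC (⟦ β ⟧ P) K K′) n k Zr.≈ comb Z σ zᵖ (λ r → rc (φ (βsec P r)) n k)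
      rc-comb n k = Zr.trans (Bp.coef-cong (Cp.coef-cong (ΘC-comb K K′) k) n) (Zr.trans (Bp.coef-cong (PolySections.coef-comb (mapHom σ) (Bp.K zᵖ) secB (λ r → φ (βsec P r)) k) n) (PolySections.coef-comb σ zᵖ secZ (λ r → Cp.coef (φ (βsec P r)) k) n))

      private
        q = Vp.K pᵖ Vr.- Vp.X
        module χq = Component q (Vp.K zᵖ)
        q≉0 : ¬ (q Vr.≈ Vr.0#)
        q≉0 h = dZ.1≉0 (Zr.trans (Zr.sym (-‿involutive _)) (Zr.trans (Zr.-‿cong (Zr.trans (Zr.sym (Zr.trans (Vp.coef-sub _ _ 1) (Zr.trans (Zr.+-cong (Vp.coef-Ksuc _ 0) (Zr.-‿cong (Vp.coef-X 1))) (Zr.+-identityˡ _)))) (Vp.coef≈0 h 1))) -0#≈0#))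
          where open import Algebra.Properties.Ring Zr.ring using (-‿involutive; -0#≈0#)

        χU-x : ⟦ U.χ ⟧ xC VVr.≈ VVp.X
        χU-x = VVr.trans U.χ-x (VVr.trans (VVr.*-congʳ (Hom.1-homo VVp.KHom)) (VVr.*-identityˡ _))

        χU-d : ⟦ U.χ ⟧ dC′ VVr.≈ VVp.K q VVr.* VVp.X
        χU-d = VVr.trans (χU.sub-homo _ _) (VVr.trans (VVr.+-cong (VVr.trans (χU.*-homo _ _) (VVr.*-cong (U.χ-ι pᵖ) χU-x)) (VVr.-‿cong U.χ-y))
          (VVr.trans (let open VVs.Solver in solve 3 (λ p y s → p :* s :- y :* s := (p :- y) :* s) VVr.refl (VVp.K (Vp.K pᵖ)) (VVp.K Vp.X) VVp.X) (VVr.*-congʳ (VVr.sym (Hom.sub-homo VVp.KHom _ _)))))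

        χU-zx : ⟦ U.χ ⟧ zxC VVr.≈ VVp.K (Vp.K zᵖ) VVr.* VVp.X
        χU-zx = VVr.trans (χU.*-homo _ _) (VVr.*-cong (U.χ-ι zᵖ) χU-x)

        χU-α : ∀ ψ → ⟦ U.χ ⟧ (⟦ α ⟧ ψ) VVr.≈ ⟦ χq.χ ⟧ ψ
        χU-α = extC (U.χ ∘H α) χq.χ
          (λ c → VVr.trans (χU.⟦⟧-cong (αL.liftC-ι c)) (VVr.trans (U.χ-ι c) (VVr.sym (χq.χ-ι c))))
          (VVr.trans (χU.⟦⟧-cong αL.liftC-x) (VVr.trans χU-d (VVr.sym χq.χ-x)))
          (VVr.trans (χU.⟦⟧-cong αL.liftC-y) (VVr.trans χU-zx (VVr.sym χq.χ-y)))

        χU-4zx^ : ∀ n → ⟦ U.χ ⟧ (4zxC Cs.^ n) VVr.≈ VVp.X VVs.^ n VVr.* (⟦ ιVV ⟧ (four Zr.* zᵖ)) VVs.^ n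
        χU-4zx^ n = VVr.trans (Hom.^-homo U.χ _ n) (VVr.trans (VVs.^-cong n (VVr.trans (χU.*-homo _ _) (VVr.trans (VVr.*-cong (U.χ-ι four) χU-zx)
          (VVr.trans (VVr.sym (VVr.*-assoc _ _ _)) (VVr.trans (VVr.*-congʳ (VVr.sym (Hom.*-homo ιVV _ _))) (VVr.*-comm _ _)))))) (VVs.^-* _ _ n))

        -- α sends x and y to linear forms, and d and 4 z x are linear forms. Both sides of `lead`
        -- therefore shift the degree by K′, and the component of degree e after β depends only on
        -- the component of degree e before.
        vanishing : ∀ e → R e (φ P) Vr.≈ Vr.0# → R e (ΘC (⟦ β ⟧ P) K K′) Vr.≈ Vr.0#
        vanishing e h = dV.cancel0 (dV.^≉0 K′ q≉0) (Vr.trans (Vr.sym lhs) (Vr.trans (VVp.coef-cong (χU.⟦⟧-cong lead) (K′ ℕ.+ e)) rhs))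
          where
          lhs : VVp.coef (⟦ U.χ ⟧ (dC′ Cs.^ K′ Cr.* ΘC (⟦ β ⟧ P) K K′)) (K′ ℕ.+ e) Vr.≈ q Vs.^ K′ Vr.* R e (ΘC (⟦ β ⟧ P) K K′)
          lhs = Vr.trans (VVp.coef-cong (VVr.trans (χU.*-homo _ _) (VVr.trans (VVr.*-congʳ (VVr.trans (Hom.^-homo U.χ _ K′) (VVr.trans (VVs.^-cong K′ χU-d) (VVr.trans (VVs.^-* _ _ K′) (VVr.*-congʳ (VVr.sym (Hom.^-homo VVp.KHom q K′))))))) (VVr.*-assoc _ _ _))) (K′ ℕ.+ e))
            (Vr.trans (VVp.coef-K* _ _ (K′ ℕ.+ e)) (Vr.*-congˡ (VVA.X^-+ _ K′ e)))
          u = ⟦ χq.χ ⟧ (φ P)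
          c₁ = ⟦ U.χ ⟧ (4C Cs.^ K)
          c₂ = (⟦ ιVV ⟧ (four Zr.* zᵖ)) VVs.^ K′
          ku : VVp.coef u e Vr.≈ Vr.0#
          ku = Vr.trans (χq.coef-χ e (φ P)) (χq.comp-zero e (φ P) (R≈0⇒Zero e (φ P) h))
          c₁≈ : c₁ VVr.≈ ⟦ ιVV ⟧ (four Zs.^ K)
          c₁≈ = VVr.trans (Hom.^-homo U.χ 4C K) (VVr.trans (VVs.^-cong K (U.χ-ι four)) (VVr.sym (Hom.^-homo ιVV four K)))
          c₂≈ : c₂ VVr.≈ ⟦ ιVV ⟧ ((four Zr.* zᵖ) Zs.^ K′)
          c₂≈ = VVr.sym (Hom.^-homo ιVV _ K′)
          rhs : VVp.coef (⟦ U.χ ⟧ (4C Cs.^ K Cr.* (4zxC Cs.^ K′ Cr.* ⟦ α ⟧ (φ P)))) (K′ ℕ.+ e) Vr.≈ Vr.0#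
          rhs = Vr.trans (VVp.coef-cong (VVr.trans (χU.*-homo _ _) (VVr.*-cong c₁≈ (VVr.trans (χU.*-homo _ _) (VVr.trans (VVr.*-cong (VVr.trans (χU-4zx^ K′) (VVr.*-congˡ c₂≈)) (χU-α (φ P))) (VVr.*-assoc _ _ _))))) (K′ ℕ.+ e))
            (Vr.trans (coef-ι* _ _ (K′ ℕ.+ e)) (Vr.trans (Vr.*-congˡ (Vr.trans (VVA.X^-+ _ K′ e) (Vr.trans (coef-ι* _ u e) (Vr.trans (Vr.*-congˡ ku) (Vr.zeroʳ _))))) (Vr.zeroʳ _)))

      supp-sec : ∀ e → R e (φ P) Vr.≈ Vr.0# → ∀ r → R e (φ (βsec P r)) Vr.≈ Vr.0#
      supp-sec e h r = Zero⇒R≈0 e _ (λ n n≤e → Sections.sec-uniq secZ (λ r → rc (φ (βsec P r)) n (e ∸ n))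
        (Zr.trans (Zr.sym (rc-comb n (e ∸ n))) (R≈0⇒Zero e _ (vanishing e h) n n≤e)) r)

    module OnLine (l : Zr.Carrier) where
      open Line l using (η; η-form) public
      private
        W₂ W₃ : CRing
        W₂ = Poly B₁
        W₃ = Poly W₂
        module W₂p = Pol B₁
        module W₃p = Pol W₂
        module W₃r = CommutativeRing W₃
        domW₂ = Pol.WithDom.dom B₁ domV
        domW₃ = Pol.WithDom.dom W₂ domW₂

        κ₃ : Hom B₁ W₃
        κ₃ = W₃p.KHom ∘H W₂p.KHom

        ηA : Hom A W₃
        ηA = mapHom (mapHom η)

        ηA-j : ∀ c → ⟦ ηA ⟧ (⟦ jA ⟧ c) W₃r.≈ ⟦ κ₃ ⟧ (⟦ η ⟧ c)
        ηA-j c = W₃r.trans (map-K (mapHom η) _) (Hom.⟦⟧-cong W₃p.KHom (map-K η c))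

        κ₃-refl : ∀ {b} → ⟦ κ₃ ⟧ b W₃r.≈ W₃r.0# → b Br.≈ Br.0#
        κ₃-refl h = Br.trans (Br.sym (W₂p.coef-K0 _)) (W₂p.coef≈0 (CommutativeRing.trans W₂ (CommutativeRing.sym W₂ (W₃p.coef-K0 _)) (W₃p.coef≈0 h 0)) 0)

      -- On y = l x the left side of the relation vanishes and f does not, so every coefficient of Q
      -- vanishes on the line and is divisible by y - l x.
      divide : ∀ f f′ P Q → ⟦ jA ⟧ f′ Ar.* P Ar.≈ ⟦ jA ⟧ f Ar.* Q → ⟦ η ⟧ f′ Br.≈ Br.0# → ¬ (⟦ η ⟧ f Br.≈ Br.0#) → Σ Ar.Carrier λ Q′ → Q Ar.≈ ⟦ jA ⟧ (ℓC l) Ar.* Q′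
      divide f f′ P Q e z nz = Roots.divisible C₁ (Tp.K (ℓC l)) Q (λ j → Roots.divisible C (ℓC l) (Ap.coef Q j) (λ i → Roots.factor B₁ (Bp.K l Br.* Bp.X) (coef² Q j i) (vanish j i)))
        where
        ηQ : ⟦ ηA ⟧ Q W₃r.≈ W₃r.0#
        ηQ = Dom.cancel0 domW₃ (λ h → nz (κ₃-refl h)) (W₃r.trans (W₃r.*-congʳ (W₃r.sym (ηA-j f))) (W₃r.trans (W₃r.sym (Hom.*-homo ηA _ _)) (W₃r.trans (Hom.⟦⟧-cong ηA (Ar.sym e))
          (W₃r.trans (Hom.*-homo ηA _ _) (W₃r.trans (W₃r.*-congʳ (W₃r.trans (ηA-j f′) (Hom.≈0-homo κ₃ z))) (W₃r.zeroˡ _))))))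
        vanish : ∀ j i → ⟦ η ⟧ (coef² Q j i) Br.≈ Br.0#
        vanish j i = Br.trans (Br.sym (coef-map η _ i)) (Br.trans (W₂p.coef-cong (CommutativeRing.sym W₂ (coef-map (mapHom η) Q j)) i) (W₂p.coef≈0 (W₃p.coef≈0 ηQ j) i))

    module Step (W : ℕ) (IHW : ∀ a P → Cls P → Supp a W P → P Ar.≈ Ar.0#) (a : ℕ)
      (IHa : ∀ a′ → a ≡ suc a′ → ∀ P → Cls P → Supp a′ (suc W) P → P Ar.≈ Ar.0#) (P : Ar.Carrier) (p : Cls P) (supp : Supp a (suc W) P) where

      D : ℕ
      D = a ℕ.+ W

      above : ∀ Q → Supp a (suc W) Q → ∀ e → D < e → R e (φ Q) Vr.≈ Vr.0#
      above Q s e l = s e (inj₂ (ℕP.≤-trans (ℕP.≤-reflexive (ℕP.+-suc a W)) l))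

      narrow : ∀ Q → Cls Q → Supp a (suc W) Q → R D (φ Q) Vr.≈ Vr.0# → Q Ar.≈ Ar.0#
      narrow Q q s h = IHW a Q q λ { e (inj₁ l) → s e (inj₁ l) ; e (inj₂ l) → go e (ℕP.m≤n⇒m<n∨m≡n l) }
        where
        go : ∀ e → D < e ⊎ D ≡ e → R e (φ Q) Vr.≈ Vr.0#
        go e (inj₁ l)      = above Q s e l
        go e (inj₂ ≡.refl) = h

      module _ (k : ℕ) where
        private
          l = PowerSeries.natR Z k
          ev = Roots.evalAt Z l
          module O = OnLine l

        -- Let f and f′ be the top forms of φ P and φ Q. In X = f′ P - f Q the components of degree
        -- 2D cancel, so the window of X has width W and X = 0. On the line f′ vanishes but f does
        -- not; hence Q = (y - l x) Q′, and the window of Q′ is smaller again, so Q′ = 0.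
        kill : ¬ (⟦ ev ⟧ (R D (φ P)) Zr.≈ Zr.0#) → ∀ Q → Cls Q → Supp a (suc W) Q → ⟦ ev ⟧ (R D (φ Q)) Zr.≈ Zr.0# → Q Ar.≈ Ar.0#
        kill nz Q q s z = finish (O.divide f f′ P Q cross ηf′ ηf)
          where
          f = form D (φ P)
          f′ = form D (φ Q)
          X = ⟦ jA ⟧ f′ Ar.* P Ar.- ⟦ jA ⟧ f Ar.* Q
          φX : φ X Cr.≈ f′ Cr.* φ P Cr.- f Cr.* φ Q
          φX = ΘC-lin f′ f P Q K K′
          RX : ∀ e → R e (φ X) Vr.≈ R e (f′ Cr.* φ P) Vr.- R e (f Cr.* φ Q)
          RX e = Vr.trans (R-cong φX e) (R-sub _ _ e)
          sub0 : ∀ {x y} → x Vr.≈ Vr.0# → y Vr.≈ Vr.0# → x Vr.- y Vr.≈ Vr.0#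
          sub0 hx hy = Vr.trans (Vr.+-cong hx (Vr.-‿cong hy)) (Vr.-‿inverseʳ Vr.0#)
          RX< : ∀ e → e < D → R e (φ X) Vr.≈ Vr.0#
          RX< e l = Vr.trans (RX e) (sub0 (R-form*< D (φ Q) (φ P) e l) (R-form*< D (φ P) (φ Q) e l))
          RX+ : ∀ j → R (D ℕ.+ j) (φ X) Vr.≈ R D (φ Q) Vr.* R j (φ P) Vr.- R D (φ P) Vr.* R j (φ Q)
          RX+ j = Vr.trans (RX (D ℕ.+ j)) (Vr.+-cong (R-form* D (φ Q) (φ P) j) (Vr.-‿cong (R-form* D (φ P) (φ Q) j)))
          RX0 : ∀ j → R j (φ P) Vr.≈ Vr.0# → R j (φ Q) Vr.≈ Vr.0# → R (D ℕ.+ j) (φ X) Vr.≈ Vr.0#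
          RX0 j h h′ = Vr.trans (RX+ j) (sub0 (Vr.trans (Vr.*-congˡ h) (Vr.zeroʳ _)) (Vr.trans (Vr.*-congˡ h′) (Vr.zeroʳ _)))
          RXD : R (D ℕ.+ D) (φ X) Vr.≈ Vr.0#
          RXD = Vr.trans (RX+ D) (Vr.trans (Vr.+-congʳ (Vr.*-comm _ _)) (Vr.-‿inverseʳ _))
          atD : ∀ e → D ≤ e → (∀ j → e ≡ D ℕ.+ j → R (D ℕ.+ j) (φ X) Vr.≈ Vr.0#) → R e (φ X) Vr.≈ Vr.0#
          atD e le h = Vr.trans (Vr.reflexive (≡.cong (λ m → R m (φ X)) (≡.sym (ℕP.m+[n∸m]≡n le)))) (h (e ∸ D) (≡.sym (ℕP.m+[n∸m]≡n le)))
          suppX : Supp (D ℕ.+ a) W X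
          suppX e (inj₁ lt) = low (D ℕ.≤? e)
            where
            low′ : ∀ j → e ≡ D ℕ.+ j → j < a
            low′ j e≡ = ℕP.+-cancelˡ-< D j a (ℕP.≤-<-trans (ℕP.≤-reflexive (≡.sym e≡)) lt)
            low : Dec (D ≤ e) → R e (φ X) Vr.≈ Vr.0#
            low (no nle) = RX< e (ℕP.≰⇒> nle)
            low (yes le) = atD e le (λ j e≡ → RX0 j (supp j (inj₁ (low′ j e≡))) (s j (inj₁ (low′ j e≡))))
          suppX e (inj₂ le) = atD e (ℕP.≤-trans (ℕP.≤-trans (ℕP.m≤m+n D a) (ℕP.m≤m+n _ W)) le) λ j e≡ →
              go j (ℕP.m≤n⇒m<n∨m≡n (ℕP.+-cancelˡ-≤ D D j (ℕP.≤-trans (ℕP.≤-reflexive (≡.sym (ℕP.+-assoc D a W))) (ℕP.≤-trans le (ℕP.≤-reflexive e≡)))))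
            where
            go : ∀ j → D < j ⊎ D ≡ j → R (D ℕ.+ j) (φ X) Vr.≈ Vr.0#
            go j (inj₁ lt)     = RX0 j (above P supp j lt) (above Q s j lt)
            go j (inj₂ ≡.refl) = RXD
          cross : ⟦ jA ⟧ f′ Ar.* P Ar.≈ ⟦ jA ⟧ f Ar.* Q
          cross = x∙y⁻¹≈ε⇒x≈y _ _ (IHW (D ℕ.+ a) X (cls-lin f′ f P Q p q) suppX)
            where open import Algebra.Properties.Ring Ar.ring using (x∙y⁻¹≈ε⇒x≈y)
          ηf′ : ⟦ O.η ⟧ f′ Br.≈ Br.0#
          ηf′ = Br.trans (O.η-form D (φ Q)) (Br.trans (Br.*-congˡ (Hom.≈0-homo Bp.KHom z)) (Br.zeroʳ _))
          ηf : ¬ (⟦ O.η ⟧ f Br.≈ Br.0#)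
          ηf h = dV.*≉0 (dV.^≉0 D (λ e → dZ.1≉0 (Zr.trans (Zr.sym (Bp.coef-X 1)) (Bp.coef≈0 e 1)))) (λ e → nz (Zr.trans (Zr.sym (Bp.coef-K0 _)) (Bp.coef≈0 e 0))) (Br.trans (Br.sym (O.η-form D (φ P))) h)
          finish : (Σ Ar.Carrier λ Q′ → Q Ar.≈ ⟦ jA ⟧ (ℓC l) Ar.* Q′) → Q Ar.≈ Ar.0#
          finish (Q′ , e) = Ar.trans e (Ar.trans (Ar.*-congˡ (descend a ≡.refl)) (Ar.zeroʳ _))
            where
            q′ : Cls Q′
            q′ = cls-line k q e
            R′ : ∀ e → R (suc e) (φ Q) Vr.≈ Vr.0# → R e (φ Q′) Vr.≈ Vr.0#
            R′ i h = dV.cancel0 (VAD.X-K≉0 l) (Vr.trans (Vr.sym (Vr.trans (R-cong (Cr.trans (ΘC-cong e K K′) (ΘC-j* (ℓC l) Q′ K K′)) (suc i)) (R-ℓ* l (φ Q′) i))) h)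
            descend : ∀ b → a ≡ b → Q′ Ar.≈ Ar.0#
            -- A window starting at 0 cannot move down; division by the linear form then removes its
            -- top degree, so the width drops instead.
            descend zero a≡ = IHW 0 Q′ q′ λ { i (inj₂ le) → R′ i (above Q s (suc i) (s≤s (ℕP.≤-trans (ℕP.≤-reflexive (≡.cong (ℕ._+ W) a≡)) le))) }
            descend (suc b) a≡ = IHa b a≡ Q′ q′ λ
              { i (inj₁ lt) → R′ i (s (suc i) (inj₁ (ℕP.≤-trans (s≤s lt) (ℕP.≤-reflexive (≡.sym a≡)))))
              ; i (inj₂ le) → R′ i (above Q s (suc i) (s≤s (ℕP.≤-trans (ℕP.≤-reflexive (≡.trans (≡.cong (ℕ._+ W) a≡) (≡.sym (ℕP.+-suc b W)))) le))) }

module MainTheorem (rel : Ar.Carrier → Set) (rels : IsRelations rel) where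
  open IsRelations rels
  open Main rel rels

  module AtLevel (K K′ : ℕ) where
    open Fixed K K′
    open Cls

    module Proportional (P : Ar.Carrier) (p : Cls P) (κ ƛ : Zr.Carrier) (κ≉0 : ¬ (κ Zr.≈ Zr.0#))
      (eq : ⟦ ιA ⟧ κ Ar.* ⟦ β ⟧ P Ar.≈ ⟦ ιA ⟧ ƛ Ar.* ⟦ σA ⟧ P) where
      private
        module Ct = Contr K K′ P (λ j l → Tp.ext0 (dτ p j l)) (dt p) κ ƛ κ≉0 eq

      -- With K = K′ = 0 the only coefficient of Θ P is the constant μ in ℤ[z]. So P itself lies in
      -- ℤ[z], where `rel-const` leaves only zero.
      constantCase : K ≡ 0 → K′ ≡ 0 → Ct.μ Zr.≈ Zr.0#
      constantCase e e′ = rel-const Ct.μ (isRel p) (x∙y⁻¹≈ε⇒x≈y P (⟦ ιA ⟧ Ct.μ) (Θ-injective _ (Ar.trans (Hom.sub-homo Θ _ _) (Ar.trans (Ar.+-cong (constant (λ j l → dτ p j (≡.subst (_< j) (≡.sym e) l)) (λ i l → Cr.trans (Cr.reflexive (≡.cong (λ k → ΘC P k i) (≡.sym e))) (dt p i (≡.subst (_< i) (≡.sym e′) l))) value) (Ar.-‿cong (ΘL.liftA-j _))) (Ar.-‿inverseʳ _)))))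
        where
        open import Algebra.Properties.Ring Ar.ring using (x∙y⁻¹≈ε⇒x≈y)
        constant : ∀ {H c} → (∀ j → 0 < j → ∀ i → coef² H j i Cr.≈ Cr.0#) → (∀ i → 0 < i → coef² H 0 i Cr.≈ Cr.0#) → coef² H 0 0 Cr.≈ c → H Ar.≈ ⟦ jA ⟧ c
        constant {H} {c} hj hi h0 = Ar.trans (Ap.Deg≤0 (λ j l → Tp.ext0 (hj j l))) (Hom.⟦⟧-cong Ap.KHom (Tr.trans (Tp.Deg≤0 hi) (Hom.⟦⟧-cong Tp.KHom h0)))
        value : ΘC P 0 0 Cr.≈ ⟦ ιC ⟧ Ct.μ
        value = Cr.trans (Cr.reflexive (≡.cong₂ (ΘC P) (≡.sym e) (≡.sym e′))) (Cp.ext λ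
            { zero → Br.trans (Bp.ext λ { zero → Zr.trans (Zr.reflexive (≡.cong (λ m → rc (φ P) m 0) (≡.sym e′))) (Zr.sym (Bp.coef-K0 _))
                                        ; (suc n) → Zr.trans (Ct.otherZero (suc n) 0 (λ q → suc≢0 (≡.trans (proj₁ q) e′))) (Zr.sym (Bp.coef-Ksuc _ n)) }) (Br.sym (Cp.coef-K0 _))
            ; (suc k) → Br.trans (Bp.ext0 (λ n → Ct.otherZero n (suc k) (λ q → suc≢0 (proj₂ q)))) (Br.sym (Cp.coef-Ksuc _ k)) })
          where
          suc≢0 : ∀ {n} → ¬ (suc n ≡ 0)
          suc≢0 ()

      φ≈0 : φ P Cr.≈ Cr.0#
      φ≈0 = Ct.φ-zero (cases K K′ ≡.refl ≡.refl)
        where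
        cases : ∀ k k′ → K ≡ k → K′ ≡ k′ → Ct.μ Zr.≈ Zr.0#
        cases k (suc k′) _ e′ = Ct.noQuad k′ e′
        cases (suc k) zero e e′ = Ct.noτ k e e′
        cases zero zero e e′ = constantCase e e′

    module Leading (W : ℕ) (IHW : ∀ a P → Cls P → Supp a W P → P Ar.≈ Ar.0#) (a : ℕ)
      (IHa : ∀ a′ → a ≡ suc a′ → ∀ P → Cls P → Supp a′ (suc W) P → P Ar.≈ Ar.0#) (P : Ar.Carrier) (p : Cls P) (supp : Supp a (suc W) P) where
      open Step W IHW a IHa P p supp
      module Sc = Sec P p

      module _ (k : ℕ) (nz : ¬ (⟦ Roots.evalAt Z (PowerSeries.natR Z k) ⟧ (R D (φ P)) Zr.≈ Zr.0#)) where
        private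
          l = PowerSeries.natR Z k
          ev = Roots.evalAt Z l
          r′ = ⟦ ev ⟧ (R D (φ P))
          ρ : Fin 4 → Zr.Carrier
          ρ i = ⟦ ev ⟧ (R D (φ (βsec P i)))
          -- The multipliers are chosen so that the top component vanishes at the single point u =
          -- k. By `kill` this one scalar condition already makes the section proportional to P.
          Q : Fin 4 → Ar.Carrier
          Q i = ⟦ ιA ⟧ r′ Ar.* βsec P i Ar.- ⟦ ιA ⟧ (ρ i) Ar.* P

          RQ : ∀ i e → R e (φ (Q i)) Vr.≈ Vp.K r′ Vr.* R e (φ (βsec P i)) Vr.- Vp.K (ρ i) Vr.* R e (φ P)
          RQ i e = Vr.trans (R-cong (ΘC-lin (⟦ ιC ⟧ r′) (⟦ ιC ⟧ (ρ i)) (βsec P i) P K K′) e) (Vr.trans (R-sub _ _ e) (Vr.+-cong (R-ι* r′ _ e) (Vr.-‿cong (R-ι* (ρ i) _ e))))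

          suppQ : ∀ i → Supp a (suc W) (Q i)
          suppQ i e h = Vr.trans (RQ i e) (Vr.trans (Vr.+-cong (Vr.trans (Vr.*-congˡ (Sc.supp-sec e (supp e h) i)) (Vr.zeroʳ _)) (Vr.-‿cong (Vr.trans (Vr.*-congˡ (supp e h)) (Vr.zeroʳ _)))) (Vr.-‿inverseʳ _))

          evQ : ∀ i → ⟦ ev ⟧ (R D (φ (Q i))) Zr.≈ Zr.0#
          evQ i = Zr.trans (Hom.⟦⟧-cong ev (RQ i D)) (Zr.trans (Hom.sub-homo ev _ _) (Zr.trans (Zr.+-cong (evK r′ _) (Zr.-‿cong (Zr.trans (evK (ρ i) _) (Zr.*-comm _ _)))) (Zr.-‿inverseʳ _)))
            where
            evK : ∀ c v → ⟦ ev ⟧ (Vp.K c Vr.* v) Zr.≈ c Zr.* ⟦ ev ⟧ v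
            evK c v = Zr.trans (Hom.*-homo ev _ _) (Zr.*-congʳ (lift-K (idHom Z) l c))

          prop : ∀ i → ⟦ ιA ⟧ r′ Ar.* βsec P i Ar.≈ P Ar.* ⟦ ιA ⟧ (ρ i)
          prop i = Ar.trans (x∙y⁻¹≈ε⇒x≈y _ _ (kill k nz (Q i) (cls-lin (⟦ ιC ⟧ r′) (⟦ ιC ⟧ (ρ i)) (βsec P i) P (Sc.cls-sec i) p) (suppQ i) (evQ i))) (Ar.*-comm _ _)
            where open import Algebra.Properties.Ring Ar.ring using (x∙y⁻¹≈ε⇒x≈y)

          σA-ι : ∀ c → ⟦ σA ⟧ (⟦ ιA ⟧ c) Ar.≈ ⟦ ιA ⟧ (⟦ σ ⟧ c)
          σA-ι c = Ar.trans (σA-j _) (Hom.⟦⟧-cong jA (σC-ι c))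

          -- β P = Σ z^i σ(P_i) is multiplied by σ(r′), and r′ P_i = ρ_i P is applied inside σ. The
          -- scalars are thus κ = σ(r′) and ƛ = Σ z^i σ(ρ_i).
          eq : ⟦ ιA ⟧ (⟦ σ ⟧ r′) Ar.* ⟦ β ⟧ P Ar.≈ ⟦ ιA ⟧ (comb Z σ zᵖ ρ) Ar.* ⟦ σA ⟧ P
          eq = Ar.trans (Ar.*-cong (Ar.sym (σA-ι r′)) Sc.βP≈) (Ar.trans (Ar.sym (Sc.CA.comb-σ* (⟦ ιA ⟧ r′) (βsec P)))
            (Ar.trans (Sc.CA.comb-cong {λ i → ⟦ ιA ⟧ r′ Ar.* βsec P i} {λ i → P Ar.* ⟦ ιA ⟧ (ρ i)} prop) (Ar.trans (Sc.CA.comb-σ* P (λ i → ⟦ ιA ⟧ (ρ i)))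
              (Ar.trans (Ar.*-comm _ _) (Ar.*-congʳ (Ar.sym (comb-hom ιA σ σA zᵖ zA (λ c → Ar.sym (σA-ι c)) Ar.refl ρ)))))))

        φ-vanishes : φ P Cr.≈ Cr.0#
        φ-vanishes = Proportional.φ≈0 P p (⟦ σ ⟧ r′) (comb Z σ zᵖ ρ) (σ≉0 nz) eq

      leads : P Ar.≈ Ar.0#
      leads = go (dV._≟0 (R D (φ P)))
        where
        go : Dec (R D (φ P) Vr.≈ Vr.0#) → P Ar.≈ Ar.0#
        go (yes h) = narrow P p supp h
        go (no ne) = ⊥-elim (ne (R-zero (φ-vanishes (proj₁ nr) (proj₂ (proj₂ nr))) D))
          where
          nr = Roots.RootsDom.nonroot Z domZ (Vp.bound (R D (φ P))) (R D (φ P)) (Vp.Deg≤-bound _) ne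

    module _ (IHφ : ∀ P → Cls P → φ P Cr.≈ Cr.0# → P Ar.≈ Ar.0#) where
      -- The width is the outer induction because `kill` needs the smaller width at a larger start,
      -- D + a. The start is the inner one, for the division by a linear form.
      byWidth : ∀ W a P → Cls P → Supp a W P → P Ar.≈ Ar.0#
      byStart : ∀ W a P → Cls P → Supp a (suc W) P → P Ar.≈ Ar.0#

      -- An empty window means φ P = 0, so the degree in t or in τ is smaller than assumed, and
      -- `IHφ` takes over.
      byWidth zero a P p s = IHφ P p (allZero⇒0 (φ P) (λ e → R≈0⇒Zero e (φ P) (s e (split e))))
        where
        split : ∀ e → e < a ⊎ a ℕ.+ 0 ≤ e
        split e = go (e ℕ.<? a)
          where
          go : Dec (e < a) → e < a ⊎ a ℕ.+ 0 ≤ e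
          go (yes l) = inj₁ l
          go (no l)  = inj₂ (ℕP.≤-trans (ℕP.≤-reflexive (ℕP.+-identityʳ a)) (ℕP.≮⇒≥ l))
      byWidth (suc W) a P p s = byStart W a P p s

      byStart W zero P p s = Leading.leads W (byWidth W) 0 (λ _ ()) P p s
      byStart W (suc a) P p s = Leading.leads W (byWidth W) (suc a) (λ a′ e → ≡.subst (λ b → ∀ P → Cls P → Supp b (suc W) P → P Ar.≈ Ar.0#) (ℕP.suc-injective e) (byStart W a)) P p s

      level : ∀ P → Cls P → P Ar.≈ Ar.0#
      level P p = byWidth (VVp.bound (⟦ U.χ ⟧ (φ P))) 0 P p λ { e (inj₂ l) → VVp.coef-bound _ e l }

  open Fixed using (Cls; cls)

  Below : ℕ → Ar.Carrier → Set
  Below K P = ∀ j → K ≤ j → ∀ i → ΘC P j i Cr.≈ Cr.0#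

  byDegree : ∀ K P → rel P → Below K P → P Ar.≈ Ar.0#
  byT : ∀ K K′ P → Cls K K′ P → P Ar.≈ Ar.0#

  byDegree zero P r b = Θ-injective P (coef²-ext0 (λ j i → b j z≤n i))
  byDegree (suc K) P r b = byT K (Tp.bound (Ap.coef (⟦ Θ ⟧ P) K)) P (cls r b (λ i l → Tp.coef-bound _ i (ℕP.<⇒≤ l)))

  byT K zero P p = AtLevel.level K 0 (λ Q q h → byDegree K Q (Fixed.Cls.isRel q) (λ j l i → below Q q h j (ℕP.m≤n⇒m<n∨m≡n l) i)) P p
    where
    below : ∀ Q → Cls K 0 Q → ΘC Q K 0 Cr.≈ Cr.0# → ∀ j → K < j ⊎ K ≡ j → ∀ i → ΘC Q j i Cr.≈ Cr.0#
    below Q q h j (inj₁ l) i = Fixed.Cls.dτ q j l i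
    below Q q h j (inj₂ ≡.refl) zero = h
    below Q q h j (inj₂ ≡.refl) (suc i) = Fixed.Cls.dt q (suc i) (s≤s z≤n)
  byT K (suc K′) P p = AtLevel.level K (suc K′) (λ Q q h → byT K K′ Q (cls (Fixed.Cls.isRel q) (Fixed.Cls.dτ q) (λ i l → below Q q h i (ℕP.m≤n⇒m<n∨m≡n l)))) P p
    where
    below : ∀ Q → Cls K (suc K′) Q → ΘC Q K (suc K′) Cr.≈ Cr.0# → ∀ i → suc K′ < i ⊎ suc K′ ≡ i → ΘC Q K i Cr.≈ Cr.0#
    below Q q h i (inj₁ l) = Fixed.Cls.dt q i l
    below Q q h i (inj₂ ≡.refl) = h

  relations-trivial : ∀ P → rel P → P Ar.≈ Ar.0#
  relations-trivial P r = byDegree (Ap.bound (⟦ Θ ⟧ P)) P r (λ j l i → Tp.coef≈0 (Ap.coef-bound _ j l) i)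

-- The power series F

module Derivation (R : CRing) where
  open CommutativeRing R hiding (zero)
  open PowerSeries R
  open Sums R
  open SeriesLaws R
  open Dilation R
  module 𝕊r = CommutativeRing 𝕊

  zS : Series
  zS = zpow 1

  -- δ = z d/dz
  δ : Series → Series
  δ f n = natR n * f n

  δ-cong : ∀ {f g} → f ≋ g → δ f ≋ δ g
  δ-cong e n = *-congˡ (e n)

  δ-+ : ∀ f g → δ (f ⊕ g) ≋ (δ f ⊕ δ g)
  δ-+ f g n = distribˡ _ _ _

  δ-sub : ∀ f g → δ (f 𝕊r.- g) ≋ (δ f 𝕊r.- δ g)
  δ-sub f g n = trans (distribˡ _ _ _) (+-congˡ (sym (-‿distribʳ-* _ _)))
    where open import Algebra.Properties.Ring ring using (-‿distribʳ-*)

  δ-z* : ∀ f → δ (zS ⊙ f) ≋ ((zS ⊙ f) ⊕ (zS ⊙ δ f))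
  δ-z* f zero = trans (zeroˡ _) (sym (trans (+-cong (z*0 f) (z*0 (δ f))) (+-identityˡ _)))
  δ-z* f (suc n) = trans (distribʳ _ _ _) (+-cong (*-identityˡ _) (trans (*-congˡ (z* f n)) (sym (z* (δ f) n))))

  δ-dil : ∀ f → δ (dil f) ≋ (natR 4 · dil (δ f))
  δ-dil f = by4 _ _
    (λ k → trans (*-cong (trans (natR-* k 4) (*-comm _ _)) (at0 vs k)) (trans (*-assoc _ _ _) (*-congˡ (sym (at0 ws k)))))
    (λ k → trans (*-congˡ (at1 vs k)) (trans (zeroʳ _) (sym (trans (*-congˡ (at1 ws k)) (zeroʳ _)))))
    (λ k → trans (*-congˡ (at2 vs k)) (trans (zeroʳ _) (sym (trans (*-congˡ (at2 ws k)) (zeroʳ _)))))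
    (λ k → trans (*-congˡ (at3 vs k)) (trans (zeroʳ _) (sym (trans (*-congˡ (at3 ws k)) (zeroʳ _)))))
    where
    open Vals
    vs = dil-vals f
    ws = dil-vals (δ f)

  δ-deriv : ∀ f → δ f ≋ (zS ⊙ deriv f)
  δ-deriv f zero = trans (zeroˡ _) (sym (z*0 (deriv f)))
  δ-deriv f (suc n) = sym (z* (deriv f) n)

  zpow-dil : dil zS ≋ zpow 4
  zpow-dil 0 = refl
  zpow-dil 1 = refl
  zpow-dil 2 = refl
  zpow-dil 3 = refl
  zpow-dil (suc (suc (suc (suc n)))) = dil-1 n

  zpow-suc : ∀ k → zpow (suc k) ≋ (zS ⊙ zpow k)
  zpow-suc k zero = sym (z*0 (zpow k))
  zpow-suc k (suc n) = sym (z* (zpow k) n)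

  open import Data.Nat using (_≡ᵇ_; _%_; _/_; NonZero)
  open import Data.Bool using (if_then_else_)
  open import Data.Nat.DivMod using ([m+n]%n≡m%n; m/n≡1+[m∸n]/n)

  private
    mod≡ : ∀ k .{{_ : NonZero k}} n → (k ℕ.+ n) % k ≡ n % k
    mod≡ k n = ≡.trans (≡.cong (_% k) (ℕP.+-comm k n)) ([m+n]%n≡m%n n k)

    div≡ : ∀ k .{{_ : NonZero k}} n → (k ℕ.+ n) / k ≡ suc (n / k)
    div≡ k n = ≡.trans (m/n≡1+[m∸n]/n (ℕP.m≤m+n k n)) (≡.cong (λ m → suc (m / k)) (ℕP.m+n∸m≡n k n))

  dilate≋dil : ∀ f → dilate 4 f ≋ dil f
  dilate≋dil f 0 = refl
  dilate≋dil f 1 = refl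
  dilate≋dil f 2 = refl
  dilate≋dil f 3 = refl
  dilate≋dil f (suc (suc (suc (suc n)))) = trans (reflexive (≡.cong₂ (λ a b → if a ≡ᵇ 0 then f b else 0#) (mod≡ 4 n) (div≡ 4 n))) (dilate≋dil (tail f) n)

  dilate16≋dil : ∀ f → dilate 16 f ≋ dil (dil f)
  dilate16≋dil f 0 = refl
  dilate16≋dil f 1 = refl
  dilate16≋dil f 2 = refl
  dilate16≋dil f 3 = refl
  dilate16≋dil f 4 = refl
  dilate16≋dil f 5 = refl
  dilate16≋dil f 6 = refl
  dilate16≋dil f 7 = refl
  dilate16≋dil f 8 = refl
  dilate16≋dil f 9 = refl
  dilate16≋dil f 10 = refl
  dilate16≋dil f 11 = refl
  dilate16≋dil f 12 = refl
  dilate16≋dil f 13 = refl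
  dilate16≋dil f 14 = refl
  dilate16≋dil f 15 = refl
  dilate16≋dil f (suc (suc (suc (suc (suc (suc (suc (suc (suc (suc (suc (suc (suc (suc (suc (suc n)))))))))))))))) =
    trans (reflexive (≡.cong₂ (λ a b → if a ≡ᵇ 0 then f b else 0#) (mod≡ 16 n) (div≡ 16 n))) (dilate16≋dil (tail f) n)

module DerivationIdentities (R : CRing) where
  open CommutativeRing R
  open Sums R using (module Solver)
  open PowerSeries R using (intR)
  open Solver

  expand-p : ∀ z f → (1# + (z + z * z)) * f ≈ f + (z * f + z * (z * f))
  expand-p z f = trans (distribʳ f 1# _) (+-cong (*-identityˡ f) (solve 2 (λ z f → (z :+ z :* z) :* f := z :* f :+ z :* (z :* f)) refl z f))

  collect-p : ∀ z f d → d + ((z * f + z * d) + (z * (z * f) + z * (z * f + z * d))) ≈ (z + intR (+ 2) * (z * z)) * f + (1# + (z + z * z)) * d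
  collect-p z f d = trans (solve 3 (λ z f d → d :+ ((z :* f :+ z :* d) :+ (z :* (z :* f) :+ z :* (z :* f :+ z :* d))) := (z :+ con (+ 2) :* (z :* z)) :* f :+ (d :+ (z :+ z :* z) :* d)) refl z f d)
    (+-congˡ (sym (trans (distribʳ d 1# _) (+-congʳ (*-identityˡ d)))))

  expand-z⁴ : ∀ z f → (z * (z * (z * z))) * f ≈ z * (z * (z * (z * f)))
  expand-z⁴ z f = solve 2 (λ z f → (z :* (z :* (z :* z))) :* f := z :* (z :* (z :* (z :* f)))) refl z f

  collect-z⁴ : ∀ z f d → z * (z * (z * (z * f))) + z * (z * (z * (z * f)) + z * (z * (z * f) + z * (z * f + z * d))) ≈ intR (+ 4) * ((z * (z * (z * z))) * f) + (z * (z * (z * z))) * d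
  collect-z⁴ z f d = solve 3 (λ z f d → z :* (z :* (z :* (z :* f))) :+ z :* (z :* (z :* (z :* f)) :+ z :* (z :* (z :* f) :+ z :* (z :* f :+ z :* d))) := con (+ 4) :* ((z :* (z :* (z :* z))) :* f) :+ (z :* (z :* (z :* z))) :* d) refl z f d

𝕊 : CRing
𝕊 = ZD.𝕊
module Sr = CommutativeRing 𝕊
module Ss = Sums 𝕊
module ZΔ = Derivation ℤring

numS : ∀ i → ⟦ ZD.ζ ⟧ (Zp.K i) Sr.≈ PowerSeries.intR 𝕊 i
numS i = Sr.trans (Hom.⟦⟧-cong (ZD.ζ ∘H Zp.KHom) (≡.sym (intR-ℤ i))) (Hom.intR-homo (ZD.ζ ∘H Zp.KHom) i)

module Solution (F : ℕ → ℤ) (isF : IsF F) where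
  open PowerSeries ℤring using (zpow; _⊕_)
  open ZD using (dil; σS; ζ; dil-cong)
  open ZΔ using (δ; zS; δ-cong; δ-+; δ-sub; δ-z*; δ-dil)
  open import Relation.Binary.Reasoning.Setoid Sr.setoid
  module Id = DerivationIdentities 𝕊
  module σS = Hom σS
  module ζ = Hom ζ

  G E s pS δpS : Sr.Carrier
  G = dil F
  E = δ F
  s = dil zS
  pS = ⟦ ζ ⟧ pᵖ
  δpS = ⟦ ζ ⟧ δpᵖ

  n4 : Sr.Carrier
  n4 = PowerSeries.intR 𝕊 (+ 4)

  pS≈ : pS Sr.≈ Sr.1# Sr.+ (zS Sr.+ zS Sr.* zS)
  pS≈ = Sr.trans (ζ.+-homo _ _) (Sr.+-cong ζ.1-homo (Sr.trans (ζ.+-homo _ _) (Sr.+-cong Zp.coef-X (Sr.trans (ζ.*-homo _ _) (Sr.*-cong {x = Zp.coef Zp.X} Zp.coef-X Zp.coef-X)))))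

  δpS≈ : δpS Sr.≈ zS Sr.+ PowerSeries.intR 𝕊 (+ 2) Sr.* (zS Sr.* zS)
  δpS≈ = Sr.trans (ζ.+-homo _ _) (Sr.+-cong Zp.coef-X (Sr.trans (ζ.*-homo _ _) (Sr.*-cong {x = Zp.coef (Zp.K (+ 2))} (numS (+ 2)) (Sr.trans (ζ.*-homo _ _) (Sr.*-cong {x = Zp.coef Zp.X} Zp.coef-X Zp.coef-X)))))

  s≈ : s Sr.≈ zS Sr.* (zS Sr.* (zS Sr.* zS))
  s≈ = Sr.trans ZΔ.zpow-dil (Sr.trans (ZΔ.zpow-suc 3) (Sr.*-congˡ {zS} (Sr.trans (ZΔ.zpow-suc 2) (Sr.*-congˡ {zS} (ZΔ.zpow-suc 1)))))

  F-eq : F Sr.≈ pS Sr.* G Sr.- s Sr.* dil G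
  F-eq = Sr.trans (proj₂ isF) (Sr.+-cong
      (Sr.*-cong {x = (zpow 0 ⊕ zpow 1) ⊕ zpow 2} (Sr.trans (Sr.+-assoc (zpow 0) (zpow 1) (zpow 2)) (Sr.trans (Sr.+-congˡ {zpow 0} (Sr.+-congˡ {zpow 1} (ZΔ.zpow-suc 1))) (Sr.sym pS≈))) (ZΔ.dilate≋dil F))
      (Sr.-‿cong (Sr.*-cong {x = zpow 4} (Sr.sym ZΔ.zpow-dil) (ZΔ.dilate16≋dil F))))

  δdil : ∀ f → δ (dil f) Sr.≈ n4 Sr.* dil (δ f)
  δdil f = Sr.trans (δ-dil f) (λ n → ≡.trans (≡.sym (SeriesLaws.⊙-const ℤring (+ 4) (dil (δ f)) n)) (Sr.*-congʳ {dil (δ f)} cn n))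
    where
    cn : SeriesLaws.const ℤring (+ 4) Sr.≈ n4
    cn = Sr.trans (λ { zero → ≡.sym (Zp.coef-K0 (+ 4)) ; (suc n) → ≡.sym (Zp.coef-Ksuc (+ 4) n) }) (numS (+ 4))

  δ-p* : ∀ f → δ (pS Sr.* f) Sr.≈ δpS Sr.* f Sr.+ pS Sr.* δ f
  δ-p* f = begin
    δ (pS Sr.* f)
      ≈⟨ δ-cong (Sr.trans (Sr.*-congʳ {f} pS≈) (Id.expand-p zS f)) ⟩
    δ (f Sr.+ (zS Sr.* f Sr.+ zS Sr.* (zS Sr.* f)))
      ≈⟨ Sr.trans (δ-+ f _) (Sr.+-congˡ {δ f} (Sr.trans (δ-+ (zS Sr.* f) _) (Sr.+-cong (δ-z* f) (Sr.trans (δ-z* (zS Sr.* f)) (Sr.+-congˡ {zS Sr.* (zS Sr.* f)} (Sr.*-congˡ {zS} (δ-z* f))))))) ⟩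
    δ f Sr.+ ((zS Sr.* f Sr.+ zS Sr.* δ f) Sr.+ (zS Sr.* (zS Sr.* f) Sr.+ zS Sr.* (zS Sr.* f Sr.+ zS Sr.* δ f)))
      ≈⟨ Id.collect-p zS f (δ f) ⟩
    (zS Sr.+ PowerSeries.intR 𝕊 (+ 2) Sr.* (zS Sr.* zS)) Sr.* f Sr.+ (Sr.1# Sr.+ (zS Sr.+ zS Sr.* zS)) Sr.* δ f
      ≈⟨ Sr.+-cong (Sr.*-congʳ {f} δpS≈) (Sr.*-congʳ {δ f} pS≈) ⟨
    δpS Sr.* f Sr.+ pS Sr.* δ f ∎

  δ-s* : ∀ f → δ (s Sr.* f) Sr.≈ n4 Sr.* (s Sr.* f) Sr.+ s Sr.* δ f
  δ-s* f = begin
    δ (s Sr.* f) ≈⟨ δ-cong (Sr.trans (Sr.*-congʳ {f} s≈) (Id.expand-z⁴ zS f)) ⟩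
    δ (zS Sr.* (zS Sr.* (zS Sr.* (zS Sr.* f))))
      ≈⟨ Sr.trans (δ-z* (zS Sr.* (zS Sr.* (zS Sr.* f)))) (Sr.+-congˡ {zS Sr.* (zS Sr.* (zS Sr.* (zS Sr.* f)))} (Sr.*-congˡ {zS} (Sr.trans (δ-z* (zS Sr.* (zS Sr.* f))) (Sr.+-congˡ {zS Sr.* (zS Sr.* (zS Sr.* f))} (Sr.*-congˡ {zS} (Sr.trans (δ-z* (zS Sr.* f)) (Sr.+-congˡ {zS Sr.* (zS Sr.* f)} (Sr.*-congˡ {zS} (δ-z* f))))))))) ⟩
    zS Sr.* (zS Sr.* (zS Sr.* (zS Sr.* f))) Sr.+ zS Sr.* (zS Sr.* (zS Sr.* (zS Sr.* f)) Sr.+ zS Sr.* (zS Sr.* (zS Sr.* f) Sr.+ zS Sr.* (zS Sr.* f Sr.+ zS Sr.* δ f)))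
      ≈⟨ Id.collect-z⁴ zS f (δ f) ⟩
    n4 Sr.* ((zS Sr.* (zS Sr.* (zS Sr.* zS))) Sr.* f) Sr.+ (zS Sr.* (zS Sr.* (zS Sr.* zS))) Sr.* δ f
      ≈⟨ Sr.+-cong (Sr.*-congˡ {n4} (Sr.*-congʳ {f} s≈)) (Sr.*-congʳ {δ f} s≈) ⟨
    n4 Sr.* (s Sr.* f) Sr.+ s Sr.* δ f ∎

  -- `F-eq` differentiated. Factors 4 arise from δσ = 4σδ, twice for the second dilation, and from
  -- δ(z⁴) = 4 z⁴.
  E-eq : E Sr.≈ (δpS Sr.* G Sr.+ pS Sr.* (n4 Sr.* dil E)) Sr.- (n4 Sr.* (s Sr.* dil G) Sr.+ s Sr.* (n4 Sr.* (n4 Sr.* dil (dil E))))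
  E-eq = begin
    δ F ≈⟨ δ-cong F-eq ⟩
    δ (pS Sr.* G Sr.- s Sr.* dil G) ≈⟨ δ-sub (pS Sr.* G) (s Sr.* dil G) ⟩
    δ (pS Sr.* G) Sr.- δ (s Sr.* dil G) ≈⟨ Sr.+-cong (δ-p* G) (Sr.-‿cong (δ-s* (dil G))) ⟩
    (δpS Sr.* G Sr.+ pS Sr.* δ G) Sr.- (n4 Sr.* (s Sr.* dil G) Sr.+ s Sr.* δ (dil G))
      ≈⟨ Sr.+-cong (Sr.+-congˡ {δpS Sr.* G} (Sr.*-congˡ {pS} (δdil F)))
          (Sr.-‿cong (Sr.+-congˡ {n4 Sr.* (s Sr.* dil G)} (Sr.*-congˡ {s} (Sr.trans (δdil G) (Sr.*-congˡ {n4} (Sr.trans (dil-cong (δdil F)) (Sr.trans (σS.*-homo n4 (dil E)) (Sr.*-congʳ {dil (dil E)} (σS.intR-homo (+ 4))))))))))  ⟩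
    _ ∎

-- What the argument uses of ℤ[[z]] and F; E stands for z F′.
record Model : Set₁ where
  field
    S   : CRing
    σ′  : Hom S S
    ζ   : Hom Z S
  open CommutativeRing S
  field
    secS  : Sections S σ′ (⟦ ζ ⟧ zᵖ)
    ζσ    : ∀ q → ⟦ ζ ⟧ (⟦ σ ⟧ q) ≈ ⟦ σ′ ⟧ (⟦ ζ ⟧ q)
    ζ-inj : ∀ q → ⟦ ζ ⟧ q ≈ 0# → q Zr.≈ Zr.0#
    F E   : Carrier
    F-eq  : F ≈ ⟦ ζ ⟧ pᵖ * ⟦ σ′ ⟧ F - ⟦ σ′ ⟧ (⟦ ζ ⟧ zᵖ) * ⟦ σ′ ⟧ (⟦ σ′ ⟧ F)
    E-eq  : E ≈ (⟦ ζ ⟧ δpᵖ * ⟦ σ′ ⟧ F + ⟦ ζ ⟧ pᵖ * (⟦ ζ ⟧ four * ⟦ σ′ ⟧ E))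
                - (⟦ ζ ⟧ four * (⟦ σ′ ⟧ (⟦ ζ ⟧ zᵖ) * ⟦ σ′ ⟧ (⟦ σ′ ⟧ F)) + ⟦ σ′ ⟧ (⟦ ζ ⟧ zᵖ) * (⟦ ζ ⟧ four * (⟦ ζ ⟧ four * ⟦ σ′ ⟧ (⟦ σ′ ⟧ E))))
    line  : ∀ k f → (⟦ ζ ⟧ zᵖ * ⟦ σ′ ⟧ F - ⟦ ζ ⟧ (PowerSeries.natR Z k) * F) * f ≈ 0# → f ≈ 0#

module Evaluation (M : Model) where
  open Model M
  open CommutativeRing S
  open Sums S using (module Solver)
  open Solver
  private
    module σ′ = Hom σ′
    module ζ = Hom ζ

  z f4 p δp s G : Carrier
  z = ⟦ ζ ⟧ zᵖ
  f4 = ⟦ ζ ⟧ four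
  p = ⟦ ζ ⟧ pᵖ
  δp = ⟦ ζ ⟧ δpᵖ
  s = ⟦ σ′ ⟧ z
  G = ⟦ σ′ ⟧ F

  -- A `Model` has no derivation, so 4δ(z σF) is written out by the product rule and δσ = 4σδ; this
  -- gives the two summands of `Y′`.
  X Y X′ Y′ : Carrier
  X = F
  Y = z * G
  X′ = f4 * E
  Y′ = f4 * Y + f4 * (f4 * (z * ⟦ σ′ ⟧ E))

  module evC = LiftC ζ X Y
  module ev = LiftA evC.liftC Y′ X′
  eval : Hom A S
  eval = ev.liftA

  module evσC = LiftC ζ (⟦ σ′ ⟧ X) (⟦ σ′ ⟧ Y)
  module evσ = LiftA evσC.liftC (⟦ σ′ ⟧ Y′) (⟦ σ′ ⟧ X′)
  evalσ : Hom A S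
  evalσ = evσ.liftA

  private
    module eσ = Hom evalσ

    eσ-ι : ∀ q → ⟦ evalσ ⟧ (⟦ ιA ⟧ q) ≈ ⟦ ζ ⟧ q
    eσ-ι q = trans (evσ.liftA-j _) (evσC.liftC-ι q)

    σ′4 : ⟦ σ′ ⟧ f4 ≈ f4
    σ′4 = trans (sym (ζσ four)) (ζ.⟦⟧-cong σ4)
      where
      σ4 : ⟦ σ ⟧ four Zr.≈ four
      σ4 = ℤ-hom-unique (σ ∘H Zp.KHom) Zp.KHom (+ 4)

    σY : ⟦ σ′ ⟧ Y ≈ s * ⟦ σ′ ⟧ G
    σY = σ′.*-homo _ _

    σX′ : ⟦ σ′ ⟧ X′ ≈ f4 * ⟦ σ′ ⟧ E
    σX′ = trans (σ′.*-homo _ _) (*-congʳ σ′4)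

    σY′ : ⟦ σ′ ⟧ Y′ ≈ f4 * (s * ⟦ σ′ ⟧ G) + f4 * (f4 * (s * ⟦ σ′ ⟧ (⟦ σ′ ⟧ E)))
    σY′ = trans (σ′.+-homo _ _) (+-cong (trans (σ′.*-homo _ _) (*-cong σ′4 σY)) (trans (σ′.*-homo _ _) (*-cong σ′4 (trans (σ′.*-homo _ _) (*-cong σ′4 (σ′.*-homo _ _))))))

    evσC-d : ⟦ evσC.liftC ⟧ dC′ ≈ X
    evσC-d = trans (Hom.sub-homo evσC.liftC _ _) (trans (+-cong (trans (Hom.*-homo evσC.liftC _ _) (*-cong (evσC.liftC-ι pᵖ) evσC.liftC-x)) (-‿cong (trans evσC.liftC-y σY))) (sym F-eq))

    evσC-zx : ⟦ evσC.liftC ⟧ zxC ≈ Y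
    evσC-zx = trans (Hom.*-homo evσC.liftC _ _) (*-cong (evσC.liftC-ι zᵖ) evσC.liftC-x)

    onC : ∀ c → ⟦ evC.liftC ⟧ c ≈ ⟦ evσC.liftC ⟧ (⟦ α ⟧ c)
    onC = extC evC.liftC (evσC.liftC ∘H α)
      (λ q → trans (evC.liftC-ι q) (sym (trans (Hom.⟦⟧-cong evσC.liftC (αL.liftC-ι q)) (evσC.liftC-ι q))))
      (trans evC.liftC-x (sym (trans (Hom.⟦⟧-cong evσC.liftC αL.liftC-x) evσC-d)))
      (trans evC.liftC-y (sym (trans (Hom.⟦⟧-cong evσC.liftC αL.liftC-y) evσC-zx)))

    on-t : Y′ ≈ ⟦ evalσ ⟧ yβ
    on-t = sym (trans (eσ.*-homo _ _) (trans (*-cong (trans (evσ.liftA-j _) (trans (Hom.*-homo evσC.liftC _ _) (*-cong (evσC.liftC-ι four) (evσC.liftC-ι zᵖ))))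
        (trans (eσ.+-homo _ _) (+-cong (trans (evσ.liftA-j xC) evσC.liftC-x) (trans evσ.liftA-τ σX′))))
      (solve 4 (λ f z g e → (f :* z) :* (g :+ f :* e) := f :* (z :* g) :+ f :* (f :* (z :* e))) refl f4 z G (⟦ σ′ ⟧ E))))

    on-τ : X′ ≈ ⟦ evalσ ⟧ xβ
    on-τ = sym (trans (eσ.sub-homo _ _) (trans (+-cong
        (trans (eσ.+-homo _ _) (+-cong (trans (evσ.liftA-j _) (trans (Hom.*-homo evσC.liftC _ _) (*-cong (evσC.liftC-ι four) (trans (Hom.*-homo evσC.liftC _ _) (*-cong (evσC.liftC-ι δpᵖ) evσC.liftC-x)))))
          (trans (eσ.*-homo _ _) (*-cong (trans (evσ.liftA-j _) (trans (Hom.*-homo evσC.liftC _ _) (*-cong (evσC.liftC-ι four) (evσC.liftC-ι pᵖ)))) (trans evσ.liftA-τ σX′)))))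
        (-‿cong (trans (eσ.*-homo _ _) (*-cong (trans (evσ.liftA-j 4C) (evσC.liftC-ι four)) (trans evσ.liftA-t σY′)))))
      (trans (combine f4 (δp * G) p (⟦ σ′ ⟧ E) (s * ⟦ σ′ ⟧ G) (s * ⟦ σ′ ⟧ (⟦ σ′ ⟧ E))) (*-congˡ (trans (+-congˡ (-‿cong (+-congˡ (swap f4 s (⟦ σ′ ⟧ (⟦ σ′ ⟧ E)))))) (sym E-eq))))))
      where
      combine : ∀ f a p e b c → (f * a + (f * p) * (f * e)) - f * (f * b + f * (f * c)) ≈ f * ((a + p * (f * e)) - (f * b + f * (f * c)))
      combine = solve 6 (λ f a p e b c → (f :* a :+ (f :* p) :* (f :* e)) :- f :* (f :* b :+ f :* (f :* c)) := f :* ((a :+ p :* (f :* e)) :- (f :* b :+ f :* (f :* c)))) refl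
      swap : ∀ f s e → f * (f * (s * e)) ≈ s * (f * (f * e))
      swap = solve 3 (λ f s e → f :* (f :* (s :* e)) := s :* (f :* (f :* e))) refl

  eval-β : ∀ P → ⟦ eval ⟧ P ≈ ⟦ evalσ ⟧ (⟦ β ⟧ P)
  eval-β = extA eval (evalσ ∘H β)
    (λ c → trans (ev.liftA-j c) (trans (onC c) (sym (trans (eσ.⟦⟧-cong (βL.liftA-j c)) (evσ.liftA-j _)))))
    (trans ev.liftA-t (trans on-t (sym (eσ.⟦⟧-cong βL.liftA-t))))
    (trans ev.liftA-τ (trans on-τ (sym (eσ.⟦⟧-cong βL.liftA-τ))))

  eval-σ : ∀ P → ⟦ evalσ ⟧ (⟦ σA ⟧ P) ≈ ⟦ σ′ ⟧ (⟦ eval ⟧ P)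
  eval-σ = extA (evalσ ∘H σA) (σ′ ∘H eval)
    (λ c → trans (eσ.⟦⟧-cong (σA-j c)) (trans (evσ.liftA-j _) (trans (onσ c) (sym (σ′.⟦⟧-cong (ev.liftA-j c))))))
    (trans (eσ.⟦⟧-cong σA-t) (trans evσ.liftA-t (sym (σ′.⟦⟧-cong ev.liftA-t))))
    (trans (eσ.⟦⟧-cong (map-X σT)) (trans evσ.liftA-τ (sym (σ′.⟦⟧-cong ev.liftA-τ))))
    where
    onσ : ∀ c → ⟦ evσC.liftC ⟧ (⟦ σC ⟧ c) ≈ ⟦ σ′ ⟧ (⟦ evC.liftC ⟧ c)
    onσ = extC (evσC.liftC ∘H σC) (σ′ ∘H evC.liftC)
      (λ q → trans (Hom.⟦⟧-cong evσC.liftC (σC-ι q)) (trans (evσC.liftC-ι _) (trans (ζσ q) (sym (σ′.⟦⟧-cong (evC.liftC-ι q))))))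
      (trans (Hom.⟦⟧-cong evσC.liftC σC-x) (trans evσC.liftC-x (sym (σ′.⟦⟧-cong evC.liftC-x))))
      (trans (Hom.⟦⟧-cong evσC.liftC σC-y) (trans evσC.liftC-y (sym (σ′.⟦⟧-cong evC.liftC-y))))

  eval-comb : ∀ Q → ⟦ evalσ ⟧ (comb A σA zA Q) ≈ comb S σ′ z (λ i → ⟦ eval ⟧ (Q i))
  eval-comb Q = step (step (step (eval-σ _)))
    where
    step : ∀ {x y w} → ⟦ evalσ ⟧ y ≈ w → ⟦ evalσ ⟧ (⟦ σA ⟧ x Ar.+ zA Ar.* y) ≈ ⟦ σ′ ⟧ (⟦ eval ⟧ x) + z * w
    step e = trans (eσ.+-homo _ _) (+-cong (eval-σ _) (trans (eσ.*-homo _ _) (*-cong (eσ-ι zᵖ) e)))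

  relations : IsRelations (λ P → ⟦ eval ⟧ P ≈ 0#)
  relations = record
    { rel-sub = λ h h′ → trans (Hom.sub-homo eval _ _) (trans (+-cong h (-‿cong h′)) (-‿inverseʳ 0#))
    ; rel-mul = λ Q h → trans (Hom.*-homo eval _ _) (trans (*-congˡ h) (zeroʳ _))
    ; rel-line = λ k {P} {Q} h e → line k (⟦ eval ⟧ P) (trans (*-congʳ (sym (ev-ℓ k))) (trans (sym (Hom.*-homo eval _ _)) (trans (sym (Hom.⟦⟧-cong eval e)) h)))
    ; rel-sec = λ {P} h i → Sections.sec-uniq secS (λ i → ⟦ eval ⟧ (βsec P i)) (trans (sym (eval-comb (βsec P))) (trans (eσ.⟦⟧-cong (Ar.sym (Sections.sec-comb secA _))) (trans (sym (eval-β P)) h))) i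
    ; rel-const = λ q h e → ζ-inj q (trans (sym (trans (ev.liftA-j _) (evC.liftC-ι q))) (trans (sym (Hom.⟦⟧-cong eval e)) h)) }
    where
    ev-ℓ : ∀ k → ⟦ eval ⟧ (⟦ jA ⟧ (ℓC (PowerSeries.natR Z k))) ≈ z * G - ⟦ ζ ⟧ (PowerSeries.natR Z k) * F
    ev-ℓ k = trans (ev.liftA-j _) (trans (Hom.sub-homo evC.liftC _ _) (+-cong evC.liftC-y (-‿cong (trans (Hom.⟦⟧-cong evC.liftC (Hom.*-homo Cp.KHom _ _)) (trans (Hom.*-homo evC.liftC _ _) (*-cong (evC.liftC-ι _) evC.liftC-x))))))

  no-relations : ∀ P → ⟦ eval ⟧ P ≈ 0# → P Ar.≈ Ar.0#
  no-relations = MainTheorem.relations-trivial (λ P → ⟦ eval ⟧ P ≈ 0#) relations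

module SeriesCancel where
  open PowerSeries ℤring using (Series; _⊙_)
  open SeriesLaws ℤring
  open ≡ using (trans; sym; cong)

  -- The constant term of h need not be invertible in ℤ. Being nonzero it still forces f(0) = 0, and
  -- the argument is repeated for the tail of f.
  cancel-unit : ∀ (h f : Series) → ¬ h 0 ≡ + 0 → (∀ n → (h ⊙ f) n ≡ + 0) → ∀ n → f n ≡ + 0
  cancel-unit h f h0 e = go
    where
    f0 : f 0 ≡ + 0
    f0 = Dom.cancel0 ℤ-dom h0 (trans (sym (⊙-zero h f)) (e 0))
    e′ : ∀ n → (h ⊙ tail f) n ≡ + 0
    e′ n = trans (sym (ℤP.+-identityʳ _)) (trans (cong (λ u → (h ⊙ tail f) n ℤ.+ u) (sym (trans (cong (λ u → h (suc n) ℤ.* u) f0) (ℤP.*-zeroʳ (h (suc n)))))) (trans (sym (⊙-sucʳ h f n)) (e (suc n))))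
    go : ∀ n → f n ≡ + 0
    go zero    = f0
    go (suc n) = cancel-unit h (tail f) h0 e′ n

  cancel-z : ∀ (h f : Series) → h 0 ≡ + 0 → (∀ n → (h ⊙ f) n ≡ + 0) → ∀ n → (tail h ⊙ f) n ≡ + 0
  cancel-z h f h0 e n = trans (sym (ℤP.+-identityˡ _)) (trans (cong (λ u → u ℤ.+ (tail h ⊙ f) n) (sym (cong (λ u → u ℤ.* f (suc n)) h0))) (trans (sym (⊙-suc h f n)) (e (suc n))))

Sections-cong : {R : CRing} {σ : Hom R R} {z z′ : CommutativeRing.Carrier R} → CommutativeRing._≈_ R z z′ → Sections R σ z → Sections R σ z′
Sections-cong {R} {σ} {z} {z′} e S = record
  { sec = sec
  ; sec-comb = λ x → trans (sec-comb x) (comb≈ (sec x))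
  ; sec-uniq = λ s h → sec-uniq s (trans (comb≈ s) h) }
  where
  open CommutativeRing R
  open Sections S
  comb≈ : ∀ s → comb R σ z s ≈ comb R σ z′ s
  comb≈ s = +-congˡ (*-cong e (+-congˡ (*-cong e (+-congˡ (*-congʳ e)))))

module SeriesModel (F : ℕ → ℤ) (isF : IsF F) where
  open Solution F isF
  open SeriesCancel
  open ZD using (dil; σS; ζ)
  open ZΔ using (zS)
  open SeriesLaws ℤring using (tail; ⊙-zero)

  zζ : ⟦ ζ ⟧ zᵖ Sr.≈ zS
  zζ = Zp.coef-X

  4ζ : ⟦ ζ ⟧ four Sr.≈ n4
  4ζ = numS (+ 4)

  sζ : dil (⟦ ζ ⟧ zᵖ) Sr.≈ s
  sζ = ZD.dil-cong zζ

  -- The constant term of z G - k F is -k, which settles k > 0. For k = 0 one factor z is removed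
  -- first, and the constant term becomes F(0) = 1.
  line : ∀ k f → (⟦ ζ ⟧ zᵖ Sr.* G Sr.- ⟦ ζ ⟧ (PowerSeries.natR Z k) Sr.* F) Sr.* f Sr.≈ Sr.0# → f Sr.≈ Sr.0#
  line k f e = go k h0 h1 e
    where
    nat0 : ∀ k n → ⟦ ζ ⟧ (PowerSeries.natR Z k) n ≡ PowerSeries.natR 𝕊 k n
    nat0 k = Hom.natR-homo ζ k
    natS : ∀ k → PowerSeries.natR 𝕊 k 0 ≡ + k
    natS zero    = ≡.refl
    natS (suc k) = ≡.cong (ℤ._+_ (+ 1)) (natS k)
    natS0 : ∀ n → PowerSeries.natR 𝕊 0 n ≡ + 0
    natS0 n = ≡.refl
    h : ℕ → ℕ → ℤ
    h k = ⟦ ζ ⟧ zᵖ Sr.* G Sr.- ⟦ ζ ⟧ (PowerSeries.natR Z k) Sr.* F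
    h0 : ∀ k → h k 0 ≡ ℤ.- (+ k)
    h0 k = ≡.trans (≡.cong₂ (λ a b → a ℤ.+ ℤ.- b)
      (≡.trans (⊙-zero (⟦ ζ ⟧ zᵖ) G) (≡.cong (λ u → u ℤ.* G 0) (zζ 0)))
      (≡.trans (⊙-zero (⟦ ζ ⟧ (PowerSeries.natR Z k)) F) (≡.trans (≡.cong₂ ℤ._*_ (≡.trans (nat0 k 0) (natS k)) (proj₁ isF)) (ℤP.*-identityʳ (+ k)))))
      (ℤP.+-identityˡ (ℤ.- (+ k)))
    h1 : h 0 1 ≡ + 1
    h1 = ≡.cong₂ (λ a b → a ℤ.+ ℤ.- b) z1 (Sr.trans (Sr.*-congʳ {F} (Sr.trans (nat0 0) natS0)) (Sr.zeroˡ F) 1)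
      where
      z1 : (⟦ ζ ⟧ zᵖ Sr.* G) 1 ≡ + 1
      z1 = ≡.trans (Sr.*-congʳ {G} zζ 1) (≡.trans (ZD.z* G 0) (proj₁ isF))
    go : ∀ k → (∀ k → h k 0 ≡ ℤ.- (+ k)) → h 0 1 ≡ + 1 → h k Sr.* f Sr.≈ Sr.0# → f Sr.≈ Sr.0#
    go zero    a b e = cancel-unit (tail (h 0)) f (λ q → one≢ (≡.trans (≡.sym b) q)) (cancel-z (h 0) f (a 0) e)
      where
      one≢ : ¬ (+ 1 ≡ + 0)
      one≢ ()
    go (suc k) a b e = cancel-unit (h (suc k)) f (λ q → neg≢ (≡.trans (≡.sym (a (suc k))) q)) e
      where
      neg≢ : ¬ (ℤ.- (+ suc k) ≡ + 0)
      neg≢ ()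

  model : Model
  model = record
    { S = 𝕊 ; σ′ = σS ; ζ = ζ
    ; secS = Sections-cong {𝕊} {σS} {zS} {⟦ ζ ⟧ zᵖ} (Sr.sym zζ) ZD.seriesSections
    ; ζσ = ZD.coef-σ
    ; ζ-inj = λ q → Zp.ext0 {q}
    ; F = F ; E = E
    ; F-eq = Sr.trans F-eq (Sr.+-congˡ {pS Sr.* G} (Sr.-‿cong {s Sr.* dil G} (Sr.*-congʳ {dil G} (Sr.sym sζ))))
    ; E-eq = Sr.trans E-eq (Sr.+-cong (Sr.+-congˡ {δpS Sr.* G} (Sr.*-congˡ {pS} (Sr.*-congʳ {dil E} (Sr.sym 4ζ))))
        (Sr.-‿cong (Sr.+-cong (Sr.*-cong {n4} (Sr.sym 4ζ) (Sr.*-congʳ {dil G} (Sr.sym sζ)))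
          (Sr.*-cong {s} (Sr.sym sζ) (Sr.*-cong {n4} (Sr.sym 4ζ) (Sr.*-congʳ {dil (dil E)} (Sr.sym 4ζ)))))))
    ; line = line }

-- Zero estimate and descent to the integers

module RowReduction {c ℓ : Level} (R : CommutativeRing c ℓ) where
  open CommutativeRing R hiding (zero)
  open PowerSeries R using (Σ<)
  open Sums R

  row : ℕ → (ℕ → ℕ → Carrier) → (ℕ → Carrier) → ℕ → Carrier
  row N a x n = Σ< N (λ j → a n j * x j)

  -- Fraction-free elimination of the first unknown by the pivot row n₀, so the matrix stays
  -- integral.
  reduce : (ℕ → ℕ → Carrier) → ℕ → ℕ → ℕ → Carrier
  reduce a n₀ n j = a n₀ 0 * a n (suc j) - a n 0 * a n₀ (suc j)

  drop-zero : ∀ N a x n → a n 0 ≈ 0# → row (suc N) a x n ≈ row N (λ n j → a n (suc j)) (λ j → x (suc j)) n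
  drop-zero N a x n e = trans (Σ-first N (λ j → a n j * x j)) (trans (+-congʳ (trans (*-congʳ e) (zeroˡ _))) (+-identityˡ _))

  row-reduce : ∀ N a x n₀ n → row N (reduce a n₀) (λ j → x (suc j)) n ≈ a n₀ 0 * row (suc N) a x n - a n 0 * row (suc N) a x n₀
  row-reduce N a x n₀ n = trans (linear N (a n₀ 0) (a n 0) (λ j → a n (suc j)) (λ j → a n₀ (suc j)) (λ j → x (suc j)))
    (trans (collect (a n₀ 0) (a n 0) (x 0) _ _) (sym (+-cong (*-congˡ (Σ-first N (λ j → a n j * x j))) (-‿cong (*-congˡ (Σ-first N (λ j → a n₀ j * x j)))))))
    where
    open Solver
    step : ∀ p q s t u v c → (p * s - q * t) + (p * u - q * v) * c ≈ p * (s + u * c) - q * (t + v * c)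
    step = solve 7 (λ p q x y u v c → (p :* x :- q :* y) :+ (p :* u :- q :* v) :* c := p :* (x :+ u :* c) :- q :* (y :+ v :* c)) refl
    linear : ∀ N p q (u v x : ℕ → Carrier) → Σ< N (λ j → (p * u j - q * v j) * x j) ≈ p * Σ< N (λ j → u j * x j) - q * Σ< N (λ j → v j * x j)
    linear zero    p q u v x = solve 2 (λ p q → con (+ 0) := p :* con (+ 0) :- q :* con (+ 0)) refl p q
    linear (suc N) p q u v x = trans (+-congʳ (linear N p q u v x)) (step p q _ _ (u N) (v N) (x N))
    collect : ∀ p q c x y → p * x - q * y ≈ p * (q * c + x) - q * (p * c + y)
    collect = solve 5 (λ p q c x y → p :* x :- q :* y := p :* (q :* c :+ x) :- q :* (p :* c :+ y)) refl

  reduce-vanish : ∀ N a x n₀ n → row (suc N) a x n ≈ 0# → row (suc N) a x n₀ ≈ 0# → row N (reduce a n₀) (λ j → x (suc j)) n ≈ 0#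
  reduce-vanish N a x n₀ n e e₀ = trans (row-reduce N a x n₀ n) (trans (+-cong (*-congˡ e) (-‿cong (*-congˡ e₀)))
    (let open Solver in solve 2 (λ p q → p :* con (+ 0) :- q :* con (+ 0) := con (+ 0)) refl (a n₀ 0) (a n 0)))

  reduce-vanish⁻¹ : ∀ N a x n₀ n → row N (reduce a n₀) (λ j → x (suc j)) n ≈ 0# → row (suc N) a x n₀ ≈ 0# → a n₀ 0 * row (suc N) a x n ≈ 0#
  reduce-vanish⁻¹ N a x n₀ n e e₀ = trans (trans (let open Solver in solve 2 (λ u q → u := u :- q :* con (+ 0)) refl (a n₀ 0 * row (suc N) a x n) (a n 0)) (+-congˡ (-‿cong (*-congˡ (sym e₀)))))
    (trans (sym (row-reduce N a x n₀ n)) e)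

module ℤRows = RowReduction ℤring

find≢0 : ∀ M (a : ℕ → ℤ) → (∀ n → n < M → a n ≡ + 0) ⊎ Σ ℕ (λ n → n < M × ¬ a n ≡ + 0)
find≢0 zero    a = inj₁ (λ n ())
find≢0 (suc M) a with find≢0 M a
... | inj₂ (n , l , h) = inj₂ (n , ℕP.m<n⇒m<1+n l , h)
... | inj₁ h with a M ℤ.≟ + 0
...   | no ne = inj₂ (M , ℕP.n<1+n M , ne)
...   | yes e = inj₁ (λ n l → case n (ℕP.m≤n⇒m<n∨m≡n (ℕP.≤-pred l)))
  where
  case : ∀ n → n < M ⊎ n ≡ M → a n ≡ + 0
  case n (inj₁ l)      = h n l
  case n (inj₂ ≡.refl) = e

-- The rank of the rows of index < 4^k can grow at most N times.
stabilise : ∀ N (a : ℕ → ℕ → ℤ) k₀ → Σ ℕ λ k → (k₀ ≤ k) ×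
  (∀ x → (∀ n → n < 4 ℕ.^ k → ℤRows.row N a x n ≡ + 0) → ∀ n → n < 4 ℕ.^ suc k → ℤRows.row N a x n ≡ + 0)
stabilise zero    a k₀ = k₀ , ℕP.≤-refl , λ x h n l → ≡.refl
stabilise (suc N) a k₀ with stabilise N (λ n j → a n (suc j)) k₀
-- The pivot is sought one level higher than k₁. If there is none, the first unknown is invisible in
-- all rows concerned and k₁ serves. Otherwise the second call starts at k₁ + 1, which puts the
-- pivot row among the known rows.
... | k₁ , k₀≤k₁ , st with find≢0 (4 ℕ.^ suc k₁) (λ n → a n 0)
...   | inj₁ zs = k₁ , k₀≤k₁ , λ x h n l → ≡.trans (ℤRows.drop-zero N a x n (zs n l))
          (st (λ j → x (suc j)) (λ m l′ → ≡.trans (≡.sym (ℤRows.drop-zero N a x m (zs m (ℕP.<-≤-trans l′ (ℕP.^-monoʳ-≤ 4 (ℕP.n≤1+n k₁)))))) (h m l′)) n l)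
...   | inj₂ (n₀ , l₀ , ne) with stabilise N (ℤRows.reduce a n₀) (suc k₁)
...     | k₂ , k₁<k₂ , st₂ = k₂ , ℕP.≤-trans k₀≤k₁ (ℕP.≤-trans (ℕP.n≤1+n k₁) k₁<k₂) , main
  where
  main : ∀ x → (∀ n → n < 4 ℕ.^ k₂ → ℤRows.row (suc N) a x n ≡ + 0) → ∀ n → n < 4 ℕ.^ suc k₂ → ℤRows.row (suc N) a x n ≡ + 0
  main x h n l = Dom.cancel0 ℤ-dom ne (ℤRows.reduce-vanish⁻¹ N a x n₀ n
    (st₂ (λ j → x (suc j)) (λ m l′ → ℤRows.reduce-vanish N a x n₀ m (h m l′) h₀) n l) h₀)
    where
    h₀ : ℤRows.row (suc N) a x n₀ ≡ + 0
    h₀ = h n₀ (ℕP.<-≤-trans l₀ (ℕP.^-monoʳ-≤ 4 k₁<k₂))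

module FieldKernel {c ℓ : Level} (K : CommutativeRing c ℓ) (isField : IsChar0Field K) where
  open CommutativeRing K hiding (zero)
  open PowerSeries K using (intR)
  open Sums K
  open IsChar0Field isField
  open RowReduction K
  open import Algebra.Properties.Ring ring using (-0#≈0#; -‿involutive)

  intR≉0 : ∀ i → ¬ i ≡ + 0 → ¬ (intR i ≈ 0#)
  intR≉0 (+ n)    ne e = ne (≡.cong (λ m → + m) (char0 n e))
  intR≉0 -[1+ n ] ne e with char0 (suc n) (trans (sym (-‿involutive _)) (trans (-‿cong e) -0#≈0#))
  ... | ()

  cancel : ∀ i x → ¬ i ≡ + 0 → intR i * x ≈ 0# → x ≈ 0#
  cancel i x ne e = let (y , iy) = inverse (intR i) (intR≉0 i ne) in
    trans (sym (*-identityˡ x)) (trans (*-congʳ (sym iy)) (trans (solve 3 (λ i y x → (i :* y) :* x := y :* (i :* x)) refl (intR i) y x) (trans (*-congˡ e) (zeroʳ y))))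
    where open Solver

  intR-reduce : ∀ a n₀ n j → intR (ℤRows.reduce a n₀ n j) ≈ reduce (λ n j → intR (a n j)) n₀ n j
  intR-reduce a n₀ n j = trans (intR-+ (a n₀ 0 ℤ.* a n (suc j)) (ℤ.- (a n 0 ℤ.* a n₀ (suc j)))) (+-cong (intR-* (a n₀ 0) (a n (suc j))) (trans (intR-neg (a n 0 ℤ.* a n₀ (suc j))) (-‿cong (intR-* (a n 0) (a n₀ (suc j))))))

  IntegerKernel : ℕ → ℕ → (ℕ → ℕ → ℤ) → Set
  IntegerKernel N M a = Σ (ℕ → ℤ) λ x → (Σ ℕ λ j → j < N × ¬ x j ≡ + 0) × (∀ n → n < M → ℤRows.row N a x n ≡ + 0)

  NoKernel : ℕ → ℕ → (ℕ → ℕ → ℤ) → Set (c Level.⊔ ℓ)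
  NoKernel N M a = ∀ x → (∀ n → n < M → row N (λ n j → intR (a n j)) x n ≈ 0#) → ∀ j → j < N → x j ≈ 0#

  private
    module NoPivot (N M : ℕ) (a : ℕ → ℕ → ℤ) (zs : ∀ n → n < M → a n 0 ≡ + 0) where
      e₀ : ℕ → ℤ
      e₀ zero    = + 1
      e₀ (suc j) = + 0
      found : IntegerKernel (suc N) M a
      found = e₀ , (0 , s≤s z≤n , λ ()) , λ n l → ≡.trans (ℤRows.drop-zero N a e₀ n (zs n l)) (Sums.Σ-zero ℤring N {λ i → a n (suc i) ℤ.* + 0} (λ i _ → ℤP.*-zeroʳ (a n (suc i))))

    module Pivot (N M : ℕ) (a : ℕ → ℕ → ℤ) (n₀ : ℕ) (l₀ : n₀ < M) (ne : ¬ a n₀ 0 ≡ + 0) where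
      extend : IntegerKernel N M (ℤRows.reduce a n₀) → IntegerKernel (suc N) M a
      extend (x , (j , j<N , xj) , h) = x⁺ , (suc j , s≤s j<N , Dom.*≉0 ℤ-dom ne xj) , vanish
        where
        p = a n₀ 0
        -- The old coordinates are scaled by the pivot, so the coordinate solved from row n₀ is
        -- integral.
        x⁺ : ℕ → ℤ
        x⁺ zero    = ℤ.- ℤRows.row N (λ n j → a n (suc j)) x n₀
        x⁺ (suc j) = p ℤ.* x j
        module S = Sums ℤring
        r : ℕ → ℤ
        r = ℤRows.row N (λ n j → a n (suc j)) x
        open S.Solver
        move : ∀ a p x → a ℤ.* (p ℤ.* x) ≡ p ℤ.* (a ℤ.* x)
        move = solve 3 (λ a p x → a :* (p :* x) := p :* (a :* x)) ≡.refl
        row⁺ : ∀ n → ℤRows.row (suc N) a x⁺ n ≡ a n 0 ℤ.* (ℤ.- r n₀) ℤ.+ p ℤ.* r n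
        row⁺ n = ≡.trans (S.Σ-first N (λ j → a n j ℤ.* x⁺ j)) (≡.cong (λ u → a n 0 ℤ.* (ℤ.- r n₀) ℤ.+ u)
          (≡.trans (S.Σ-cong′ N (λ j → move (a n (suc j)) p (x j))) (S.Σ-*ˡ N p (λ j → a n (suc j) ℤ.* x j))))
        row₀ : ℤRows.row (suc N) a x⁺ n₀ ≡ + 0
        row₀ = ≡.trans (row⁺ n₀) (solve 2 (λ p r → p :* (:- r) :+ p :* r := con (+ 0)) ≡.refl p (r n₀))
        scaled : ∀ n → n < M → ℤRows.row N (ℤRows.reduce a n₀) (λ j → p ℤ.* x j) n ≡ + 0
        scaled n l = ≡.trans (S.Σ-cong′ N (λ j → move (ℤRows.reduce a n₀ n j) p (x j))) (≡.trans (S.Σ-*ˡ N p (λ j → ℤRows.reduce a n₀ n j ℤ.* x j)) (≡.trans (≡.cong (λ u → p ℤ.* u) (h n l)) (ℤP.*-zeroʳ p)))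
        vanish : ∀ n → n < M → ℤRows.row (suc N) a x⁺ n ≡ + 0
        vanish n l = Dom.cancel0 ℤ-dom ne (ℤRows.reduce-vanish⁻¹ N a x⁺ n₀ n (scaled n l) row₀)

      none : NoKernel N M (ℤRows.reduce a n₀) → NoKernel (suc N) M a
      none ih x h = λ { zero l → x0 ; (suc j) l → xs j (ℕP.≤-pred l) }
        where
        aK : ℕ → ℕ → Carrier
        aK n j = intR (a n j)
        xs : ∀ j → j < N → x (suc j) ≈ 0#
        xs = ih (λ j → x (suc j)) (λ n l → trans (Σ-cong′ N (λ j → *-congʳ (intR-reduce a n₀ n j))) (reduce-vanish N aK x n₀ n (h n l) (h n₀ l₀)))
        x0 : x 0 ≈ 0#
        x0 = cancel (a n₀ 0) (x 0) ne (trans (sym (trans (+-congˡ (Σ-zero N {λ j → aK n₀ (suc j) * x (suc j)} (λ j l → trans (*-congˡ (xs j l)) (zeroʳ _)))) (+-identityʳ _))) (trans (sym (Σ-first N (λ j → aK n₀ j * x j))) (h n₀ l₀)))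

  -- Only integers are tested for zero, and in K only nonzero integers are inverted. The alternative
  -- is therefore decided without deciding equality in K.
  kernel : ∀ N M a → IntegerKernel N M a ⊎ NoKernel N M a
  kernel zero    M a = inj₂ (λ x h j ())
  kernel (suc N) M a = pivot (find≢0 M (λ n → a n 0))
    where
    pivot : (∀ n → n < M → a n 0 ≡ + 0) ⊎ Σ ℕ (λ n → n < M × ¬ a n 0 ≡ + 0) → IntegerKernel (suc N) M a ⊎ NoKernel (suc N) M a
    pivot (inj₁ zs) = inj₁ (NoPivot.found N M a zs)
    pivot (inj₂ (n₀ , l₀ , ne)) = Sum.map (Pivot.extend N M a n₀ l₀ ne) (Pivot.none N M a n₀ l₀ ne) (kernel N M (ℤRows.reduce a n₀))

module Spans (S : CRing) where
  open CommutativeRing S hiding (zero)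
  open PowerSeries S using (intR)
  open Sums S
  open Solver

  -- Membership carries integer coordinates along the list; `coordinates` extracts them and thereby
  -- turns statements about the span into statements about an integer matrix.
  Span : List Carrier → Carrier → Set
  Span []       f = f ≈ 0#
  Span (a ∷ as) f = Σ ℤ λ c → Σ Carrier λ g → Span as g × f ≈ intR c * a + g

  span-resp : ∀ as {f g} → f ≈ g → Span as f → Span as g
  span-resp []       e h = trans (sym e) h
  span-resp (a ∷ as) e (c , g , h , q) = c , g , h , trans (sym e) q

  span-0 : ∀ as {f} → f ≈ 0# → Span as f
  span-0 []       e = e
  span-0 (a ∷ as) e = + 0 , 0# , span-0 as refl , trans e (solve 1 (λ a → con (+ 0) := con (+ 0) :* a :+ con (+ 0)) refl a)

  span-+ : ∀ as {f g} → Span as f → Span as g → Span as (f + g)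
  span-+ []       h h′ = trans (+-cong h h′) (+-identityˡ 0#)
  span-+ (a ∷ as) (c , g , h , q) (c′ , g′ , h′ , q′) = c ℤ.+ c′ , g + g′ , span-+ as h h′ ,
    trans (+-cong q q′) (trans (solve 5 (λ c c′ a g g′ → (c :* a :+ g) :+ (c′ :* a :+ g′) := (c :+ c′) :* a :+ (g :+ g′)) refl (intR c) (intR c′) a g g′) (+-congʳ (*-congʳ (sym (intR-+ c c′)))))

  span-scal : ∀ as i {f} → Span as f → Span as (intR i * f)
  span-scal []       i h = trans (*-congˡ h) (zeroʳ _)
  span-scal (a ∷ as) i (c , g , h , q) = i ℤ.* c , intR i * g , span-scal as i h ,
    trans (*-congˡ q) (trans (solve 4 (λ i c a g → i :* (c :* a :+ g) := (i :* c) :* a :+ i :* g) refl (intR i) (intR c) a g) (+-congʳ (*-congʳ (sym (intR-* i c)))))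

  span-sub : ∀ as {f g} → Span as f → Span as g → Span as (f - g)
  span-sub as {f} {g} h h′ = span-resp as (+-congˡ (trans (*-congʳ (intR-neg (+ 1))) (trans (*-congʳ (-‿cong intR-1)) (-1*x≈-x g)))) (span-+ as h (span-scal as (ℤ.- (+ 1)) h′))
    where open import Algebra.Properties.Ring ring using (-1*x≈-x)

  span-++ˡ : ∀ as bs {f} → Span as f → Span (as ++ bs) f
  span-++ˡ []       bs e = span-0 bs e
  span-++ˡ (a ∷ as) bs (c , g , h , q) = c , g , span-++ˡ as bs h , q

  span-++ʳ : ∀ as bs {f} → Span bs f → Span (as ++ bs) f
  span-++ʳ []       bs h = h
  span-++ʳ (a ∷ as) bs {f} h = + 0 , f , span-++ʳ as bs h , solve 2 (λ a f → f := con (+ 0) :* a :+ f) refl a f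

  span-++⁻ : ∀ as bs {f} → Span (as ++ bs) f → Σ Carrier λ g → Σ Carrier λ h → Span as g × Span bs h × f ≈ g + h
  span-++⁻ []       bs {f} h = 0# , f , refl , h , sym (+-identityˡ f)
  span-++⁻ (a ∷ as) bs (c , g , h , q) with span-++⁻ as bs h
  ... | g₁ , g₂ , h₁ , h₂ , e = intR c * a + g₁ , g₂ , (c , g₁ , h₁ , refl) , h₂ , trans q (trans (+-congˡ e) (sym (+-assoc _ _ _)))

  record Linear (φ : Carrier → Carrier) : Set where
    field
      lin-cong : ∀ {x y} → x ≈ y → φ x ≈ φ y
      lin-0    : φ 0# ≈ 0#
      lin-+    : ∀ x y → φ (x + y) ≈ φ x + φ y
      lin-scal : ∀ i x → φ (intR i * x) ≈ intR i * φ x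

  linear-* : ∀ u → Linear (u *_)
  linear-* u = record { lin-cong = *-congˡ ; lin-0 = zeroʳ u ; lin-+ = distribˡ u
    ; lin-scal = λ i x → solve 3 (λ u i x → u :* (i :* x) := i :* (u :* x)) refl u (intR i) x }

  linear-hom : (σ : Hom S S) → Linear ⟦ σ ⟧
  linear-hom σ = record { lin-cong = Hom.⟦⟧-cong σ ; lin-0 = Hom.0-homo σ ; lin-+ = Hom.+-homo σ
    ; lin-scal = λ i x → trans (Hom.*-homo σ _ _) (*-congʳ (Hom.intR-homo σ i)) }

  module _ {φ : Carrier → Carrier} (L : Linear φ) where
    open Linear L

    span-map : ∀ as {f} → Span as f → Span (List.map φ as) (φ f)
    span-map []       e = trans (lin-cong e) lin-0
    span-map (a ∷ as) (c , g , h , q) = c , φ g , span-map as h , trans (lin-cong q) (trans (lin-+ _ _) (+-congʳ (lin-scal c a)))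

    span-map⁻ : ∀ as {f} → Span (List.map φ as) f → Σ Carrier λ g → Span as g × f ≈ φ g
    span-map⁻ []       e = 0# , refl , trans e (sym lin-0)
    span-map⁻ (a ∷ as) (c , g , h , q) with span-map⁻ as h
    ... | g′ , h′ , e = intR c * a + g′ , (c , g′ , h′ , refl) , trans q (trans (+-cong (sym (lin-scal c a)) e) (sym (lin-+ _ _)))

    span-subst : ∀ as bs → All (λ a → Span bs (φ a)) as → ∀ {f} → Span as f → Span bs (φ f)
    span-subst []       bs [] e = span-0 bs (trans (lin-cong e) lin-0)
    span-subst (a ∷ as) bs (p ∷ ps) (c , g , h , q) = span-resp bs (sym (trans (lin-cong q) (trans (lin-+ _ _) (+-congʳ (lin-scal c a)))))
      (span-+ bs (span-scal bs c p) (span-subst as bs ps h))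

  linear-id : Linear (λ x → x)
  linear-id = record { lin-cong = λ e → e ; lin-0 = refl ; lin-+ = λ _ _ → refl ; lin-scal = λ _ _ → refl }

  module Horner (z : Carrier) where
    -- generators z^j φ(a), j < E, a ∈ as
    horner : (Carrier → Carrier) → ℕ → List Carrier → List Carrier
    horner φ zero    as = []
    horner φ (suc E) as = List.map φ as ++ List.map (z *_) (horner φ E as)

    module _ {φ : Carrier → Carrier} (L : Linear φ) where
      horner-φ : ∀ E as {f} → Span as f → Span (horner φ (suc E) as) (φ f)
      horner-φ E as h = span-++ˡ (List.map φ as) _ (span-map L as h)

      horner-z : ∀ E as {f} → Span (horner φ E as) f → Span (horner φ (suc E) as) (z * f)
      horner-z E as h = span-++ʳ (List.map φ as) _ (span-map (linear-* z) (horner φ E as) h)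

      horner⁻ : ∀ E as {f} → Span (horner φ (suc E) as) f → Σ Carrier λ g → Σ Carrier λ h → Span as g × Span (horner φ E as) h × f ≈ φ g + z * h
      horner⁻ E as s with span-++⁻ (List.map φ as) (List.map (z *_) (horner φ E as)) s
      ... | g₁ , g₂ , s₁ , s₂ , e with span-map⁻ L as s₁ | span-map⁻ (linear-* z) (horner φ E as) s₂
      ...   | g , t₁ , e₁ | h , t₂ , e₂ = g , h , t₁ , t₂ , trans e (+-cong e₁ e₂)

      horner-suc : ∀ E as {f} → Span (horner φ E as) f → Span (horner φ (suc E) as) f
      horner-suc zero    as e = span-0 (horner φ 1 as) e
      horner-suc (suc E) as s with horner⁻ E as s
      ... | g , h , t₁ , t₂ , e = span-resp (horner φ (2 ℕ.+ E) as) (sym e) (span-+ (horner φ (2 ℕ.+ E) as) (horner-φ (suc E) as t₁) (horner-z (suc E) as (horner-suc E as t₂)))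

      horner-+ : ∀ k E as {f} → Span (horner φ E as) f → Span (horner φ (k ℕ.+ E) as) f
      horner-+ zero    E as s = s
      horner-+ (suc k) E as s = horner-suc (k ℕ.+ E) as (horner-+ k E as s)

      horner-≤ : ∀ {E E′} as → E ≤ E′ → ∀ {f} → Span (horner φ E as) f → Span (horner φ E′ as) f
      horner-≤ {E} {E′} as l {f} s = ≡.subst (λ m → Span (horner φ m as) f) (ℕP.m∸n+n≡m l) (horner-+ (E′ ∸ E) E as s)

    ext : List Carrier → List Carrier → List Carrier
    ext []       as = []
    ext (u ∷ us) as = List.map (u *_) as ++ ext us as

    words : List Carrier → ℕ → List Carrier
    words us zero    = 1# ∷ []
    words us (suc n) = ext us (words us n)

  module Closure (σ : Hom S S) (z : Carrier) (σz : ⟦ σ ⟧ z ≈ z * (z * (z * z))) where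
    open Horner z
    private
      module σH = Hom σ
      lσ = linear-hom σ

    -- The generator z^(4i+r) σ(a) contributes z^i a to the section of index r, so four layers of
    -- generators with σ become one layer without it.
    sections : ∀ E as {f} → Span (horner ⟦ σ ⟧ (E ℕ.* 4) as) f → Σ (Fin 4 → Carrier) λ s → (∀ i → Span (horner (λ x → x) E as) (s i)) × f ≈ comb S σ z s
    sections zero    as e = (λ _ → 0#) , (λ _ → refl) , trans e (sym (trans (+-cong σH.0-homo (*-congˡ (+-cong σH.0-homo (*-congˡ (+-cong σH.0-homo (*-congˡ σH.0-homo))))))
      (solve 1 (λ z → con (+ 0) :+ z :* (con (+ 0) :+ z :* (con (+ 0) :+ z :* con (+ 0))) := con (+ 0)) refl z)))
    sections (suc E) as h₀ with horner⁻ lσ (3 ℕ.+ E ℕ.* 4) as h₀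
    ... | a₀ , f₁ , s₀ , h₁ , e₀ with horner⁻ lσ (2 ℕ.+ E ℕ.* 4) as h₁
    ...   | a₁ , f₂ , s₁ , h₂ , e₁ with horner⁻ lσ (1 ℕ.+ E ℕ.* 4) as h₂
    ...     | a₂ , f₃ , s₂ , h₃ , e₂ with horner⁻ lσ (E ℕ.* 4) as h₃
    ...       | a₃ , f₄ , s₃ , h₄ , e₃ with sections E as h₄
    ...         | t , ht , e₄ = s , hs , trans e₀ (trans (+-congˡ (*-congˡ (trans e₁ (+-congˡ (*-congˡ (trans e₂ (+-congˡ (*-congˡ (trans e₃ (+-congˡ (*-congˡ e₄)))))))))))
                  (trans (regroup z (⟦ σ ⟧ a₀) (⟦ σ ⟧ a₁) (⟦ σ ⟧ a₂) (⟦ σ ⟧ a₃) (⟦ σ ⟧ (t 0F)) (⟦ σ ⟧ (t 1F)) (⟦ σ ⟧ (t 2F)) (⟦ σ ⟧ (t 3F)))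
                    (sym (+-cong (σ-+z a₀ 0F) (*-congˡ (+-cong (σ-+z a₁ 1F) (*-congˡ (+-cong (σ-+z a₂ 2F) (*-congˡ (σ-+z a₃ 3F))))))))))
      where
      P′ = horner (λ x → x) (suc E) as
      s : Fin 4 → Carrier
      s 0F = a₀ + z * t 0F
      s 1F = a₁ + z * t 1F
      s 2F = a₂ + z * t 2F
      s 3F = a₃ + z * t 3F
      mem : ∀ {a} i → Span as a → Span P′ (a + z * t i)
      mem i h = span-+ P′ (horner-φ linear-id E as h) (horner-z linear-id E as (ht i))
      hs : ∀ i → Span P′ (s i)
      hs 0F = mem 0F s₀
      hs 1F = mem 1F s₁
      hs 2F = mem 2F s₂
      hs 3F = mem 3F s₃
      σ-+z : ∀ a i → ⟦ σ ⟧ (a + z * t i) ≈ ⟦ σ ⟧ a + (z * (z * (z * z))) * ⟦ σ ⟧ (t i)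
      σ-+z a i = trans (σH.+-homo _ _) (+-congˡ (trans (σH.*-homo _ _) (*-congʳ σz)))
      regroup : ∀ z a b c d t u v w → a + z * (b + z * (c + z * (d + z * (t + z * (u + z * (v + z * w)))))) ≈
        (a + (z * (z * (z * z))) * t) + z * ((b + (z * (z * (z * z))) * u) + z * ((c + (z * (z * (z * z))) * v) + z * (d + (z * (z * (z * z))) * w)))
      regroup z a b c d t u v w = trans (solve 6 (λ z a b c d t → a :+ z :* (b :+ z :* (c :+ z :* (d :+ z :* t))) := (a :+ z :* (b :+ z :* (c :+ z :* d))) :+ (z :* (z :* (z :* z))) :* t) refl z a b c d _)
        (trans (+-congˡ (solve 6 (λ q z t u v w → q :* (t :+ z :* (u :+ z :* (v :+ z :* w))) := q :* t :+ z :* (q :* u :+ z :* (q :* v :+ z :* (q :* w)))) refl (z * (z * (z * z))) z t u v w))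
          (merge z a b c d _ _ _ _))
        where
        merge₁ : ∀ z a b t u → (a + z * b) + (t + z * u) ≈ (a + t) + z * (b + u)
        merge₁ = solve 5 (λ z a b t u → (a :+ z :* b) :+ (t :+ z :* u) := (a :+ t) :+ z :* (b :+ u)) refl
        merge : ∀ z a b c d t u v w → (a + z * (b + z * (c + z * d))) + (t + z * (u + z * (v + z * w))) ≈ (a + t) + z * ((b + u) + z * ((c + v) + z * (d + w)))
        merge z a b c d t u v w = trans (merge₁ z a _ t _) (+-congˡ (*-congˡ (trans (merge₁ z b _ u _) (+-congˡ (*-congˡ (merge₁ z c d v w))))))

module SectionClosed (S : CRing) (σ′ : Hom S S) (z F E : CommutativeRing.Carrier S) where
  open CommutativeRing S hiding (zero)
  open PowerSeries S using (intR)
  open Sums S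
  open Solver
  open Spans S
  open Horner z
  private module σ′ = Hom σ′

  G H : Carrier
  G = ⟦ σ′ ⟧ F
  H = ⟦ σ′ ⟧ E

  z⁴ pz δpz : Carrier
  z⁴ = z * (z * (z * z))
  pz = 1# + (z + z * z)
  δpz = z + intR (+ 2) * (z * z)

  us : List Carrier
  us = 1# ∷ F ∷ G ∷ E ∷ H ∷ []

  Ext : List Carrier → Carrier → Set
  Ext as u = ∀ {f} → Span as f → Span (ext us as) (u * f)

  module _ (as : List Carrier) where
    private
      m : Carrier → List Carrier
      m u = List.map (u *_) as
      mm : ∀ u → ∀ {f} → Span as f → Span (m u) (u * f)
      mm u = span-map (linear-* u) as
    ext-1 : Ext as 1#
    ext-1 h = span-++ˡ (m 1#) _ (mm 1# h)
    ext-F : Ext as F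
    ext-F h = span-++ʳ (m 1#) _ (span-++ˡ (m F) _ (mm F h))
    ext-G : Ext as G
    ext-G h = span-++ʳ (m 1#) _ (span-++ʳ (m F) _ (span-++ˡ (m G) _ (mm G h)))
    ext-E : Ext as E
    ext-E h = span-++ʳ (m 1#) _ (span-++ʳ (m F) _ (span-++ʳ (m G) _ (span-++ˡ (m E) _ (mm E h))))
    ext-H : Ext as H
    ext-H h = span-++ʳ (m 1#) _ (span-++ʳ (m F) _ (span-++ʳ (m G) _ (span-++ʳ (m E) _ (span-++ˡ (m H) _ (mm H h)))))

  W : ℕ → List Carrier
  W = words us

  lσ : Linear ⟦ σ′ ⟧
  lσ = linear-hom σ′

  T : ℕ → List Carrier → Carrier → Set
  T e as = Span (horner ⟦ σ′ ⟧ e as)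

  T-σ* : ∀ u as → Ext as u → ∀ e {f} → T e as f → T e (ext us as) (⟦ σ′ ⟧ u * f)
  T-σ* u as x zero    h = trans (*-congˡ h) (zeroʳ _)
  T-σ* u as x (suc e) h with horner⁻ lσ e as h
  ... | g , f′ , s , t , q = span-resp B (sym (trans (*-congˡ q) (trans (solve 4 (λ u g z f → u :* (g :+ z :* f) := u :* g :+ z :* (u :* f)) refl (⟦ σ′ ⟧ u) (⟦ σ′ ⟧ g) z f′) (+-congʳ (sym (σ′.*-homo u g))))))
      (span-+ B (horner-φ lσ e (ext us as) (x s)) (horner-z lσ e (ext us as) (T-σ* u as x e t)))
    where B = horner ⟦ σ′ ⟧ (suc e) (ext us as)

  module _ (as : List Carrier) where
    private
      L : ℕ → List Carrier
      L e = horner ⟦ σ′ ⟧ e as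
      tz : ∀ e {f} → T e as f → T (suc e) as (z * f)
      tz e = horner-z lσ e as

    T-p : ∀ e {f} → T e as f → T (2 ℕ.+ e) as (pz * f)
    T-p e {f} h = span-resp (L (2 ℕ.+ e)) (sym (trans (distribʳ f 1# _) (+-cong (*-identityˡ f) (solve 2 (λ z f → (z :+ z :* z) :* f := z :* f :+ z :* (z :* f)) refl z f))))
      (span-+ (L (2 ℕ.+ e)) (horner-+ lσ 2 e as h) (span-+ (L (2 ℕ.+ e)) (horner-suc lσ (suc e) as (tz e h)) (tz (suc e) (tz e h))))

    T-δp : ∀ e {f} → T e as f → T (2 ℕ.+ e) as (δpz * f)
    T-δp e {f} h = span-resp (L (2 ℕ.+ e)) (solve 3 (λ t z f → z :* f :+ t :* (z :* (z :* f)) := (z :+ t :* (z :* z)) :* f) refl (intR (+ 2)) z f)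
      (span-+ (L (2 ℕ.+ e)) (horner-suc lσ (suc e) as (tz e h)) (span-scal (L (2 ℕ.+ e)) (+ 2) (tz (suc e) (tz e h))))

    T-z⁴ : ∀ e {f} → T e as f → T (4 ℕ.+ e) as (z⁴ * f)
    T-z⁴ e {f} h = span-resp (L (4 ℕ.+ e)) (solve 2 (λ z f → z :* (z :* (z :* (z :* f))) := (z :* (z :* (z :* z))) :* f) refl z f)
      (tz (3 ℕ.+ e) (tz (2 ℕ.+ e) (tz (suc e) (tz e h))))

  module _ (F-eq : F ≈ pz * G - z⁴ * ⟦ σ′ ⟧ G)
           (E-eq : E ≈ (δpz * G + pz * (intR (+ 4) * H)) - (intR (+ 4) * (z⁴ * ⟦ σ′ ⟧ G) + z⁴ * (intR (+ 4) * (intR (+ 4) * ⟦ σ′ ⟧ H))))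
           (σz : ⟦ σ′ ⟧ z ≈ z⁴) where

    module _ (as : List Carrier) (e : ℕ) {f : Carrier} (h : T e as f) where
      private
        B = ext us as
        L = horner ⟦ σ′ ⟧ (4 ℕ.+ e) B
        G* : T e B (G * f)
        G* = T-σ* F as (ext-F as) e h
        σG* : T e B (⟦ σ′ ⟧ G * f)
        σG* = T-σ* G as (ext-G as) e h
        H* : T e B (H * f)
        H* = T-σ* E as (ext-E as) e h
        σH* : T e B (⟦ σ′ ⟧ H * f)
        σH* = T-σ* H as (ext-H as) e h

      T-1* : T (4 ℕ.+ e) B (1# * f)
      T-1* = horner-+ lσ 4 e B (span-resp (horner ⟦ σ′ ⟧ e B) (*-congʳ σ′.1-homo) (T-σ* 1# as (ext-1 as) e h))
      T-G* : T (4 ℕ.+ e) B (G * f)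
      T-G* = horner-+ lσ 4 e B G*
      T-H* : T (4 ℕ.+ e) B (H * f)
      T-H* = horner-+ lσ 4 e B H*
      T-F* : T (4 ℕ.+ e) B (F * f)
      T-F* = span-resp L (sym (trans (*-congʳ F-eq) (solve 5 (λ p g q s f → (p :* g :- q :* s) :* f := p :* (g :* f) :- q :* (s :* f)) refl pz G z⁴ (⟦ σ′ ⟧ G) f)))
        (span-sub L (horner-+ lσ 2 (2 ℕ.+ e) B (T-p B e G*)) (T-z⁴ B e σG*))
      T-E* : T (4 ℕ.+ e) B (E * f)
      T-E* = span-resp L (sym (trans (*-congʳ E-eq) (trans (solve 3 (λ a b f → (a :- b) :* f := a :* f :- b :* f) refl _ _ f) (+-cong
          (solve 6 (λ d g p n k f → (d :* g :+ p :* (n :* k)) :* f := d :* (g :* f) :+ p :* (n :* (k :* f))) refl δpz G pz (intR (+ 4)) H f)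
          (-‿cong (solve 5 (λ n q s t f → (n :* (q :* s) :+ q :* (n :* (n :* t))) :* f := n :* (q :* (s :* f)) :+ q :* (n :* (n :* (t :* f)))) refl (intR (+ 4)) z⁴ (⟦ σ′ ⟧ G) (⟦ σ′ ⟧ H) f))))))
        (span-sub L
          (span-+ L (horner-+ lσ 2 (2 ℕ.+ e) B (T-δp B e G*)) (horner-+ lσ 2 (2 ℕ.+ e) B (T-p B e (span-scal Le (+ 4) H*))))
          (span-+ L (span-scal L (+ 4) (T-z⁴ B e σG*)) (T-z⁴ B e (span-scal Le (+ 4) (span-scal Le (+ 4) σH*)))))
        where Le = horner ⟦ σ′ ⟧ e B

    -- Each of 1, F, G, E, H is an integral combination of z^j σ(u) with j ≤ 4 and u again one of
    -- them: by the functional equation for F, by its derivative for E, and by definition for G = σF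
    -- and H = σE. A word of length n thus needs exponents up to 4n.
    T-words : ∀ n → All (T (1 ℕ.+ n ℕ.* 4) (W n)) (W n)
    T-words zero    = span-resp (horner ⟦ σ′ ⟧ 1 (W 0)) σ′.1-homo (horner-φ lσ 0 (W 0) (+ 1 , 0# , refl , sym (trans (+-identityʳ _) (trans (*-identityʳ _) intR-1)))) ∷ []
    T-words (suc n) =
      AllP.++⁺ (AllP.map⁺ (All.map (T-1* (W n) e) ih)) (AllP.++⁺ (AllP.map⁺ (All.map (T-F* (W n) e) ih)) (AllP.++⁺ (AllP.map⁺ (All.map (T-G* (W n) e) ih))
        (AllP.++⁺ (AllP.map⁺ (All.map (T-E* (W n) e) ih)) (AllP.++⁺ (AllP.map⁺ (All.map (T-H* (W n) e) ih)) []))))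
      where
      e = 1 ℕ.+ n ℕ.* 4
      ih = T-words n

    P : ℕ → ℕ → List Carrier
    P e n = horner (λ x → x) e (W n)

    P⊆T : ∀ e n {f} → Span (P e n) f → T (e ℕ.+ (1 ℕ.+ n ℕ.* 4)) (W n) f
    P⊆T zero    n h = span-0 (horner ⟦ σ′ ⟧ (1 ℕ.+ n ℕ.* 4) (W n)) h
    P⊆T (suc e) n h with horner⁻ linear-id e (W n) h
    ... | g , f′ , s , t , q = span-resp L (sym q) (span-+ L
        (horner-+ lσ (suc e) (1 ℕ.+ n ℕ.* 4) (W n) (span-subst linear-id (W n) (horner ⟦ σ′ ⟧ (1 ℕ.+ n ℕ.* 4) (W n)) (T-words n) s))
        (horner-z lσ (e ℕ.+ (1 ℕ.+ n ℕ.* 4)) (W n) (P⊆T e n t)))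
      where L = horner ⟦ σ′ ⟧ (suc e ℕ.+ (1 ℕ.+ n ℕ.* 4)) (W n)

    -- Rewriting in terms of σ raises the number of powers of z from e to e + (4n + 1), and taking
    -- sections divides it by 4. This returns to e because 4n + 1 ≤ e.
    closed : ∀ e n → 1 ℕ.+ n ℕ.* 4 ≤ e → ∀ {f} → Span (P e n) f → Σ (Fin 4 → Carrier) λ s → (∀ i → Span (P e n) (s i)) × f ≈ comb S σ′ z s
    closed e n l h = Closure.sections σ′ z σz e (W n) (horner-≤ lσ (W n) bound (P⊆T e n h))
      where
      bound : e ℕ.+ (1 ℕ.+ n ℕ.* 4) ≤ e ℕ.* 4
      bound = ℕP.≤-trans (ℕP.+-monoʳ-≤ e l) (ℕP.≤-trans (ℕP.≤-reflexive (solve₂ e)) (ℕP.*-monoʳ-≤ e (s≤s (s≤s z≤n))))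
        where
        solve₂ : ∀ e → e ℕ.+ e ≡ e ℕ.* 2
        solve₂ = solve-∀

    W-^ : ∀ u → (∀ as → Ext as u) → ∀ k n {f} → Span (W n) f → Span (W (k ℕ.+ n)) (u ^ k * f)
    W-^ u x zero    n {f} h = span-resp (W n) (sym (*-identityˡ f)) h
    W-^ u x (suc k) n {f} h = span-resp (W (suc k ℕ.+ n)) (sym (*-assoc _ _ _)) (x (W (k ℕ.+ n)) (W-^ u x k n h))

    W-≤ : ∀ {n n′} → n ≤ n′ → ∀ {f} → Span (W n) f → Span (W n′) f
    W-≤ {n} {n′} l {f} h = ≡.subst (λ m → Span (W m) f) (ℕP.m∸n+n≡m l)
      (span-resp (W (n′ ∸ n ℕ.+ n)) (trans (*-congʳ (1^ (n′ ∸ n))) (*-identityˡ f)) (W-^ 1# ext-1 (n′ ∸ n) n h))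

    P-monomial : ∀ {d} e n {e₀ e₁ e₂ e₃ e₄} → e₀ < e → e₁ ≤ d → e₂ ≤ d → e₃ ≤ d → e₄ ≤ d → d ℕ.+ (d ℕ.+ (d ℕ.+ (d ℕ.+ 0))) ≤ n →
      Span (P e n) (z ^ e₀ * (F ^ e₁ * (G ^ e₂ * (E ^ e₃ * (H ^ e₄ * 1#)))))
    P-monomial e n {e₀} {e₁} {e₂} {e₃} {e₄} l₀ l₁ l₂ l₃ l₄ ln = horner-≤ linear-id (W n) l₀ (shift e₀ (W-≤ (ℕP.≤-trans (ℕP.+-mono-≤ l₁ (ℕP.+-mono-≤ l₂ (ℕP.+-mono-≤ l₃ (ℕP.+-monoˡ-≤ 0 l₄)))) ln)
      (W-^ F ext-F e₁ _ (W-^ G ext-G e₂ _ (W-^ E ext-E e₃ _ (W-^ H ext-H e₄ 0 (+ 1 , 0# , refl , sym (trans (+-identityʳ _) (trans (*-identityʳ _) intR-1)))))))))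
      where
      shift : ∀ k {f} → Span (W n) f → Span (P (suc k) n) (z ^ k * f)
      shift zero    {f} h = span-resp (P 1 n) (sym (*-identityˡ f)) (horner-φ linear-id 0 (W n) h)
      shift (suc k) {f} h = span-resp (P (2 ℕ.+ k) n) (sym (*-assoc _ _ _)) (horner-z linear-id (suc k) (W n) (shift k h))

module ZSpans = Spans 𝕊

scalar : ∀ c a n → (PowerSeries.intR 𝕊 c Sr.* a) n ≡ c ℤ.* a n
scalar c a n = ≡.trans (Sr.*-congʳ {a} cn n) (SeriesLaws.⊙-const ℤring c a n)
  where
  cn : PowerSeries.intR 𝕊 c Sr.≈ SeriesLaws.const ℤring c
  cn = Sr.trans (Sr.sym (numS c)) (λ { zero → Zp.coef-K0 c ; (suc n) → Zp.coef-Ksuc c n })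

module ZeroEstimate (as : List Sr.Carrier)
  (closed : ∀ {f} → ZSpans.Span as f → Σ (Fin 4 → Sr.Carrier) λ s → (∀ i → ZSpans.Span as (s i)) × f Sr.≈ comb 𝕊 ZD.σS ZΔ.zS s) where
  open ZSpans using (Span)
  open ≡ using (trans; sym; cong₂)

  nth : List Sr.Carrier → ℕ → Sr.Carrier
  nth []       j       = Sr.0#
  nth (a ∷ as) zero    = a
  nth (a ∷ as) (suc j) = nth as j

  coordinates : ∀ as {f} → Span as f → Σ (ℕ → ℤ) λ x → ∀ n → f n ≡ ℤRows.row (List.length as) (λ n j → nth as j n) x n
  coordinates []       e = (λ _ → + 0) , e
  coordinates (a ∷ as) {f} (c , g , h , q) = x′ , λ n → trans (q n) (trans (cong₂ (λ u v → u ℤ.+ v) (trans (scalar c a n) (ℤP.*-comm c (a n))) (proj₂ ih n)) (sym (Sums.Σ-first ℤring (List.length as) (λ j → nth (a ∷ as) j n ℤ.* x′ j))))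
    where
    ih = coordinates as h
    x′ : ℕ → ℤ
    x′ zero    = c
    x′ (suc j) = proj₁ ih j

  ZeroUpTo : Sr.Carrier → ℕ → Set
  ZeroUpTo f k = ∀ n → n < 4 ℕ.^ k → f n ≡ + 0

  Stable : ℕ → Set
  Stable k = ∀ {f} → Span as f → ZeroUpTo f k → ZeroUpTo f (suc k)

  private
    i*4 : ∀ r i k → r < 4 → i < 4 ℕ.^ k → r ℕ.+ i ℕ.* 4 < 4 ℕ.^ suc k
    i*4 r i k r<4 l = ℕP.≤-trans (ℕP.+-monoˡ-≤ (i ℕ.* 4) r<4) (ℕP.≤-trans (ℕP.*-monoˡ-≤ 4 l) (ℕP.≤-reflexive (ℕP.*-comm (4 ℕ.^ k) 4)))

    i*4⁻¹ : ∀ r i k → r ℕ.+ i ℕ.* 4 < 4 ℕ.^ suc k → i < 4 ℕ.^ k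
    i*4⁻¹ r i k l = ℕP.*-cancelʳ-< 4 i (4 ℕ.^ k) (ℕP.≤-<-trans (ℕP.m≤n+m (i ℕ.* 4) r) (ℕP.<-≤-trans l (ℕP.≤-reflexive (ℕP.*-comm 4 (4 ℕ.^ k)))))

  -- If f vanishes below 4^(k+1), its sections vanish below 4^k. They lie in the same span, so
  -- stability at k extends this to 4^(k+1), and reassembling them gives f below 4^(k+2).
  stable-suc : ∀ k → Stable k → Stable (suc k)
  stable-suc k st {f} h z = elim4 (λ n → n < 4 ℕ.^ (2 ℕ.+ k) → f n ≡ + 0)
      (λ i l → trans (f≈ (i ℕ.* 4)) (trans (at0 vs i) (zs 0F i (i*4⁻¹ 0 i (suc k) l))))
      (λ i l → trans (f≈ (1 ℕ.+ i ℕ.* 4)) (trans (at1 vs i) (zs 1F i (i*4⁻¹ 1 i (suc k) l))))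
      (λ i l → trans (f≈ (2 ℕ.+ i ℕ.* 4)) (trans (at2 vs i) (zs 2F i (i*4⁻¹ 2 i (suc k) l))))
      (λ i l → trans (f≈ (3 ℕ.+ i ℕ.* 4)) (trans (at3 vs i) (zs 3F i (i*4⁻¹ 3 i (suc k) l))))
    where
    open ZD.Vals
    s = proj₁ (closed h)
    f≈ = proj₂ (proj₂ (closed h))
    vs = ZD.comb-vals s
    zs₀ : ∀ i → ZeroUpTo (s i) k
    zs₀ 0F i l = trans (sym (at0 vs i)) (trans (sym (f≈ (i ℕ.* 4))) (z _ (i*4 0 i k (s≤s z≤n) l)))
    zs₀ 1F i l = trans (sym (at1 vs i)) (trans (sym (f≈ (1 ℕ.+ i ℕ.* 4))) (z _ (i*4 1 i k (s≤s (s≤s z≤n)) l)))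
    zs₀ 2F i l = trans (sym (at2 vs i)) (trans (sym (f≈ (2 ℕ.+ i ℕ.* 4))) (z _ (i*4 2 i k (s≤s (s≤s (s≤s z≤n))) l)))
    zs₀ 3F i l = trans (sym (at3 vs i)) (trans (sym (f≈ (3 ℕ.+ i ℕ.* 4))) (z _ (i*4 3 i k ℕP.≤-refl l)))
    zs : ∀ i → ZeroUpTo (s i) (suc k)
    zs i = st (proj₁ (proj₂ (closed h)) i) (zs₀ i)

  zero-estimate : Σ ℕ λ M → ∀ {f} → Span as f → (∀ n → n < M → f n ≡ + 0) → ∀ n → f n ≡ + 0
  zero-estimate = 4 ℕ.^ k , λ h z n → upTo n h z n (ℕP.<-≤-trans (n<4^n n) (ℕP.^-monoʳ-≤ 4 (ℕP.m≤m+n n k)))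
    where
    N = List.length as
    a : ℕ → ℕ → ℤ
    a n j = nth as j n
    st₀ = stabilise N a 0
    k = proj₁ st₀
    base : Stable k
    base h z n l = let (x , e) = coordinates as h in trans (e n) (proj₂ (proj₂ st₀) x (λ m l′ → trans (sym (e m)) (z m l′)) n l)
    stable : ∀ i → Stable (i ℕ.+ k)
    stable zero    = base
    stable (suc i) = stable-suc (i ℕ.+ k) (stable i)
    upTo : ∀ i {f} → Span as f → ZeroUpTo f k → ZeroUpTo f (i ℕ.+ k)
    upTo zero    h z = z
    upTo (suc i) h z = stable i h (upTo i h z)
    n<4^n : ∀ n → n < 4 ℕ.^ n
    n<4^n zero    = s≤s z≤n
    n<4^n (suc n) = ℕP.≤-trans (s≤s (n<4^n n)) (ℕP.≤-trans (ℕP.+-monoˡ-≤ (4 ℕ.^ n) (ℕP.m^n>0 4 n)) (ℕP.+-monoʳ-≤ (4 ℕ.^ n) (ℕP.m≤m+n (4 ℕ.^ n) _)))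

-- Independence over ℤ of monomials in z, F, G, E, H

module Independence (M : Model) where
  open Model M using (S; σ′; ζ; F; E)
  open CommutativeRing S hiding (zero)
  open PowerSeries S using (intR; Σ<)
  open Sums S
  open Solver
  open Evaluation M using (eval; no-relations; z; f4; G; Y)
  private
    module Ev = Evaluation M
    module ζ = Hom ζ
    module ℤs = Sums ℤring
    module BA = PolyAux Z
    module CA = PolyAux B₁
    module TA = PolyAux C
    module AA = PolyAux C₁

  H : Carrier
  H = ⟦ σ′ ⟧ E

  4yA : Ar.Carrier
  4yA = ⟦ jA ⟧ (4C Cr.* yC)

  -- t ↦ t - 4y removes the mixed term of Y′.
  module θL = LiftA jA (tA Ar.- 4yA) τA
  module θ⁻L = LiftA jA (tA Ar.+ 4yA) τA
  θ θ⁻ : Hom A A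
  θ = θL.liftA
  θ⁻ = θ⁻L.liftA

  θ⁻θ : ∀ P → ⟦ θ⁻ ⟧ (⟦ θ ⟧ P) Ar.≈ P
  θ⁻θ = extA (θ⁻ ∘H θ) (idHom A)
    (λ c → Ar.trans (Hom.⟦⟧-cong θ⁻ (θL.liftA-j c)) (θ⁻L.liftA-j c))
    (Ar.trans (Hom.⟦⟧-cong θ⁻ θL.liftA-t) (Ar.trans (Hom.sub-homo θ⁻ _ _) (Ar.trans (Ar.+-cong θ⁻L.liftA-t (Ar.-‿cong (θ⁻L.liftA-j _)))
      (let open As.Solver in As.Solver.solve 2 (λ t y → (t As.Solver.:+ y) As.Solver.:- y As.Solver.:= t) Ar.refl tA 4yA))))
    (Ar.trans (Hom.⟦⟧-cong θ⁻ θL.liftA-τ) θ⁻L.liftA-τ)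

  eval′ : Hom A S
  eval′ = eval ∘H θ

  eval′-inj : ∀ P → ⟦ eval′ ⟧ P ≈ 0# → P Ar.≈ Ar.0#
  eval′-inj P e = Ar.trans (Ar.sym (θ⁻θ P)) (Hom.≈0-homo θ⁻ (no-relations (⟦ θ ⟧ P) e))

  eval′-j : ∀ c → ⟦ eval′ ⟧ (⟦ jA ⟧ c) ≈ ⟦ Ev.evC.liftC ⟧ c
  eval′-j c = trans (Hom.⟦⟧-cong eval (θL.liftA-j c)) (Ev.ev.liftA-j c)

  s16 : Carrier
  s16 = f4 * f4

  eval′-t : ⟦ eval′ ⟧ tA ≈ (s16 * z) * H
  eval′-t = trans (Hom.⟦⟧-cong eval θL.liftA-t) (trans (Hom.sub-homo eval _ _)
    (trans (+-cong Ev.ev.liftA-t (-‿cong (trans (Ev.ev.liftA-j _) (trans (Hom.*-homo Ev.evC.liftC _ _) (*-cong (Ev.evC.liftC-ι four) Ev.evC.liftC-y)))))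
      (solve 4 (λ f y z h → (f :* y :+ f :* (f :* (z :* h))) :- f :* y := ((f :* f) :* z) :* h) refl f4 Y z H)))

  eval′-τ : ⟦ eval′ ⟧ τA ≈ f4 * E
  eval′-τ = trans (Hom.⟦⟧-cong eval θL.liftA-τ) Ev.ev.liftA-τ

  mono : ℤ → ℕ → ℕ → ℕ → ℕ → ℕ → Ar.Carrier
  mono i w e₁ e₂ e₃ e₄ = Ap.K (Tp.K (Cp.K (Bp.K (Zp.K i Zr.* zᵖ ZA.^ₚ w) Br.* Bp.X BA.^ₚ e₁) Cr.* Cp.X CA.^ₚ e₂) Tr.* Tp.X TA.^ₚ e₄) Ar.* Ap.X AA.^ₚ e₃

  coefficient : ℕ → ℕ → ℕ → ℕ → ℕ → Ar.Carrier → ℤ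
  coefficient w e₁ e₂ e₃ e₄ P = Zp.coef (Bp.coef (Cp.coef (Tp.coef (Ap.coef P e₃) e₄) e₂) e₁) w

  coefficient-Σ : ∀ w e₁ e₂ e₃ e₄ N (P : ℕ → Ar.Carrier) → coefficient w e₁ e₂ e₃ e₄ (PowerSeries.Σ< A N P) ≡ PowerSeries.Σ< ℤring N (λ k → coefficient w e₁ e₂ e₃ e₄ (P k))
  coefficient-Σ w e₁ e₂ e₃ e₄ N P = ≡.trans (Zp.coef-cong (Br-cong (Cr-cong (Tr-cong (Ap.coef-Σ N P e₃)))) w) (≡.trans
    (Zp.coef-cong (Br-cong (Cr-cong (Tp.coef-Σ N (λ k → Ap.coef (P k) e₃) e₄))) w) (≡.trans
    (Zp.coef-cong (Br-cong (Cp.coef-Σ N (λ k → Tp.coef (Ap.coef (P k) e₃) e₄) e₂)) w) (≡.trans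
    (Zp.coef-cong (Bp.coef-Σ N (λ k → Cp.coef (Tp.coef (Ap.coef (P k) e₃) e₄) e₂) e₁) w)
    (Zp.coef-Σ N (λ k → Bp.coef (Cp.coef (Tp.coef (Ap.coef (P k) e₃) e₄) e₂) e₁) w))))
    where
    Br-cong : ∀ {p q} → p Br.≈ q → Bp.coef p e₁ Zr.≈ Bp.coef q e₁
    Br-cong e = Bp.coef-cong e e₁
    Cr-cong : ∀ {p q} → p Cr.≈ q → Cp.coef p e₂ Br.≈ Cp.coef q e₂
    Cr-cong e = Cp.coef-cong e e₂
    Tr-cong : ∀ {p q} → p Tr.≈ q → Tp.coef p e₄ Cr.≈ Tp.coef q e₄
    Tr-cong e = Tp.coef-cong e e₄

  coefficient-0 : ∀ w e₁ e₂ e₃ e₄ {P} → P Ar.≈ Ar.0# → coefficient w e₁ e₂ e₃ e₄ P ≡ + 0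
  coefficient-0 w e₁ e₂ e₃ e₄ e = Zp.coef≈0 (Bp.coef≈0 (Cp.coef≈0 (Tp.coef≈0 (Ap.coef≈0 e e₃) e₄) e₂) e₁) w

  coefficient-same : ∀ i w e₁ e₂ e₃ e₄ → coefficient w e₁ e₂ e₃ e₄ (mono i w e₁ e₂ e₃ e₄) ≡ i
  coefficient-same i w e₁ e₂ e₃ e₄ = ≡.trans
    (Zp.coef-cong (Zr.trans (Bp.coef-cong (Br.trans (Cp.coef-cong (Cr.trans (Tp.coef-cong (AA.mon-same _ e₃) e₄) (TA.mon-same _ e₄)) e₂) (CA.mon-same _ e₂)) e₁) (BA.mon-same _ e₁)) w)
    (ZA.mon-same i w)

  coefficient-other : ∀ i w e₁ e₂ e₃ e₄ w′ e₁′ e₂′ e₃′ e₄′ → (w ≡ w′ → e₁ ≡ e₁′ → e₂ ≡ e₂′ → e₃ ≡ e₃′ → e₄ ≡ e₄′ → ⊥) →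
    coefficient w e₁ e₂ e₃ e₄ (mono i w′ e₁′ e₂′ e₃′ e₄′) ≡ + 0
  coefficient-other i w e₁ e₂ e₃ e₄ w′ e₁′ e₂′ e₃′ e₄′ ne = τ-case (e₃ ℕ.≟ e₃′)
    where
    q = Zp.K i Zr.* zᵖ ZA.^ₚ w′
    m₁ = Bp.K q Br.* Bp.X BA.^ₚ e₁′
    m₂ = Cp.K m₁ Cr.* Cp.X CA.^ₚ e₂′
    m₄ = Tp.K m₂ Tr.* Tp.X TA.^ₚ e₄′
    x-case : e₂ ≡ e₂′ → e₃ ≡ e₃′ → e₄ ≡ e₄′ → Dec (e₁ ≡ e₁′) → Zp.coef (Bp.coef m₁ e₁) w ≡ + 0
    x-case q₂ q₃ q₄ (no n) = Zp.coef≈0 (BA.mon-other q e₁′ e₁ n) w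
    x-case q₂ q₃ q₄ (yes q₁) = ≡.trans (Zp.coef-cong (Zr.trans (Zr.reflexive (≡.cong (Bp.coef m₁) q₁)) (BA.mon-same q e₁′)) w) (ZA.mon-other i w′ w (λ qw → ne qw q₁ q₂ q₃ q₄))
    y-case : e₃ ≡ e₃′ → e₄ ≡ e₄′ → Dec (e₂ ≡ e₂′) → Zp.coef (Bp.coef (Cp.coef m₂ e₂) e₁) w ≡ + 0
    y-case q₃ q₄ (no n) = Zp.coef≈0 (Bp.coef≈0 (CA.mon-other m₁ e₂′ e₂ n) e₁) w
    y-case q₃ q₄ (yes q₂) = ≡.trans (Zp.coef-cong (Bp.coef-cong (Br.trans (Br.reflexive (≡.cong (Cp.coef m₂) q₂)) (CA.mon-same m₁ e₂′)) e₁) w) (x-case q₂ q₃ q₄ (e₁ ℕ.≟ e₁′))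
    t-case : e₃ ≡ e₃′ → Dec (e₄ ≡ e₄′) → Zp.coef (Bp.coef (Cp.coef (Tp.coef m₄ e₄) e₂) e₁) w ≡ + 0
    t-case q₃ (no n) = Zp.coef≈0 (Bp.coef≈0 (Cp.coef≈0 (TA.mon-other m₂ e₄′ e₄ n) e₂) e₁) w
    t-case q₃ (yes q₄) = ≡.trans (Zp.coef-cong (Bp.coef-cong (Cp.coef-cong (Cr.trans (Cr.reflexive (≡.cong (Tp.coef m₄) q₄)) (TA.mon-same m₂ e₄′)) e₂) e₁) w) (y-case q₃ q₄ (e₂ ℕ.≟ e₂′))
    τ-case : Dec (e₃ ≡ e₃′) → coefficient w e₁ e₂ e₃ e₄ (mono i w′ e₁′ e₂′ e₃′ e₄′) ≡ + 0
    τ-case (no n) = Zp.coef≈0 (Bp.coef≈0 (Cp.coef≈0 (Tp.coef≈0 (AA.mon-other m₄ e₃′ e₃ n) e₄) e₂) e₁) w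
    τ-case (yes q₃) = ≡.trans (Zp.coef-cong (Bp.coef-cong (Cp.coef-cong (Tp.coef-cong (Tr.trans (Tr.reflexive (≡.cong (Ap.coef (Ap.K m₄ Ar.* Ap.X AA.^ₚ e₃′)) q₃)) (AA.mon-same m₄ e₃′)) e₄) e₂) e₁) w) (t-case q₃ (e₄ ℕ.≟ e₄′))

  eval′-mono : ∀ i w e₁ e₂ e₃ e₄ → ⟦ eval′ ⟧ (mono i w e₁ e₂ e₃ e₄) ≈ ((((intR i * z ^ w) * F ^ e₁) * (z * G) ^ e₂) * ((s16 * z) * H) ^ e₄) * (f4 * E) ^ e₃
  eval′-mono i w e₁ e₂ e₃ e₄ = trans (Hom.*-homo eval′ _ _) (*-cong
    (trans (Hom.⟦⟧-cong eval′ (Hom.*-homo Ap.KHom _ _)) (trans (Hom.*-homo eval′ _ _) (*-cong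
      (trans (eval′-j _) (trans (Hom.*-homo Ev.evC.liftC _ _) (*-cong
        (trans (Hom.⟦⟧-cong Ev.evC.liftC (Hom.*-homo Cp.KHom _ _)) (trans (Hom.*-homo Ev.evC.liftC _ _) (*-cong
          (trans (Ev.evC.liftC-ι _) (trans (ζ.*-homo _ _) (*-cong (ℤ-hom-unique (ζ ∘H Zp.KHom) (intHom S) i) (ζ.^-homo zᵖ w))))
          (trans (Hom.^-homo (Ev.evC.liftC ∘H Cp.KHom) Bp.X e₁) (^-cong e₁ Ev.evC.liftC-x)))))
        (trans (Hom.^-homo Ev.evC.liftC yC e₂) (^-cong e₂ Ev.evC.liftC-y)))))
      (trans (Hom.^-homo (eval′ ∘H Ap.KHom) Tp.X e₄) (^-cong e₄ eval′-t)))))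
    (trans (Hom.^-homo eval′ τA e₃) (^-cong e₃ eval′-τ)))

  module _ (d : ℕ) where
    -- Under `eval′` the variables y, t, τ become z G, 16 z H and 4 E. Here and in `weight` every
    -- monomial is padded with the complementary powers up to exponent d. The surplus factor is then
    -- the common `cst`, so a linear relation between monomials becomes a polynomial relation with
    -- value zero.
    scale : ℕ → ℕ → ℤ
    scale e₃ e₄ = (+ 4) ℤs.^ (d ∸ e₃) ℤ.* (+ 16) ℤs.^ (d ∸ e₄)

    scale≢0 : ∀ e₃ e₄ → ¬ scale e₃ e₄ ≡ + 0
    scale≢0 e₃ e₄ = Dom.*≉0 ℤ-dom (Dom.^≉0 ℤ-dom (d ∸ e₃) (λ ())) (Dom.^≉0 ℤ-dom (d ∸ e₄) (λ ()))

    weight : ℕ → ℕ → ℕ → ℕ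
    weight e₀ e₂ e₄ = (e₀ ℕ.+ (d ∸ e₂)) ℕ.+ (d ∸ e₄)

    cst : Carrier
    cst = (z ^ d * f4 ^ d) * (s16 ^ d * z ^ d)

    monomial : ℕ → ℕ → ℕ → ℕ → ℕ → Carrier
    monomial e₀ e₁ e₂ e₃ e₄ = z ^ e₀ * (F ^ e₁ * (G ^ e₂ * (E ^ e₃ * (H ^ e₄ * 1#))))

    private
      intR-scale : ∀ e₃ e₄ → intR (scale e₃ e₄) ≈ f4 ^ (d ∸ e₃) * s16 ^ (d ∸ e₄)
      intR-scale e₃ e₄ = trans (intR-* ((+ 4) ℤs.^ (d ∸ e₃)) ((+ 16) ℤs.^ (d ∸ e₄))) (*-cong
        (trans (Hom.^-homo (intHom S) (+ 4) (d ∸ e₃)) (^-cong (d ∸ e₃) 4≈))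
        (trans (Hom.^-homo (intHom S) (+ 16) (d ∸ e₄)) (^-cong (d ∸ e₄) (trans (intR-* (+ 4) (+ 4)) (*-cong 4≈ 4≈)))))
        where
        4≈ : intR (+ 4) ≈ f4
        4≈ = ℤ-hom-unique (intHom S) (ζ ∘H Zp.KHom) (+ 4)

      join : ∀ x e → e ≤ d → x ^ (d ∸ e) * x ^ e ≈ x ^ d
      join x e l = trans (sym (^-+ x (d ∸ e) e)) (reflexive (≡.cong (x ^_) (ℕP.m∸n+n≡m l)))

      split₁ : ∀ a p r u v w → (a * (p * r)) * ((u * v) * w) ≈ (a * u) * (v * (p * (r * w)))
      split₁ = solve 6 (λ a p r u v w → (a :* (p :* r)) :* ((u :* v) :* w) := (a :* u) :* (v :* (p :* (r :* w)))) refl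

      split₂ : ∀ a v p r f y t x → ((((a * (v * (p * r))) * f) * y) * t) * x ≈ (a * f) * ((v * y) * ((p * x) * (r * t)))
      split₂ = solve 8 (λ a v p r f y t x → ((((a :* (v :* (p :* r))) :* f) :* y) :* t) :* x := (a :* f) :* ((v :* y) :* ((p :* x) :* (r :* t)))) refl

      split₃ : ∀ a b g c e q h → a * ((b * g) * ((c * e) * (q * h))) ≈ ((b * c) * q) * (a * (g * (e * h)))
      split₃ = solve 7 (λ a b g c e q h → a :* ((b :* g) :* ((c :* e) :* (q :* h))) := ((b :* c) :* q) :* (a :* (g :* (e :* h)))) refl

    eval′-scaled : ∀ i e₀ e₁ e₂ e₃ e₄ → e₂ ≤ d → e₃ ≤ d → e₄ ≤ d →
      ⟦ eval′ ⟧ (mono (i ℤ.* scale e₃ e₄) (weight e₀ e₂ e₄) e₁ e₂ e₃ e₄) ≈ cst * (intR i * monomial e₀ e₁ e₂ e₃ e₄)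
    eval′-scaled i e₀ e₁ e₂ e₃ e₄ l₂ l₃ l₄ = trans (eval′-mono (i ℤ.* scale e₃ e₄) (weight e₀ e₂ e₄) e₁ e₂ e₃ e₄) (trans
      (*-congʳ (*-congʳ (*-congʳ (*-congʳ (trans (*-cong (trans (intR-* i (scale e₃ e₄)) (*-congˡ (intR-scale e₃ e₄))) (trans (^-+ z (e₀ ℕ.+ (d ∸ e₂)) (d ∸ e₄)) (*-congʳ (^-+ z e₀ (d ∸ e₂)))))
        (split₁ (intR i) _ _ (z ^ e₀) _ _)))))) (trans
      (split₂ (intR i * z ^ e₀) (z ^ (d ∸ e₂)) (f4 ^ (d ∸ e₃)) (s16 ^ (d ∸ e₄) * z ^ (d ∸ e₄)) (F ^ e₁) ((z * G) ^ e₂) (((s16 * z) * H) ^ e₄) ((f4 * E) ^ e₃)) (trans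
      (*-congˡ (*-cong (merge z G e₂ l₂) (*-cong (merge f4 E e₃ l₃) (trans (*-congʳ (sym (^-* s16 z (d ∸ e₄)))) (trans (merge (s16 * z) H e₄ l₄) (*-congʳ (^-* s16 z d))))))) (trans
      (split₃ ((intR i * z ^ e₀) * F ^ e₁) (z ^ d) (G ^ e₂) (f4 ^ d) (E ^ e₃) (s16 ^ d * z ^ d) (H ^ e₄))
      (*-congˡ (trans (*-assoc _ _ _) (trans (*-assoc _ _ _) (*-congˡ (*-congˡ (*-congˡ (*-congˡ (*-congˡ (sym (*-identityʳ _)))))))))))))) 
      where
      merge : ∀ x y e → e ≤ d → x ^ (d ∸ e) * (x * y) ^ e ≈ x ^ d * y ^ e
      merge x y e l = trans (*-congˡ (^-* x y e)) (trans (sym (*-assoc _ _ _)) (*-congʳ (join x e l)))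

    independent : ∀ N (x : ℕ → ℤ) (e₀ e₁ e₂ e₃ e₄ : ℕ → ℕ) → (∀ k → e₂ k ≤ d) → (∀ k → e₃ k ≤ d) → (∀ k → e₄ k ≤ d) →
      (∀ i k → e₀ i ≡ e₀ k → e₁ i ≡ e₁ k → e₂ i ≡ e₂ k → e₃ i ≡ e₃ k → e₄ i ≡ e₄ k → i ≡ k) →
      Σ< N (λ k → intR (x k) * monomial (e₀ k) (e₁ k) (e₂ k) (e₃ k) (e₄ k)) ≈ 0# → ∀ k → k < N → x k ≡ + 0
    independent N x e₀ e₁ e₂ e₃ e₄ l₂ l₃ l₄ inj e k k<N = Dom.cancel0 ℤ-dom (scale≢0 (e₃ k) (e₄ k)) (≡.trans (ℤP.*-comm (scale (e₃ k) (e₄ k)) (x k)) (≡.trans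
      (≡.sym (coefficient-same (x k ℤ.* scale (e₃ k) (e₄ k)) (w k) (e₁ k) (e₂ k) (e₃ k) (e₄ k))) (≡.trans
      (≡.sym (ℤs.Σ-single N k (λ i → coefficient (w k) (e₁ k) (e₂ k) (e₃ k) (e₄ k) (m i)) k<N other)) (≡.trans
      (≡.sym (coefficient-Σ (w k) (e₁ k) (e₂ k) (e₃ k) (e₄ k) N m)) (coefficient-0 (w k) (e₁ k) (e₂ k) (e₃ k) (e₄ k) P≈0)))))
      where
      w : ℕ → ℕ
      w k = weight (e₀ k) (e₂ k) (e₄ k)
      m : ℕ → Ar.Carrier
      m k = mono (x k ℤ.* scale (e₃ k) (e₄ k)) (w k) (e₁ k) (e₂ k) (e₃ k) (e₄ k)
      P≈0 : PowerSeries.Σ< A N m Ar.≈ Ar.0#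
      P≈0 = eval′-inj _ (trans (Hom.Σ-homo eval′ N m) (trans (Σ-cong′ N (λ k → eval′-scaled (x k) (e₀ k) (e₁ k) (e₂ k) (e₃ k) (e₄ k) (l₂ k) (l₃ k) (l₄ k)))
        (trans (Σ-*ˡ N cst _) (trans (*-congˡ e) (zeroʳ cst)))))
      other : ∀ i → ¬ i ≡ k → coefficient (w k) (e₁ k) (e₂ k) (e₃ k) (e₄ k) (m i) ≡ + 0
      other i ne = coefficient-other (x i ℤ.* scale (e₃ i) (e₄ i)) (w k) (e₁ k) (e₂ k) (e₃ k) (e₄ k) (w i) (e₁ i) (e₂ i) (e₃ i) (e₄ i)
        (λ qw q₁ q₂ q₃ q₄ → ne (≡.sym (inj k i (cancel-w qw q₂ q₄) q₁ q₂ q₃ q₄)))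
        where
        -- The padding of the exponent of z depends only on e₂ and e₄, which already agree.
        cancel-w : w k ≡ w i → e₂ k ≡ e₂ i → e₄ k ≡ e₄ i → e₀ k ≡ e₀ i
        cancel-w qw q₂ q₄ = ℕP.+-cancelʳ-≡ (d ∸ e₂ i) (e₀ k) (e₀ i) (ℕP.+-cancelʳ-≡ (d ∸ e₄ i) _ _
          (≡.trans (≡.sym (≡.cong₂ (λ a b → (e₀ k ℕ.+ (d ∸ a)) ℕ.+ (d ∸ b)) q₂ q₄)) qw))

-- Five exponents as the digits of one index

module Digits (d : ℕ) where
  open import Data.Nat.DivMod using (_/_; _%_; m≡m%n+[m/n]*n; [m+kn]%n≡m%n; m<n⇒m%n≡m; m%n<n; m<n*o⇒m/o<n)

  D : ℕ
  D = suc d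

  abstract
    quo rem : ℕ → ℕ
    quo k = k / D
    rem k = k % D

    rem≤ : ∀ k → rem k ≤ d
    rem≤ k = ℕP.≤-pred (m%n<n k D)

    quo< : ∀ m {k} → k < m ℕ.* D → quo k < m
    quo< m l = m<n*o⇒m/o<n {n = m} l

    div-mod : ∀ k → k ≡ rem k ℕ.+ quo k ℕ.* D
    div-mod k = m≡m%n+[m/n]*n k D

    rem-+ : ∀ i j → j ≤ d → rem (j ℕ.+ i ℕ.* D) ≡ j
    rem-+ i j l = ≡.trans ([m+kn]%n≡m%n j i D) (m<n⇒m%n≡m (s≤s l))

  quo-+ : ∀ i j → j ≤ d → quo (j ℕ.+ i ℕ.* D) ≡ i
  quo-+ i j l = ℕP.*-cancelʳ-≡ _ _ D (ℕP.+-cancelˡ-≡ j _ _ (≡.trans (≡.cong (ℕ._+ quo (j ℕ.+ i ℕ.* D) ℕ.* D) (≡.sym (rem-+ i j l))) (≡.sym (div-mod (j ℕ.+ i ℕ.* D)))))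

  digits-inj : ∀ i k → quo i ≡ quo k → rem i ≡ rem k → i ≡ k
  digits-inj i k q r = ≡.trans (div-mod i) (≡.trans (≡.cong₂ (λ a b → a ℕ.+ b ℕ.* D) r q) (≡.sym (div-mod k)))

  <-+ : ∀ {m i j} → i < m → j ≤ d → j ℕ.+ i ℕ.* D < m ℕ.* D
  <-+ {m} {i} l l′ = ℕP.≤-trans (ℕP.+-monoˡ-≤ (i ℕ.* D) (s≤s l′)) (ℕP.*-monoˡ-≤ D l)

  D⁵ : ℕ
  D⁵ = (((D ℕ.* D) ℕ.* D) ℕ.* D) ℕ.* D

  d₀ d₁ d₂ d₃ d₄ : ℕ → ℕ
  d₄ k = rem k
  d₃ k = rem (quo k)
  d₂ k = rem (quo (quo k))
  d₁ k = rem (quo (quo (quo k)))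
  d₀ k = quo (quo (quo (quo k)))

  flat : ∀ {c} {A : Set c} → (ℕ → ℕ → ℕ → ℕ → ℕ → A) → ℕ → A
  flat b k = b (d₀ k) (d₁ k) (d₂ k) (d₃ k) (d₄ k)

  d₀≤ : ∀ k → k < D⁵ → d₀ k ≤ d
  d₀≤ k l = ℕP.≤-pred (quo< D (quo< (D ℕ.* D) (quo< ((D ℕ.* D) ℕ.* D) (quo< (((D ℕ.* D) ℕ.* D) ℕ.* D) l))))

  flat-inj : ∀ i k → d₀ i ≡ d₀ k → d₁ i ≡ d₁ k → d₂ i ≡ d₂ k → d₃ i ≡ d₃ k → d₄ i ≡ d₄ k → i ≡ k
  flat-inj i k q₀ q₁ q₂ q₃ q₄ = digits-inj i k (digits-inj _ _ (digits-inj _ _ (digits-inj _ _ q₀ q₁) q₂) q₃) q₄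

  flat-surj : ∀ {c} {A : Set c} (b : ℕ → ℕ → ℕ → ℕ → ℕ → A) {e₀ e₁ e₂ e₃ e₄} → e₀ ≤ d → e₁ ≤ d → e₂ ≤ d → e₃ ≤ d → e₄ ≤ d → Σ ℕ λ k → (k < D⁵) × flat b k ≡ b e₀ e₁ e₂ e₃ e₄
  flat-surj b {e₀} {e₁} {e₂} {e₃} {e₄} l₀ l₁ l₂ l₃ l₄ = k₄ , <-+ (<-+ (<-+ (<-+ (s≤s l₀) l₁) l₂) l₃) l₄ , eq
    where
    k₁ = e₁ ℕ.+ e₀ ℕ.* D
    k₂ = e₂ ℕ.+ k₁ ℕ.* D
    k₃ = e₃ ℕ.+ k₂ ℕ.* D
    k₄ = e₄ ℕ.+ k₃ ℕ.* D
    eq : flat b k₄ ≡ b e₀ e₁ e₂ e₃ e₄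
    eq rewrite quo-+ k₃ e₄ l₄ | rem-+ k₃ e₄ l₄ | quo-+ k₂ e₃ l₃ | rem-+ k₂ e₃ l₃ | quo-+ k₁ e₂ l₂ | rem-+ k₁ e₂ l₂ | quo-+ e₀ e₁ l₁ | rem-+ e₀ e₁ l₁ = ≡.refl

  module _ {c ℓ : Level} (R : CommutativeRing c ℓ) where
    open CommutativeRing R hiding (zero)
    open PowerSeries R using (Σ<)
    open Sums R

    Σ-flatten : ∀ m (b : ℕ → ℕ → Carrier) → Σ< m (λ i → Σ< D (b i)) ≈ Σ< (m ℕ.* D) (λ k → b (quo k) (rem k))
    Σ-flatten zero    b = refl
    Σ-flatten (suc m) b = trans (+-cong (Σ-flatten m b) (Σ-cong D (λ j l → reflexive (≡.sym (at j (ℕP.≤-pred l))))))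
      (trans (sym (Σ-split (m ℕ.* D) D (λ k → b (quo k) (rem k)))) (reflexive (≡.cong (λ n → Σ< n (λ k → b (quo k) (rem k))) (ℕP.+-comm (m ℕ.* D) D))))
      where
      at : ∀ j → j ≤ d → b (quo (m ℕ.* D ℕ.+ j)) (rem (m ℕ.* D ℕ.+ j)) ≡ b m j
      at j l = ≡.trans (≡.cong (λ k → b (quo k) (rem k)) (ℕP.+-comm (m ℕ.* D) j)) (≡.cong₂ b (quo-+ m j l) (rem-+ m j l))

    Σ-flatten₅ : (b : ℕ → ℕ → ℕ → ℕ → ℕ → Carrier) →
      Σ< D (λ e₀ → Σ< D (λ e₁ → Σ< D (λ e₂ → Σ< D (λ e₃ → Σ< D (λ e₄ → b e₀ e₁ e₂ e₃ e₄))))) ≈ Σ< D⁵ (flat b)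
    Σ-flatten₅ b = trans (Σ-flatten D (λ e₀ e₁ → Σ< D (λ e₂ → Σ< D (λ e₃ → Σ< D (λ e₄ → b e₀ e₁ e₂ e₃ e₄)))))
      (trans (Σ-flatten (D ℕ.* D) (λ k e₂ → Σ< D (λ e₃ → Σ< D (λ e₄ → b (quo k) (rem k) e₂ e₃ e₄))))
      (trans (Σ-flatten ((D ℕ.* D) ℕ.* D) (λ k e₃ → Σ< D (λ e₄ → b (quo (quo k)) (rem (quo k)) (rem k) e₃ e₄)))
        (Σ-flatten (((D ℕ.* D) ℕ.* D) ℕ.* D) (λ k e₄ → b (quo (quo (quo k))) (rem (quo (quo k))) (rem (quo k)) (rem k) e₄))))

-- Transfer from ℤ to the field

module IntegerSeries {c ℓ : Level} (K : CommutativeRing c ℓ) where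
  open CommutativeRing K hiding (zero)
  open PowerSeries K
  open Sums K
  private module PZ = PowerSeries ℤring

  ↑ : (ℕ → ℤ) → Series
  ↑ f n = intR (f n)

  ↑-Σ : ∀ n f → intR (PZ.Σ< n f) ≈ Σ< n (λ i → intR (f i))
  ↑-Σ zero    f = refl
  ↑-Σ (suc n) f = trans (intR-+ (PZ.Σ< n f) (f n)) (+-congʳ (↑-Σ n f))

  ↑-⊙ : ∀ {f g : ℕ → ℤ} {f′ g′} → ↑ f ≋ f′ → ↑ g ≋ g′ → ↑ (f PZ.⊙ g) ≋ (f′ ⊙ g′)
  ↑-⊙ {f} {g} p q n = trans (↑-Σ (suc n) (λ i → f i ℤ.* g (n ∸ i))) (Σ-cong′ (suc n) (λ i → trans (intR-* (f i) (g (n ∸ i))) (*-cong (p i) (q (n ∸ i)))))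

  ↑-zpow : ∀ k → ↑ (PZ.zpow k) ≋ zpow k
  ↑-zpow k n with n ℕ.≡ᵇ k
  ... | true  = intR-1
  ... | false = refl

  ↑-⊙^ : ∀ {f : ℕ → ℤ} {f′} → ↑ f ≋ f′ → ∀ k → ↑ (f PZ.⊙^ k) ≋ (f′ ⊙^ k)
  ↑-⊙^ p zero    = ↑-zpow 0
  ↑-⊙^ {f} p (suc k) = ↑-⊙ {f} {f PZ.⊙^ k} p (↑-⊙^ p k)

  ↑-dilate : ∀ {f : ℕ → ℤ} {f′} → ↑ f ≋ f′ → ↑ (PZ.dilate 4 f) ≋ dilate 4 f′
  ↑-dilate p n with (n ℕ.% 4) ℕ.≡ᵇ 0
  ... | true  = p (n ℕ./ 4)
  ... | false = refl

  ↑-deriv : ∀ f → ↑ (PZ.deriv f) ≋ deriv (↑ f)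
  ↑-deriv f n = trans (intR-* (PZ.natR (suc n)) (f (suc n))) (*-congʳ (reflexive (≡.cong intR (intR-ℤ (+ suc n)))))

module ClearDenominators (R : CRing) where
  open CommutativeRing R hiding (zero)
  open Sums R
  open Solver

  z⁴^ : ∀ z m → z ^ (m ℕ.* 4) ≈ (z * (z * (z * z))) ^ m
  z⁴^ z zero    = refl
  z⁴^ z (suc m) = trans (solve 2 (λ z y → z :* (z :* (z :* (z :* y))) := (z :* (z :* (z :* z))) :* y) refl z (z ^ (m ℕ.* 4))) (*-congˡ (z⁴^ z m))

  merge : ∀ d z {x y} e → e ≤ d → x ≈ z * y → z ^ (d ∸ e) * x ^ e ≈ z ^ d * y ^ e
  merge d z {x} {y} e l q = trans (*-congˡ (trans (^-cong e q) (^-* z y e))) (trans (sym (*-assoc _ _ _)) (*-congʳ (trans (sym (^-+ z (d ∸ e) e)) (reflexive (≡.cong (z ^_) (ℕP.m∸n+n≡m l))))))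

  -- Padding with z^(d-e₃) and z^(4(d-e₄)) compensates the factors z in E = z D and z⁴ in H = z⁴ D′.
  -- The surplus is the same for every monomial, so relations between the derivatives become
  -- relations between E and H.
  column : ∀ d z F G E H D D′ → E ≈ z * D → H ≈ (z * (z * (z * z))) * D′ → ∀ e₀ e₁ e₂ e₃ e₄ → e₃ ≤ d → e₄ ≤ d →
    z ^ (e₀ ℕ.+ ((d ∸ e₃) ℕ.+ (d ∸ e₄) ℕ.* 4)) * (F ^ e₁ * (G ^ e₂ * (E ^ e₃ * (H ^ e₄ * 1#)))) ≈
    (z ^ d * (z * (z * (z * z))) ^ d) * (z ^ e₀ * (F ^ e₁ * (G ^ e₂ * (D ^ e₃ * D′ ^ e₄))))
  column d z F G E H D D′ qE qH e₀ e₁ e₂ e₃ e₄ l₃ l₄ = trans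
    (*-cong (trans (^-+ z e₀ _) (*-congˡ (trans (^-+ z (d ∸ e₃) _) (*-congˡ (z⁴^ z (d ∸ e₄)))))) (*-congˡ (*-congˡ (*-congˡ (*-identityʳ _))))) (trans
    (gather (z ^ e₀) (z ^ (d ∸ e₃)) ((z * (z * (z * z))) ^ (d ∸ e₄)) (F ^ e₁) (G ^ e₂) (E ^ e₃) (H ^ e₄)) (trans
    (*-congˡ (*-congˡ (*-congˡ (*-cong (merge d z e₃ l₃ qE) (merge d (z * (z * (z * z))) e₄ l₄ qH)))))
    (factor (z ^ e₀) (F ^ e₁) (G ^ e₂) (z ^ d) (D ^ e₃) ((z * (z * (z * z))) ^ d) (D′ ^ e₄))))
    where
    gather : ∀ u v w f g x y → (u * (v * w)) * (f * (g * (x * y))) ≈ u * (f * (g * ((v * x) * (w * y))))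
    gather = solve 7 (λ u v w f g x y → (u :* (v :* w)) :* (f :* (g :* (x :* y))) := u :* (f :* (g :* ((v :* x) :* (w :* y))))) refl
    factor : ∀ u f g a p b q → u * (f * (g * ((a * p) * (b * q)))) ≈ (a * b) * (u * (f * (g * (p * q))))
    factor = solve 7 (λ u f g a p b q → u :* (f :* (g :* ((a :* p) :* (b :* q)))) := (a :* b) :* (u :* (f :* (g :* (p :* q))))) refl

module Columns (F : ℕ → ℤ) (isF : IsF F) (d : ℕ) where
  open Solution F isF using (G; E; n4; F-eq; E-eq; pS≈; δpS≈; s≈)
  open SeriesModel F isF using (model; zζ)
  open ZD using (dil; σS)
  open ZΔ using (zS)
  open PowerSeries ℤring using (zpow; dilate; deriv; _⊙_; _⊙^_)
  module SC = SectionClosed 𝕊 σS zS F E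
  module Ind = Independence model
  open Digits d

  H z⁴ : Sr.Carrier
  H = dil E
  z⁴ = SC.z⁴

  weight : ℕ → ℕ → ℕ → ℕ
  weight e₀ e₃ e₄ = e₀ ℕ.+ ((d ∸ e₃) ℕ.+ (d ∸ e₄) ℕ.* 4)

  column : ℕ → ℕ → ℕ → ℕ → ℕ → Sr.Carrier
  column e₀ e₁ e₂ e₃ e₄ = zS Ss.^ weight e₀ e₃ e₄ Sr.* (F Ss.^ e₁ Sr.* (G Ss.^ e₂ Sr.* (E Ss.^ e₃ Sr.* (H Ss.^ e₄ Sr.* Sr.1#))))

  term : ℕ → ℕ → ℕ → ℕ → ℕ → Sr.Carrier
  term e₀ e₁ e₂ e₃ e₄ = zpow e₀ ⊙ ((F ⊙^ e₁) ⊙ ((dilate 4 F ⊙^ e₂) ⊙ ((deriv F ⊙^ e₃) ⊙ (dilate 4 (deriv F) ⊙^ e₄))))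

  cst : Sr.Carrier
  cst = zS Ss.^ d Sr.* z⁴ Ss.^ d

  private
    pow : ∀ {f g} → f Sr.≈ g → ∀ n → f Ss.^ n Sr.≈ (g ⊙^ n)
    pow e zero    = Sr.refl
    pow {f} {g} e (suc n) = Sr.*-cong {x = f} e (pow e n)

    z-pow : ∀ n → zS Ss.^ n Sr.≈ zpow n
    z-pow zero    = Sr.refl
    z-pow (suc n) = Sr.trans (Sr.*-congˡ {zS} (z-pow n)) (Sr.sym (ZΔ.zpow-suc n))

  column≈ : ∀ e₀ e₁ e₂ e₃ e₄ → e₃ ≤ d → e₄ ≤ d → column e₀ e₁ e₂ e₃ e₄ Sr.≈ cst Sr.* term e₀ e₁ e₂ e₃ e₄
  column≈ e₀ e₁ e₂ e₃ e₄ l₃ l₄ = Sr.trans (ClearDenominators.column 𝕊 d zS F G E H (deriv F) (dil (deriv F)) (ZΔ.δ-deriv F) H≈ e₀ e₁ e₂ e₃ e₄ l₃ l₄)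
    (Sr.*-congˡ {cst} (Sr.*-cong {x = zS Ss.^ e₀} (z-pow e₀) (Sr.*-cong {x = F Ss.^ e₁} (pow {F} Sr.refl e₁) (Sr.*-cong {x = G Ss.^ e₂} (pow {G} (Sr.sym (ZΔ.dilate≋dil F)) e₂)
      (Sr.*-cong {x = deriv F Ss.^ e₃} (pow {deriv F} Sr.refl e₃) (pow {dil (deriv F)} (Sr.sym (ZΔ.dilate≋dil (deriv F))) e₄))))))
    where
    H≈ : H Sr.≈ z⁴ Sr.* dil (deriv F)
    H≈ = Sr.trans (ZD.dil-cong (ZΔ.δ-deriv F)) (Sr.trans (ZD.dil-⊙ zS (deriv F)) (Sr.*-congʳ {dil (deriv F)} s≈))

  -- Four factors with exponents at most d form words of length n = 4d. The value 4n + 1 for e is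
  -- the smallest that `closed` admits, and it exceeds every `weight`, since these are at most 6d.
  n e : ℕ
  n = d ℕ.+ (d ℕ.+ (d ℕ.+ (d ℕ.+ 0)))
  e = 1 ℕ.+ n ℕ.* 4

  private
    F-eq′ : F Sr.≈ SC.pz Sr.* G Sr.- z⁴ Sr.* dil G
    F-eq′ = Sr.trans F-eq (Sr.+-cong (Sr.*-congʳ {G} pS≈) (Sr.-‿cong (Sr.*-congʳ {dil G} s≈)))
    E-eq′ : E Sr.≈ (SC.δpz Sr.* G Sr.+ SC.pz Sr.* (n4 Sr.* H)) Sr.- (n4 Sr.* (z⁴ Sr.* dil G) Sr.+ z⁴ Sr.* (n4 Sr.* (n4 Sr.* dil H)))
    E-eq′ = Sr.trans E-eq (Sr.+-cong (Sr.+-cong (Sr.*-congʳ {G} δpS≈) (Sr.*-congʳ {n4 Sr.* H} pS≈))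
      (Sr.-‿cong (Sr.+-cong (Sr.*-congˡ {n4} (Sr.*-congʳ {dil G} s≈)) (Sr.*-congʳ {n4 Sr.* (n4 Sr.* dil H)} s≈))))

  columns : List Sr.Carrier
  columns = SC.P F-eq′ E-eq′ s≈ e n

  module ZE = ZeroEstimate columns (SC.closed F-eq′ E-eq′ s≈ e n ℕP.≤-refl)

  M : ℕ
  M = proj₁ ZE.zero-estimate

  a : ℕ → ℕ → ℤ
  a i k = flat column k i

  column-mem : ∀ k → k < D⁵ → ZSpans.Span columns (flat column k)
  column-mem k l = SC.P-monomial F-eq′ E-eq′ s≈ {d} e n (s≤s bound) (rem≤ _) (rem≤ _) (rem≤ _) (rem≤ _) ℕP.≤-refl
    where
    bound : weight (d₀ k) (d₃ k) (d₄ k) ≤ n ℕ.* 4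
    bound = ℕP.≤-trans (ℕP.+-mono-≤ (d₀≤ k l) (ℕP.+-mono-≤ (ℕP.m∸n≤m d (d₃ k)) (ℕP.*-monoˡ-≤ 4 (ℕP.m∸n≤m d (d₄ k)))))
      (ℕP.≤-trans (ℕP.m≤m+n _ (d ℕ.* 10)) (ℕP.≤-reflexive (sum d)))
      where
      sum : ∀ d → (d ℕ.+ (d ℕ.+ d ℕ.* 4)) ℕ.+ d ℕ.* 10 ≡ (d ℕ.+ (d ℕ.+ (d ℕ.+ (d ℕ.+ 0)))) ℕ.* 4
      sum = solve-∀

  -- The combination of columns lies in the span, so its first M coefficients decide whether it is
  -- zero; finitely many rows of the matrix thus stand for an identity of series, to which
  -- `independent` applies.
  no-integer-kernel : ∀ x → (∀ i → i < M → ℤRows.row D⁵ a x i ≡ + 0) → ∀ k → k < D⁵ → x k ≡ + 0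
  no-integer-kernel x h = Ind.independent d D⁵ x (λ k → weight (d₀ k) (d₃ k) (d₄ k)) d₁ d₂ d₃ d₄ (λ k → rem≤ _) (λ k → rem≤ _) (λ k → rem≤ _)
      (λ i k q₀ q₁ q₂ q₃ q₄ → flat-inj i k (cancel-weight i k q₀ q₃ q₄) q₁ q₂ q₃ q₄)
      (Sr.trans (Ss.Σ-cong′ D⁵ (λ k → Sr.*-congˡ {iS (x k)} (Sr.*-congʳ {F Ss.^ d₁ k Sr.* (G Ss.^ d₂ k Sr.* (E Ss.^ d₃ k Sr.* (H Ss.^ d₄ k Sr.* Sr.1#)))} (Ss.^-cong (weight (d₀ k) (d₃ k) (d₄ k)) zζ))))
        (proj₂ ZE.zero-estimate {f} (f-mem D⁵ ℕP.≤-refl) (λ i l → ≡.trans (f-row D⁵ i) (h i l))))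
    where
    iS : ℤ → Sr.Carrier
    iS = PowerSeries.intR 𝕊
    partial : ℕ → Sr.Carrier
    partial N = PowerSeries.Σ< 𝕊 N (λ k → iS (x k) Sr.* flat column k)
    f : Sr.Carrier
    f = partial D⁵
    f-mem : ∀ N → N ≤ D⁵ → ZSpans.Span columns (partial N)
    f-mem zero    l = ZSpans.span-0 columns Sr.refl
    f-mem (suc N) l = ZSpans.span-+ columns (f-mem N (ℕP.<⇒≤ l)) (ZSpans.span-scal columns (x N) (column-mem N l))
    f-row : ∀ N i → partial N i ≡ ℤRows.row N a x i
    f-row zero    i = ≡.refl
    f-row (suc N) i = ≡.cong₂ ℤ._+_ (f-row N i) (≡.trans (scalar (x N) (flat column N) i) (ℤP.*-comm (x N) (a i N)))
    cancel-weight : ∀ i k → weight (d₀ i) (d₃ i) (d₄ i) ≡ weight (d₀ k) (d₃ k) (d₄ k) → d₃ i ≡ d₃ k → d₄ i ≡ d₄ k → d₀ i ≡ d₀ k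
    cancel-weight i k q q₃ q₄ = ℕP.+-cancelʳ-≡ ((d ∸ d₃ k) ℕ.+ (d ∸ d₄ k) ℕ.* 4) (d₀ i) (d₀ k)
      (≡.trans (≡.sym (≡.cong₂ (λ u v → d₀ i ℕ.+ ((d ∸ u) ℕ.+ (d ∸ v) ℕ.* 4)) q₃ q₄)) q)

module OverField {c ℓ : Level} (K : CommutativeRing c ℓ) (isField : IsChar0Field K) (F : ℕ → ℤ) (isF : IsF F) where
  open CommutativeRing K hiding (zero)
  open PowerSeries K
  open Sums K
  open IntegerSeries K
  open FieldKernel K isField using (kernel; IntegerKernel; NoKernel)

  module _ (P : Poly5) (h : eval5 P (↑ F) (dilate 4 (↑ F)) (deriv (↑ F)) (dilate 4 (deriv (↑ F))) ≋ (λ _ → 0#)) where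
    open Poly5 P renaming (deg to d)
    open Columns F isF d
    open Digits d

    ↑-term : ∀ e₀ e₁ e₂ e₃ e₄ → ↑ (term e₀ e₁ e₂ e₃ e₄) ≋ (zpow e₀ ⊙ ((↑ F ⊙^ e₁) ⊙ ((dilate 4 (↑ F) ⊙^ e₂) ⊙ ((deriv (↑ F) ⊙^ e₃) ⊙ (dilate 4 (deriv (↑ F)) ⊙^ e₄)))))
    ↑-term e₀ e₁ e₂ e₃ e₄ = ↑-⊙ {Z.zpow e₀} {(F Z.⊙^ e₁) Z.⊙ r₁} (↑-zpow e₀) (↑-⊙ {F Z.⊙^ e₁} {r₁} (↑-⊙^ {F} (λ _ → refl) e₁)
        (↑-⊙ {Z.dilate 4 F Z.⊙^ e₂} {r₂} (↑-⊙^ {Z.dilate 4 F} (↑-dilate {F} (λ _ → refl)) e₂)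
          (↑-⊙ {Z.deriv F Z.⊙^ e₃} {Z.dilate 4 (Z.deriv F) Z.⊙^ e₄} (↑-⊙^ {Z.deriv F} (↑-deriv F) e₃) (↑-⊙^ {Z.dilate 4 (Z.deriv F)} (↑-dilate {Z.deriv F} (↑-deriv F)) e₄))))
      where
      module Z = PowerSeries ℤring
      r₂ = (Z.deriv F Z.⊙^ e₃) Z.⊙ (Z.dilate 4 (Z.deriv F) Z.⊙^ e₄)
      r₁ = (Z.dilate 4 F Z.⊙^ e₂) Z.⊙ r₂

    terms-vanish : ∀ i → Σ< D⁵ (λ k → flat coeff k * intR (flat term k i)) ≈ 0#
    terms-vanish i = trans (sym (Σ-flatten₅ K (λ e₀ e₁ e₂ e₃ e₄ → coeff e₀ e₁ e₂ e₃ e₄ * intR (term e₀ e₁ e₂ e₃ e₄ i))))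
      (trans (Σ-cong′ D (λ e₀ → Σ-cong′ D (λ e₁ → Σ-cong′ D (λ e₂ → Σ-cong′ D (λ e₃ → Σ-cong′ D (λ e₄ → *-congˡ (↑-term e₀ e₁ e₂ e₃ e₄ i))))))) (h i))

    -- The given relation concerns the terms with F′, whereas the matrix is formed from the columns.
    -- Multiplication by the common series `cst` leads from one to the other: row i of the columns
    -- combines the rows i - j of the terms, and all of these vanish.
    columns-vanish : ∀ i → Σ< D⁵ (λ k → intR (a i k) * flat coeff k) ≈ 0#
    columns-vanish i = trans (Σ-cong′ D⁵ expand) (trans (Σ-swap D⁵ (suc i) (λ k j → intR (cst j) * (flat coeff k * intR (flat term k (i ∸ j)))))
      (Σ-zero (suc i) (λ j _ → trans (Σ-*ˡ D⁵ (intR (cst j)) _) (trans (*-congˡ (terms-vanish (i ∸ j))) (zeroʳ _)))))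
      where
      expand : ∀ k → intR (a i k) * flat coeff k ≈ Σ< (suc i) (λ j → intR (cst j) * (flat coeff k * intR (flat term k (i ∸ j))))
      expand k = trans (*-congʳ (trans (reflexive (≡.cong intR (column≈ (d₀ k) (d₁ k) (d₂ k) (d₃ k) (d₄ k) (rem≤ _) (rem≤ _) i))) (↑-⊙ {cst} {flat term k} (λ _ → refl) (λ _ → refl) i)))
        (trans (sym (Σ-*ʳ (suc i) (flat coeff k) _)) (Σ-cong′ (suc i) (λ j → solve 3 (λ x y z → (x :* y) :* z := x :* (z :* y)) refl (intR (cst j)) (intR (flat term k (i ∸ j))) (flat coeff k))))
        where open Solver

    coeff-vanish : ∀ k → k < D⁵ → flat coeff k ≈ 0#
    coeff-vanish = conclude (kernel D⁵ M a)
      where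
      conclude : IntegerKernel D⁵ M a ⊎ NoKernel D⁵ M a → ∀ k → k < D⁵ → flat coeff k ≈ 0#
      conclude (inj₁ (x , (j , l , ne) , z)) = ⊥-elim (ne (no-integer-kernel x z j l))
      conclude (inj₂ none) = none (flat coeff) (λ i _ → columns-vanish i)

    vanish : IsZeroPoly5 P
    vanish e₀ e₁ e₂ e₃ e₄ l₀ l₁ l₂ l₃ l₄ = let (k , l , q) = flat-surj coeff l₀ l₁ l₂ l₃ l₄ in trans (reflexive (≡.sym q)) (coeff-vanish k l)

theorem1p1 : {c ℓ : Level} (K : CommutativeRing c ℓ) → IsChar0Field K →
             (F : ℕ → ℤ) → IsF F →
             let open PowerSeries K
                 FK = λ n → intR (F n)
             in AlgIndep4 FK (dilate 4 FK) (deriv FK) (dilate 4 (deriv FK))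
theorem1p1 K isField F isF = OverField.vanish K isField F isF
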